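{- Let $q$ be an odd prime power and let $l$ be a line of an elliptic quadric $Q^-(5,q)$ of $\mathrm{PG}(5,q)$. Then $\mathfrak{X}_l=(\mathcal{X}',\{R'_0,\dots,R'_5\})$ is a symmetric, imprimitive association scheme, and it is isomorphic to the association scheme $\mathfrak{X}_P$ for any point $P$ of $H(3,q^2)$.
   Context: Let $\perp$ be the polarity of $Q^-(5,q)$; dimensions are vector-space dimensions over $\mathrm{GF}(q)$. Three pairwise disjoint lines $l_1,l_2,l_3$ of $Q^-(5,q)$ spanning the whole space are in perspective if, with $T_i=l_i^\perp$, $s_k=T_i\cap T_j$, $\Sigma_k=\langle s_k,l_k\rangle$ ($\{i,j,k\}=\{1,2,3\}$), $\Sigma_1\cap\Sigma_2\cap\Sigma_3$ is 2-dimensional. $\mathcal{X}'$ is the set of lines of $Q^-(5,q)$ disjoint from $l$; relations: $R'_0$ diagonal; $R'_1$: $m,n$ meet in a point; $R'_2$: $\dim\langle l,m,n\rangle=4$; $R'_3$: $m,n$ disjoint and $\dim\langle l,m,n\rangle=5$; $R'_4$: $l,m,n$ span the whole space and are not in perspective; $R'_5$: $l,m,n$ span the whole space and are in perspective. $H(3,q^2)$ is the Hermitian surface of $\mathrm{PG}(3,q^2)$ given by $h(\mathbf{x},\mathbf{y})=x_0y_3^q-x_1y_1^q-x_2y_2^q+x_3y_0^q$; collinear points are those with $h(\mathbf p,\mathbf q)=0$. For distinct points, $z(P,Q,R)=h(\mathbf p,\mathbf q)h(\mathbf q,\mathbf r)h(\mathbf r,\mathbf p)\mathrm{GF}(q)^*\in\{0\}\cup\mathrm{GF}(q^2)^*/\mathrm{GF}(q)^*$;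 $e=\mathrm{GF}(q)^*$, $t=\theta\mathrm{GF}(q)^*$ with $\theta^q=-\theta$, $\Gamma$ the remaining cosets. $\mathfrak{X}_P$ has vertex set the points of $H(3,q^2)$ not collinear with $P$, with $R_0$ diagonal and, for distinct $Q,R$: $R_1$: $z(P,Q,R)=0$; $R_2$: $P,Q,R$ lie on a common line; $R_3$: $z=t$; $R_4$: $z\in\Gamma$; $R_5$: $z=e$.
   Formalization: Relation R_3 of X_P is taken as "z = t and P, Q, R not on a common line", since collinear triples (R_2) also have z = t and the relations would otherwise overlap; R'_1 to R'_5 are taken for distinct lines only. -}

module Defs where

open import Data.Nat as ℕ using (ℕ; zero; suc)
open import Data.Nat.Divisibility using (_∣_)
open import Data.Nat.Primality using (Prime)
open import Data.Fin using (Fin; zero; suc)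
open import Data.List using (List; length)
open import Data.List.Membership.Propositional using (_∈_)
open import Data.List.Relation.Unary.Unique.Propositional using (Unique)
open import Data.Product using (Σ; ∃; _×_; _,_; proj₁)
open import Data.Sum using (_⊎_)
open import Data.Fin.Permutation using (Permutation′; _⟨$⟩ʳ_)
open import Relation.Nullary using (¬_)
open import Relation.Binary.PropositionalEquality using (_≡_; _≢_)
open import Relation.Binary.Construct.Closure.ReflexiveTransitive using (Star)
open import Algebra.Structures using (IsCommutativeRing)
open import Function using (_∘_)

OddPrimePower : ℕ → Set
OddPrimePower q = ∃ λ p → ∃ λ k → Prime p × ¬ (2 ∣ p) × q ≡ p ℕ.^ suc k

record FiniteField : Set₁ where
  infixl 6 _+_
  infixl 7 _*_
  infix 8 -_
  field
    Carrier    : Set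
    _+_ _*_    : Carrier → Carrier → Carrier
    -_         : Carrier → Carrier
    0# 1#      : Carrier
    isCommRing : IsCommutativeRing _≡_ _+_ _*_ -_ 0# 1#
    0≢1        : 0# ≢ 1#
    inverse    : (x : Carrier) → x ≢ 0# → Σ Carrier λ y → x * y ≡ 1#
    elements   : List Carrier
    complete   : (x : Carrier) → x ∈ elements
    unique     : Unique elements

  order : ℕ
  order = length elements

  infixl 6 _-_
  _-_ : Carrier → Carrier → Carrier
  x - y = x + (- y)

  pow : Carrier → ℕ → Carrier
  pow x zero    = 1#
  pow x (suc n) = x * pow x n

  sumF : ∀ {k} → (Fin k → Carrier) → Carrier
  sumF {zero}  f = 0#
  sumF {suc k} f = f zero + sumF (f ∘ suc)

module LinAlg (F : FiniteField) where
  open FiniteField F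

  V : ℕ → Set
  V n = Fin n → Carrier

  _≋_ : ∀ {n} → V n → V n → Set
  x ≋ y = ∀ i → x i ≡ y i

  0V : ∀ {n} → V n
  0V _ = 0#

  _⊕_ : ∀ {n} → V n → V n → V n
  (x ⊕ y) i = x i + y i

  lincomb : ∀ {n k} → (Fin k → Carrier) → (Fin k → V n) → V n
  lincomb c b i = sumF (λ j → c j * b j i)

  InSpan : ∀ {n k} → (Fin k → V n) → V n → Set
  InSpan b x = Σ (Fin _ → Carrier) λ c → lincomb c b ≋ x

  LinIndep : ∀ {n k} → (Fin k → V n) → Set
  LinIndep b = ∀ c → lincomb c b ≋ 0V → ∀ j → c j ≡ 0#

  Dim : ∀ {n} → (V n → Set) → ℕ → Set
  Dim {n} P k = Σ (Fin k → V n) λ b →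
    (∀ j → P (b j)) × LinIndep b × (∀ x → P x → InSpan b x)

  fam2 : ∀ {n} → V n → V n → Fin 2 → V n
  fam2 u v zero       = u
  fam2 u v (suc zero) = v

  fam3 : ∀ {n} → V n → V n → V n → Fin 3 → V n
  fam3 u v w zero             = u
  fam3 u v w (suc zero)       = v
  fam3 u v w (suc (suc zero)) = w

record Scheme : Set₁ where
  field
    Vtx : Set
    _≈_ : Vtx → Vtx → Set
    R   : Fin 6 → Vtx → Vtx → Set

Equinumerous : {A : Set} (_≈_ : A → A → Set) → (A → Set) → (A → Set) → Set
Equinumerous {A} _≈_ P Q =
  Σ (Σ A P → Σ A Q) λ f → Σ (Σ A Q → Σ A P) λ g →
    (∀ a a' → proj₁ a ≈ proj₁ a' → proj₁ (f a) ≈ proj₁ (f a')) ×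
    (∀ b b' → proj₁ b ≈ proj₁ b' → proj₁ (g b) ≈ proj₁ (g b')) ×
    (∀ a → proj₁ (g (f a)) ≈ proj₁ a) ×
    (∀ b → proj₁ (f (g b)) ≈ proj₁ b)

module _ (X : Scheme) where
  open Scheme X

  IsSymmetricAssociationScheme : Set
  IsSymmetricAssociationScheme =
    (∀ x → x ≈ x) × (∀ x y → x ≈ y → y ≈ x) × (∀ x y z → x ≈ y → y ≈ z → x ≈ z) ×
    (∀ i x x' y y' → x ≈ x' → y ≈ y' → R i x y → R i x' y') ×
    (∀ x y → ∃ λ i → R i x y) ×
    (∀ i j x y → R i x y → R j x y → i ≡ j) ×
    (∀ i → ∃ λ x → ∃ λ y → R i x y) ×
    (∀ x y → (R zero x y → x ≈ y) × (x ≈ y → R zero x y)) ×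
    (∀ i x y → R i x y → R i y x) ×
    -- intersection numbers p^k_{ij} exist
    (∀ i j k x y x' y' → R k x y → R k x' y' →
       Equinumerous _≈_ (λ z → R i x z × R j z y) (λ z → R i x' z × R j z y'))

  IsImprimitive : Set
  IsImprimitive = ∃ λ i → i ≢ zero × ∃ λ x → ∃ λ y →
    ¬ Star (λ a b → R i a b ⊎ a ≈ b) x y

Isomorphic : Scheme → Scheme → Set
Isomorphic X Y =
  Σ (X.Vtx → Y.Vtx) λ f → Σ (Y.Vtx → X.Vtx) λ g → Σ (Permutation′ 6) λ σ →
    (∀ x x' → x X.≈ x' → f x Y.≈ f x') ×
    (∀ y y' → y Y.≈ y' → g y X.≈ g y') ×
    (∀ x → g (f x) X.≈ x) × (∀ y → f (g y) Y.≈ y) ×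
    (∀ i x x' → (X.R i x x' → Y.R (σ ⟨$⟩ʳ i) (f x) (f x')) ×
                (Y.R (σ ⟨$⟩ʳ i) (f x) (f x') → X.R i x x'))
  where module X = Scheme X
        module Y = Scheme Y

module Quadric (F : FiniteField) (a : Fin 6 → Fin 6 → FiniteField.Carrier F) where
  open FiniteField F
  open LinAlg F

  Qf : V 6 → Carrier
  Qf x = sumF (λ i → sumF (λ j → a i j * x i * x j))

  Bf : V 6 → V 6 → Carrier
  Bf x y = Qf (x ⊕ y) - Qf x - Qf y

  NonDegenerate : Set
  NonDegenerate = ∀ x → (∀ y → Bf x y ≡ 0#) → x ≋ 0V

  -- elliptic quadric Q⁻(5,q): non-degenerate, Witt index 2
  -- (no totally singular 3-dimensional subspace)
  Elliptic : Set
  Elliptic = NonDegenerate ×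
    ¬ (Σ (Fin 3 → V 6) λ b → LinIndep b × (∀ i → Qf (b i) ≡ 0#) ×
                              (∀ i j → Bf (b i) (b j) ≡ 0#))

  record Line : Set where
    field
      u v   : V 6
      sing-u : Qf u ≡ 0#
      sing-v : Qf v ≡ 0#
      orth   : Bf u v ≡ 0#
      indep  : LinIndep (fam2 u v)

  OnLine : Line → V 6 → Set
  OnLine m = InSpan (fam2 (Line.u m) (Line.v m))

  SameLine : Line → Line → Set
  SameLine m n = (∀ x → OnLine m x → OnLine n x) × (∀ x → OnLine n x → OnLine m x)

  Disjoint : Line → Line → Set
  Disjoint m n = ∀ x → OnLine m x → OnLine n x → x ≋ 0V

  Span3 : Line → Line → Line → V 6 → Set
  Span3 l m n x = ∃ λ y → ∃ λ z → ∃ λ w →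
    OnLine l y × OnLine m z × OnLine n w × ((y ⊕ z) ⊕ w) ≋ x

  Perp : Line → V 6 → Set
  Perp m x = ∀ y → OnLine m y → Bf x y ≡ 0#

  SigmaK : Line → Line → Line → V 6 → Set
  SigmaK li lj lk x = ∃ λ y → ∃ λ z →
    (Perp li y × Perp lj y) × OnLine lk z × (y ⊕ z) ≋ x

  InPerspective : Line → Line → Line → Set
  InPerspective l1 l2 l3 =
    Dim (λ x → SigmaK l2 l3 l1 x × SigmaK l1 l3 l2 x × SigmaK l1 l2 l3 x) 2

  Xl : Line → Scheme
  Xl l = record
    { Vtx = Σ Line (Disjoint l)
    ; _≈_ = λ m n → SameLine (proj₁ m) (proj₁ n)
    ; R   = rel
    }
    where
    rel : Fin 6 → Σ Line (Disjoint l) → Σ Line (Disjoint l) → Set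
    rel zero (m , _) (n , _) = SameLine m n
    rel (suc zero) (m , _) (n , _) =
      ¬ SameLine m n × Dim (λ x → OnLine m x × OnLine n x) 1
    rel (suc (suc zero)) (m , _) (n , _) =
      ¬ SameLine m n × Dim (Span3 l m n) 4
    rel (suc (suc (suc zero))) (m , _) (n , _) =
      ¬ SameLine m n × Disjoint m n × Dim (Span3 l m n) 5
    rel (suc (suc (suc (suc zero)))) (m , _) (n , _) =
      ¬ SameLine m n × Dim (Span3 l m n) 6 × ¬ InPerspective l m n
    rel (suc (suc (suc (suc (suc zero))))) (m , _) (n , _) =
      ¬ SameLine m n × Dim (Span3 l m n) 6 × InPerspective l m n

-- Hermitian surface H(3,q²) over a field K of order q²

module Hermitian (K : FiniteField) (q : ℕ) where
  open FiniteField K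
  open LinAlg K

  conj : Carrier → Carrier
  conj x = pow x q

  h : V 4 → V 4 → Carrier
  h x y = x zero * conj (y (suc (suc (suc zero))))
        - x (suc zero) * conj (y (suc zero))
        - x (suc (suc zero)) * conj (y (suc (suc zero)))
        + x (suc (suc (suc zero))) * conj (y zero)

  record HPoint : Set where
    field
      vec     : V 4
      nonzero : ¬ (vec ≋ 0V)
      iso     : h vec vec ≡ 0#

  SamePoint : HPoint → HPoint → Set
  SamePoint P Q = Σ Carrier λ c → ∀ i → HPoint.vec P i ≡ c * HPoint.vec Q i

  -- representative of z(P,Q,R) = h(p,q) h(q,r) h(r,p) GF(q)*
  zrep : HPoint → HPoint → HPoint → Carrier
  zrep P Q R = h p q' * h q' r * h r p
    where p = HPoint.vec P ; q' = HPoint.vec Q ; r = HPoint.vec R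

  OnCommonLine : HPoint → HPoint → HPoint → Set
  OnCommonLine P Q R =
    Dim (InSpan (fam3 (HPoint.vec P) (HPoint.vec Q) (HPoint.vec R))) 2

  XP : HPoint → Scheme
  XP P = record
    { Vtx = Σ HPoint λ Q → h (HPoint.vec P) (HPoint.vec Q) ≢ 0#
    ; _≈_ = λ Q R → SamePoint (proj₁ Q) (proj₁ R)
    ; R   = rel
    }
    where
    Vt = Σ HPoint λ Q → h (HPoint.vec P) (HPoint.vec Q) ≢ 0#
    rel : Fin 6 → Vt → Vt → Set
    rel zero (Q , _) (R , _) = SamePoint Q R
    rel (suc zero) (Q , _) (R , _) =
      ¬ SamePoint Q R × zrep P Q R ≡ 0#
    rel (suc (suc zero)) (Q , _) (R , _) =
      ¬ SamePoint Q R × OnCommonLine P Q R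
    -- z = t = θ GF(q)*  ⇔  z ≠ 0 and z^q = -z
    rel (suc (suc (suc zero))) (Q , _) (R , _) =
      ¬ SamePoint Q R × ¬ OnCommonLine P Q R ×
      zrep P Q R ≢ 0# × conj (zrep P Q R) ≡ - zrep P Q R
    -- z ∈ Γ: z ≠ 0, z ∉ GF(q)*, z ∉ θ GF(q)*
    rel (suc (suc (suc (suc zero)))) (Q , _) (R , _) =
      ¬ SamePoint Q R × zrep P Q R ≢ 0# ×
      conj (zrep P Q R) ≢ zrep P Q R × conj (zrep P Q R) ≢ - zrep P Q R
    -- z = e = GF(q)*  ⇔  z ≠ 0 and z^q = z
    rel (suc (suc (suc (suc (suc zero))))) (Q , _) (R , _) =
      ¬ SamePoint Q R × zrep P Q R ≢ 0# × conj (zrep P Q R) ≡ zrep P Q R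

-- Both schemes have the same coordinates over GF(q): a vertex is a triple (w₁, w₂, t) with wᵢ in GF(q)(√ν) and t in
-- GF(q), and the relation of two vertices depends only on which of u, det u and s vanish, where (u, s) is their
-- quotient in a Heisenberg group.
-- On Q⁻(5,q), let l = ⟨e₁, e₂⟩ and complete e₁, e₂ by f₁, f₂ to a hyperbolic basis; the orthogonal complement is
-- anisotropic, with form g (x² - ν y²). A line disjoint from l has a unique basis dual to e₁, e₂, whose coordinates give
-- the vertex, and moving f₁, f₂ to a line m replaces the coordinates of every line by the quotient by those of m. With
-- m = ⟨f₁, f₂⟩ all dimensions are visible, and l, m, n are in perspective exactly when a 2 × 2 matrix is symmetric.
-- On H(3,q²), the points not collinear with P are P′ + b A + c B + d P for a suitable basis, and the form of two of
-- them is ν det u - θ s, where θ² = ν. The field GF(q²) contains GF(q) and θ by uniqueness of finite fields.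
-- In the model, translations, row operations and multiplications by GF(q)(√ν)* act transitively on each relation but
-- {det u ≠ 0, s ≠ 0}. There, a bijection that is not an automorphism still carries a pair with s to a pair with s′
-- and preserves the intersection pattern; it exists because all nonzero norms have the same number of preimages.
module Submission where

open import Defs

-- The obstruction to a proof by automorphisms is the quotient of `t` by `det`: row operations and
-- multiplications by GF(q)(√ν)* scale both by one common factor, so pairs with both nonzero and
-- different quotients cannot be joined by them. Equal intersection numbers ask for less, namely a
-- bijection of the third vertices that keeps, towards both ends of the pair, which quantities
-- vanish. This is `Matching`, which serves all i and j at once. The nonsquare ν is dictated by the
-- quadric: it is -Q(w₂)/Q(w₁) for an orthogonal basis of the anisotropic plane, and ellipticity
-- makes it a nonsquare. The Hermitian side must then supply a θ with this very square. As GF(q) and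
-- GF(q²) are given as unrelated fields, an embedding has to be built. It is built from minimal
-- polynomials over an abstract ring, hence under double negation, which is removed at the end by a
-- finite search among all maps between the two fields. On the quadric, `t` is the skew part of a 2
-- × 2 matrix A attached to a line, A₁₂ - A₂₁ = 2 g t; this is why symmetry of A and the θ-part of
-- the Hermitian form are one coordinate.

-- Integer coefficients and a solver for polynomial identities in a finite field

module Rings where

  open import Algebra.Bundles using (CommutativeRing)
  import Algebra.Solver.Ring
  import Algebra.Solver.Ring.AlmostCommutativeRing as ACR
  import Algebra.Properties.Ring
  import Algebra.Properties.Semiring.Mult.TCOptimised as Mult
  open import Data.Integer as ℤ using (ℤ; -[1+_])
  import Data.Integer.Properties as ℤ
  open import Data.Nat as ℕ using (ℕ; zero; suc)
  open import Data.Maybe using (Maybe; just; nothing)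
  open import Relation.Nullary using (yes; no)
  open import Relation.Binary.PropositionalEquality

  module Arithmetic (F : FiniteField) where
    open FiniteField F

    commutativeRing : CommutativeRing _ _
    commutativeRing = record { isCommutativeRing = isCommRing }

    open CommutativeRing commutativeRing public
      using (+-assoc; +-comm; +-identityˡ; +-identityʳ; *-assoc; *-comm; *-identityˡ; *-identityʳ;
             -‿inverseˡ; -‿inverseʳ; zeroˡ; zeroʳ; distribˡ; distribʳ; semiring; ring;
             +-commutativeMonoid; *-commutativeMonoid)
    open Algebra.Properties.Ring ring
      using (-‿distribˡ-*; -‿distribʳ-*; -0#≈0#; -‿involutive)
    -- The optimised multiple computes `1 · x` to `x`, so that `:1` and `:2` below denote `1#` and
    -- `two` definitionally.
    open Mult semiring using (×-homo-+; 1+×; ×1-homo-*) renaming (_×_ to _·_)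

    two : Carrier
    two = 1# + 1#

    nat : ℕ → Carrier
    nat n = n · 1#

    int : ℤ → Carrier
    int (ℤ.+ n)    = nat n
    int -[1+ n ] = - nat (suc n)

    private
      neg-sum : ∀ x y → - (x + y) ≡ - x + - y
      neg-sum x y = sym (⁻¹-∙-comm x y)
        where open import Algebra.Properties.AbelianGroup
                     (CommutativeRing.+-abelianGroup commutativeRing) using (⁻¹-∙-comm)

      cancel-1 : ∀ x y → x + - y ≡ (1# + x) + - (1# + y)
      cancel-1 x y = sym (begin
        (1# + x) + - (1# + y)       ≡⟨ cong ((1# + x) +_) (neg-sum 1# y) ⟩
        (1# + x) + (- 1# + - y)     ≡⟨ cong (_+ (- 1# + - y)) (+-comm 1# x) ⟩
        (x + 1#) + (- 1# + - y)     ≡⟨ +-assoc x 1# _ ⟩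
        x + (1# + (- 1# + - y))     ≡⟨ cong (x +_) (+-assoc 1# (- 1#) (- y)) ⟨
        x + ((1# + - 1#) + - y)     ≡⟨ cong (λ z → x + (z + - y)) (-‿inverseʳ 1#) ⟩
        x + (0# + - y)              ≡⟨ cong (x +_) (+-identityˡ (- y)) ⟩
        x + - y                     ∎)
        where open ≡-Reasoning

      int-⊖ : ∀ m n → int (m ℤ.⊖ n) ≡ nat m + - nat n
      int-⊖ zero    zero    = sym (-‿inverseʳ 0#)
      int-⊖ zero    (suc n) = sym (+-identityˡ _)
      int-⊖ (suc m) zero    = sym (trans (cong (nat (suc m) +_) -0#≈0#) (+-identityʳ _))
      int-⊖ (suc m) (suc n) = begin
        int (suc m ℤ.⊖ suc n)               ≡⟨ cong int (ℤ.[1+m]⊖[1+n]≡m⊖n m n) ⟩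
        int (m ℤ.⊖ n)                       ≡⟨ int-⊖ m n ⟩
        nat m + - nat n                     ≡⟨ cancel-1 (nat m) (nat n) ⟩
        (1# + nat m) + - (1# + nat n)       ≡⟨ cong₂ (λ x y → x + - y) (1+× m 1#) (1+× n 1#) ⟨
        nat (suc m) + - nat (suc n)         ∎
        where open ≡-Reasoning

    int-neg : ∀ i → int (ℤ.- i) ≡ - int i
    int-neg (ℤ.+ zero)  = sym -0#≈0#
    int-neg (ℤ.+ suc n) = refl
    int-neg -[1+ n ]  = sym (-‿involutive _)

    int-+ : ∀ i j → int (i ℤ.+ j) ≡ int i + int j
    int-+ (ℤ.+ m)    (ℤ.+ n)    = ×-homo-+ 1# m n
    int-+ (ℤ.+ m)    -[1+ n ] = int-⊖ m (suc n)
    int-+ -[1+ m ] (ℤ.+ n)    = trans (int-⊖ n (suc m)) (+-comm _ _)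
    int-+ -[1+ m ] -[1+ n ] =
      trans (cong (λ k → - nat (suc k)) (sym (+-suc′ m n)))
            (trans (cong -_ (×-homo-+ 1# (suc m) (suc n))) (neg-sum _ _))
      where
      open import Data.Nat.Properties using (+-suc)
      +-suc′ : ∀ m n → m ℕ.+ suc n ≡ suc (m ℕ.+ n)
      +-suc′ = +-suc

    int-* : ∀ i j → int (i ℤ.* j) ≡ int i * int j
    int-* = go
      where
      open ≡-Reasoning
      pos : ∀ m n → int ((ℤ.+ m) ℤ.* (ℤ.+ n)) ≡ nat m * nat n
      pos m n = trans (cong int (sym (ℤ.pos-* m n))) (×1-homo-* m n)
      go : ∀ i j → int (i ℤ.* j) ≡ int i * int j
      go (ℤ.+ m) (ℤ.+ n) = pos m n
      go (ℤ.+ m) -[1+ n ] = begin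
        int ((ℤ.+ m) ℤ.* -[1+ n ])         ≡⟨ cong int (sym (ℤ.neg-distribʳ-* (ℤ.+ m) (ℤ.+ suc n))) ⟩
        int (ℤ.- ((ℤ.+ m) ℤ.* (ℤ.+ suc n)))  ≡⟨ int-neg ((ℤ.+ m) ℤ.* (ℤ.+ suc n)) ⟩
        - int ((ℤ.+ m) ℤ.* (ℤ.+ suc n))      ≡⟨ cong -_ (pos m (suc n)) ⟩
        - (nat m * nat (suc n))          ≡⟨ -‿distribʳ-* _ _ ⟩
        nat m * - nat (suc n)            ∎
      go -[1+ m ] (ℤ.+ n) = begin
        int (-[1+ m ] ℤ.* (ℤ.+ n))         ≡⟨ cong int (sym (ℤ.neg-distribˡ-* (ℤ.+ suc m) (ℤ.+ n))) ⟩
        int (ℤ.- ((ℤ.+ suc m) ℤ.* (ℤ.+ n)))  ≡⟨ int-neg ((ℤ.+ suc m) ℤ.* (ℤ.+ n)) ⟩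
        - int ((ℤ.+ suc m) ℤ.* (ℤ.+ n))      ≡⟨ cong -_ (pos (suc m) n) ⟩
        - (nat (suc m) * nat n)          ≡⟨ -‿distribˡ-* _ _ ⟩
        - nat (suc m) * nat n            ∎
      go -[1+ m ] -[1+ n ] = begin
        nat (suc m ℕ.* suc n)            ≡⟨ ×1-homo-* (suc m) (suc n) ⟩
        nat (suc m) * nat (suc n)        ≡⟨ -‿involutive _ ⟨
        - - (nat (suc m) * nat (suc n))  ≡⟨ cong -_ (-‿distribˡ-* _ _) ⟩
        - (- nat (suc m) * nat (suc n))  ≡⟨ -‿distribʳ-* _ _ ⟩
        - nat (suc m) * - nat (suc n)    ∎

    private
      almostCommutativeRing : ACR.AlmostCommutativeRing _ _
      almostCommutativeRing = ACR.fromCommutativeRing commutativeRing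

      morphism : ℤ.+-*-rawRing ACR.-Raw-AlmostCommutative⟶ almostCommutativeRing
      morphism = record
        { ⟦_⟧ = int ; +-homo = int-+ ; *-homo = int-* ; -‿homo = int-neg
        ; 0-homo = refl ; 1-homo = refl }

      -- Coefficients are compared as integers. This is a semi-decision: identities that hold only
      -- in a particular characteristic are beyond the solver.
      dec : ∀ i j → Maybe (int i ≡ int j)
      dec i j with i ℤ.≟ j
      ... | yes i≡j = just (cong int i≡j)
      ... | no _    = nothing

    open Algebra.Solver.Ring ℤ.+-*-rawRing almostCommutativeRing morphism dec public
      using (solve; con; _:=_; _:+_; _:*_; :-_; _:-_; _:^_; Polynomial)

    :0 :1 :2 : ∀ {n} → Polynomial n
    :0 = con (ℤ.+ 0)
    :1 = con (ℤ.+ 1)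
    :2 = con (ℤ.+ 2)

-- Finite fields: counting arguments, powers and roots of polynomials

module Fields where

  open Rings
  open import Data.Empty using (⊥-elim)
  open import Data.Fin as Fin using (Fin; zero; suc; punchOut; punchIn)
  import Data.Fin.Properties as Fin
  open import Data.Fin.Permutation as Perm using (Permutation′; permutation; _⟨$⟩ʳ_)
  open import Data.List using (List; lookup)
  open import Data.List.Membership.Propositional.Properties using (∈-lookup)
  open import Data.List.Relation.Unary.Any using (index)
  open import Data.List.Relation.Unary.Any.Properties using (lookup-index)
  open import Data.List.Relation.Unary.Unique.Propositional using (Unique)
  open import Data.List.Relation.Unary.AllPairs using (_∷_)
  import Data.List.Relation.Unary.All as All
  open import Data.Nat as ℕ using (ℕ; zero; suc)
  import Data.Nat.Properties as ℕ
  open import Data.Product using (∃; _,_; proj₁; proj₂)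
  open import Data.Sum using (_⊎_; inj₁; inj₂)
  open import Data.Vec using (Vec; []; _∷_; zipWith)
  open import Function using (_∘_)
  open import Relation.Nullary using (¬_; Dec; yes; no)
  open import Relation.Nullary.Decidable using (map′)
  open import Relation.Binary.PropositionalEquality
  import Algebra.Bundles
  import Algebra.Properties.CommutativeMonoid.Sum as Sum
  import Algebra.Properties.Semiring.Mult.TCOptimised as Mult

  all₂ : ∀ {P : Fin 2 → Set} → P zero → P (suc zero) → ∀ i → P i
  all₂ a b zero       = a
  all₂ a b (suc zero) = b

  all₃ : ∀ {P : Fin 3 → Set} → P zero → P (suc zero) → P (suc (suc zero)) → ∀ i → P i
  all₃     a b c zero    = a
  all₃ {P} a b c (suc i) = all₂ {P ∘ suc} b c i

  all₄ : ∀ {P : Fin 4 → Set} → P zero → P (suc zero) → P (suc (suc zero)) → P (suc (suc (suc zero))) → ∀ i → P i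
  all₄     a b c d zero    = a
  all₄ {P} a b c d (suc i) = all₃ {P ∘ suc} b c d i

  all₆ : ∀ {P : Fin 6 → Set} → P zero → P (suc zero) → P (suc (suc zero)) → P (suc (suc (suc zero))) →
         P (suc (suc (suc (suc zero)))) → P (suc (suc (suc (suc (suc zero))))) → ∀ i → P i
  all₆     a b c d e f zero          = a
  all₆     a b c d e f (suc zero)    = b
  all₆ {P} a b c d e f (suc (suc i)) = all₄ {λ j → P (suc (suc j))} c d e f i

  all₄₊ : ∀ {k} {P : Fin (4 ℕ.+ k) → Set} → P zero → P (suc zero) → P (suc (suc zero)) → P (suc (suc (suc zero))) →
          (∀ i → P (suc (suc (suc (suc i))))) → ∀ i → P i
  all₄₊ a b c d f zero                      = a
  all₄₊ a b c d f (suc zero)                = b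
  all₄₊ a b c d f (suc (suc zero))          = c
  all₄₊ a b c d f (suc (suc (suc zero)))    = d
  all₄₊ a b c d f (suc (suc (suc (suc i)))) = f i

  vec₂ : ∀ {A : Set} → A → A → Fin 2 → A
  vec₂ = all₂

  vec₃ : ∀ {A : Set} → A → A → A → Fin 3 → A
  vec₃ = all₃

  vec₄ : ∀ {A : Set} → A → A → A → A → Fin 4 → A
  vec₄ = all₄

  vec₆ : ∀ {A : Set} → A → A → A → A → A → A → Fin 6 → A
  vec₆ = all₆

  cong₃ : ∀ {A B : Set} (f : A → A → A → B) {a b c a′ b′ c′} → a ≡ a′ → b ≡ b′ → c ≡ c′ → f a b c ≡ f a′ b′ c′
  cong₃ f refl refl refl = refl

  cong₄ : ∀ {A B : Set} (f : A → A → A → A → B) {a b c d a′ b′ c′ d′} → a ≡ a′ → b ≡ b′ → c ≡ c′ → d ≡ d′ →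
          f a b c d ≡ f a′ b′ c′ d′
  cong₄ f refl refl refl refl = refl

  cong₅ : ∀ {A B : Set} (f : A → A → A → A → A → B) {a b c d e a′ b′ c′ d′ e′} → a ≡ a′ → b ≡ b′ → c ≡ c′ → d ≡ d′ → e ≡ e′ →
          f a b c d e ≡ f a′ b′ c′ d′ e′
  cong₅ f refl refl refl refl refl = refl

  cong₆ : ∀ {A B : Set} (g : A → A → A → A → A → A → B) {a b c d e f a′ b′ c′ d′ e′ f′} →
          a ≡ a′ → b ≡ b′ → c ≡ c′ → d ≡ d′ → e ≡ e′ → f ≡ f′ → g a b c d e f ≡ g a′ b′ c′ d′ e′ f′
  cong₆ g refl refl refl refl refl refl = refl

  lookup-injective : ∀ {A : Set} {xs : List A} → Unique xs → ∀ i j → lookup xs i ≡ lookup xs j → i ≡ j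
  lookup-injective (_ ∷ _)  zero    zero    eq = refl
  lookup-injective (x≢ ∷ _)  zero    (suc j) eq = ⊥-elim (All.lookup x≢ (∈-lookup j) eq)
  lookup-injective (x≢ ∷ _)  (suc i) zero    eq = ⊥-elim (All.lookup x≢ (∈-lookup i) (sym eq))
  lookup-injective (_ ∷ us) (suc i) (suc j) eq = cong suc (lookup-injective us i j eq)

  -- If `j` were missed, punching it out of the range would give an injection of `Fin (suc n)` into
  -- `Fin n`.
  Fin-injective⇒surjective : ∀ {n} (f : Fin n → Fin n) → (∀ i j → f i ≡ f j → i ≡ j) →
                             ∀ j → ∃ λ i → f i ≡ j
  Fin-injective⇒surjective {suc n} f inj j with Fin.any? (λ i → f i Fin.≟ j)
  ... | yes found = found
  ... | no ∄i = ⊥-elim (ℕ.<-irrefl refl (Fin.injective⇒≤ {f = g} g-inj))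
    where
    j≢f : ∀ i → j ≢ f i
    j≢f i j≡fi = ∄i (i , sym j≡fi)
    g : Fin (suc n) → Fin n
    g i = punchOut (j≢f i)
    g-inj : ∀ {i k} → g i ≡ g k → i ≡ k
    g-inj {i} {k} eq = inj i k (Fin.punchOut-injective (j≢f i) (j≢f k) eq)

  module FieldProperties (F : FiniteField) where
    open FiniteField F
    open Arithmetic F

    infixl 7 _/_
    infix 9 _⁻¹

    idx : Carrier → Fin order
    idx x = index (complete x)

    elt : Fin order → Carrier
    elt = lookup elements

    elt-idx : ∀ x → elt (idx x) ≡ x
    elt-idx x = sym (lookup-index (complete x))

    idx-elt : ∀ i → idx (elt i) ≡ i
    idx-elt i = lookup-injective unique _ _ (elt-idx (elt i))

    idx-injective : ∀ {x y} → idx x ≡ idx y → x ≡ y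
    idx-injective {x} {y} eq = trans (sym (elt-idx x)) (trans (cong elt eq) (elt-idx y))

    elt-injective : ∀ i j → elt i ≡ elt j → i ≡ j
    elt-injective i j eq = trans (sym (idx-elt i)) (trans (cong idx eq) (idx-elt j))

    -- Equality is decided by positions in `elements`; opacity keeps this search out of later normal
    -- forms.
    opaque
      _≟_ : (x y : Carrier) → Dec (x ≡ y)
      x ≟ y = map′ idx-injective (cong idx) (idx x Fin.≟ idx y)

    any-element? : {P : Carrier → Set} → (∀ x → Dec (P x)) → Dec (∃ P)
    any-element? {P} P? = map′ (λ (i , p) → elt i , p) (λ (x , p) → idx x , subst P (sym (elt-idx x)) p)
                           (Fin.any? (P? ∘ elt))

    injective⇒surjective : (f : Carrier → Carrier) → (∀ x y → f x ≡ f y → x ≡ y) →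
                           ∀ y → ∃ λ x → f x ≡ y
    injective⇒surjective f inj y =
      let i , eq = Fin-injective⇒surjective (idx ∘ f ∘ elt)
                     (λ i j eq → elt-injective i j (inj _ _ (idx-injective eq))) (idx y)
      in elt i , idx-injective eq

    -- Total by the default value 0 at 0, so that quotients can be written without a proof; the
    -- cancellation laws carry the hypothesis instead.
    opaque
      _⁻¹ : Carrier → Carrier
      x ⁻¹ with x ≟ 0#
      ... | yes _   = 0#
      ... | no  x≢0 = proj₁ (inverse x x≢0)

      ⁻¹-inverseʳ : ∀ {x} → x ≢ 0# → x * x ⁻¹ ≡ 1#
      ⁻¹-inverseʳ {x} x≢0 with x ≟ 0#
      ... | yes x≡0  = ⊥-elim (x≢0 x≡0)
      ... | no  x≢0′ = proj₂ (inverse x x≢0′)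

    _/_ : Carrier → Carrier → Carrier
    x / y = x * y ⁻¹

    ⁻¹-inverseˡ : ∀ {x} → x ≢ 0# → x ⁻¹ * x ≡ 1#
    ⁻¹-inverseˡ x≢0 = trans (*-comm _ _) (⁻¹-inverseʳ x≢0)

    1≢0 : 1# ≢ 0#
    1≢0 = 0≢1 ∘ sym

    *-cancelˡ : ∀ {x y z} → x ≢ 0# → x * y ≡ x * z → y ≡ z
    *-cancelˡ {x} {y} {z} x≢0 eq = begin
      y               ≡⟨ *-identityˡ y ⟨
      1# * y          ≡⟨ cong (_* y) (⁻¹-inverseˡ x≢0) ⟨
      x ⁻¹ * x * y    ≡⟨ *-assoc _ _ _ ⟩
      x ⁻¹ * (x * y)  ≡⟨ cong (x ⁻¹ *_) eq ⟩
      x ⁻¹ * (x * z)  ≡⟨ *-assoc _ _ _ ⟨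
      x ⁻¹ * x * z    ≡⟨ cong (_* z) (⁻¹-inverseˡ x≢0) ⟩
      1# * z          ≡⟨ *-identityˡ z ⟩
      z               ∎
      where open ≡-Reasoning

    zero-product : ∀ {x y} → x * y ≡ 0# → x ≢ 0# → y ≡ 0#
    zero-product xy≡0 x≢0 = *-cancelˡ x≢0 (trans xy≡0 (sym (zeroʳ _)))

    *-nonzero : ∀ {x y} → x ≢ 0# → y ≢ 0# → x * y ≢ 0#
    *-nonzero x≢0 y≢0 xy≡0 = y≢0 (zero-product xy≡0 x≢0)

    ⁻¹-nonzero : ∀ {x} → x ≢ 0# → x ⁻¹ ≢ 0#
    ⁻¹-nonzero {x} x≢0 eq = 1≢0 (trans (sym (⁻¹-inverseʳ x≢0)) (trans (cong (x *_) eq) (zeroʳ x)))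

    /-*-cancel : ∀ {x y} → y ≢ 0# → x / y * y ≡ x
    /-*-cancel {x} {y} y≢0 = trans (*-assoc x (y ⁻¹) y)
      (trans (cong (x *_) (⁻¹-inverseˡ y≢0)) (*-identityʳ x))

    x-y≡0⇒x≡y : ∀ {x y} → x - y ≡ 0# → x ≡ y
    x-y≡0⇒x≡y {x} {y} eq = begin
      x            ≡⟨ solve 2 (λ x y → x := (x :- y) :+ y) refl x y ⟩
      (x - y) + y  ≡⟨ cong (_+ y) eq ⟩
      0# + y       ≡⟨ +-identityˡ y ⟩
      y            ∎
      where open ≡-Reasoning

    x≡y⇒x-y≡0 : ∀ {x y} → x ≡ y → x - y ≡ 0#
    x≡y⇒x-y≡0 {x} refl = -‿inverseʳ x

    -x≡0⇒x≡0 : ∀ {x} → - x ≡ 0# → x ≡ 0#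
    -x≡0⇒x≡0 {x} eq = trans (solve 1 (λ x → x := :- (:- x)) refl x) (trans (cong -_ eq) (solve 0 (:- :0 := :0) refl ))

    square≡square : ∀ {x y} → x * x ≡ y * y → x ≡ y ⊎ x ≡ - y
    square≡square {x} {y} eq with (x - y) ≟ 0#
    ... | yes x-y≡0 = inj₁ (x-y≡0⇒x≡y x-y≡0)
    ... | no  x-y≢0 = inj₂ (x-y≡0⇒x≡y (zero-product (trans (solve 2 (λ x y → (x :- y) :* (x :- (:- y)) := x :* x :- y :* y) refl x y)
                                      (x≡y⇒x-y≡0 eq)) x-y≢0))

    pow-* : ∀ x y n → pow (x * y) n ≡ pow x n * pow y n
    pow-* x y zero    = sym (*-identityˡ 1#)
    pow-* x y (suc n) = trans (cong (x * y *_) (pow-* x y n))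
      (solve 4 (λ x y u v → x :* y :* (u :* v) := x :* u :* (y :* v)) refl x y (pow x n) (pow y n))

    pow-+ : ∀ x m n → pow x (m ℕ.+ n) ≡ pow x m * pow x n
    pow-+ x zero    n = sym (*-identityˡ _)
    pow-+ x (suc m) n = trans (cong (x *_) (pow-+ x m n)) (sym (*-assoc _ _ _))

    pow-1 : ∀ n → pow 1# n ≡ 1#
    pow-1 zero    = refl
    pow-1 (suc n) = trans (*-identityˡ _) (pow-1 n)

    pow-pow : ∀ x m n → pow x (m ℕ.* n) ≡ pow (pow x m) n
    pow-pow x m n = trans (cong (pow x) (ℕ.*-comm m n)) (go n)
      where
      go : ∀ n → pow x (n ℕ.* m) ≡ pow (pow x m) n
      go zero    = refl
      go (suc n) = trans (pow-+ x m (n ℕ.* m)) (cong (pow x m *_) (go n))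

    pow-nonzero : ∀ {x} n → x ≢ 0# → pow x n ≢ 0#
    pow-nonzero zero    x≢0 = 1≢0
    pow-nonzero (suc n) x≢0 = *-nonzero x≢0 (pow-nonzero n x≢0)

    private
      module Π = Sum *-commutativeMonoid
      module Σ′ = Sum +-commutativeMonoid
      open Mult semiring using (×ᵤ≈×)
      open import Algebra.Properties.Monoid.Mult
        (Algebra.Bundles.CommutativeMonoid.monoid *-commutativeMonoid) using () renaming (_×_ to _^_)

      ^≡pow : ∀ n x → n ^ x ≡ pow x n
      ^≡pow zero    x = refl
      ^≡pow (suc n) x = cong (x *_) (^≡pow n x)

      Π-nonzero : ∀ {n} (f : Fin n → Carrier) → (∀ i → f i ≢ 0#) → Π.sum f ≢ 0#
      Π-nonzero {zero}  f nz = 1≢0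
      Π-nonzero {suc n} f nz = *-nonzero (nz zero) (Π-nonzero (f ∘ suc) (nz ∘ suc))

      bijection : (f g : Carrier → Carrier) → (∀ x → f (g x) ≡ x) → (∀ x → g (f x) ≡ x) → Permutation′ order
      bijection f g fg gf = permutation (idx ∘ f ∘ elt) (idx ∘ g ∘ elt)
        (λ i → trans (cong (idx ∘ f) (elt-idx _)) (trans (cong idx (fg _)) (idx-elt i)))
        (λ i → trans (cong (idx ∘ g) (elt-idx _)) (trans (cong idx (gf _)) (idx-elt i)))

    -- Translation by 1 permutes the field, so the sum of all elements does not change when `order`
    -- ones are added to it.
    nat-order : nat order ≡ 0#
    nat-order = begin
      nat order                                  ≡⟨ ×ᵤ≈× order 1# ⟨
      order ×ᵤ 1#                                ≡⟨ Σ′.sum-replicate order ⟨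
      S₁                                         ≡⟨ solve 2 (λ a b → b := (a :+ b) :- a) refl S S₁ ⟩
      (S + S₁) - S                               ≡⟨ cong (_- S) (Σ′.∑-distrib-+ elt (λ _ → 1#)) ⟨
      Σ′.sum (λ i → elt i + 1#) - S              ≡⟨ cong (_- S) shifted ⟨
      S - S                                      ≡⟨ -‿inverseʳ S ⟩
      0#                                         ∎
      where
      open ≡-Reasoning
      open import Algebra.Properties.Semiring.Mult semiring using () renaming (_×_ to _×ᵤ_)
      S S₁ : Carrier
      S  = Σ′.sum elt
      S₁ = Σ′.sum {order} (λ _ → 1#)
      π : Permutation′ order
      π = bijection (_+ 1#) (_- 1#) (λ x → solve 1 (λ x → x :- :1 :+ :1 := x) refl x) (λ x → solve 1 (λ x → x :+ :1 :- :1 := x) refl x)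
      shifted : S ≡ Σ′.sum (λ i → elt i + 1#)
      shifted = trans (Σ′.sum-permute elt π) (Σ′.sum-cong-≗ (λ i → elt-idx (elt i + 1#)))

    -- Multiplication by x permutes the nonzero elements; comparing the products gives x^(order - 1) = 1.
    pow-order : ∀ x → pow x order ≡ x
    pow-order x with x ≟ 0#
    ... | yes refl = helper order refl
      where
      helper : ∀ m → m ≡ order → pow 0# m ≡ 0#
      helper zero    eq with () ← subst Fin (sym eq) (idx 0#)
      helper (suc m) eq = zeroˡ _
    ... | no x≢0 = go order refl
      where
      open ≡-Reasoning
      -- `u` replaces 0 by 1, so that the product of `u` over the whole field is the product of the
      -- nonzero elements; `k` is the factor by which multiplication by `x` changes `u`.
      u : Carrier → Carrier
      u y with y ≟ 0#
      ... | yes _ = 1#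
      ... | no  _ = y
      k : Carrier → Carrier
      k y with y ≟ 0#
      ... | yes _ = 1#
      ... | no  _ = x
      u-nonzero : ∀ y → u y ≢ 0#
      u-nonzero y with y ≟ 0#
      ... | yes _   = 1≢0
      ... | no  y≢0 = y≢0
      u-* : ∀ y → u (x * y) ≡ k y * u y
      u-* y with y ≟ 0# | (x * y) ≟ 0#
      ... | yes _    | yes _    = sym (*-identityˡ 1#)
      ... | yes refl | no xy≢0  = ⊥-elim (xy≢0 (zeroʳ x))
      ... | no  y≢0  | yes xy≡0 = ⊥-elim (*-nonzero x≢0 y≢0 xy≡0)
      ... | no  _    | no _     = refl
      π : Permutation′ order
      π = bijection (x *_) (x ⁻¹ *_)
        (λ y → trans (sym (*-assoc _ _ _)) (trans (cong (_* y) (⁻¹-inverseʳ x≢0)) (*-identityˡ y)))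
        (λ y → trans (sym (*-assoc _ _ _)) (trans (cong (_* y) (⁻¹-inverseˡ x≢0)) (*-identityˡ y)))
      P : Carrier
      P = Π.sum (u ∘ elt)
      P≡ : P ≡ Π.sum (k ∘ elt) * P
      P≡ = begin
        P                                  ≡⟨ Π.sum-permute (u ∘ elt) π ⟩
        Π.sum (λ i → u (elt (π ⟨$⟩ʳ i)))   ≡⟨ Π.sum-cong-≗ (λ i → trans (cong u (elt-idx _)) (u-* (elt i))) ⟩
        Π.sum (λ i → k (elt i) * u (elt i)) ≡⟨ Π.∑-distrib-+ (k ∘ elt) (u ∘ elt) ⟩
        Π.sum (k ∘ elt) * P                ∎
      Πk : Π.sum (k ∘ elt) ≡ 1#
      Πk = *-cancelˡ (Π-nonzero (u ∘ elt) (u-nonzero ∘ elt))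
        (trans (*-comm _ _) (trans (sym P≡) (sym (*-identityʳ P))))
      k-0 : k 0# ≡ 1#
      k-0 with 0# ≟ 0#
      ... | yes _  = refl
      ... | no 0≢0 = ⊥-elim (0≢0 refl)
      k-≢0 : ∀ {y} → y ≢ 0# → k y ≡ x
      k-≢0 {y} y≢0 with y ≟ 0#
      ... | yes y≡0 = ⊥-elim (y≢0 y≡0)
      ... | no  _   = refl
      -- The product of `k` has one factor 1, at the position of 0, and otherwise factors `x`; the
      -- order is matched as a successor in order to remove that position.
      go : ∀ m (eq : m ≡ order) → pow x m ≡ x
      go zero    eq with () ← subst Fin (sym eq) (idx 0#)
      go (suc n) eq = trans (cong (x *_) (lemma elt′ z≡0 others (subst-Π eq))) (*-identityʳ x)
        where
        elt′ : Fin (suc n) → Carrier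
        elt′ i = elt (subst Fin eq i)
        z : Fin (suc n)
        z = subst Fin (sym eq) (idx 0#)
        z≡0 : elt′ z ≡ 0#
        z≡0 = trans (cong elt (subst-subst-sym eq)) (elt-idx 0#)
        others : ∀ i → elt′ (punchIn z i) ≢ 0#
        others i e = Fin.punchInᵢ≢i z i
          (trans (sym (subst-sym-subst eq)) (cong (subst Fin (sym eq)) (trans (sym (idx-elt _)) (cong idx e))))
        subst-Π : ∀ {m} (eq : m ≡ order) → Π.sum (λ (i : Fin m) → k (elt (subst Fin eq i))) ≡ 1#
        subst-Π refl = Πk
        lemma : (e : Fin (suc n) → Carrier) → e z ≡ 0# → (∀ i → e (punchIn z i) ≢ 0#) →
                Π.sum (k ∘ e) ≡ 1# → pow x n ≡ 1#
        lemma e ez oth Π≡1 = begin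
          pow x n                                         ≡⟨ ^≡pow n x ⟨
          n ^ x                                           ≡⟨ Π.sum-replicate n ⟨
          Π.sum {n} (λ _ → x)                             ≡⟨ Π.sum-cong-≗ (λ i → sym (k-≢0 (oth i))) ⟩
          Π.sum (λ i → k (e (punchIn z i)))               ≡⟨ *-identityˡ _ ⟨
          1# * Π.sum (λ i → k (e (punchIn z i)))          ≡⟨ cong (_* Π.sum (λ i → k (e (punchIn z i)))) (trans (cong k ez) k-0) ⟨
          k (e z) * Π.sum (λ i → k (e (punchIn z i)))     ≡⟨ Π.sum-remove {i = z} (k ∘ e) ⟨
          Π.sum (k ∘ e)                                   ≡⟨ Π≡1 ⟩
          1#                                              ∎

    -- Horner evaluation, lowest coefficient first. Polynomials are compared only through their
    -- values.
    ev evm : ∀ {n} → Vec Carrier n → Carrier → Carrier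
    ev []       x = 0#
    ev (c ∷ cs) x = c + x * ev cs x
    -- The monic polynomial of degree n with lower coefficients cs.
    evm []       x = 1#
    evm (c ∷ cs) x = c + x * evm cs x

    -- Synthetic division by x - a: the coefficients of the quotient are the values at `a` of the
    -- successive tails.
    quotient quotientm : ∀ {n} → Carrier → Vec Carrier (suc n) → Vec Carrier n
    quotient {zero}  a (c ∷ cs) = []
    quotient {suc n} a (c ∷ cs) = ev cs a ∷ quotient a cs
    quotientm {zero}  a (c ∷ cs) = []
    quotientm {suc n} a (c ∷ cs) = evm cs a ∷ quotientm a cs

    quotient-correct : ∀ {n} a (cs : Vec Carrier (suc n)) x → ev cs x ≡ ev cs a + (x - a) * ev (quotient a cs) x
    quotient-correct {zero}  a (c ∷ []) x = solve 3 (λ a c x → c :+ x :* :0 := c :+ a :* :0 :+ (x :- a) :* :0) refl a c x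
    quotient-correct {suc n} a (c ∷ cs) x = trans (cong (λ y → c + x * y) (quotient-correct a cs x))
      (solve 5 (λ a c x u v → c :+ x :* (u :+ (x :- a) :* v) := c :+ a :* u :+ (x :- a) :* (u :+ x :* v)) refl a c x (ev cs a) (ev (quotient a cs) x))

    quotientm-correct : ∀ {n} a (cs : Vec Carrier (suc n)) x →
                        evm cs x ≡ evm cs a + (x - a) * evm (quotientm a cs) x
    quotientm-correct {zero}  a (c ∷ []) x = solve 3 (λ a c x → c :+ x :* :1 := c :+ a :* :1 :+ (x :- a) :* :1) refl a c x
    quotientm-correct {suc n} a (c ∷ cs) x = trans (cong (λ y → c + x * y) (quotientm-correct a cs x))
      (solve 5 (λ a c x u v → c :+ x :* (u :+ (x :- a) :* v) := c :+ a :* u :+ (x :- a) :* (u :+ x :* v)) refl a c x (evm cs a) (evm (quotientm a cs) x))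

    -- Each root splits off a linear factor, and after as many roots as coefficients nothing is
    -- left.
    ev-vanishes : ∀ {n} (cs : Vec Carrier n) (r : Fin n → Carrier) → (∀ i j → r i ≡ r j → i ≡ j) →
                  (∀ i → ev cs (r i) ≡ 0#) → ∀ x → ev cs x ≡ 0#
    ev-vanishes {zero}  []  r inj van x = refl
    ev-vanishes {suc n} cs r inj van x = trans (quotient-correct (r zero) cs x)
      (trans (cong₂ (λ u v → u + (x - r zero) * v) (van zero)
        (ev-vanishes (quotient (r zero) cs) (r ∘ suc) (λ i j eq → Fin.suc-injective (inj _ _ eq)) rest x))
        (solve 1 (λ y → :0 :+ y :* :0 := :0) refl (x - r zero)))
      where
      rest : ∀ i → ev (quotient (r zero) cs) (r (suc i)) ≡ 0#
      rest i = zero-product {r (suc i) - r zero}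
        (trans (solve 2 (λ u v → v := u :+ v :- u) refl (ev cs (r zero)) ((r (suc i) - r zero) * ev (quotient (r zero) cs) (r (suc i))))
          (trans (cong₂ _-_ (trans (sym (quotient-correct (r zero) cs (r (suc i)))) (van (suc i))) (van zero))
                 (solve 0 (:0 :- :0 := :0) refl )))
        (λ eq → Fin.0≢1+n (inj zero (suc i) (sym (x-y≡0⇒x≡y eq))))

    -- Division by a root keeps a polynomial monic, so n roots leave the constant 1, which cannot
    -- vanish at one more point.
    evm-roots : ∀ {n} (cs : Vec Carrier n) (r : Fin (suc n) → Carrier) → (∀ i j → r i ≡ r j → i ≡ j) →
                ¬ (∀ i → evm cs (r i) ≡ 0#)
    evm-roots {zero}  []  r inj van = 1≢0 (van zero)
    evm-roots {suc n} cs r inj van =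
      evm-roots (quotientm (r zero) cs) (r ∘ suc) (λ i j eq → Fin.suc-injective (inj _ _ eq)) rest
      where
      rest : ∀ i → evm (quotientm (r zero) cs) (r (suc i)) ≡ 0#
      rest i = zero-product {r (suc i) - r zero}
        (trans (solve 2 (λ u v → v := u :+ v :- u) refl (evm cs (r zero)) ((r (suc i) - r zero) * evm (quotientm (r zero) cs) (r (suc i))))
          (trans (cong₂ _-_ (trans (sym (quotientm-correct (r zero) cs (r (suc i)))) (van (suc i))) (van zero))
                 (solve 0 (:0 :- :0 := :0) refl )))
        (λ eq → Fin.0≢1+n (inj zero (suc i) (sym (x-y≡0⇒x≡y eq))))

    evm-difference : ∀ {n} (cs ds : Vec Carrier n) x → evm cs x - evm ds x ≡ ev (zipWith _-_ cs ds) x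
    evm-difference []       []       x = -‿inverseʳ 1#
    evm-difference (c ∷ cs) (d ∷ ds) x =
      trans (solve 5 (λ c d x u v → c :+ x :* u :- (d :+ x :* v) := c :- d :+ x :* (u :- v)) refl c d x (evm cs x) (evm ds x))
            (cong (λ y → c - d + x * y) (evm-difference cs ds x))

    -- The leading terms cancel in the difference, which leaves n coefficients and n zeros.
    -- Additivity of the map x ↦ x^q is drawn from this, without binomial coefficients.
    evm-agree : ∀ {n} (cs ds : Vec Carrier n) (r : Fin n → Carrier) → (∀ i j → r i ≡ r j → i ≡ j) →
                (∀ i → evm cs (r i) ≡ evm ds (r i)) → ∀ x → evm cs x ≡ evm ds x
    evm-agree cs ds r inj agree x = x-y≡0⇒x≡y (trans (evm-difference cs ds x)
      (ev-vanishes (zipWith _-_ cs ds) r inj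
        (λ i → trans (sym (evm-difference cs ds (r i))) (x≡y⇒x-y≡0 (agree i))) x))

    Monic : ℕ → (Carrier → Carrier) → Set
    Monic n f = ∃ λ (cs : Vec Carrier n) → ∀ x → evm cs x ≡ f x

    monic-pow : ∀ n → Monic n (λ x → pow x n)
    monic-pow zero    = [] , λ _ → refl
    monic-pow (suc n) = 0# ∷ proj₁ (monic-pow n) ,
      λ x → trans (+-identityˡ _) (cong (x *_) (proj₂ (monic-pow n) x))

    monic-+ : ∀ {n f} → Monic n f → (ds : Vec Carrier n) → Monic n (λ x → f x + ev ds x)
    monic-+ {zero}  (cs , eq)     []       = cs , λ x → trans (eq x) (sym (+-identityʳ _))
    monic-+ {suc n} (c ∷ cs , eq) (d ∷ ds) = let es , eq′ = monic-+ (cs , λ x → refl) ds in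
      c + d ∷ es , λ x → trans (cong (λ y → c + d + x * y) (eq′ x))
        (trans (solve 5 (λ c d x u v → c :+ d :+ x :* (u :+ v) := c :+ x :* u :+ (d :+ x :* v)) refl c d x (evm cs x) (ev ds x))
               (cong (_+ (d + x * ev ds x)) (eq x)))

    monic-shift : ∀ c n → Monic n (λ x → pow (x + c) n)
    monic-shift c zero    = [] , λ _ → refl
    monic-shift c (suc n) = let cs , eq = monic-shift c n
                                es , eq′ = monic-+ {suc n} (0# ∷ cs , λ x → refl) (scaled cs)
      in es , λ x → trans (eq′ x) (trans (cong (0# + x * evm cs x +_) (scaled-correct cs x))
        (trans (solve 3 (λ c x u → :0 :+ x :* u :+ c :* u := (x :+ c) :* u) refl c x (evm cs x)) (cong ((x + c) *_) (eq x))))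
      where
      scaled : ∀ {n} → Vec Carrier n → Vec Carrier (suc n)
      scaled []       = c ∷ []
      scaled (d ∷ ds) = c * d ∷ scaled ds
      scaled-correct : ∀ {n} (ds : Vec Carrier n) x → ev (scaled ds) x ≡ c * evm ds x
      scaled-correct []       x = solve 2 (λ c x → c :+ x :* :0 := c :* :1) refl c x
      scaled-correct (d ∷ ds) x = trans (cong (λ y → c * d + x * y) (scaled-correct ds x))
        (solve 4 (λ c d x u → c :* d :+ x :* (c :* u) := c :* (d :+ x :* u)) refl c d x (evm ds x))

-- Embedding one finite field into another

module FieldEmbeddings where

  open Rings
  open Fields
  open import Data.Empty using (⊥; ⊥-elim)
  open import Data.Fin as Fin using (Fin; zero; suc)
  import Data.Fin.Properties as Fin
  open import Data.Integer as ℤ using (ℤ)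
  open import Data.List as List using (List)
  open import Data.List.Membership.Propositional using (_∈_)
  open import Data.List.Relation.Unary.Any using (here; there)
  open import Data.Nat as ℕ using (ℕ; zero; suc; _≤_; _<_; s≤s; z≤n)
  import Data.Nat.Properties as ℕ
  open import Data.Nat.Coprimality using (prime⇒coprime; coprime-Bézout)
  open import Data.Nat.GCD using (module Bézout)
  open import Data.Nat.DivMod using (_%_; _/_; m≡m%n+[m/n]*n; m%n<n)
  open import Data.Nat.Primality using (Prime; prime⇒nonZero)
  open import Data.Product using (∃; Σ; _×_; _,_; proj₁; proj₂)
  open import Data.Vec as Vec using (Vec; []; _∷_; _∷ʳ_; initLast; map)
  open import Function using (_∘_; id)
  open import Relation.Nullary using (¬_; Dec; yes; no)
  open import Relation.Nullary.Decidable using (map′; decidable-stable; _×-dec_)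
  open import Relation.Binary.PropositionalEquality

  -- Applied to tables of values, this search decides whether a homomorphism exists.
  any-vec? : ∀ {m} n {P : Vec (Fin m) n → Set} → (∀ v → Dec (P v)) → Dec (∃ P)
  any-vec? zero    P? = map′ ([] ,_) (λ { ([] , p) → p }) (P? [])
  any-vec? (suc n) P? = map′ (λ (x , v , p) → x ∷ v , p) (λ { (x ∷ v , p) → x , v , p })
                            (Fin.any? λ x → any-vec? n λ v → P? (x ∷ v))

  -- No laws are asked for, because elements are compared only through their images in the two
  -- fields.
  record RawRing : Set₁ where
    field
      R       : Set
      _⊕_ _⊗_ : R → R → R
      ⊝_      : R → R
      𝟘 𝟙     : R

  record Hom (A : RawRing) (L : FiniteField) : Set where
    open RawRing A
    open FiniteField L
    field
      ⟦_⟧ : R → Carrier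
      ⟦⊕⟧ : ∀ r s → ⟦ r ⊕ s ⟧ ≡ ⟦ r ⟧ + ⟦ s ⟧
      ⟦⊗⟧ : ∀ r s → ⟦ r ⊗ s ⟧ ≡ ⟦ r ⟧ * ⟦ s ⟧
      ⟦⊝⟧ : ∀ r → ⟦ ⊝ r ⟧ ≡ - ⟦ r ⟧
      ⟦𝟘⟧ : ⟦ 𝟘 ⟧ ≡ 0#
      ⟦𝟙⟧ : ⟦ 𝟙 ⟧ ≡ 1#

  ℤ-ring : RawRing
  ℤ-ring = record { R = ℤ ; _⊕_ = ℤ._+_ ; _⊗_ = ℤ._*_ ; ⊝_ = ℤ.-_ ; 𝟘 = ℤ.+ 0 ; 𝟙 = ℤ.+ 1 }

  int-hom : (L : FiniteField) → Hom ℤ-ring L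
  int-hom L = record { ⟦_⟧ = int ; ⟦⊕⟧ = int-+ ; ⟦⊗⟧ = int-* ; ⟦⊝⟧ = int-neg ; ⟦𝟘⟧ = refl ; ⟦𝟙⟧ = refl }
    where open Arithmetic L

  module Polynomials (A : RawRing) where
    open RawRing A

    Poly : Set
    Poly = List R

    infixl 6 _⊕ₚ_
    _⊕ₚ_ : Poly → Poly → Poly
    List.[]     ⊕ₚ g          = g
    (c List.∷ f) ⊕ₚ List.[]    = c List.∷ f
    (c List.∷ f) ⊕ₚ (d List.∷ g) = c ⊕ d List.∷ (f ⊕ₚ g)

    scale : R → Poly → Poly
    scale c = List.map (c ⊗_)

    _⊗ₚ_ : Poly → Poly → Poly
    List.[]     ⊗ₚ g = List.[]
    (c List.∷ f) ⊗ₚ g = scale c g ⊕ₚ (𝟘 List.∷ (f ⊗ₚ g))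

    polynomials : RawRing
    polynomials = record { R = Poly ; _⊕_ = _⊕ₚ_ ; _⊗_ = _⊗ₚ_ ; ⊝_ = List.map ⊝_
                         ; 𝟘 = List.[] ; 𝟙 = 𝟙 List.∷ List.[] }

    subtract-multiple : ∀ {n} → Vec R n → R → Vec R n → Vec R n
    subtract-multiple r c m = Vec.zipWith (λ x y → x ⊕ (⊝ (c ⊗ y))) r m

    -- The remainder of c + x r modulo the monic polynomial with lower coefficients m, and its quotient.
    step : ∀ {n} → R → Vec R n → Vec R n → Vec R n × R
    step c r m with initLast (c ∷ r)
    ... | init , l , _ = subtract-multiple init l m , l

    divide : ∀ {n} → Vec R n → Poly → Vec R n × Poly
    divide m List.[]       = Vec.replicate _ 𝟘 , List.[]
    divide m (c List.∷ f) =
      let r , s = divide m f ; r′ , l = step c r m in r′ , l List.∷ s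

    -- A quotient of monic polynomials is again monic and its degree is visible in the type; both
    -- are used in `root` to bound its number of zeros.
    dividem : ∀ {n} k → Vec R n → Vec R (k ℕ.+ n) → Vec R n × Vec R k
    dividem zero    m f       = subtract-multiple f 𝟙 m , []
    dividem (suc k) m (c ∷ f) =
      let r , s = dividem k m f ; r′ , l = step c r m in r′ , l ∷ s

    module Evaluation (L : FiniteField) (h : Hom A L) where
      open FiniteField L
      open Arithmetic L
      open FieldProperties L
      open Hom h

      eval : Poly → Carrier → Carrier
      eval List.[]       x = 0#
      eval (c List.∷ f) x = ⟦ c ⟧ + x * eval f x

      eval-⊕ : ∀ f g x → eval (f ⊕ₚ g) x ≡ eval f x + eval g x
      eval-⊕ List.[]       g              x = sym (+-identityˡ _)
      eval-⊕ (c List.∷ f) List.[]        x = sym (+-identityʳ _)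
      eval-⊕ (c List.∷ f) (d List.∷ g) x = trans (cong₂ (λ y z → y + x * z) (⟦⊕⟧ c d) (eval-⊕ f g x))
        (solve 5 (λ c d x u v → c :+ d :+ x :* (u :+ v) := c :+ x :* u :+ (d :+ x :* v)) refl (⟦ c ⟧) (⟦ d ⟧) x (eval f x) (eval g x))

      eval-scale : ∀ c g x → eval (scale c g) x ≡ ⟦ c ⟧ * eval g x
      eval-scale c List.[]       x = sym (zeroʳ _)
      eval-scale c (d List.∷ g) x = trans (cong₂ (λ y z → y + x * z) (⟦⊗⟧ c d) (eval-scale c g x))
        (solve 4 (λ c d x v → c :* d :+ x :* (c :* v) := c :* (d :+ x :* v)) refl (⟦ c ⟧) (⟦ d ⟧) x (eval g x))

      eval-⊗ : ∀ f g x → eval (f ⊗ₚ g) x ≡ eval f x * eval g x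
      eval-⊗ List.[]       g x = sym (zeroˡ _)
      eval-⊗ (c List.∷ f) g x = trans (eval-⊕ (scale c g) _ x)
        (trans (cong₂ _+_ (eval-scale c g x) (cong₂ (λ y z → y + x * z) ⟦𝟘⟧ (eval-⊗ f g x)))
        (solve 4 (λ c x u v → c :* v :+ (:0 :+ x :* (u :* v)) := (c :+ x :* u) :* v) refl (⟦ c ⟧) x (eval f x) (eval g x)))

      eval-⊝ : ∀ f x → eval (List.map ⊝_ f) x ≡ - eval f x
      eval-⊝ List.[]       x = solve 0 (:0 := :- :0) refl
      eval-⊝ (c List.∷ f) x = trans (cong₂ (λ y z → y + x * z) (⟦⊝⟧ c) (eval-⊝ f x))
        (solve 3 (λ c x u → :- c :+ x :* (:- u) := :- (c :+ x :* u)) refl (⟦ c ⟧) x (eval f x))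

      eval-const : ∀ c x → eval (c List.∷ List.[]) x ≡ ⟦ c ⟧
      eval-const c x = solve 2 (λ c x → c :+ x :* :0 := c) refl (⟦ c ⟧) x

      eval-hom : Carrier → Hom polynomials L
      eval-hom a = record
        { ⟦_⟧ = λ f → eval f a
        ; ⟦⊕⟧ = λ f g → eval-⊕ f g a
        ; ⟦⊗⟧ = λ f g → eval-⊗ f g a
        ; ⟦⊝⟧ = λ f → eval-⊝ f a
        ; ⟦𝟘⟧ = refl
        ; ⟦𝟙⟧ = trans (eval-const 𝟙 a) ⟦𝟙⟧ }

      evᵣ evmᵣ : ∀ {n} → Vec R n → Carrier → Carrier
      evᵣ cs  = ev (map ⟦_⟧ cs)
      evmᵣ cs = evm (map ⟦_⟧ cs)

      ev-replicate : ∀ n x → evᵣ (Vec.replicate n 𝟘) x ≡ 0#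
      ev-replicate zero    x = refl
      ev-replicate (suc n) x = trans (cong₂ (λ y z → y + x * z) ⟦𝟘⟧ (ev-replicate n x)) (solve 1 (λ x → :0 :+ x :* :0 := :0) refl x)

      ev-∷ʳ : ∀ {n} (cs : Vec R n) l x → evᵣ (cs ∷ʳ l) x ≡ evᵣ cs x + ⟦ l ⟧ * pow x n
      ev-∷ʳ []       l x = solve 2 (λ l x → l :+ x :* :0 := :0 :+ l :* :1) refl (⟦ l ⟧) x
      ev-∷ʳ {suc n} (c ∷ cs) l x = trans (cong (λ y → ⟦ c ⟧ + x * y) (ev-∷ʳ cs l x))
        (solve 5 (λ c l x u p → c :+ x :* (u :+ l :* p) := c :+ x :* u :+ l :* (x :* p)) refl (⟦ c ⟧) (⟦ l ⟧) x (evᵣ cs x) (pow x n))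

      evm-pow : ∀ {n} (cs : Vec R n) x → evmᵣ cs x ≡ evᵣ cs x + pow x n
      evm-pow []       x = sym (+-identityˡ 1#)
      evm-pow {suc n} (c ∷ cs) x = trans (cong (λ y → ⟦ c ⟧ + x * y) (evm-pow cs x))
        (solve 4 (λ c x u p → c :+ x :* (u :+ p) := c :+ x :* u :+ x :* p) refl (⟦ c ⟧) x (evᵣ cs x) (pow x n))

      ev-subtract : ∀ {n} (r : Vec R n) c m x → evᵣ (subtract-multiple r c m) x ≡ evᵣ r x - ⟦ c ⟧ * evᵣ m x
      ev-subtract []      c []      x = solve 1 (λ c → :0 := :0 :- c :* :0) refl (⟦ c ⟧)
      ev-subtract (r ∷ rs) c (m ∷ ms) x = trans
        (cong₂ (λ y z → y + x * z) (trans (⟦⊕⟧ r _) (cong (⟦ r ⟧ +_) (trans (⟦⊝⟧ _) (cong -_ (⟦⊗⟧ c m))))) (ev-subtract rs c ms x))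
        (solve 6 (λ r c m x u v → r :- c :* m :+ x :* (u :- c :* v) := r :+ x :* u :- c :* (m :+ x :* v)) refl (⟦ r ⟧) (⟦ c ⟧) (⟦ m ⟧) x (evᵣ rs x) (evᵣ ms x))

      step-correct : ∀ {n} c (r m : Vec R n) x → let r′ , l = step c r m in
                     ⟦ c ⟧ + x * evᵣ r x ≡ evmᵣ m x * ⟦ l ⟧ + evᵣ r′ x
      step-correct {n} c r m x with initLast (c ∷ r)
      ... | init , l , eq = begin
        ⟦ c ⟧ + x * evᵣ r x                      ≡⟨ cong (λ v → evᵣ v x) eq ⟩
        evᵣ (init ∷ʳ l) x                        ≡⟨ ev-∷ʳ init l x ⟩
        evᵣ init x + ⟦ l ⟧ * pow x n             ≡⟨ solve 4 (λ i l p m → i :+ l :* p := (m :+ p) :* l :+ (i :- l :* m)) refl (evᵣ init x) (⟦ l ⟧) (pow x n) (evᵣ m x) ⟩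
        (evᵣ m x + pow x n) * ⟦ l ⟧ + (evᵣ init x - ⟦ l ⟧ * evᵣ m x)
          ≡⟨ cong₂ (λ y z → y * ⟦ l ⟧ + z) (evm-pow m x) (ev-subtract init l m x) ⟨
        evmᵣ m x * ⟦ l ⟧ + evᵣ (subtract-multiple init l m) x ∎
        where open ≡-Reasoning

      divide-correct : ∀ {n} (m : Vec R n) f x → let r , s = divide m f in
                       eval f x ≡ evmᵣ m x * eval s x + evᵣ r x
      divide-correct {n} m List.[] x = sym (trans (cong (evmᵣ m x * 0# +_) (ev-replicate n x))
        (solve 1 (λ m → m :* :0 :+ :0 := :0) refl (evmᵣ m x)))
      divide-correct m (c List.∷ f) x = let r , s = divide m f ; r′ , l = step c r m in
        trans (cong (λ y → ⟦ c ⟧ + x * y) (divide-correct m f x))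
        (trans (solve 5 (λ c x m s r → c :+ x :* (m :* s :+ r) := m :* (x :* s) :+ (c :+ x :* r)) refl (⟦ c ⟧) x (evmᵣ m x) (eval s x) (evᵣ r x))
        (trans (cong (evmᵣ m x * (x * eval s x) +_) (step-correct c r m x))
        (solve 5 (λ x m s l r → m :* (x :* s) :+ (m :* l :+ r) := m :* (l :+ x :* s) :+ r) refl x (evmᵣ m x) (eval s x) (⟦ l ⟧) (evᵣ r′ x))))

      dividem-correct : ∀ {n} k (m : Vec R n) (f : Vec R (k ℕ.+ n)) x → let r , s = dividem k m f in
                        evmᵣ f x ≡ evmᵣ m x * evmᵣ s x + evᵣ r x
      dividem-correct {n} zero m f x = begin
        evmᵣ f x                                ≡⟨ evm-pow f x ⟩
        evᵣ f x + pow x n                       ≡⟨ solve 3 (λ f p m → f :+ p := (m :+ p) :* :1 :+ (f :- :1 :* m)) refl (evᵣ f x) (pow x n) (evᵣ m x) ⟩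
        (evᵣ m x + pow x n) * 1# + (evᵣ f x - 1# * evᵣ m x)
          ≡⟨ cong₂ (λ y z → y * 1# + z) (evm-pow m x)
               (trans (ev-subtract f 𝟙 m x) (cong (λ y → evᵣ f x - y * evᵣ m x) ⟦𝟙⟧)) ⟨
        evmᵣ m x * 1# + evᵣ (subtract-multiple f 𝟙 m) x ∎
        where open ≡-Reasoning
      dividem-correct (suc k) m (c ∷ f) x = let r , s = dividem k m f ; r′ , l = step c r m in
        trans (cong (λ y → ⟦ c ⟧ + x * y) (dividem-correct k m f x))
        (trans (solve 5 (λ c x m s r → c :+ x :* (m :* s :+ r) := m :* (x :* s) :+ (c :+ x :* r)) refl (⟦ c ⟧) x (evmᵣ m x) (evmᵣ s x) (evᵣ r x))
        (trans (cong (evmᵣ m x * (x * evmᵣ s x) +_) (step-correct c r m x))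
        (solve 5 (λ x m s l r → m :* (x :* s) :+ (m :* l :+ r) := m :* (l :+ x :* s) :+ r) refl x (evmᵣ m x) (evmᵣ s x) (⟦ l ⟧) (evᵣ r′ x))))

  record FieldHom (F K : FiniteField) : Set where
    private
      module F = FiniteField F
      module K = FiniteField K
    field
      ι   : F.Carrier → K.Carrier
      ι-+ : ∀ x y → ι (x F.+ y) ≡ ι x K.+ ι y
      ι-* : ∀ x y → ι (x F.* y) ≡ ι x K.* ι y
      ι-1 : ι F.1# ≡ K.1#

  -- Uniqueness of finite fields, as an extension argument: a ring R with homomorphisms to F and to K such
  -- that ker (R → F) ⊆ ker (R → K) gives a homomorphism im (R → F) → K.  For a ∈ F the minimal polynomial of a
  -- over the image divides x^Q - x, which splits over K, so R[x] can be mapped to F and K with x ↦ a.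
  module Embedding (F K : FiniteField)
    (F-pow : ∀ x → FiniteField.pow F x (FiniteField.order K) ≡ x)
    (int-ker : ∀ i → Arithmetic.int F i ≡ FiniteField.0# F → Arithmetic.int K i ≡ FiniteField.0# K) where
    private
      module F = FiniteField F
      module FA = Arithmetic F
      module FP = FieldProperties F
      module K = FiniteField K
      module KA = Arithmetic K
      module KP = FieldProperties K

    Q : ℕ
    Q = K.order

    record Span : Set₁ where
      field
        A   : RawRing
        φ   : Hom A F
        ψ   : Hom A K
        ker : ∀ r → Hom.⟦_⟧ φ r ≡ F.0# → Hom.⟦_⟧ ψ r ≡ K.0#
      open RawRing A public

    Covers : Span → F.Carrier → Set
    Covers S a = ∃ λ r → Hom.⟦_⟧ (Span.φ S) r ≡ a

    module _ (S : Span) (a : F.Carrier) where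
      open Span S
      open Polynomials A
      private
        module φ where
          open Hom φ public
          open Evaluation F φ public
        module ψ where
          open Hom ψ public
          open Evaluation K ψ public

      Annihilator : ℕ → Set
      Annihilator n = Σ (Vec R n) λ m → φ.evmᵣ m a ≡ F.0#

      x^_-x : ∀ n → Vec R (2 ℕ.+ n)
      x^ n -x = 𝟘 ∷ ⊝ 𝟙 ∷ Vec.replicate n 𝟘

      module _ (L : FiniteField) (h : Hom A L) where
        open FiniteField L
        open Arithmetic L
        open Polynomials.Evaluation A L h
        open Hom h
        ev-x^n-x : ∀ n x → evmᵣ (x^ n -x) x ≡ pow x (2 ℕ.+ n) - x
        ev-x^n-x n x = trans (cong₂ (λ y z → y + x * z) ⟦𝟘⟧
            (cong₂ (λ y z → y + x * z) (trans (⟦⊝⟧ 𝟙) (cong -_ ⟦𝟙⟧))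
              (trans (evm-pow (Vec.replicate n 𝟘) x) (cong (_+ pow x n) (ev-replicate n x)))))
          (solve 2 (λ x p → :0 :+ x :* (:- :1 :+ x :* (:0 :+ p)) := x :* (x :* p) :- x) refl x (pow x n))

      powR : R → ℕ → R
      powR r zero    = 𝟙
      powR r (suc n) = r ⊗ powR r n

      powR-pow : ∀ r n → φ.⟦ powR r n ⟧ ≡ F.pow φ.⟦ r ⟧ n
      powR-pow r zero    = φ.⟦𝟙⟧
      powR-pow r (suc n) = trans (φ.⟦⊗⟧ r _) (cong (φ.⟦ r ⟧ F.*_) (powR-pow r n))

      ev-scale : ∀ {n} c (cs : Vec R n) x → φ.evᵣ (map (c ⊗_) cs) x ≡ φ.⟦ c ⟧ F.* φ.evᵣ cs x
      ev-scale c []       x = sym (FA.zeroʳ _)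
      ev-scale c (d ∷ cs) x = trans (cong₂ (λ y z → y F.+ x F.* z) (φ.⟦⊗⟧ c d) (ev-scale c cs x)) lemma
        where
        open F
        open FA
        lemma : φ.⟦ c ⟧ * φ.⟦ d ⟧ + x * (φ.⟦ c ⟧ * φ.evᵣ cs x) ≡ φ.⟦ c ⟧ * (φ.⟦ d ⟧ + x * φ.evᵣ cs x)
        lemma = solve 4 (λ c d x v → c :* d :+ x :* (c :* v) := c :* (d :+ x :* v)) refl (φ.⟦ c ⟧) (φ.⟦ d ⟧) x (φ.evᵣ cs x)

      -- A least degree is found only under double negation, since for an abstract `R` there is no
      -- test for an annihilator of given degree.
      least : ∀ n → Annihilator n → ¬ ¬ (∃ λ m → m ≤ n × Annihilator m × (∀ k → k < m → ¬ Annihilator k))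
      least n ann none = go n (suc n) (ℕ.n<1+n n) ann ℕ.≤-refl
        where
        -- `b` is fuel: it exceeds the current degree and drops by one with every smaller
        -- annihilator.
        go : ∀ m b → m < b → Annihilator m → m ≤ n → ⊥
        go m (suc b) (s≤s m≤b) ann m≤n = none (m , m≤n , ann , λ k k<m ann′ →
          go k b (ℕ.<-≤-trans k<m m≤b) ann′ (ℕ.≤-trans (ℕ.<⇒≤ k<m) m≤n))

      module _ (n : ℕ) (2+n≡Q : 2 ℕ.+ n ≡ Q)
               (d : ℕ) (d≤Q : d ≤ Q) (m : Vec R d) (m[a]≡0 : φ.evmᵣ m a ≡ F.0#)
               (minimal : ∀ k → k < d → ¬ Annihilator k) where

        -- With n = Q - 2 this provides inverses inside `R`, which has none of its own: a power in
        -- `R` is mapped to the inverse in F.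
        inverse-pow : ∀ x → x ≢ F.0# → x F.* F.pow x n ≡ F.1#
        inverse-pow x x≢0 = FP.*-cancelˡ x≢0 (trans (trans (cong (F.pow x) 2+n≡Q) (F-pow x)) (sym (FA.*-identityʳ x)))

        -- If the leading coefficient were nonzero in F, scaling by its inverse would give a monic
        -- annihilator of degree below d. So it vanishes in F, by `ker` in K as well, and the
        -- shorter polynomial takes over.
        remainder-zero : ∀ k → k ≤ d → (r : Vec R k) → φ.evᵣ r a ≡ F.0# → ∀ y → ψ.evᵣ r y ≡ K.0#
        remainder-zero zero    k≤d [] r[a]≡0 y = refl
        remainder-zero (suc k) k<d r  r[a]≡0 y with initLast r
        ... | init , l , refl with φ.⟦ l ⟧ FP.≟ F.0#
        ... | yes φl≡0 = begin
          ψ.evᵣ (init ∷ʳ l) y                      ≡⟨ ψ.ev-∷ʳ init l y ⟩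
          ψ.evᵣ init y K.+ ψ.⟦ l ⟧ K.* K.pow y k   ≡⟨ cong₂ (λ u v → u K.+ v K.* K.pow y k)
                                                      (remainder-zero k (ℕ.<⇒≤ k<d) init init[a]≡0 y) (ker l φl≡0) ⟩
          K.0# K.+ K.0# K.* K.pow y k              ≡⟨ trans (KA.+-identityˡ _) (KA.zeroˡ _) ⟩
          K.0#                                     ∎
          where
          open ≡-Reasoning
          init[a]≡0 : φ.evᵣ init a ≡ F.0#
          init[a]≡0 = begin
            φ.evᵣ init a                              ≡⟨ FA.+-identityʳ _ ⟨
            φ.evᵣ init a F.+ F.0#                     ≡⟨ cong (φ.evᵣ init a F.+_) (FA.zeroˡ _) ⟨
            φ.evᵣ init a F.+ F.0# F.* F.pow a k       ≡⟨ cong (λ u → φ.evᵣ init a F.+ u F.* F.pow a k) φl≡0 ⟨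
            φ.evᵣ init a F.+ φ.⟦ l ⟧ F.* F.pow a k    ≡⟨ φ.ev-∷ʳ init l a ⟨
            φ.evᵣ (init ∷ʳ l) a                       ≡⟨ r[a]≡0 ⟩
            F.0#                                      ∎
        ... | no φl≢0 = ⊥-elim (minimal k k<d (map (powR l n ⊗_) init , (begin
            φ.evmᵣ (map (l⁻¹ ⊗_) init) a                      ≡⟨ φ.evm-pow (map (l⁻¹ ⊗_) init) a ⟩
            φ.evᵣ (map (l⁻¹ ⊗_) init) a F.+ F.pow a k         ≡⟨ cong₂ F._+_ (ev-scale l⁻¹ init a) (sym (FA.*-identityˡ _)) ⟩
            φ.⟦ l⁻¹ ⟧ F.* φ.evᵣ init a F.+ F.1# F.* F.pow a k  ≡⟨ cong (λ u → φ.⟦ l⁻¹ ⟧ F.* φ.evᵣ init a F.+ u F.* F.pow a k)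
                                                                    (trans (sym (inverse-pow _ φl≢0))
                                                                    (trans (FA.*-comm _ _) (cong (F._* φ.⟦ l ⟧) (sym (powR-pow l n))))) ⟩
            φ.⟦ l⁻¹ ⟧ F.* φ.evᵣ init a F.+ φ.⟦ l⁻¹ ⟧ F.* φ.⟦ l ⟧ F.* F.pow a k
              ≡⟨ trans (cong (φ.⟦ l⁻¹ ⟧ F.* φ.evᵣ init a F.+_) (FA.*-assoc _ _ _)) (sym (FA.distribˡ _ _ _)) ⟩
            φ.⟦ l⁻¹ ⟧ F.* (φ.evᵣ init a F.+ φ.⟦ l ⟧ F.* F.pow a k)  ≡⟨ cong (φ.⟦ l⁻¹ ⟧ F.*_) (trans (sym (φ.ev-∷ʳ init l a)) r[a]≡0) ⟩
            φ.⟦ l⁻¹ ⟧ F.* F.0#                                ≡⟨ FA.zeroʳ _ ⟩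
            F.0#                                              ∎)))
          where
          open ≡-Reasoning
          l⁻¹ : R
          l⁻¹ = powR l n

        -- Otherwise the cofactor `s` of `m` in x^Q - x has all Q elements of K as zeros. Its degree
        -- is Q - d, which is below Q because a monic polynomial of degree 0 is the constant 1 and
        -- annihilates nothing.
        root : ∃ λ b → ψ.evmᵣ m b ≡ K.0#
        root with KP.any-element? (λ b → ψ.evmᵣ m b KP.≟ K.0#)
        ... | yes found = found
        ... | no ∄b = ⊥-elim (no-root (Q ℕ.∸ d) (trans (ℕ.m∸n+n≡m d≤Q) (sym 2+n≡Q)))
          where
          no-root : ∀ k → k ℕ.+ d ≡ 2 ℕ.+ n → ⊥
          no-root k k+d≡2+n = KP.evm-roots (map ψ.⟦_⟧ s) (λ i → KP.elt (Fin.inject≤ i k<Q))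
            (λ i j eq → Fin.inject≤-injective k<Q k<Q i j (KP.elt-injective _ _ eq)) (λ i → s-root _)
            where
            f : Vec R (k ℕ.+ d)
            f = subst (Vec R) (sym k+d≡2+n) (x^ n -x)
            ev-subst : ∀ {L} (h : Hom A L) {i j} (eq : i ≡ j) (v : Vec R i) x →
                       Polynomials.Evaluation.evmᵣ A L h (subst (Vec R) eq v) x ≡ Polynomials.Evaluation.evmᵣ A L h v x
            ev-subst h refl v x = refl
            r : Vec R d
            r = proj₁ (dividem k m f)
            s : Vec R k
            s = proj₂ (dividem k m f)
            f[a]≡0 : φ.evmᵣ f a ≡ F.0#
            f[a]≡0 = trans (ev-subst φ (sym k+d≡2+n) (x^ n -x) a) (trans (ev-x^n-x F φ n a)
              (FP.x≡y⇒x-y≡0 (trans (cong (F.pow a) 2+n≡Q) (F-pow a))))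
            f[y]≡0 : ∀ y → ψ.evmᵣ f y ≡ K.0#
            f[y]≡0 y = trans (ev-subst ψ (sym k+d≡2+n) (x^ n -x) y) (trans (ev-x^n-x K ψ n y)
              (KP.x≡y⇒x-y≡0 (trans (cong (K.pow y) 2+n≡Q) (KP.pow-order y))))
            r[a]≡0 : φ.evᵣ r a ≡ F.0#
            r[a]≡0 = trans (sym (trans (cong (λ u → u F.* φ.evmᵣ s a F.+ φ.evᵣ r a) m[a]≡0)
                                       (trans (cong (F._+ φ.evᵣ r a) (FA.zeroˡ _)) (FA.+-identityˡ _))))
                           (trans (sym (φ.dividem-correct k m f a)) f[a]≡0)
            s-root : ∀ y → ψ.evmᵣ s y ≡ K.0#
            s-root y = KP.zero-product (trans (sym (KA.+-identityʳ _))
              (trans (cong (ψ.evmᵣ m y K.* ψ.evmᵣ s y K.+_) (sym (remainder-zero d ℕ.≤-refl r r[a]≡0 y)))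
              (trans (sym (ψ.dividem-correct k m f y)) (f[y]≡0 y)))) (λ e → ∄b (y , e))
            d≢0 : ∀ {e} (v : Vec R e) → φ.evmᵣ v a ≡ F.0# → 0 < e
            d≢0 []      eq = ⊥-elim (FP.1≢0 eq)
            d≢0 (_ ∷ _) eq = s≤s z≤n
            k<Q : suc k ≤ Q
            k<Q = ℕ.≤-trans (ℕ.≤-reflexive (ℕ.+-comm 1 k)) (ℕ.≤-trans (ℕ.+-monoʳ-≤ k (d≢0 m m[a]≡0))
                    (ℕ.≤-reflexive (trans k+d≡2+n 2+n≡Q)))

        extension : Span
        extension = record { A = polynomials ; φ = φ.eval-hom a ; ψ = ψ.eval-hom (proj₁ root) ; ker = kernel }
          where
          kernel : ∀ f → φ.eval f a ≡ F.0# → ψ.eval f (proj₁ root) ≡ K.0#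
          kernel f f[a]≡0 = let r , s = divide m f ; b , m[b]≡0 = root in
            trans (ψ.divide-correct m f b) (trans (cong₂ (λ u v → u K.* ψ.eval s b K.+ v) m[b]≡0
              (remainder-zero d ℕ.≤-refl r
                (trans (sym (trans (cong (λ u → u F.* φ.eval s a F.+ φ.evᵣ r a) m[a]≡0)
                                       (trans (cong (F._+ φ.evᵣ r a) (FA.zeroˡ _)) (FA.+-identityˡ _))))
                       (trans (sym (φ.divide-correct m f a)) f[a]≡0)) b))
              (trans (KA.+-identityʳ _) (KA.zeroˡ _)))

        extension-covers-a : Covers extension a
        extension-covers-a = 𝟘 List.∷ 𝟙 List.∷ List.[] , trans (cong₂ (λ u v → u F.+ a F.* v) φ.⟦𝟘⟧
          (trans (φ.eval-const 𝟙 a) φ.⟦𝟙⟧)) (trans (FA.+-identityˡ _) (FA.*-identityʳ a))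

        extension-covers : ∀ x → Covers S x → Covers extension x
        extension-covers x (r , eq) = r List.∷ List.[] , trans (φ.eval-const r a) eq

      extend : ¬ ¬ (Σ Span λ T → Covers T a × (∀ x → Covers S x → Covers T x))
      extend none = go Q refl
        where
        go : ∀ c → c ≡ Q → ⊥
        -- Orders 0 and 1 are excluded by the elements 0 and 1 of K, so that the exponent Q - 2
        -- makes sense.
        go 0 eq with () ← subst Fin (sym eq) (KP.idx K.0#)
        go 1 eq = K.0≢1 (KP.idx-injective (Fin1 (sym eq) (KP.idx K.0#) (KP.idx K.1#)))
          where
          Fin1 : ∀ {c} → c ≡ 1 → (i j : Fin c) → i ≡ j
          Fin1 refl zero zero = refl
        go (suc (suc n)) eq = least (2 ℕ.+ n)
          (x^ n -x , trans (ev-x^n-x F φ n a) (FP.x≡y⇒x-y≡0 (trans (cong (F.pow a) eq) (F-pow a))))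
          λ (d , d≤ , (m , m[a]≡0) , minimal) → none
            ( extension n eq d (subst (d ≤_) eq d≤) m m[a]≡0 minimal
            , extension-covers-a n eq d (subst (d ≤_) eq d≤) m m[a]≡0 minimal
            , extension-covers n eq d (subst (d ≤_) eq d≤) m m[a]≡0 minimal)

    prime-ring : Span
    prime-ring = record { A = ℤ-ring ; φ = int-hom F ; ψ = int-hom K ; ker = int-ker }

    covering : (xs : List F.Carrier) → ¬ ¬ (Σ Span λ S → ∀ x → x ∈ xs → Covers S x)
    covering List.[]       none = none (prime-ring , λ x ())
    covering (a List.∷ xs) none = covering xs λ (S , cov) → extend S a λ (T , T-a , T-S) →
      none (T , λ { x (here refl) → T-a ; x (there x∈) → T-S x (cov x x∈) })

    IsHom : (F.Carrier → K.Carrier) → Set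
    IsHom f = (∀ x y → f (x F.+ y) ≡ f x K.+ f y) × (∀ x y → f (x F.* y) ≡ f x K.* f y) × f F.1# ≡ K.1#

    span⇒hom : (S : Span) → (∀ x → Covers S x) → ∃ IsHom
    span⇒hom S cov = f ,
      (λ x y → trans (well-defined _ (r x ⊕ r y) (trans (φ-r (x F.+ y)) (sym (trans (φ.⟦⊕⟧ _ _) (cong₂ F._+_ (φ-r x) (φ-r y))))))
                     (ψ.⟦⊕⟧ _ _)) ,
      (λ x y → trans (well-defined _ (r x ⊗ r y) (trans (φ-r (x F.* y)) (sym (trans (φ.⟦⊗⟧ _ _) (cong₂ F._*_ (φ-r x) (φ-r y))))))
                     (ψ.⟦⊗⟧ _ _)) ,
      trans (well-defined _ 𝟙 (trans (φ-r F.1#) (sym φ.⟦𝟙⟧))) ψ.⟦𝟙⟧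
      where
      open Span S
      module φ = Hom φ
      module ψ = Hom ψ
      r : F.Carrier → R
      r x = proj₁ (cov x)
      φ-r : ∀ x → φ.⟦ r x ⟧ ≡ x
      φ-r x = proj₂ (cov x)
      f : F.Carrier → K.Carrier
      f x = ψ.⟦ r x ⟧
      well-defined : ∀ s t → φ.⟦ s ⟧ ≡ φ.⟦ t ⟧ → ψ.⟦ s ⟧ ≡ ψ.⟦ t ⟧
      well-defined s t eq = KP.x-y≡0⇒x≡y (trans (sym (trans (ψ.⟦⊕⟧ _ _) (cong (ψ.⟦ s ⟧ K.+_) (ψ.⟦⊝⟧ t))))
        (ker (s ⊕ (⊝ t)) (trans (trans (φ.⟦⊕⟧ _ _) (cong (φ.⟦ s ⟧ F.+_) (φ.⟦⊝⟧ t))) (FP.x≡y⇒x-y≡0 eq))))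

    -- The chain of extensions exists only under double negation. A homomorphism is a finite table
    -- of values, so its existence is decidable and hence stable.
    embedding : FieldHom F K
    embedding = let v , +-hom , *-hom , 1-hom = decidable-stable table? λ none →
                      covering F.elements λ (S , cov) →
                        let f , hom = span⇒hom S (λ x → cov x (F.complete x)) in
                        none (Vec.tabulate (KP.idx ∘ f ∘ FP.elt) , cong-hom f (fn (Vec.tabulate (KP.idx ∘ f ∘ FP.elt))) (agree f) hom)
      in record { ι = fn v ; ι-+ = +-hom ; ι-* = *-hom ; ι-1 = 1-hom }
      where
      fn : Vec (Fin K.order) F.order → F.Carrier → K.Carrier
      fn v x = KP.elt (Vec.lookup v (FP.idx x))
      all-elements? : {P : F.Carrier → Set} → (∀ x → Dec (P x)) → Dec (∀ x → P x)
      all-elements? {P} P? = map′ (λ h x → subst P (FP.elt-idx x) (h (FP.idx x))) (λ h i → h (FP.elt i)) (Fin.all? (P? ∘ FP.elt))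
      table? : Dec (∃ λ v → IsHom (fn v))
      table? = any-vec? F.order λ v →
        (all-elements? λ x → all-elements? λ y → fn v (x F.+ y) KP.≟ (fn v x K.+ fn v y)) ×-dec
        (all-elements? λ x → all-elements? λ y → fn v (x F.* y) KP.≟ (fn v x K.* fn v y)) ×-dec
        (fn v F.1# KP.≟ K.1#)
      agree : ∀ f x → f x ≡ fn (Vec.tabulate (KP.idx ∘ f ∘ FP.elt)) x
      agree f x = sym (trans (cong KP.elt (lookup∘tabulate (KP.idx ∘ f ∘ FP.elt) (FP.idx x)))
        (trans (KP.elt-idx _) (cong f (FP.elt-idx x))))
        where open import Data.Vec.Properties using (lookup∘tabulate)
      cong-hom : ∀ f g → (∀ x → f x ≡ g x) → IsHom f → IsHom g
      cong-hom f g eq (+-hom , *-hom , 1-hom) =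
        (λ x y → trans (sym (eq (x F.+ y))) (trans (+-hom x y) (cong₂ K._+_ (eq x) (eq y)))) ,
        (λ x y → trans (sym (eq (x F.* y))) (trans (*-hom x y) (cong₂ K._*_ (eq x) (eq y)))) ,
        trans (sym (eq _)) 1-hom

  -- Both kernels contain p, and a residue 0 < r < p cannot vanish in F, because it is invertible
  -- modulo p by Bézout. So an integer that vanishes in F is a multiple of p.
  int-kernel : ∀ {p} → Prime p → (F K : FiniteField) →
               Arithmetic.nat F p ≡ FiniteField.0# F → Arithmetic.nat K p ≡ FiniteField.0# K →
               ∀ i → Arithmetic.int F i ≡ FiniteField.0# F → Arithmetic.int K i ≡ FiniteField.0# K
  int-kernel {p} p-prime F K Fp≡0 Kp≡0 = go
    where
    module F = FiniteField F
    module FA = Arithmetic F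
    module FP = FieldProperties F
    module K = FiniteField K
    module KA = Arithmetic K
    module KP = FieldProperties K
    instance _ = prime⇒nonZero p-prime

    module _ (L : FiniteField) (open-p : Arithmetic.nat L p ≡ FiniteField.0# L) where
      open FiniteField L
      open Arithmetic L
      nat-+ : ∀ m n → nat (m ℕ.+ n) ≡ nat m + nat n
      nat-+ m n = int-+ (ℤ.+ m) (ℤ.+ n)
      nat-* : ∀ m n → nat (m ℕ.* n) ≡ nat m * nat n
      nat-* m n = trans (cong int (ℤ.pos-* m n)) (int-* (ℤ.+ m) (ℤ.+ n))
        where import Data.Integer.Properties as ℤ
      multiple : ∀ k → nat (k ℕ.* p) ≡ 0#
      multiple k = trans (nat-* k p) (trans (cong (nat k *_) open-p) (zeroʳ _))
      nat-% : ∀ n → nat n ≡ nat (n % p)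
      nat-% n = trans (cong nat (m≡m%n+[m/n]*n n p)) (trans (nat-+ (n % p) (n / p ℕ.* p))
        (trans (cong (nat (n % p) +_) (multiple (n / p))) (+-identityʳ _)))

    small : ∀ r → r < p → FA.nat r ≡ F.0# → r ≡ 0
    small zero    r<p eq = refl
    small (suc r) r<p eq with coprime-Bézout (prime⇒coprime p-prime r<p)
    ... | Bézout.+- x y id = ⊥-elim (FP.1≢0 (begin
      F.1#                                ≡⟨ FA.+-identityʳ _ ⟨
      F.1# F.+ F.0#                       ≡⟨ cong (F.1# F.+_) (trans (nat-* F Fp≡0 y (suc r)) (trans (cong (FA.nat y F.*_) eq) (FA.zeroʳ _))) ⟨
      FA.nat 1 F.+ FA.nat (y ℕ.* suc r)   ≡⟨ nat-+ F Fp≡0 1 (y ℕ.* suc r) ⟨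
      FA.nat (1 ℕ.+ y ℕ.* suc r)          ≡⟨ cong FA.nat id ⟩
      FA.nat (x ℕ.* p)                    ≡⟨ multiple F Fp≡0 x ⟩
      F.0#                                ∎))
      where open ≡-Reasoning
    ... | Bézout.-+ x y id = ⊥-elim (FP.1≢0 (begin
      F.1#                                ≡⟨ FA.+-identityʳ _ ⟨
      F.1# F.+ F.0#                       ≡⟨ cong (F.1# F.+_) (multiple F Fp≡0 x) ⟨
      FA.nat 1 F.+ FA.nat (x ℕ.* p)       ≡⟨ nat-+ F Fp≡0 1 (x ℕ.* p) ⟨
      FA.nat (1 ℕ.+ x ℕ.* p)              ≡⟨ cong FA.nat id ⟩
      FA.nat (y ℕ.* suc r)                ≡⟨ trans (nat-* F Fp≡0 y (suc r)) (trans (cong (FA.nat y F.*_) eq) (FA.zeroʳ _)) ⟩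
      F.0#                                ∎))
      where open ≡-Reasoning

    pos : ∀ n → FA.nat n ≡ F.0# → KA.nat n ≡ K.0#
    pos n eq = trans (nat-% K Kp≡0 n) (cong KA.nat (small (n % p) (m%n<n n p) (trans (sym (nat-% F Fp≡0 n)) eq)))

    go : ∀ i → FA.int i ≡ F.0# → KA.int i ≡ K.0#
    go (ℤ.+ n)    eq = pos n eq
    go ℤ.-[1+ n ] eq = trans (cong K.-_ (pos (suc n) (FP.-x≡0⇒x≡0 eq))) (trans (sym (KA.int-neg (ℤ.+ 0))) refl)

-- Squares, norms and the extension of degree two

module QuadraticExtensions where

  open Rings
  open Fields
  open FieldEmbeddings
  open import Data.Empty using (⊥-elim)
  open import Data.Fin as Fin using (Fin; zero; suc)
  import Data.Fin.Properties as Fin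
  open import Data.Integer as ℤ using (ℤ)
  open import Data.Nat as ℕ using (ℕ; zero; suc; _≤_; _<_; s≤s)
  import Data.Nat.Properties as ℕ
  open import Data.Nat.Divisibility using (_∣_; divides)
  open import Data.Nat.Primality using (euclidsLemma; prime[2])
  open import Data.Nat.Solver using (module +-*-Solver)
  open import Data.Product using (∃; ∃₂; _×_; _,_; proj₁; proj₂)
  open import Data.Sum using (_⊎_; inj₁; inj₂; [_,_]′)
  open import Data.Vec as Vec using (_∷_)
  open import Function using (id)
  open import Relation.Nullary using (¬_; Dec; yes; no)
  open import Relation.Binary.PropositionalEquality

  -- The form 2(m + 1) + 1 also records q ≥ 3, so that q - 1 and (q - 1)/2 are successors.
  odd-prime-power : ∀ {q} → OddPrimePower q → ∃ λ m → q ≡ suc (suc m ℕ.+ suc m)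
  odd-prime-power {q} (p , k , p-prime , p-odd , refl) = half q (power-odd (suc k)) (power>1 k)
    where
    open import Data.Nat.Primality using (prime⇒nonTrivial)
    power-odd : ∀ j → ¬ (2 ∣ p ℕ.^ j)
    power-odd zero    (divides (suc n) ())
    power-odd (suc j) 2∣ = [ p-odd , power-odd j ]′ (euclidsLemma p (p ℕ.^ j) prime[2] 2∣)
    power>1 : ∀ j → 1 < p ℕ.^ suc j
    power>1 zero    = subst (1 <_) (sym (ℕ.*-identityʳ p)) (ℕ.nonTrivial⇒n>1 p {{prime⇒nonTrivial p-prime}})
    power>1 (suc j) = ℕ.≤-trans (power>1 j) (ℕ.m≤n*m (p ℕ.^ suc j) p {{ℕ.nonTrivial⇒nonZero p {{prime⇒nonTrivial p-prime}}}})
    parity : ∀ n → (∃ λ m → n ≡ m ℕ.+ m) ⊎ (∃ λ m → n ≡ suc (m ℕ.+ m))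
    parity zero    = inj₁ (0 , refl)
    parity (suc n) with parity n
    ... | inj₁ (m , eq) = inj₂ (m , cong suc eq)
    ... | inj₂ (m , eq) = inj₁ (suc m , trans (cong suc eq) (cong suc (sym (ℕ.+-suc m m))))
    half : ∀ n → ¬ (2 ∣ n) → 1 < n → ∃ λ m → n ≡ suc (suc m ℕ.+ suc m)
    half n odd 1<n with parity n
    ... | inj₁ (m , eq)     = ⊥-elim (odd (divides m (trans eq (trans (cong (m ℕ.+_) (sym (ℕ.+-identityʳ m))) (ℕ.*-comm 2 m)))))
    ... | inj₂ (zero , eq)  = ⊥-elim (ℕ.<-irrefl (sym eq) 1<n)
    ... | inj₂ (suc m , eq) = m , eq

  -- Here `half` is q - 1 and `e` is (q - 1)(q + 1)/2, the exponent of Euler's criterion in a field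
  -- of order q².
  odd-square : ∀ m → let half = suc m ℕ.+ suc m ; e = half ℕ.* suc (suc m) in suc half ℕ.* suc half ≡ suc (e ℕ.+ e)
  odd-square = solve 1 (λ m → let n = con 1 :+ m ; h = n :+ n ; e = h :* (con 1 :+ n) in
    (con 1 :+ h) :* (con 1 :+ h) := con 1 :+ (e :+ e)) refl
    where open +-*-Solver

  module OddOrder (F : FiniteField) (m : ℕ) (odd : FiniteField.order F ≡ suc (m ℕ.+ m)) where
    open FiniteField F
    open Arithmetic F
    open FieldProperties F

    -- An odd number of ones sums to 0; if two of them did, a single 1 would remain.
    two≢0 : two ≢ 0#
    two≢0 2≡0 = 1≢0 (begin
      1#                          ≡⟨ solve 1 (λ n → :1 := (:1 :+ (n :+ n)) :- :2 :* n) refl (nat m) ⟩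
      (1# + (nat m + nat m)) - two * nat m  ≡⟨ cong₂ (λ u v → u - v * nat m)
                                      (trans (cong (1# +_) (sym (int-+ (ℤ.+ m) (ℤ.+ m))))
                                      (trans (sym (int-+ (ℤ.+ 1) (ℤ.+ (m ℕ.+ m)))) (trans (cong nat (sym odd)) nat-order))) 2≡0 ⟩
      0# - 0# * nat m             ≡⟨ solve 1 (λ n → :0 :- :0 :* n := :0) refl (nat m) ⟩
      0#                          ∎)
      where open ≡-Reasoning

  module SquareRoots (F : FiniteField) where
    open FiniteField F
    open Arithmetic F
    open FieldProperties F

    NonSquare : Carrier → Set
    NonSquare c = ∀ x → x * x ≢ c

    -- The set of x preceding - x is a half-system for x ↦ - x. Mapping it by x ↦ x² and its complement by g gives
    -- an injective, hence surjective, map.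
    half-system : (g : Carrier → Carrier) → (∀ x y → g x ≡ g y → x * x ≡ y * y) →
                  (∀ x y → y ≢ 0# → x * x ≢ g y) → ∀ z → ∃ λ x → z ≡ x * x ⊎ (x ≢ 0# × z ≡ g x)
    half-system g g-inj disjoint z = let x , eq = injective⇒surjective f f-inj z in x , cases x (sym eq)
      where
      Half : Carrier → Set
      Half x = idx x Fin.≤ idx (- x)
      half? : ∀ x → Dec (Half x)
      half? x = idx x Fin.≤? idx (- x)
      f : Carrier → Carrier
      f x with half? x
      ... | yes _ = x * x
      ... | no _  = g x
      neg-neg : ∀ {x y} → x ≡ - y → - x ≡ y
      neg-neg {x} {y} eq = trans (cong -_ eq) (solve 1 (λ y → :- (:- y) := y) refl y)
      ¬half⇒≢0 : ∀ {x} → ¬ Half x → x ≢ 0#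
      ¬half⇒≢0 ¬h refl = ¬h (Fin.≤-reflexive (cong idx (solve 0 (:0 := :- :0) refl )))
      f-inj : ∀ x y → f x ≡ f y → x ≡ y
      f-inj x y eq with half? x | half? y
      ... | yes hx | yes hy = [ id , (λ x≡-y → sym (trans (idx-injective (Fin.≤-antisym hy
                                (subst₂ (λ a b → idx a Fin.≤ idx b) x≡-y (neg-neg x≡-y) hx))) (sym x≡-y))) ]′ (square≡square eq)
      ... | yes hx | no  hy = ⊥-elim (disjoint x y (¬half⇒≢0 hy) eq)
      ... | no  hx | yes hy = ⊥-elim (disjoint y x (¬half⇒≢0 hx) (sym eq))
      ... | no  hx | no  hy = [ id , (λ x≡-y → ⊥-elim ([ hy , (λ h → hx (subst₂ (λ a b → idx a Fin.≤ idx b) (sym x≡-y) (sym (neg-neg x≡-y)) h)) ]′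
                                (Fin.≤-total (idx y) (idx (- y))))) ]′ (square≡square (g-inj x y eq))
      cases : ∀ x → z ≡ f x → z ≡ x * x ⊎ (x ≢ 0# × z ≡ g x)
      cases x eq with half? x
      ... | yes _ = inj₁ eq
      ... | no ¬h = inj₂ (¬half⇒≢0 ¬h , eq)

    -- Without a solution the values c + ν y² avoid all squares, so by `half-system` squares and
    -- such values with y ≠ 0 fill the field. Then c itself is either a square, which is a solution
    -- with b = 0, or of the form c + ν x² with x ≠ 0, which is absurd.
    norm-surjective : ∀ ν → ν ≢ 0# → ∀ c → ∃₂ λ a b → a * a - ν * (b * b) ≡ c
    norm-surjective ν ν≢0 c with any-element? (λ a → any-element? λ b → (a * a - ν * (b * b)) ≟ c)
    ... | yes found = found
    ... | no ∄ = ⊥-elim (contra (half-system g g-inj disjoint c))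
      where
      g : Carrier → Carrier
      g y = c + ν * (y * y)
      g-inj : ∀ x y → g x ≡ g y → x * x ≡ y * y
      g-inj x y eq = *-cancelˡ ν≢0 (trans (solve 2 (λ c u → u := c :+ u :- c) refl c (ν * (x * x))) (trans (cong (_- c) eq) (solve 2 (λ c u → c :+ u :- c := u) refl c (ν * (y * y)))))
      disjoint : ∀ x y → y ≢ 0# → x * x ≢ g y
      disjoint x y _ eq = ∄ (x , y , trans (cong (_- ν * (y * y)) eq) (solve 2 (λ c u → c :+ u :- u := c) refl c (ν * (y * y))))
      contra : ¬ (∃ λ x → c ≡ x * x ⊎ (x ≢ 0# × c ≡ g x))
      contra (x , inj₁ eq) = ∄ (x , 0# , trans (solve 2 (λ x ν → x :* x :- ν :* (:0 :* :0) := x :* x) refl x ν) (sym eq))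
      contra (x , inj₂ (x≢0 , eq)) = *-nonzero ν≢0 (*-nonzero x≢0 x≢0)
        (trans (solve 2 (λ c u → u := c :+ u :- c) refl c (ν * (x * x))) (x≡y⇒x-y≡0 (sym eq)))

  -- The last field ties the power x^q, by which the Hermitian form conjugates, to the map θ ↦ -θ.
  record QuadraticExtension (F K : FiniteField) (ν : FiniteField.Carrier F) : Set where
    private
      module F = FiniteField F
      module K = FiniteField K
    field
      hom     : FieldHom F K
    open FieldHom hom public
    field
      θ       : K.Carrier
      θ²      : θ K.* θ ≡ ι ν
      re im   : K.Carrier → F.Carrier
      re-im   : ∀ z → ι (re z) K.+ ι (im z) K.* θ ≡ z
      independent : ∀ a b → ι a K.+ ι b K.* θ ≡ K.0# → a ≡ F.0# × b ≡ F.0#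
      frobenius   : ∀ a b → K.pow (ι a K.+ ι b K.* θ) F.order ≡ ι a K.- ι b K.* θ

  module HomProperties {F K : FiniteField} (h : FieldHom F K) where
    private
      module F where
        open FiniteField F public
        open Arithmetic F public
        open FieldProperties F public
      module K where
        open FiniteField K public
        open Arithmetic K public
        open FieldProperties K public
    open FieldHom h

    ι-0 : ι F.0# ≡ K.0#
    ι-0 = begin
      ι F.0#                             ≡⟨ cancel (ι F.0#) (ι F.0#) ⟩
      ι F.0# K.+ ι F.0# K.- ι F.0#       ≡⟨ cong (K._- ι F.0#) (trans (sym (ι-+ _ _)) (cong ι (F.+-identityˡ _))) ⟩
      ι F.0# K.- ι F.0#                  ≡⟨ K.-‿inverseʳ _ ⟩
      K.0#                               ∎
      where
      open ≡-Reasoning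
      open K
      cancel : ∀ x y → x ≡ x + y - y
      cancel x y = solve 2 (λ x y → x := x :+ y :- y) refl x y

    ι-neg : ∀ x → ι (F.- x) ≡ K.- ι x
    ι-neg x = K.x-y≡0⇒x≡y (trans (lemma (ι (F.- x)) (ι x)) (trans (sym (ι-+ _ _)) (trans (cong ι (F.-‿inverseʳ x)) ι-0)))
      where
      open K
      lemma : ∀ x y → x - (- y) ≡ y + x
      lemma x y = solve 2 (λ x y → x :- (:- y) := y :+ x) refl x y

    ι-minus : ∀ x y → ι (x F.- y) ≡ ι x K.- ι y
    ι-minus x y = trans (ι-+ _ _) (cong (ι x K.+_) (ι-neg y))

    ι-pow : ∀ x n → ι (F.pow x n) ≡ K.pow (ι x) n
    ι-pow x zero    = ι-1
    ι-pow x (suc n) = trans (ι-* _ _) (cong (ι x K.*_) (ι-pow x n))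

    ι≡0 : ∀ {x} → ι x ≡ K.0# → x ≡ F.0#
    ι≡0 {x} eq with x F.≟ F.0#
    ... | yes x≡0 = x≡0
    ... | no x≢0 = ⊥-elim (K.1≢0 (trans (sym ι-1) (trans (cong ι (sym (F.⁻¹-inverseʳ x≢0)))
                     (trans (ι-* _ _) (trans (cong (K._* ι (x F.⁻¹)) eq) (K.zeroˡ _))))))

    ι-injective : ∀ {x y} → ι x ≡ ι y → x ≡ y
    ι-injective {x} {y} eq = F.x-y≡0⇒x≡y (ι≡0 (trans (ι-minus x y) (K.x≡y⇒x-y≡0 eq)))

  -- The numbers are variables tied by equations: `half` is q - 1, `m` is (q - 1)/2 and `e` is (q² -
  -- 1)/2, while `n` and `n′` are the predecessors of `half` and `e`.
  module Extension (F K : FiniteField) (h : FieldHom F K) (ν : FiniteField.Carrier F)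
                   (ν-nonsquare : SquareRoots.NonSquare F ν)
                   (m half n e n′ : ℕ) (odd : FiniteField.order F ≡ suc half) (half≡m+m : half ≡ m ℕ.+ m)
                   (half≡1+n : half ≡ suc n) (e≡ : e ≡ half ℕ.* suc m) (e≡1+n′ : e ≡ suc n′)
                   (K-order : FiniteField.order K ≡ FiniteField.order F ℕ.* FiniteField.order F)
                   (K-order′ : FiniteField.order K ≡ suc (e ℕ.+ e)) where
    private
      module F where
        open FiniteField F public
        open Arithmetic F public
        open FieldProperties F public
    open FiniteField K
    open Arithmetic K
    open FieldProperties K
    open FieldHom h
    open HomProperties h

    q : ℕ
    q = F.order

    ν≢0 : ν ≢ F.0#
    ν≢0 ν≡0 = ν-nonsquare F.0# (trans (F.zeroˡ _) (sym ν≡0))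

    x^_-x : ∀ n → Monic (suc (suc n)) (λ x → pow x (suc (suc n)) - x)
    x^ n -x = 0# ∷ - 1# ∷ proj₁ (monic-pow n) , λ x →
      trans (cong (λ y → 0# + x * (- 1# + x * y)) (proj₂ (monic-pow n) x))
            (solve 2 (λ x p → :0 :+ x :* (:- :1 :+ x :* p) := x :* (x :* p) :- x) refl x (pow x n))

    pow-half : ∀ {x} → x ≢ F.0# → F.pow x half ≡ F.1#
    pow-half {x} x≢0 = F.*-cancelˡ x≢0 (trans (trans (cong (F.pow x) (sym odd)) (F.pow-order x)) (sym (F.*-identityʳ x)))

    pow-square : ∀ x n → pow (x * x) n ≡ pow x (n ℕ.+ n)
    pow-square x n = trans (pow-* x x n) (sym (pow-+ x n n))

    -- If ν remained a nonsquare in K, every nonzero z would be x² or ν x², and z^e = 1 in both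
    -- cases, since 2e = q² - 1 and e is a multiple of q - 1. Then the polynomial x^(e + 1) - x
    -- would have all 2e + 1 elements of K as roots.
    sqrt : ∃ λ θ → θ * θ ≡ ι ν
    sqrt with any-element? (λ θ → (θ * θ) ≟ ι ν)
    ... | yes found = found
    ... | no ∄θ = ⊥-elim (evm-roots (proj₁ (x^ n′ -x)) (λ i → elt (Fin.inject≤ i bound))
        (λ i j eq → Fin.inject≤-injective bound bound i j (elt-injective _ _ eq))
        (λ i → trans (proj₂ (x^ n′ -x) _) (x≡y⇒x-y≡0 (pow-e _))))
      where
      open SquareRoots K
      ιν≢0 : ι ν ≢ 0#
      ιν≢0 eq = ν≢0 (ι≡0 eq)
      bound : suc (suc (suc n′)) ≤ order
      bound = subst (λ k → suc (suc k) ≤ order) e≡1+n′ (subst (suc (suc e) ≤_) (sym K-order′)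
        (s≤s (subst (suc e ≤_) (cong (ℕ._+ e) (sym e≡1+n′)) (s≤s (ℕ.m≤n+m e n′)))))
      quotient-square : ∀ {x y} → y ≢ 0# → x * x ≡ ι ν * (y * y) → x / y * (x / y) ≡ ι ν
      quotient-square {x} {y} y≢0 eq = *-cancelˡ (*-nonzero y≢0 y≢0) (trans
         (trans (solve 2 (λ a y → y :* y :* (a :* a) := a :* y :* (a :* y)) refl (x / y) y) (cong₂ _*_ (/-*-cancel y≢0) (/-*-cancel y≢0)))
         (trans eq (*-comm _ _)))
      from-square : ∀ {z} → z ≢ 0# → (∃ λ x → z ≡ x * x ⊎ (x ≢ 0# × z ≡ ι ν * (x * x))) → pow z e ≡ 1#
      from-square z≢0 (x , inj₁ refl) = trans (pow-square x e) (*-cancelˡ x≢0 (trans (trans (cong (pow x) (sym K-order′)) (pow-order x)) (sym (*-identityʳ x))))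
        where
        x≢0 : x ≢ 0#
        x≢0 eq = z≢0 (trans (cong (_* x) eq) (zeroˡ x))
      from-square z≢0 (x , inj₂ (x≢0 , refl)) = begin
        pow (ι ν * (x * x)) e           ≡⟨ pow-* (ι ν) (x * x) e ⟩
        pow (ι ν) e * pow (x * x) e     ≡⟨ cong₂ _*_ (trans (trans (cong (pow (ι ν)) e≡) (pow-pow (ι ν) half (suc m)))
                                            (trans (cong (λ y → pow y (suc m)) (trans (sym (ι-pow ν half)) (trans (cong ι (pow-half ν≢0)) ι-1)))
                                                   (pow-1 (suc m))))
                                            (trans (pow-square x e) (*-cancelˡ x≢0 (trans (trans (cong (pow x) (sym K-order′)) (pow-order x)) (sym (*-identityʳ x))))) ⟩
        1# * 1#                         ≡⟨ *-identityˡ 1# ⟩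
        1#                              ∎
        where open ≡-Reasoning
      pow-e-nonzero : ∀ {z} → z ≢ 0# → pow z e ≡ 1#
      pow-e-nonzero {z} z≢0 = from-square z≢0 (half-system (λ y → ι ν * (y * y)) (λ x y → *-cancelˡ ιν≢0)
        (λ x y y≢0 eq → ∄θ (x / y , quotient-square y≢0 eq)) z)
      pow-e : ∀ z → pow z (suc (suc n′)) ≡ z
      pow-e z with z ≟ 0#
      ... | yes refl = zeroˡ _
      ... | no z≢0   = trans (cong (z *_) (trans (cong (pow z) (sym e≡1+n′)) (pow-e-nonzero z≢0))) (*-identityʳ z)

    module WithRoot (θ : Carrier) (θ² : θ * θ ≡ ι ν) where
      θ≢ι : ∀ a → θ ≢ ι a
      θ≢ι a eq = ν-nonsquare a (ι-injective (trans (ι-* a a) (trans (sym (cong₂ _*_ eq eq)) θ²)))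

      combine : F.Carrier → F.Carrier → Carrier
      combine a b = ι a + ι b * θ

      independent : ∀ a b → combine a b ≡ 0# → a ≡ F.0# × b ≡ F.0#
      independent a b eq with b F.≟ F.0#
      ... | yes b≡0 = ι≡0 (trans (solve 2 (λ a θ → a := a :+ :0 :* θ) refl (ι a) θ)
                        (trans (cong (λ y → ι a + y * θ) (sym (trans (cong ι b≡0) ι-0))) eq)) , b≡0
      ... | no b≢0 = ⊥-elim (θ≢ι (F.- (a F./ b)) (*-cancelˡ (λ ιb≡0 → b≢0 (ι≡0 ιb≡0)) (begin
        ι b * θ                     ≡⟨ solve 3 (λ a b θ → b :* θ := (a :+ b :* θ) :- a) refl (ι a) (ι b) θ ⟩
        combine a b - ι a           ≡⟨ cong (_- ι a) eq ⟩
        0# - ι a                    ≡⟨ solve 1 (λ a → :0 :- a := :- a) refl (ι a) ⟩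
        - ι a                       ≡⟨ cong (λ y → - ι y) (F./-*-cancel b≢0) ⟨
        - ι ((a F./ b) F.* b)       ≡⟨ cong -_ (ι-* _ _) ⟩
        - (ι (a F./ b) * ι b)       ≡⟨ solve 2 (λ c b → :- (c :* b) := b :* (:- c)) refl (ι (a F./ b)) (ι b) ⟩
        ι b * (- ι (a F./ b))       ≡⟨ cong (ι b *_) (ι-neg _) ⟨
        ι b * ι (F.- (a F./ b))     ∎)))
        where open ≡-Reasoning

      combine-injective : ∀ a b a′ b′ → combine a b ≡ combine a′ b′ → a ≡ a′ × b ≡ b′
      combine-injective a b a′ b′ eq =
        let p , r = independent (a F.- a′) (b F.- b′) (trans (cong₂ (λ x y → x + y * θ) (ι-minus a a′) (ι-minus b b′))
                      (trans (solve 5 (λ a b c d θ → a :- c :+ (b :- d) :* θ := (a :+ b :* θ) :- (c :+ d :* θ)) refl (ι a) (ι b) (ι a′) (ι b′) θ)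
                             (x≡y⇒x-y≡0 eq)))
        in F.x-y≡0⇒x≡y p , F.x-y≡0⇒x≡y r

      -- K has as many elements as there are pairs (a , b), so the injective map from pairs to K is
      -- onto. The pair is split off from a position in K by division with remainder.
      coordinates : ∀ z → ∃₂ λ a b → combine a b ≡ z
      coordinates z =
        let k , eq = Fin-injective⇒surjective f f-inj (idx z)
            i , j  = Fin.remQuot {F.order} F.order (Fin.cast K-order k)
        in F.elt i , F.elt j , idx-injective eq
        where
        pair : Fin order → Fin F.order × Fin F.order
        pair k = Fin.remQuot {F.order} F.order (Fin.cast K-order k)
        f : Fin order → Fin order
        f k = let i , j = pair k in idx (combine (F.elt i) (F.elt j))
        f-inj : ∀ k l → f k ≡ f l → k ≡ l
        f-inj k l eq =
          let i , j = pair k ; i′ , j′ = pair l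
              p , r = combine-injective (F.elt i) (F.elt j) (F.elt i′) (F.elt j′) (idx-injective eq)
          in Fin.toℕ-injective (trans (sym (Fin.toℕ-cast K-order k)) (trans (cong Fin.toℕ
               (trans (sym (Fin.combine-remQuot {F.order} F.order (Fin.cast K-order k)))
               (trans (cong₂ Fin.combine (F.elt-injective i i′ p) (F.elt-injective j j′ r))
                      (Fin.combine-remQuot {F.order} F.order (Fin.cast K-order l)))))
               (Fin.toℕ-cast K-order l)))

      pow-ι : ∀ a → pow (ι a) q ≡ ι a
      pow-ι a = trans (sym (ι-pow a q)) (cong ι (F.pow-order a))

      -- Both sides are monic of degree q in x and agree on the subfield.
      pow-shift : ∀ c x → pow (x + ι c) q ≡ pow x q + ι c
      pow-shift c x = go q odd x
        where
        go : ∀ k → k ≡ suc half → ∀ x → pow (x + ι c) k ≡ pow x k + ι c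
        go k refl x = trans (sym (proj₂ (monic-shift (ι c) k) x)) (trans
          (evm-agree (proj₁ (monic-shift (ι c) k)) (ι c ∷ proj₁ (monic-pow half)) (λ i → ι (F.elt (Fin.cast (sym odd) i)))
            (λ i j eq → Fin.toℕ-injective (trans (sym (Fin.toℕ-cast (sym odd) i)) (trans (cong Fin.toℕ (F.elt-injective _ _ (ι-injective eq))) (Fin.toℕ-cast (sym odd) j))))
            (λ i → agree (F.elt (Fin.cast (sym odd) i))) x)
          (rhs x))
          where
          rhs : ∀ x → evm (ι c ∷ proj₁ (monic-pow half)) x ≡ pow x (suc half) + ι c
          rhs x = trans (cong (λ y → ι c + x * y) (proj₂ (monic-pow half) x)) (+-comm _ _)
          pow-ι′ : ∀ a → pow (ι a) (suc half) ≡ ι a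
          pow-ι′ a = trans (cong (pow (ι a)) (sym odd)) (pow-ι a)
          agree : ∀ a → evm (proj₁ (monic-shift (ι c) k)) (ι a) ≡ evm (ι c ∷ proj₁ (monic-pow half)) (ι a)
          agree a = trans (proj₂ (monic-shift (ι c) k) (ι a)) (trans (trans (cong (λ y → pow y k) (sym (ι-+ a c)))
            (trans (pow-ι′ (a F.+ c)) (trans (ι-+ a c) (cong (_+ ι c) (sym (pow-ι′ a)))))) (sym (rhs (ι a))))

      -- θ^q = θ ν^m and ν^(2m) = 1, so the factor is 1 or -1. The value 1 would make θ a root of
      -- x^q - x in addition to the q elements of the subfield.
      pow-θ : pow θ q ≡ - θ
      pow-θ = [ impossible , negative ]′ (F.square≡square {F.pow ν m} {F.1#}
                   (trans (sym (F.pow-+ ν m m)) (trans (trans (cong (F.pow ν) (sym half≡m+m)) (pow-half ν≢0)) (sym (F.*-identityˡ F.1#)))))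
        where
        θ^q : pow θ q ≡ θ * ι (F.pow ν m)
        θ^q = trans (cong (pow θ) odd) (cong (θ *_) (trans (cong (pow θ) half≡m+m) (trans (sym (pow-square θ m))
                (trans (cong (λ y → pow y m) θ²) (sym (ι-pow ν m))))))
        negative : F.pow ν m ≡ F.- F.1# → pow θ q ≡ - θ
        negative eq = trans θ^q (trans (cong (λ y → θ * ι y) eq) (trans (cong (θ *_) (trans (ι-neg F.1#) (cong -_ ι-1)))
                        (solve 1 (λ θ → θ :* (:- :1) := :- θ) refl θ)))
        impossible : F.pow ν m ≡ F.1# → pow θ q ≡ - θ
        impossible eq = ⊥-elim (evm-roots (proj₁ (x^ n -x)) r r-inj
                        (λ i → trans (proj₂ (x^ n -x) (r i)) (x≡y⇒x-y≡0 (trans (cong (pow (r i)) (sym odd′)) (fixed i)))))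
          where
          odd′ : q ≡ suc (suc n)
          odd′ = trans odd (cong suc half≡1+n)
          θ^q≡θ : pow θ q ≡ θ
          θ^q≡θ = trans (cong (pow θ) odd) (trans (cong (θ *_) (trans (cong (pow θ) half≡m+m) (trans (sym (pow-square θ m))
                  (trans (cong (λ y → pow y m) θ²) (trans (sym (ι-pow ν m)) (trans (cong ι eq) ι-1)))))) (*-identityʳ θ))
          r : Fin (suc (suc (suc n))) → Carrier
          r zero    = θ
          r (suc i) = ι (F.elt (Fin.cast (sym odd′) i))
          r-inj : ∀ i j → r i ≡ r j → i ≡ j
          r-inj zero    zero    eq = refl
          r-inj zero    (suc j) eq = ⊥-elim (θ≢ι _ eq)
          r-inj (suc i) zero    eq = ⊥-elim (θ≢ι _ (sym eq))
          r-inj (suc i) (suc j) eq = cong suc (Fin.toℕ-injective (trans (sym (Fin.toℕ-cast (sym odd′) i))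
            (trans (cong Fin.toℕ (F.elt-injective _ _ (ι-injective eq))) (Fin.toℕ-cast (sym odd′) j))))
          fixed : ∀ i → pow (r i) q ≡ r i
          fixed zero    = θ^q≡θ
          fixed (suc i) = pow-ι _

      extension : QuadraticExtension F K ν
      extension = record
        { hom = h ; θ = θ ; θ² = θ²
        ; re = λ z → proj₁ (coordinates z)
        ; im = λ z → proj₁ (proj₂ (coordinates z))
        ; re-im = λ z → proj₂ (proj₂ (coordinates z))
        ; independent = independent
        ; frobenius = λ a b → trans (cong (λ y → pow y q) (+-comm (ι a) (ι b * θ))) (trans (pow-shift a (ι b * θ))
            (trans (cong (_+ ι a) (trans (pow-* (ι b) θ q) (cong₂ _*_ (pow-ι b) pow-θ)))
                   (solve 3 (λ a b θ → b :* (:- θ) :+ a := a :- b :* θ) refl (ι a) (ι b) θ))) }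

    quadraticExtension : QuadraticExtension F K ν
    quadraticExtension = WithRoot.extension (proj₁ sqrt) (proj₂ sqrt)

  module _ {q : ℕ} (q-odd : OddPrimePower q) (F K : FiniteField)
           (F-order : FiniteField.order F ≡ q) (K-order : FiniteField.order K ≡ q ℕ.* q) where
    private
      module F where
        open FiniteField F public
        open Arithmetic F public
        open FieldProperties F public

      p k : ℕ
      p = proj₁ q-odd
      k = suc (proj₁ (proj₂ q-odd))
      q≡ : q ≡ p ℕ.^ k
      q≡ = proj₂ (proj₂ (proj₂ (proj₂ q-odd)))

      -- The order p^j vanishes in the field, and a power vanishes only if its base does.
      nat-p≡0 : (L : FiniteField) → ∀ j → FiniteField.order L ≡ p ℕ.^ j → Arithmetic.nat L p ≡ FiniteField.0# L
      nat-p≡0 L j eq with nat p ≟ 0#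
        where
        open FiniteField L
        open Arithmetic L
        open FieldProperties L
      ... | yes p≡0 = p≡0
      ... | no  p≢0 = ⊥-elim (pow-nonzero j p≢0 (trans (sym (nat-^ j)) (trans (cong nat (sym eq)) nat-order)))
        where
        open FiniteField L
        open Arithmetic L
        open FieldProperties L
        import Data.Integer.Properties as ℤ
        nat-^ : ∀ j → nat (p ℕ.^ j) ≡ pow (nat p) j
        nat-^ zero    = refl
        nat-^ (suc j) = trans (cong int (ℤ.pos-* p (p ℕ.^ j))) (trans (int-* (ℤ.+ p) (ℤ.+ (p ℕ.^ j))) (cong (nat p *_) (nat-^ j)))

      -- The embedding argument needs the exponent q² of K also in F, where it is x ↦ x^q applied
      -- twice.
      F-pow : ∀ x → F.pow x (FiniteField.order K) ≡ x
      F-pow x = trans (cong (F.pow x) (trans K-order (cong (λ n → n ℕ.* n) (sym F-order))))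
        (trans (F.pow-pow x F.order F.order) (trans (cong (λ y → F.pow y F.order) (F.pow-order x)) (F.pow-order x)))

      hom : FieldHom F K
      hom = Embedding.embedding F K F-pow (int-kernel (proj₁ (proj₂ (proj₂ q-odd))) F K
        (nat-p≡0 F k (trans F-order q≡))
        (nat-p≡0 K (k ℕ.+ k) (trans K-order (trans (cong (λ n → n ℕ.* n) q≡) (sym (ℕ.^-distribˡ-+-* p k k))))))

    quadratic-extension : ∀ ν → SquareRoots.NonSquare F ν → QuadraticExtension F K ν
    quadratic-extension ν ν-nonsquare = let m , q≡ = odd-prime-power q-odd ; half = suc m ℕ.+ suc m in
      Extension.quadraticExtension F K hom ν ν-nonsquare (suc m) half _ (half ℕ.* suc (suc m)) _
        (trans F-order q≡) refl refl refl refl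
        (trans K-order (cong (λ n → n ℕ.* n) (sym F-order)))
        (trans K-order (trans (cong (λ n → n ℕ.* n) q≡) (odd-square m)))

-- The Heisenberg model and its automorphisms

module Model where

  open Rings
  open Fields
  open QuadraticExtensions
  open import Data.Empty using (⊥-elim)
  open import Data.Fin using (Fin; zero; suc)
  open import Data.Product using (∃; _×_; _,_; proj₁; proj₂)
  open import Function using (_∘_; id)
  open import Relation.Nullary using (¬_; Dec; yes; no)
  open import Relation.Nullary.Decidable using (_×-dec_)
  open import Relation.Binary.PropositionalEquality

  infix 3 _⇔_
  _⇔_ : Set → Set → Set
  A ⇔ B = (A → B) × (B → A)

  ⇔-refl : ∀ {A} → A ⇔ A
  ⇔-refl = id , id

  ⇔-sym : ∀ {A B} → A ⇔ B → B ⇔ A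
  ⇔-sym (f , g) = g , f

  ⇔-trans : ∀ {A B C} → A ⇔ B → B ⇔ C → A ⇔ C
  ⇔-trans (f , g) (h , k) = h ∘ f , g ∘ k

  record Vertex (A : Set) : Set where
    constructor vertex
    field
      x₁ y₁ x₂ y₂ t : A

  vertex-≡ : ∀ {A} {a b c d e a′ b′ c′ d′ e′ : A} → a ≡ a′ → b ≡ b′ → c ≡ c′ → d ≡ d′ → e ≡ e′ →
             vertex a b c d e ≡ vertex a′ b′ c′ d′ e′
  vertex-≡ refl refl refl refl refl = refl

  -- The vertices are pairs of rows wᵢ = (xᵢ , yᵢ), read as elements xᵢ + yᵢ √ν, together with a scalar t; they form a
  -- Heisenberg group for the alternating form re (w₁ w̄₂′) - re (w₂ w̄₁′), and δ v v′ is the quotient of v′ by v.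
  module HeisenbergModel (F : FiniteField) (ν : FiniteField.Carrier F) (ν-nonsquare : SquareRoots.NonSquare F ν)
                      (two≢0 : Arithmetic.two F ≢ FiniteField.0# F) where
    open FiniteField F
    open Arithmetic F
    open FieldProperties F
    open Vertex

    V : Set
    V = Vertex Carrier

    det : V → Carrier
    det v = x₁ v * y₂ v - x₂ v * y₁ v

    ω : V → V → Carrier
    ω v w = x₁ v * x₂ w - ν * y₁ v * y₂ w - x₂ v * x₁ w + ν * y₂ v * y₁ w

    δ : V → V → V
    δ v w = vertex (x₁ w - x₁ v) (y₁ w - y₁ v) (x₂ w - x₂ v) (y₂ w - y₂ v) (t w - t v + ω w v)

    origin : V
    origin = vertex 0# 0# 0# 0# 0#

    Flat : V → Set
    Flat v = x₁ v ≡ 0# × y₁ v ≡ 0# × x₂ v ≡ 0# × y₂ v ≡ 0#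

    flat? : ∀ v → Dec (Flat v)
    flat? v = (x₁ v ≟ 0#) ×-dec (y₁ v ≟ 0#) ×-dec (x₂ v ≟ 0#) ×-dec (y₂ v ≟ 0#)

    -- The numbering is that of the relations in both geometries, so the isomorphism will be the
    -- identity on indices. Flat vertices have `det` equal to 0, which leaves six patterns.
    Class : Fin 6 → V → Set
    Class zero                                     v = Flat v × t v ≡ 0#
    Class (suc zero)                               v = ¬ Flat v × det v ≡ 0# × t v ≡ 0#
    Class (suc (suc zero))                         v = Flat v × t v ≢ 0#
    Class (suc (suc (suc zero)))                   v = ¬ Flat v × det v ≡ 0# × t v ≢ 0#
    Class (suc (suc (suc (suc zero))))             v = det v ≢ 0# × t v ≢ 0#
    Class (suc (suc (suc (suc (suc zero)))))       v = det v ≢ 0# × t v ≡ 0#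

    flat⇒det≡0 : ∀ {v} → Flat v → det v ≡ 0#
    flat⇒det≡0 {vertex a b c d s} (refl , _ , refl , _) = solve 2 (λ b d → :0 :* d :- :0 :* b := :0) refl b d

    classify : ∀ v → ∃ λ i → Class i v
    classify v with flat? v | det v ≟ 0# | t v ≟ 0#
    ... | yes f | _     | yes z = zero , f , z
    ... | yes f | _     | no nz = suc (suc zero) , f , nz
    ... | no nf | yes d | yes z = suc zero , nf , d , z
    ... | no nf | yes d | no nz = suc (suc (suc zero)) , nf , d , nz
    ... | no nf | no nd | no nz = suc (suc (suc (suc zero))) , nd , nz
    ... | no nf | no nd | yes z = suc (suc (suc (suc (suc zero)))) , nd , z

    class-classify : ∀ i v → Class i v → i ≡ proj₁ (classify v)
    class-classify i v c with flat? v | det v ≟ 0# | t v ≟ 0#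
    class-classify zero v (f , z) | yes _ | _ | yes _ = refl
    class-classify zero v (f , z) | yes _ | _ | no nz = ⊥-elim (nz z)
    class-classify zero v (f , z) | no nf | _ | _ = ⊥-elim (nf f)
    class-classify (suc zero) v (nf , d , z) | yes f | _ | _ = ⊥-elim (nf f)
    class-classify (suc zero) v (nf , d , z) | no _ | yes _ | yes _ = refl
    class-classify (suc zero) v (nf , d , z) | no _ | yes _ | no nz = ⊥-elim (nz z)
    class-classify (suc zero) v (nf , d , z) | no _ | no nd | _ = ⊥-elim (nd d)
    class-classify (suc (suc zero)) v (f , nz) | yes _ | _ | yes z = ⊥-elim (nz z)
    class-classify (suc (suc zero)) v (f , nz) | yes _ | _ | no _ = refl
    class-classify (suc (suc zero)) v (f , nz) | no nf | _ | _ = ⊥-elim (nf f)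
    class-classify (suc (suc (suc zero))) v (nf , d , nz) | yes f | _ | _ = ⊥-elim (nf f)
    class-classify (suc (suc (suc zero))) v (nf , d , nz) | no _ | yes _ | yes z = ⊥-elim (nz z)
    class-classify (suc (suc (suc zero))) v (nf , d , nz) | no _ | yes _ | no _ = refl
    class-classify (suc (suc (suc zero))) v (nf , d , nz) | no _ | no nd | _ = ⊥-elim (nd d)
    class-classify (suc (suc (suc (suc zero)))) v (nd , nz) | yes f | _ | _ = ⊥-elim (nd (flat⇒det≡0 {v} f))
    class-classify (suc (suc (suc (suc zero)))) v (nd , nz) | no _ | yes d | _ = ⊥-elim (nd d)
    class-classify (suc (suc (suc (suc zero)))) v (nd , nz) | no _ | no _ | yes z = ⊥-elim (nz z)
    class-classify (suc (suc (suc (suc zero)))) v (nd , nz) | no _ | no _ | no _ = refl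
    class-classify (suc (suc (suc (suc (suc zero))))) v (nd , z) | yes f | _ | _ = ⊥-elim (nd (flat⇒det≡0 {v} f))
    class-classify (suc (suc (suc (suc (suc zero))))) v (nd , z) | no _ | yes d | _ = ⊥-elim (nd d)
    class-classify (suc (suc (suc (suc (suc zero))))) v (nd , z) | no _ | no _ | yes _ = refl
    class-classify (suc (suc (suc (suc (suc zero))))) v (nd , z) | no _ | no _ | no nz = ⊥-elim (nz z)

    class-unique : ∀ i j v → Class i v → Class j v → i ≡ j
    class-unique i j v c c′ = trans (class-classify i v c) (sym (class-classify j v c′))

    -- Only the vanishing of the three quantities is compared, not their values: this is all that a
    -- class depends on.
    Similar : V → V → Set
    Similar v w = (Flat v ⇔ Flat w) × (det v ≡ 0# ⇔ det w ≡ 0#) × (t v ≡ 0# ⇔ t w ≡ 0#)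

    similar-refl : ∀ {v} → Similar v v
    similar-refl = ⇔-refl , ⇔-refl , ⇔-refl

    similar-sym : ∀ {v w} → Similar v w → Similar w v
    similar-sym (p , q , r) = ⇔-sym p , ⇔-sym q , ⇔-sym r

    similar-trans : ∀ {u v w} → Similar u v → Similar v w → Similar u w
    similar-trans (p , q , r) (p′ , q′ , r′) = ⇔-trans p p′ , ⇔-trans q q′ , ⇔-trans r r′

    similar-class : ∀ i {v w} → Similar v w → Class i v → Class i w
    similar-class zero (p , q , r) (f , z) = proj₁ p f , proj₁ r z
    similar-class (suc zero) (p , q , r) (nf , d , z) = nf ∘ proj₂ p , proj₁ q d , proj₁ r z
    similar-class (suc (suc zero)) (p , q , r) (f , nz) = proj₁ p f , nz ∘ proj₂ r
    similar-class (suc (suc (suc zero))) (p , q , r) (nf , d , nz) = nf ∘ proj₂ p , proj₁ q d , nz ∘ proj₂ r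
    similar-class (suc (suc (suc (suc zero)))) (p , q , r) (nd , nz) = nd ∘ proj₂ q , nz ∘ proj₂ r
    similar-class (suc (suc (suc (suc (suc zero))))) (p , q , r) (nd , z) = nd ∘ proj₂ q , proj₁ r z

    -- A bijection of the third vertices `z` that keeps the classes of (a , z) and of (z , b). It
    -- gives equal intersection numbers for all pairs of indices together, and it need not respect
    -- the relations of third vertices among themselves.
    record Matching (a b a′ b′ : V) : Set where
      field
        to from : V → V
        from-to : ∀ z → from (to z) ≡ z
        to-from : ∀ z → to (from z) ≡ z
        left    : ∀ z → Similar (δ a z) (δ a′ (to z))
        right   : ∀ z → Similar (δ z b) (δ (to z) b′)

    matching-sym : ∀ {a b a′ b′} → Matching a b a′ b′ → Matching a′ b′ a b
    matching-sym {a} {b} {a′} {b′} m = record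
      { to = from ; from = to ; from-to = to-from ; to-from = from-to
      ; left  = λ z → similar-sym (subst (λ w → Similar (δ a (from z)) (δ a′ w)) (to-from z) (left (from z)))
      ; right = λ z → similar-sym (subst (λ w → Similar (δ (from z) b) (δ w b′)) (to-from z) (right (from z))) }
      where open Matching m

    matching-trans : ∀ {a b a′ b′ a″ b″} → Matching a b a′ b′ → Matching a′ b′ a″ b″ → Matching a b a″ b″
    matching-trans m n = record
      { to = n.to ∘ m.to ; from = m.from ∘ n.from
      ; from-to = λ z → trans (cong m.from (n.from-to _)) (m.from-to z)
      ; to-from = λ z → trans (cong n.to (m.to-from _)) (n.to-from z)
      ; left  = λ z → similar-trans (m.left z) (n.left _)
      ; right = λ z → similar-trans (m.right z) (n.right _) }
      where
      module m = Matching m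
      module n = Matching n

    record Automorphism : Set where
      field
        to from : V → V
        from-to : ∀ z → from (to z) ≡ z
        to-from : ∀ z → to (from z) ≡ z
        similar : ∀ v w → Similar (δ v w) (δ (to v) (to w))

    automorphism-matching : (φ : Automorphism) → ∀ a b → Matching a b (Automorphism.to φ a) (Automorphism.to φ b)
    automorphism-matching φ a b = record
      { to = to ; from = from ; from-to = from-to ; to-from = to-from
      ; left = similar a ; right = λ z → similar z b }
      where open Automorphism φ

    -- Quotients are invariant under translation; in the last coordinate this comes down to
    -- bilinearity of the alternating form.
    δ-translate : ∀ a v w → δ (δ a v) (δ a w) ≡ δ v w
    δ-translate (vertex a b c d e) (vertex a′ b′ c′ d′ e′) (vertex a″ b″ c″ d″ e″) = vertex-≡
      (solve 3 (λ a a′ a″ → a″ :- a :- (a′ :- a) := a″ :- a′) refl a a′ a″)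
      (solve 3 (λ b b′ b″ → b″ :- b :- (b′ :- b) := b″ :- b′) refl b b′ b″)
      (solve 3 (λ c c′ c″ → c″ :- c :- (c′ :- c) := c″ :- c′) refl c c′ c″)
      (solve 3 (λ d d′ d″ → d″ :- d :- (d′ :- d) := d″ :- d′) refl d d′ d″)
      (solve 16 (λ ν a b c d e a′ b′ c′ d′ e′ a″ b″ c″ d″ e″ → (e″ :- e :+ (a″ :* c :- ν :* b″ :* d :- c″ :* a :+ ν :* d″ :* b)) :- (e′ :- e :+ (a′ :* c :- ν :* b′ :* d :- c′ :* a :+ ν :* d′ :* b)) :+ ((a″ :- a) :* (c′ :- c) :- ν :* (b″ :- b) :* (d′ :- d) :- (c″ :- c) :* (a′ :- a) :+ ν :* (d″ :- d) :* (b′ :- b)) := e″ :- e′ :+ (a″ :* c′ :- ν :* b″ :* d′ :- c″ :* a′ :+ ν :* d″ :* b′)) refl ν a b c d e a′ b′ c′ d′ e′ a″ b″ c″ d″ e″)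

    δ-origin : ∀ v → δ origin v ≡ v
    δ-origin (vertex a b c d e) = vertex-≡ (z a) (z b) (z c) (z d)
      (solve 6 (λ ν a b c d e → e :- :0 :+ (a :* :0 :- ν :* b :* :0 :- c :* :0 :+ ν :* d :* :0) := e) refl ν a b c d e)
      where
      z : ∀ x → x - 0# ≡ x
      z x = solve 1 (λ x → x :- :0 := x) refl x

    δ-diagonal : ∀ v → δ v v ≡ origin
    δ-diagonal (vertex a b c d e) = vertex-≡ (-‿inverseʳ a) (-‿inverseʳ b) (-‿inverseʳ c) (-‿inverseʳ d)
      (solve 6 (λ ν a b c d e → e :- e :+ (a :* c :- ν :* b :* d :- c :* a :+ ν :* d :* b) := :0) refl ν a b c d e)

    -- `δ a origin` is the inverse of `a` in the Heisenberg group, so translating by it undoes the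
    -- translation by `a`.
    δ-inverse : ∀ a w → δ (δ a origin) (δ a w) ≡ w
    δ-inverse a w = trans (δ-translate a origin w) (δ-origin w)

    translation : V → Automorphism
    translation a = record
      { to = δ a ; from = δ (δ a origin)
      ; from-to = δ-inverse a
      ; to-from = λ z → trans (cong (λ b → δ b (δ (δ a origin) z)) (sym double)) (δ-inverse (δ a origin) z)
      ; similar = λ v w → subst (Similar (δ v w)) (sym (δ-translate a v w)) similar-refl }
      where
      double : δ (δ a origin) origin ≡ a
      double = trans (cong (δ (δ a origin)) (sym (δ-diagonal a))) (trans (δ-translate a origin a) (δ-origin a))

    scaled-zero : ∀ {k x} → k ≢ 0# → x ≡ 0# ⇔ k * x ≡ 0#
    scaled-zero k≢0 = (λ { refl → zeroʳ _ }) , λ kx≡0 → zero-product kx≡0 k≢0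

    -- One `scalar` governs both `det` and `t`, so t / det is an invariant of these maps wherever
    -- `det` is nonzero.
    record Linear : Set where
      field
        to from : V → V
        from-to : ∀ z → from (to z) ≡ z
        to-from : ∀ z → to (from z) ≡ z
        to-flat : ∀ z → Flat z → Flat (to z)
        from-flat : ∀ z → Flat z → Flat (from z)
        to-δ    : ∀ v w → δ (to v) (to w) ≡ to (δ v w)
        scalar  : Carrier
        scalar≢0 : scalar ≢ 0#
        to-det  : ∀ z → det (to z) ≡ scalar * det z
        to-t    : ∀ z → t (to z) ≡ scalar * t z

      automorphism : Automorphism
      automorphism = record
        { to = to ; from = from ; from-to = from-to ; to-from = to-from
        ; similar = λ v w → let z = δ v w in subst (Similar z) (sym (to-δ v w))
            ( (to-flat z , λ f → subst Flat (from-to z) (from-flat (to z) f))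
            , subst (λ d → det z ≡ 0# ⇔ d ≡ 0#) (sym (to-det z)) (scaled-zero scalar≢0)
            , subst (λ d → t z ≡ 0# ⇔ d ≡ 0#) (sym (to-t z)) (scaled-zero scalar≢0)) }

    rows : Carrier → Carrier → Carrier → Carrier → Carrier → V → V
    rows k α β γ ε (vertex a b c d s) = vertex (α * a + β * c) (α * b + β * d) (γ * a + ε * c) (γ * b + ε * d) (k * s)

    flat-sum : ∀ {a c} α β → a ≡ 0# → c ≡ 0# → α * a + β * c ≡ 0#
    flat-sum α β refl refl = solve 2 (λ α β → α :* :0 :+ β :* :0 := :0) refl α β

    rows-flat : ∀ k α β γ ε z → Flat z → Flat (rows k α β γ ε z)
    rows-flat k α β γ ε z (p , q , r , s) = flat-sum α β p r , flat-sum α β q s , flat-sum γ ε p r , flat-sum γ ε q s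

    -- `det` and `ω` are both multiplied by the determinant of the operation, so `t` has to be
    -- scaled by it for quotients to be respected.
    row-operation : ∀ α β γ ε → α * ε - β * γ ≢ 0# → Linear
    row-operation α β γ ε D≢0 = record
      { to = rows D α β γ ε ; from = rows i (ε * i) (- (β * i)) (- (γ * i)) (α * i)
      ; from-to = λ { (vertex a b c d s) → vertex-≡
          (step (solve 7 (λ i α β γ ε a c → ε :* i :* (α :* a :+ β :* c) :+ (:- (β :* i)) :* (γ :* a :+ ε :* c) := i :* (α :* ε :- β :* γ) :* a) refl i α β γ ε a c))
          (step (solve 7 (λ i α β γ ε b d → ε :* i :* (α :* b :+ β :* d) :+ (:- (β :* i)) :* (γ :* b :+ ε :* d) := i :* (α :* ε :- β :* γ) :* b) refl i α β γ ε b d))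
          (step (solve 7 (λ i α β γ ε a c → (:- (γ :* i)) :* (α :* a :+ β :* c) :+ α :* i :* (γ :* a :+ ε :* c) := i :* (α :* ε :- β :* γ) :* c) refl i α β γ ε a c))
          (step (solve 7 (λ i α β γ ε b d → (:- (γ :* i)) :* (α :* b :+ β :* d) :+ α :* i :* (γ :* b :+ ε :* d) := i :* (α :* ε :- β :* γ) :* d) refl i α β γ ε b d))
          (step (sym (*-assoc i D s))) }
      ; to-from = λ { (vertex a b c d s) → vertex-≡
          (step (solve 7 (λ i α β γ ε a c → α :* (ε :* i :* a :+ (:- (β :* i)) :* c) :+ β :* ((:- (γ :* i)) :* a :+ α :* i :* c) := i :* (α :* ε :- β :* γ) :* a) refl i α β γ ε a c))
          (step (solve 7 (λ i α β γ ε b d → α :* (ε :* i :* b :+ (:- (β :* i)) :* d) :+ β :* ((:- (γ :* i)) :* b :+ α :* i :* d) := i :* (α :* ε :- β :* γ) :* b) refl i α β γ ε b d))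
          (step (solve 7 (λ i α β γ ε a c → γ :* (ε :* i :* a :+ (:- (β :* i)) :* c) :+ ε :* ((:- (γ :* i)) :* a :+ α :* i :* c) := i :* (α :* ε :- β :* γ) :* c) refl i α β γ ε a c))
          (step (solve 7 (λ i α β γ ε b d → γ :* (ε :* i :* b :+ (:- (β :* i)) :* d) :+ ε :* ((:- (γ :* i)) :* b :+ α :* i :* d) := i :* (α :* ε :- β :* γ) :* d) refl i α β γ ε b d))
          (step (solve 3 (λ i D s → D :* (i :* s) := i :* D :* s) refl i D s)) }
      ; to-flat = rows-flat D α β γ ε
      ; from-flat = rows-flat i (ε * i) (- (β * i)) (- (γ * i)) (α * i)
      ; to-δ = λ { (vertex a b c d s) (vertex a′ b′ c′ d′ s′) → vertex-≡
          (lin α β a c a′ c′) (lin α β b d b′ d′) (lin γ ε a c a′ c′) (lin γ ε b d b′ d′)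
          (solve 15 (λ ν α β γ ε a b c d s a′ b′ c′ d′ s′ → (α :* ε :- β :* γ) :* s′ :- (α :* ε :- β :* γ) :* s :+ ((α :* a′ :+ β :* c′) :* (γ :* a :+ ε :* c) :- ν :* (α :* b′ :+ β :* d′) :* (γ :* b :+ ε :* d) :- (γ :* a′ :+ ε :* c′) :* (α :* a :+ β :* c) :+ ν :* (γ :* b′ :+ ε :* d′) :* (α :* b :+ β :* d)) := (α :* ε :- β :* γ) :* (s′ :- s :+ (a′ :* c :- ν :* b′ :* d :- c′ :* a :+ ν :* d′ :* b))) refl ν α β γ ε a b c d s a′ b′ c′ d′ s′) }
      ; scalar = D ; scalar≢0 = D≢0
      ; to-det = λ { (vertex a b c d s) → solve 8 (λ α β γ ε a b c d → (α :* a :+ β :* c) :* (γ :* b :+ ε :* d) :- (γ :* a :+ ε :* c) :* (α :* b :+ β :* d) := (α :* ε :- β :* γ) :* (a :* d :- c :* b)) refl α β γ ε a b c d }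
      ; to-t = λ _ → refl }
      where
      D i : Carrier
      D = α * ε - β * γ
      i = D ⁻¹
      step : ∀ {x y} → y ≡ i * D * x → y ≡ x
      step {x} eq = trans eq (trans (cong (_* x) (⁻¹-inverseˡ D≢0)) (*-identityˡ x))
      lin : ∀ α β a c a′ c′ → (α * a′ + β * c′) - (α * a + β * c) ≡ α * (a′ - a) + β * (c′ - c)
      lin α β a c a′ c′ = solve 6 (λ α β a c a′ c′ → (α :* a′ :+ β :* c′) :- (α :* a :+ β :* c) := α :* (a′ :- a) :+ β :* (c′ :- c)) refl α β a c a′ c′

    norm : Carrier → Carrier → Carrier
    norm a b = a * a - ν * (b * b)

    -- A zero with b ≠ 0 would make ν the square of a / b.
    norm-zero : ∀ {a b} → norm a b ≡ 0# → a ≡ 0# × b ≡ 0#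
    norm-zero {a} {b} eq with b ≟ 0#
    ... | yes refl = square-zero (trans (solve 2 (λ a ν → a :* a := a :* a :- ν :* (:0 :* :0)) refl a ν) eq) , refl
      where
      square-zero : ∀ {a} → a * a ≡ 0# → a ≡ 0#
      square-zero {a} aa≡0 with a ≟ 0#
      ... | yes a≡0 = a≡0
      ... | no a≢0  = zero-product aa≡0 a≢0
    ... | no b≢0 = ⊥-elim (ν-nonsquare (a / b) (*-cancelˡ (*-nonzero b≢0 b≢0)
        (trans (trans (solve 2 (λ c b → b :* b :* (c :* c) := c :* b :* (c :* b)) refl (a / b) b) (cong₂ _*_ (/-*-cancel b≢0) (/-*-cancel b≢0)))
               (trans (x-y≡0⇒x≡y eq) (*-comm ν _)))))

    norm≢0 : ∀ {a b} → ¬ (a ≡ 0# × b ≡ 0#) → norm a b ≢ 0#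
    norm≢0 nz eq = nz (norm-zero eq)

    columns : Carrier → Carrier → Carrier → V → V
    columns k e f (vertex a b c d s) = vertex (e * a + ν * f * b) (f * a + e * b) (e * c + ν * f * d) (f * c + e * d) (k * s)

    columns-flat : ∀ k e f z → Flat z → Flat (columns k e f z)
    columns-flat k e f z (p , q , r , s) = flat-sum _ _ p q , flat-sum _ _ p q , flat-sum _ _ r s , flat-sum _ _ r s

    -- Multiplication of both rows by e + f √ν.
    column-operation : ∀ e f → norm e f ≢ 0# → Linear
    column-operation e f N≢0 = record
      { to = columns N e f ; from = columns i (e * i) (- (f * i))
      ; from-to = λ { (vertex a b c d s) → vertex-≡ (ft₁ a b) (ft₂ a b) (ft₁ c d) (ft₂ c d) (step (sym (*-assoc i N s))) }
      ; to-from = λ { (vertex a b c d s) → vertex-≡ (tf₁ a b) (tf₂ a b) (tf₁ c d) (tf₂ c d) (step (solve 3 (λ i n s → n :* (i :* s) := i :* n :* s) refl i N s)) }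
      ; to-flat = columns-flat N e f
      ; from-flat = columns-flat i (e * i) (- (f * i))
      ; to-δ = λ { (vertex a b c d s) (vertex a′ b′ c′ d′ s′) → vertex-≡
          (lin e (ν * f) a b a′ b′) (lin f e a b a′ b′) (lin e (ν * f) c d c′ d′) (lin f e c d c′ d′)
          (solve 13 (λ ν e f a b c d s a′ b′ c′ d′ s′ → (e :* e :- ν :* (f :* f)) :* s′ :- (e :* e :- ν :* (f :* f)) :* s :+ ((e :* a′ :+ ν :* f :* b′) :* (e :* c :+ ν :* f :* d) :- ν :* (f :* a′ :+ e :* b′) :* (f :* c :+ e :* d) :- (e :* c′ :+ ν :* f :* d′) :* (e :* a :+ ν :* f :* b) :+ ν :* (f :* c′ :+ e :* d′) :* (f :* a :+ e :* b)) := (e :* e :- ν :* (f :* f)) :* (s′ :- s :+ (a′ :* c :- ν :* b′ :* d :- c′ :* a :+ ν :* d′ :* b))) refl ν e f a b c d s a′ b′ c′ d′ s′) }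
      ; scalar = N ; scalar≢0 = N≢0
      ; to-det = λ { (vertex a b c d s) → solve 7 (λ ν e f a b c d → (e :* a :+ ν :* f :* b) :* (f :* c :+ e :* d) :- (e :* c :+ ν :* f :* d) :* (f :* a :+ e :* b) := (e :* e :- ν :* (f :* f)) :* (a :* d :- c :* b)) refl ν e f a b c d }
      ; to-t = λ _ → refl }
      where
      N i : Carrier
      N = norm e f
      i = N ⁻¹
      step : ∀ {x y} → y ≡ i * N * x → y ≡ x
      step {x} eq = trans eq (trans (cong (_* x) (⁻¹-inverseˡ N≢0)) (*-identityˡ x))
      lin : ∀ α β a c a′ c′ → (α * a′ + β * c′) - (α * a + β * c) ≡ α * (a′ - a) + β * (c′ - c)
      lin α β a c a′ c′ = solve 6 (λ α β a c a′ c′ → (α :* a′ :+ β :* c′) :- (α :* a :+ β :* c) := α :* (a′ :- a) :+ β :* (c′ :- c)) refl α β a c a′ c′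
      ft₁ : ∀ a b → e * i * (e * a + ν * f * b) + ν * (- (f * i)) * (f * a + e * b) ≡ a
      ft₁ a b = step (solve 6 (λ ν e f i a b → e :* i :* (e :* a :+ ν :* f :* b) :+ ν :* (:- (f :* i)) :* (f :* a :+ e :* b) := i :* (e :* e :- ν :* (f :* f)) :* a) refl ν e f i a b)
      ft₂ : ∀ a b → (- (f * i)) * (e * a + ν * f * b) + e * i * (f * a + e * b) ≡ b
      ft₂ a b = step (solve 6 (λ ν e f i a b → (:- (f :* i)) :* (e :* a :+ ν :* f :* b) :+ e :* i :* (f :* a :+ e :* b) := i :* (e :* e :- ν :* (f :* f)) :* b) refl ν e f i a b)
      tf₁ : ∀ a b → e * (e * i * a + ν * (- (f * i)) * b) + ν * f * ((- (f * i)) * a + e * i * b) ≡ a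
      tf₁ a b = step (solve 6 (λ ν e f i a b → e :* (e :* i :* a :+ ν :* (:- (f :* i)) :* b) :+ ν :* f :* ((:- (f :* i)) :* a :+ e :* i :* b) := i :* (e :* e :- ν :* (f :* f)) :* a) refl ν e f i a b)
      tf₂ : ∀ a b → f * (e * i * a + ν * (- (f * i)) * b) + e * ((- (f * i)) * a + e * i * b) ≡ b
      tf₂ a b = step (solve 6 (λ ν e f i a b → f :* (e :* i :* a :+ ν :* (:- (f :* i)) :* b) :+ e :* ((:- (f :* i)) :* a :+ e :* i :* b) := i :* (e :* e :- ν :* (f :* f)) :* b) refl ν e f i a b)

-- Matchings that do not come from automorphisms

module ModelMatchings where

  open Rings
  open Fields
  open QuadraticExtensions
  open Model
  open import Data.Empty using (⊥-elim)
  open import Data.Product using (∃₂; _×_; _,_; proj₁; proj₂)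
  open import Function using (_∘_; id)
  open import Relation.Nullary using (Dec; yes; no)
  open import Relation.Binary.PropositionalEquality

  module Swap {A : Set} (_≟_ : (x y : A) → Dec (x ≡ y)) where

    swap : A → A → A → A
    swap a b x with x ≟ a
    ... | yes _ = b
    ... | no _ with x ≟ b
    ... | yes _ = a
    ... | no _  = x

    swap-left : ∀ a b → swap a b a ≡ b
    swap-left a b with a ≟ a
    ... | yes _  = refl
    ... | no a≢a = ⊥-elim (a≢a refl)

    swap-right : ∀ a b → swap a b b ≡ a
    swap-right a b with b ≟ a
    ... | yes b≡a = b≡a
    ... | no _ with b ≟ b
    ... | yes _  = refl
    ... | no b≢b = ⊥-elim (b≢b refl)

    swap-other : ∀ a b {x} → x ≢ a → x ≢ b → swap a b x ≡ x
    swap-other a b {x} x≢a x≢b with x ≟ a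
    ... | yes x≡a = ⊥-elim (x≢a x≡a)
    ... | no _ with x ≟ b
    ... | yes x≡b = ⊥-elim (x≢b x≡b)
    ... | no _    = refl

    swap-involutive : ∀ a b x → swap a b (swap a b x) ≡ x
    swap-involutive a b x with x ≟ a
    ... | yes refl = swap-right a b
    ... | no x≢a with x ≟ b
    ... | yes refl = swap-left a b
    ... | no x≢b   = swap-other a b x≢a x≢b

    record Perm : Set where
      field
        π π⁻¹   : A → A
        π⁻¹-π : ∀ x → π⁻¹ (π x) ≡ x
        π-π⁻¹ : ∀ x → π (π⁻¹ x) ≡ x

    -- A transposition sends a to a′, then a second one sends the image `c` of b to b′. The second
    -- one leaves a′ in place when a ≠ b and a′ ≠ b′.
    move : ∀ a b a′ b′ → Perm
    move a b a′ b′ = record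
      { π = swap c b′ ∘ swap a a′ ; π⁻¹ = swap a a′ ∘ swap c b′
      ; π⁻¹-π = λ x → trans (cong (swap a a′) (swap-involutive c b′ _)) (swap-involutive a a′ x)
      ; π-π⁻¹ = λ x → trans (cong (swap c b′) (swap-involutive a a′ _)) (swap-involutive c b′ x) }
      where
      c : A
      c = swap a a′ b

    open Perm

    move-second : ∀ a b a′ b′ → π (move a b a′ b′) b ≡ b′
    move-second a b a′ b′ = swap-left (swap a a′ b) b′

    move-first : ∀ a b a′ b′ → (a ≡ b ⇔ a′ ≡ b′) → π (move a b a′ b′) a ≡ a′
    move-first a b a′ b′ (f , g) with a ≟ b
    ... | yes refl = trans (move-second a a a′ b′) (sym (f refl))
    ... | no a≢b = trans (cong (swap (swap a a′ b) b′) (swap-left a a′))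
        (swap-other (swap a a′ b) b′ (λ eq → a≢b (sym (trans (sym (swap-involutive a a′ b)) (trans (cong (swap a a′) (sym eq)) (swap-right a a′)))))
                                    (λ eq → a≢b (g eq)))

    -- Used at 0, which the permutations of norms have to fix.
    move-other : ∀ a b a′ b′ z → z ≢ a → z ≢ b → z ≢ a′ → z ≢ b′ → π (move a b a′ b′) z ≡ z
    move-other a b a′ b′ z z≢a z≢b z≢a′ z≢b′ = trans (cong (swap (swap a a′ b) b′) (swap-other a a′ z≢a z≢a′))
      (swap-other (swap a a′ b) b′ (λ eq → z≢b (trans (sym (swap-other a a′ z≢a z≢a′)) (trans (cong (swap a a′) eq) (swap-involutive a a′ b)))) z≢b′)

  module Transitivity (F : FiniteField) (ν : FiniteField.Carrier F) (ν-nonsquare : SquareRoots.NonSquare F ν)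
                      (two≢0 : Arithmetic.two F ≢ FiniteField.0# F) where
    open FiniteField F
    open Arithmetic F
    open FieldProperties F
    open SquareRoots F using (norm-surjective)
    open HeisenbergModel F ν ν-nonsquare two≢0
    open Vertex
    open Swap _≟_

    ν≢0 : ν ≢ 0#
    ν≢0 ν≡0 = ν-nonsquare 0# (trans (zeroˡ 0#) (sym ν≡0))

    -- A permutation of the norms fixing 0 lifts to pairs, by multiplying with elements of suitable norm.
    module NormLift (P : Perm) (fixes-0 : Perm.π P 0# ≡ 0#) where
      open Perm P

      opaque
        -- For c ≠ 0 an element of norm π(c)/c exists because the norm is onto. At 0 the factor 1 is
        -- taken, so that multiplication by the factor is invertible in every case.
        factor : ∀ c → ∃₂ λ a b → norm a b * c ≡ π c × norm a b ≢ 0#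
        factor c with c ≟ 0#
        ... | yes refl = 1# , 0# , trans (zeroʳ _) (sym fixes-0) , λ eq → 1≢0 (trans (solve 1 (λ ν → :1 := :1 :* :1 :- ν :* (:0 :* :0)) refl ν) eq)
        ... | no c≢0 = let a , b , eq = norm-surjective ν ν≢0 (π c / c) in
          a , b , trans (cong (_* c) eq) (/-*-cancel c≢0) , λ N≡0 → *-nonzero πc≢0 (⁻¹-nonzero c≢0) (trans (sym eq) N≡0)
          where
          πc≢0 : π c ≢ 0#
          πc≢0 πc≡0 = c≢0 (trans (sym (π⁻¹-π c)) (trans (cong π⁻¹ (trans πc≡0 (sym fixes-0))) (π⁻¹-π 0#)))

      mul₁ mul₂ : Carrier → Carrier → Carrier → Carrier → Carrier
      mul₁ a b x y = a * x + ν * b * y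
      mul₂ a b x y = a * y + b * x

      norm-mul : ∀ a b x y → norm (mul₁ a b x y) (mul₂ a b x y) ≡ norm a b * norm x y
      norm-mul a b x y = solve 5 (λ ν a b x y → (a :* x :+ ν :* b :* y) :* (a :* x :+ ν :* b :* y) :- ν :* ((a :* y :+ b :* x) :* (a :* y :+ b :* x)) := (a :* a :- ν :* (b :* b)) :* (x :* x :- ν :* (y :* y))) refl ν a b x y

      -- α⁻ + β⁻ √ν is the inverse of α + β √ν, that is the conjugate divided by the norm.
      α β α⁻ β⁻ i : Carrier → Carrier
      α c = proj₁ (factor c)
      β c = proj₁ (proj₂ (factor c))
      i c = norm (α c) (β c) ⁻¹
      α⁻ c = α c * i c
      β⁻ c = - (β c * i c)

      norm-factor : ∀ c → norm (α c) (β c) * c ≡ π c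
      norm-factor c = proj₁ (proj₂ (proj₂ (factor c)))

      norm-factor≢0 : ∀ c → norm (α c) (β c) ≢ 0#
      norm-factor≢0 c = proj₂ (proj₂ (proj₂ (factor c)))

      -- The factor depends on the norm of (x , y) alone, and this norm is recovered from the image
      -- by π⁻¹; so `drop` knows by which factor to divide.
      lift₁ lift₂ drop₁ drop₂ : Carrier → Carrier → Carrier
      lift₁ x y = mul₁ (α (norm x y)) (β (norm x y)) x y
      lift₂ x y = mul₂ (α (norm x y)) (β (norm x y)) x y
      drop₁ x y = mul₁ (α⁻ (π⁻¹ (norm x y))) (β⁻ (π⁻¹ (norm x y))) x y
      drop₂ x y = mul₂ (α⁻ (π⁻¹ (norm x y))) (β⁻ (π⁻¹ (norm x y))) x y

      norm-lift : ∀ x y → norm (lift₁ x y) (lift₂ x y) ≡ π (norm x y)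
      norm-lift x y = trans (norm-mul _ _ x y) (norm-factor (norm x y))

      norm-inverse : ∀ c → norm (α⁻ c) (β⁻ c) * norm (α c) (β c) ≡ 1#
      norm-inverse c = trans (solve 4 (λ ν a b i → (a :* i :* (a :* i) :- ν :* ((:- (b :* i)) :* (:- (b :* i)))) :* (a :* a :- ν :* (b :* b)) := (i :* (a :* a :- ν :* (b :* b))) :* (i :* (a :* a :- ν :* (b :* b)))) refl ν (α c) (β c) (i c))
        (trans (cong₂ _*_ (⁻¹-inverseˡ (norm-factor≢0 c)) (⁻¹-inverseˡ (norm-factor≢0 c))) (*-identityˡ 1#))

      norm-drop : ∀ x y → norm (drop₁ x y) (drop₂ x y) ≡ π⁻¹ (norm x y)
      norm-drop x y = begin
        norm (drop₁ x y) (drop₂ x y)       ≡⟨ norm-mul _ _ x y ⟩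
        norm (α⁻ c) (β⁻ c) * norm x y      ≡⟨ cong (norm (α⁻ c) (β⁻ c) *_) (π-π⁻¹ (norm x y)) ⟨
        norm (α⁻ c) (β⁻ c) * π c           ≡⟨ cong (norm (α⁻ c) (β⁻ c) *_) (norm-factor c) ⟨
        norm (α⁻ c) (β⁻ c) * (norm (α c) (β c) * c)  ≡⟨ *-assoc _ _ _ ⟨
        norm (α⁻ c) (β⁻ c) * norm (α c) (β c) * c    ≡⟨ cong (_* c) (norm-inverse c) ⟩
        1# * c                             ≡⟨ *-identityˡ c ⟩
        c                                  ∎
        where
        open ≡-Reasoning
        c : Carrier
        c = π⁻¹ (norm x y)

      step : ∀ c {x y} → y ≡ i c * norm (α c) (β c) * x → y ≡ x
      step c {x} eq = trans eq (trans (cong (_* x) (⁻¹-inverseˡ (norm-factor≢0 c))) (*-identityˡ x))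

      cancel₁ : ∀ c x y → mul₁ (α⁻ c) (β⁻ c) (mul₁ (α c) (β c) x y) (mul₂ (α c) (β c) x y) ≡ x
      cancel₁ c x y = step c (solve 6 (λ ν a b i x y → a :* i :* (a :* x :+ ν :* b :* y) :+ ν :* (:- (b :* i)) :* (a :* y :+ b :* x) := i :* (a :* a :- ν :* (b :* b)) :* x) refl ν (α c) (β c) (i c) x y)

      cancel₂ : ∀ c x y → mul₂ (α⁻ c) (β⁻ c) (mul₁ (α c) (β c) x y) (mul₂ (α c) (β c) x y) ≡ y
      cancel₂ c x y = step c (solve 6 (λ ν a b i x y → a :* i :* (a :* y :+ b :* x) :+ (:- (b :* i)) :* (a :* x :+ ν :* b :* y) := i :* (a :* a :- ν :* (b :* b)) :* y) refl ν (α c) (β c) (i c) x y)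

      cancel₃ : ∀ c x y → mul₁ (α c) (β c) (mul₁ (α⁻ c) (β⁻ c) x y) (mul₂ (α⁻ c) (β⁻ c) x y) ≡ x
      cancel₃ c x y = step c (solve 6 (λ ν a b i x y → a :* (a :* i :* x :+ ν :* (:- (b :* i)) :* y) :+ ν :* b :* (a :* i :* y :+ (:- (b :* i)) :* x) := i :* (a :* a :- ν :* (b :* b)) :* x) refl ν (α c) (β c) (i c) x y)

      cancel₄ : ∀ c x y → mul₂ (α c) (β c) (mul₁ (α⁻ c) (β⁻ c) x y) (mul₂ (α⁻ c) (β⁻ c) x y) ≡ y
      cancel₄ c x y = step c (solve 6 (λ ν a b i x y → a :* (a :* i :* y :+ (:- (b :* i)) :* x) :+ b :* (a :* i :* x :+ ν :* (:- (b :* i)) :* y) := i :* (a :* a :- ν :* (b :* b)) :* y) refl ν (α c) (β c) (i c) x y)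

      drop-lift₁ : ∀ x y → drop₁ (lift₁ x y) (lift₂ x y) ≡ x
      drop-lift₁ x y = trans (cong (λ c → mul₁ (α⁻ c) (β⁻ c) (lift₁ x y) (lift₂ x y))
        (trans (cong π⁻¹ (norm-lift x y)) (π⁻¹-π _))) (cancel₁ (norm x y) x y)

      drop-lift₂ : ∀ x y → drop₂ (lift₁ x y) (lift₂ x y) ≡ y
      drop-lift₂ x y = trans (cong (λ c → mul₂ (α⁻ c) (β⁻ c) (lift₁ x y) (lift₂ x y))
        (trans (cong π⁻¹ (norm-lift x y)) (π⁻¹-π _))) (cancel₂ (norm x y) x y)

      lift-drop₁ : ∀ x y → lift₁ (drop₁ x y) (drop₂ x y) ≡ x
      lift-drop₁ x y = trans (cong (λ c → mul₁ (α c) (β c) (drop₁ x y) (drop₂ x y)) (norm-drop x y)) (cancel₃ (π⁻¹ (norm x y)) x y)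

      lift-drop₂ : ∀ x y → lift₂ (drop₁ x y) (drop₂ x y) ≡ y
      lift-drop₂ x y = trans (cong (λ c → mul₂ (α c) (β c) (drop₁ x y) (drop₂ x y)) (norm-drop x y)) (cancel₄ (π⁻¹ (norm x y)) x y)

    -- For z with X = ν y₁ - x₂, m = x₁ - y₂, Y = ν y₁ + x₂, p = x₁ + y₂ one has 4 ν det z = N(X, m) - N(Y, p), and
    -- 4 ν det (1 - z) = N(X, m) - N(Y, p - 2).
    module Rescale (s s′ : Carrier) (s≢0 : s ≢ 0#) (s′≢0 : s′ ≢ 0#) where
      η η⁻¹ : Carrier
      η   = s′ / s
      η⁻¹ = s / s′

      η≢0 : η ≢ 0#
      η≢0 = *-nonzero s′≢0 (⁻¹-nonzero s≢0)

      η⁻¹-η : ∀ x → η⁻¹ * (η * x) ≡ x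
      η⁻¹-η x = trans (solve 5 (λ s s′ u v x → s :* v :* (s′ :* u :* x) := (s :* u) :* (s′ :* v) :* x) refl s s′ (s ⁻¹) (s′ ⁻¹) x)
        (trans (cong₂ (λ u v → u * v * x) (⁻¹-inverseʳ s≢0) (⁻¹-inverseʳ s′≢0)) (solve 1 (λ x → :1 :* :1 :* x := x) refl x))

      η-η⁻¹ : ∀ x → η * (η⁻¹ * x) ≡ x
      η-η⁻¹ x = trans (solve 5 (λ s s′ u v x → s′ :* u :* (s :* v :* x) := s :* v :* (s′ :* u :* x)) refl s s′ (s ⁻¹) (s′ ⁻¹) x) (η⁻¹-η x)

      -- The terms with Y² cancel in the comparison, so a coincidence of the two norms does not
      -- depend on the first argument. This is the side condition of `move-first`.
      norm-η : ∀ Y p p′ → norm Y p ≡ norm Y p′ → norm (η * Y) p ≡ norm (η * Y) p′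
      norm-η Y p p′ eq = trans (solve 4 (λ η ν Y p → η :* Y :* (η :* Y) :- ν :* (p :* p) := (η :* Y :* (η :* Y) :- Y :* Y) :+ (Y :* Y :- ν :* (p :* p))) refl η ν Y p)
        (trans (cong ((η * Y * (η * Y) - Y * Y) +_) eq)
        (solve 4 (λ η ν Y p → (η :* Y :* (η :* Y) :- Y :* Y) :+ (Y :* Y :- ν :* (p :* p)) := η :* Y :* (η :* Y) :- ν :* (p :* p)) refl η ν Y p′))

      norm-η′ : ∀ Y p p′ → norm (η * Y) p ≡ norm (η * Y) p′ → norm Y p ≡ norm Y p′
      norm-η′ Y p p′ eq = trans (solve 4 (λ η ν Y p → Y :* Y :- ν :* (p :* p) := (Y :* Y :- η :* Y :* (η :* Y)) :+ (η :* Y :* (η :* Y) :- ν :* (p :* p))) refl η ν Y p)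
        (trans (cong ((Y * Y - η * Y * (η * Y)) +_) eq)
        (solve 4 (λ η ν Y p → (Y :* Y :- η :* Y :* (η :* Y)) :+ (η :* Y :* (η :* Y) :- ν :* (p :* p)) := Y :* Y :- ν :* (p :* p)) refl η ν Y p′))

      -- The map below scales `t` and Y by η, because the last coordinate of the quotient towards
      -- `unit s` is s - t + Y. This disturbs N(Y, p) and N(Y, p - 2). The permutation moves the
      -- norms N(X, m) along with them, so that each of the two determinants vanishes after the map
      -- exactly when it did before. Fixing 0 keeps scalar matrices scalar.
      record Rearrangement (Y p : Carrier) : Set where
        field
          perm  : Perm
          fix-0 : Perm.π perm 0# ≡ 0#
          at-p  : Perm.π perm (norm Y p) ≡ norm (η * Y) p
          at-p′ : Perm.π perm (norm Y (p - two)) ≡ norm (η * Y) (p - two)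

      opaque
        -- For Y ≠ 0 all four norms are nonzero, so the transpositions avoid 0. For Y = 0 the norms
        -- do not change and the identity serves.
        rearrangement : ∀ Y p → Rearrangement Y p
        rearrangement Y p with Y ≟ 0#
        ... | yes refl = record
          { perm = record { π = id ; π⁻¹ = id ; π⁻¹-π = λ _ → refl ; π-π⁻¹ = λ _ → refl }
          ; fix-0 = refl
          ; at-p  = cong (λ y → norm y p) (sym (zeroʳ η))
          ; at-p′ = cong (λ y → norm y (p - two)) (sym (zeroʳ η)) }
        ... | no Y≢0 = record
          { perm = move (norm Y p) (norm Y (p - two)) (norm (η * Y) p) (norm (η * Y) (p - two))
          ; fix-0 = move-other _ _ _ _ 0# (nz Y≢0 p) (nz Y≢0 (p - two)) (nz ηY≢0 p) (nz ηY≢0 (p - two))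
          ; at-p  = move-first _ _ _ _ (norm-η Y p (p - two) , norm-η′ Y p (p - two))
          ; at-p′ = move-second _ _ _ _ }
          where
          ηY≢0 : η * Y ≢ 0#
          ηY≢0 = *-nonzero η≢0 Y≢0
          nz : ∀ {Y} → Y ≢ 0# → ∀ p → 0# ≢ norm Y p
          nz Y≢0 p eq = Y≢0 (proj₁ (norm-zero (sym eq)))

      half : Carrier
      half = two ⁻¹

      halve : ∀ {x y} → two * x ≡ two * y → x ≡ y
      halve = *-cancelˡ two≢0

      halves : ∀ x → two * (half * x) ≡ x
      halves x = trans (sym (*-assoc _ _ _)) (trans (cong (_* x) (⁻¹-inverseʳ two≢0)) (*-identityˡ x))

      Xc Yc pc mc : V → Carrier
      Xc z = ν * y₁ z - x₂ z
      Yc z = ν * y₁ z + x₂ z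
      pc z = x₁ z + y₂ z
      mc z = x₁ z - y₂ z

      assemble : Carrier → Carrier → Carrier → Carrier → Carrier → V
      assemble X Y p m u = vertex (half * (p + m)) (ν ⁻¹ * (half * (Y + X))) (half * (Y - X)) (half * (p - m)) u

      ν-cancel : ∀ x → ν * (ν ⁻¹ * x) ≡ x
      ν-cancel x = trans (sym (*-assoc _ _ _)) (trans (cong (_* x) (⁻¹-inverseʳ ν≢0)) (*-identityˡ x))

      half-sum : ∀ a b → half * (a + b) + half * (a - b) ≡ a
      half-sum a b = trans (solve 3 (λ h a b → h :* (a :+ b) :+ h :* (a :- b) := :2 :* (h :* a)) refl half a b) (halves a)

      half-difference : ∀ a b → half * (a + b) - half * (a - b) ≡ b
      half-difference a b = trans (solve 3 (λ h a b → h :* (a :+ b) :- h :* (a :- b) := :2 :* (h :* b)) refl half a b) (halves b)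

      Xc-assemble : ∀ X Y p m u → Xc (assemble X Y p m u) ≡ X
      Xc-assemble X Y p m u = trans (cong (_- half * (Y - X)) (ν-cancel _)) (half-difference Y X)

      Yc-assemble : ∀ X Y p m u → Yc (assemble X Y p m u) ≡ Y
      Yc-assemble X Y p m u = trans (cong (_+ half * (Y - X)) (ν-cancel _)) (half-sum Y X)

      pc-assemble : ∀ X Y p m u → pc (assemble X Y p m u) ≡ p
      pc-assemble X Y p m u = half-sum p m

      mc-assemble : ∀ X Y p m u → mc (assemble X Y p m u) ≡ m
      mc-assemble X Y p m u = half-difference p m

      assemble-coordinates : ∀ z → assemble (Xc z) (Yc z) (pc z) (mc z) (t z) ≡ z
      assemble-coordinates (vertex a b c d u) = vertex-≡
        (trans (solve 3 (λ h a d → h :* (a :+ d :+ (a :- d)) := :2 :* (h :* a)) refl half a d) (halves a))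
        (trans (solve 5 (λ h n ν b c → n :* (h :* (ν :* b :+ c :+ (ν :* b :- c))) := :2 :* (h :* (ν :* (n :* b)))) refl half (ν ⁻¹) ν b c) (trans (halves _) (ν-cancel b)))
        (trans (solve 4 (λ h ν b c → h :* (ν :* b :+ c :- (ν :* b :- c)) := :2 :* (h :* c)) refl half ν b c) (halves c))
        (trans (solve 3 (λ h a d → h :* (a :+ d :- (a :- d)) := :2 :* (h :* d)) refl half a d) (halves d))
        refl

      assemble-cong : ∀ {X Y p m u X′ Y′ p′ m′ u′} → X ≡ X′ → Y ≡ Y′ → p ≡ p′ → m ≡ m′ → u ≡ u′ →
                      assemble X Y p m u ≡ assemble X′ Y′ p′ m′ u′
      assemble-cong refl refl refl refl refl = refl

      perm-at : V → Perm
      perm-at z = Rearrangement.perm (rearrangement (Yc z) (pc z))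

      module L (Y p : Carrier) = NormLift (Rearrangement.perm (rearrangement Y p)) (Rearrangement.fix-0 (rearrangement Y p))

      -- The permutation used for (X, m) depends on Y and p. Since p is kept and Y only scaled,
      -- `from` restores Y first and then knows which permutation to undo.
      to from : V → V
      to z = assemble (L.lift₁ Y p X m) (η * Y) p (L.lift₂ Y p X m) (η * t z)
        where X = Xc z ; Y = Yc z ; p = pc z ; m = mc z
      from z = assemble (L.drop₁ Y p X m) Y p (L.drop₂ Y p X m) (η⁻¹ * t z)
        where X = Xc z ; Y = η⁻¹ * Yc z ; p = pc z ; m = mc z

      Xc-to : ∀ z → Xc (to z) ≡ L.lift₁ (Yc z) (pc z) (Xc z) (mc z)
      Xc-to z = Xc-assemble (L.lift₁ (Yc z) (pc z) (Xc z) (mc z)) (η * Yc z) (pc z) (L.lift₂ (Yc z) (pc z) (Xc z) (mc z)) (η * t z)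

      Yc-to : ∀ z → Yc (to z) ≡ η * Yc z
      Yc-to z = Yc-assemble (L.lift₁ (Yc z) (pc z) (Xc z) (mc z)) (η * Yc z) (pc z) (L.lift₂ (Yc z) (pc z) (Xc z) (mc z)) (η * t z)

      pc-to : ∀ z → pc (to z) ≡ pc z
      pc-to z = pc-assemble (L.lift₁ (Yc z) (pc z) (Xc z) (mc z)) (η * Yc z) (pc z) (L.lift₂ (Yc z) (pc z) (Xc z) (mc z)) (η * t z)

      mc-to : ∀ z → mc (to z) ≡ L.lift₂ (Yc z) (pc z) (Xc z) (mc z)
      mc-to z = mc-assemble (L.lift₁ (Yc z) (pc z) (Xc z) (mc z)) (η * Yc z) (pc z) (L.lift₂ (Yc z) (pc z) (Xc z) (mc z)) (η * t z)

      Xc-from : ∀ z → Xc (from z) ≡ L.drop₁ (η⁻¹ * Yc z) (pc z) (Xc z) (mc z)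
      Xc-from z = Xc-assemble (L.drop₁ (η⁻¹ * Yc z) (pc z) (Xc z) (mc z)) (η⁻¹ * Yc z) (pc z) (L.drop₂ (η⁻¹ * Yc z) (pc z) (Xc z) (mc z)) (η⁻¹ * t z)

      Yc-from : ∀ z → Yc (from z) ≡ η⁻¹ * Yc z
      Yc-from z = Yc-assemble (L.drop₁ (η⁻¹ * Yc z) (pc z) (Xc z) (mc z)) (η⁻¹ * Yc z) (pc z) (L.drop₂ (η⁻¹ * Yc z) (pc z) (Xc z) (mc z)) (η⁻¹ * t z)

      pc-from : ∀ z → pc (from z) ≡ pc z
      pc-from z = pc-assemble (L.drop₁ (η⁻¹ * Yc z) (pc z) (Xc z) (mc z)) (η⁻¹ * Yc z) (pc z) (L.drop₂ (η⁻¹ * Yc z) (pc z) (Xc z) (mc z)) (η⁻¹ * t z)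

      mc-from : ∀ z → mc (from z) ≡ L.drop₂ (η⁻¹ * Yc z) (pc z) (Xc z) (mc z)
      mc-from z = mc-assemble (L.drop₁ (η⁻¹ * Yc z) (pc z) (Xc z) (mc z)) (η⁻¹ * Yc z) (pc z) (L.drop₂ (η⁻¹ * Yc z) (pc z) (Xc z) (mc z)) (η⁻¹ * t z)

      from-to : ∀ z → from (to z) ≡ z
      from-to z = trans (assemble-cong
          (trans (cong₄ L.drop₁ eY ep eX em) (L.drop-lift₁ Y p X m)) eY ep
          (trans (cong₄ L.drop₂ eY ep eX em) (L.drop-lift₂ Y p X m)) (η⁻¹-η (t z)))
        (assemble-coordinates z)
        where
        X Y p m : Carrier
        X = Xc z
        Y = Yc z
        p = pc z
        m = mc z
        eX : Xc (to z) ≡ L.lift₁ Y p X m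
        eX = Xc-to z
        eY : η⁻¹ * Yc (to z) ≡ Y
        eY = trans (cong (η⁻¹ *_) (Yc-to z)) (η⁻¹-η Y)
        ep : pc (to z) ≡ p
        ep = pc-to z
        em : mc (to z) ≡ L.lift₂ Y p X m
        em = mc-to z

      to-from : ∀ z → to (from z) ≡ z
      to-from z = trans (assemble-cong
          (trans (cong₄ L.lift₁ eY ep eX em) (L.lift-drop₁ Y p X m)) (trans (cong (η *_) eY) (η-η⁻¹ (Yc z))) ep
          (trans (cong₄ L.lift₂ eY ep eX em) (L.lift-drop₂ Y p X m)) (η-η⁻¹ (t z)))
        (assemble-coordinates z)
        where
        X Y p m : Carrier
        X = Xc z
        Y = η⁻¹ * Yc z
        p = pc z
        m = mc z
        eX : Xc (from z) ≡ L.drop₁ Y p X m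
        eX = Xc-from z
        eY : Yc (from z) ≡ Y
        eY = Yc-from z
        ep : pc (from z) ≡ p
        ep = pc-from z
        em : mc (from z) ≡ L.drop₂ Y p X m
        em = mc-from z

      quarter : ∀ {x y} → two * two * ν * x ≡ y → y ≡ 0# ⇔ x ≡ 0#
      quarter eq = (λ y≡0 → zero-product (trans eq y≡0) 4ν≢0) , λ x≡0 → trans (sym eq) (trans (cong (two * two * ν *_) x≡0) (zeroʳ _))
        where
        4ν≢0 : two * two * ν ≢ 0#
        4ν≢0 = *-nonzero (*-nonzero two≢0 two≢0) ν≢0

      det-norm : ∀ z → two * two * ν * det z ≡ norm (Xc z) (mc z) - norm (Yc z) (pc z)
      det-norm (vertex a b c d u) = solve 5 (λ ν a b c d → :2 :* :2 :* ν :* (a :* d :- c :* b) := (ν :* b :- c) :* (ν :* b :- c) :- ν :* ((a :- d) :* (a :- d)) :- ((ν :* b :+ c) :* (ν :* b :+ c) :- ν :* ((a :+ d) :* (a :+ d)))) refl ν a b c d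

      unit : Carrier → V
      unit s = vertex 1# 0# 0# 1# s

      det-norm′ : ∀ s z → two * two * ν * det (δ z (unit s)) ≡ norm (Xc z) (mc z) - norm (Yc z) (pc z - two)
      det-norm′ s (vertex a b c d u) = solve 5 (λ ν a b c d → :2 :* :2 :* ν :* ((:1 :- a) :* (:1 :- d) :- (:0 :- c) :* (:0 :- b)) := (ν :* b :- c) :* (ν :* b :- c) :- ν :* ((a :- d) :* (a :- d)) :- ((ν :* b :+ c) :* (ν :* b :+ c) :- ν :* ((a :+ d :- :2) :* (a :+ d :- :2)))) refl ν a b c d

      norm-cong : ∀ {a b a′ b′} → a ≡ a′ → b ≡ b′ → norm a b ≡ norm a′ b′
      norm-cong refl refl = refl

      norm-to : ∀ z → norm (Xc (to z)) (mc (to z)) ≡ Perm.π (perm-at z) (norm (Xc z) (mc z))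
      norm-to z = trans (norm-cong (Xc-to z) (mc-to z)) (L.norm-lift (Yc z) (pc z) (Xc z) (mc z))

      difference-perm : (P : Perm) → ∀ {a b} → a - b ≡ 0# ⇔ Perm.π P a - Perm.π P b ≡ 0#
      difference-perm P {a} {b} = (λ eq → x≡y⇒x-y≡0 (cong π (x-y≡0⇒x≡y eq))) ,
        λ eq → x≡y⇒x-y≡0 (trans (sym (π⁻¹-π a)) (trans (cong π⁻¹ (x-y≡0⇒x≡y eq)) (π⁻¹-π b)))
        where open Perm P

      det-to : ∀ z → det z ≡ 0# ⇔ det (to z) ≡ 0#
      det-to z = ⇔-trans (⇔-sym (quarter (det-norm z))) (⇔-trans (difference-perm (perm-at z))
        (subst (λ d → d ≡ 0# ⇔ det (to z) ≡ 0#) (cong₂ _-_ (norm-to z)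
          (trans (norm-cong (Yc-to z) (pc-to z)) (sym (Rearrangement.at-p (rearrangement (Yc z) (pc z))))))
          (quarter (det-norm (to z)))))

      det-to′ : ∀ z → det (δ z (unit s)) ≡ 0# ⇔ det (δ (to z) (unit s′)) ≡ 0#
      det-to′ z = ⇔-trans (⇔-sym (quarter (det-norm′ s z))) (⇔-trans (difference-perm (perm-at z))
        (subst (λ d → d ≡ 0# ⇔ det (δ (to z) (unit s′)) ≡ 0#) (cong₂ _-_ (norm-to z)
          (trans (norm-cong (Yc-to z) (cong (_- two) (pc-to z))) (sym (Rearrangement.at-p′ (rearrangement (Yc z) (pc z))))))
          (quarter (det-norm′ s′ (to z)))))

      -- The matrix is c times the identity: N(X, m) = 0 forces X = m = 0. The values c = 0 and c =
      -- 1 describe when `z`, and when its quotient towards `unit s`, is flat.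
      Scalar : Carrier → V → Set
      Scalar c z = norm (Xc z) (mc z) ≡ 0# × Yc z ≡ 0# × pc z ≡ two * c

      scalar⇒ : ∀ c z → Scalar c z → x₁ z ≡ c × y₁ z ≡ 0# × x₂ z ≡ 0# × y₂ z ≡ c
      scalar⇒ c (vertex a b e d u) (N≡0 , Y≡0 , p≡2c) =
        halve (trans (solve 2 (λ a d → :2 :* a := (a :+ d) :+ (a :- d)) refl a d) (trans (cong₂ _+_ p≡2c m≡0) (+-identityʳ _))) ,
        *-cancelˡ ν≢0 (halve (trans (solve 3 (λ ν b e → :2 :* (ν :* b) := (ν :* b :+ e) :+ (ν :* b :- e)) refl ν b e)
          (trans (cong₂ _+_ Y≡0 X≡0) (solve 1 (λ ν → :0 :+ :0 := :2 :* (ν :* :0)) refl ν)))) ,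
        halve (trans (solve 3 (λ ν b e → :2 :* e := (ν :* b :+ e) :- (ν :* b :- e)) refl ν b e) (trans (cong₂ _-_ Y≡0 X≡0) (solve 0 (:0 :- :0 := :2 :* :0) refl ))) ,
        halve (trans (solve 2 (λ a d → :2 :* d := (a :+ d) :- (a :- d)) refl a d) (trans (cong₂ _-_ p≡2c m≡0) (solve 1 (λ c → :2 :* c :- :0 := :2 :* c) refl c)))
        where
        X≡0 : ν * b - e ≡ 0#
        X≡0 = proj₁ (norm-zero N≡0)
        m≡0 : a - d ≡ 0#
        m≡0 = proj₂ (norm-zero N≡0)

      ⇒scalar : ∀ c z → x₁ z ≡ c × y₁ z ≡ 0# × x₂ z ≡ 0# × y₂ z ≡ c → Scalar c z
      ⇒scalar c (vertex a b e d u) (refl , refl , refl , refl) =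
        solve 2 (λ ν a → (ν :* :0 :- :0) :* (ν :* :0 :- :0) :- ν :* ((a :- a) :* (a :- a)) := :0) refl ν a ,
        solve 1 (λ ν → ν :* :0 :+ :0 := :0) refl ν , solve 1 (λ a → a :+ a := :2 :* a) refl a

      scalar-to : ∀ c z → Scalar c z ⇔ Scalar c (to z)
      scalar-to c z = (λ (N≡0 , Y≡0 , p≡2c) →
          trans (norm-to z) (trans (cong π N≡0) fix-0) ,
          trans (Yc-to z) (trans (cong (η *_) Y≡0) (zeroʳ η)) ,
          trans (pc-to z) p≡2c) ,
        λ (N≡0 , Y≡0 , p≡2c) →
          trans (sym (π⁻¹-π _)) (trans (cong π⁻¹ (trans (sym (norm-to z)) (trans N≡0 (sym fix-0)))) (π⁻¹-π 0#)) ,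
          zero-product (trans (sym (Yc-to z)) Y≡0) η≢0 ,
          trans (sym (pc-to z)) p≡2c
        where
        open Perm (perm-at z)
        open Rearrangement (rearrangement (Yc z) (pc z)) using (fix-0)

      flat-to : ∀ z → Flat z ⇔ Flat (to z)
      flat-to z = ⇔-trans (⇒scalar 0# z , scalar⇒ 0# z) (⇔-trans (scalar-to 0# z) (scalar⇒ 0# (to z) , ⇒scalar 0# (to z)))

      flat-unit : ∀ s z → Flat (δ z (unit s)) ⇔ Scalar 1# z
      flat-unit s z = (λ (p , q , r , s) → ⇒scalar 1# z
          (sym (x-y≡0⇒x≡y p) , sym (x-y≡0⇒x≡y q) , sym (x-y≡0⇒x≡y r) , sym (x-y≡0⇒x≡y s))) ,
        λ sc → let p , q , r , s = scalar⇒ 1# z sc in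
          x≡y⇒x-y≡0 (sym p) , x≡y⇒x-y≡0 (sym q) , x≡y⇒x-y≡0 (sym r) , x≡y⇒x-y≡0 (sym s)

      t-unit : ∀ s z → t (δ z (unit s)) ≡ s - t z + Yc z
      t-unit s (vertex a b c d u) = solve 7 (λ ν s a b c d u → s :- u :+ (:1 :* c :- ν :* :0 :* d :- :0 :* a :+ ν :* :1 :* b) := s :- u :+ (ν :* b :+ c)) refl ν s a b c d u

      -- Here η s = s′ enters, which dictates the choice of η.
      t-to′ : ∀ z → t (δ (to z) (unit s′)) ≡ η * t (δ z (unit s))
      t-to′ z = trans (t-unit s′ (to z)) (trans (cong₂ (λ a b → a - η * t z + b) (sym (/-*-cancel s≢0)) (Yc-to z))
        (trans (solve 4 (λ η s u Y → η :* s :- η :* u :+ η :* Y := η :* (s :- u :+ Y)) refl η s (t z) (Yc z)) (cong (η *_) (sym (t-unit s z)))))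

      matching : Matching origin (unit s) origin (unit s′)
      matching = record
        { to = to ; from = from ; from-to = from-to ; to-from = to-from
        ; left  = λ z → subst₂ Similar (sym (δ-origin z)) (sym (δ-origin (to z))) (flat-to z , det-to z , scaled-zero η≢0)
        ; right = λ z → ⇔-trans (flat-unit s z) (⇔-trans (scalar-to 1# z) (⇔-sym (flat-unit s′ (to z)))) , det-to′ z ,
                         subst (λ d → t (δ z (unit s)) ≡ 0# ⇔ d ≡ 0#) (sym (t-to′ z)) (scaled-zero η≢0) }

-- The model as an association scheme, and coordinatised schemes

module ModelScheme where

  open Rings
  open Fields
  open QuadraticExtensions
  open Model
  open ModelMatchings
  open import Data.Fin using (Fin; zero; suc)
  import Data.Fin.Permutation as Perm
  open import Data.Product using (∃; Σ; _×_; _,_; proj₁; proj₂)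
  open import Data.Sum using (_⊎_; inj₁; inj₂)
  open import Function using (_∘_; id)
  open import Relation.Nullary using (¬_; yes; no)
  open import Relation.Binary.PropositionalEquality
  open import Relation.Binary.Construct.Closure.ReflexiveTransitive using (Star; ε; _◅_)

  module Coordinates (F : FiniteField) (ν : FiniteField.Carrier F) (ν-nonsquare : SquareRoots.NonSquare F ν)
                     (two≢0 : Arithmetic.two F ≢ FiniteField.0# F) where
    open FiniteField F
    open Arithmetic F
    open FieldProperties F
    open HeisenbergModel F ν ν-nonsquare two≢0
    open Transitivity F ν ν-nonsquare two≢0 using (module Rescale)
    open Vertex

    canonical : Fin 6 → V
    canonical zero                                 = origin
    canonical (suc zero)                           = vertex 1# 0# 0# 0# 0#
    canonical (suc (suc zero))                     = vertex 0# 0# 0# 0# 1#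
    canonical (suc (suc (suc zero)))               = vertex 1# 0# 0# 0# 1#
    canonical (suc (suc (suc (suc zero))))         = vertex 1# 0# 0# 1# 1#
    canonical (suc (suc (suc (suc (suc zero)))))   = vertex 1# 0# 0# 1# 0#

    canonical-class : ∀ i → Class i (canonical i)
    canonical-class zero                               = (refl , refl , refl , refl) , refl
    canonical-class (suc zero)                         = (1≢0 ∘ proj₁) , solve 0 (:1 :* :0 :- :0 :* :0 := :0) refl  , refl
    canonical-class (suc (suc zero))                   = (refl , refl , refl , refl) , 1≢0
    canonical-class (suc (suc (suc zero)))             = (1≢0 ∘ proj₁) , solve 0 (:1 :* :0 :- :0 :* :0 := :0) refl  , 1≢0
    canonical-class (suc (suc (suc (suc zero))))       = (λ e → 1≢0 (trans (solve 0 (:1 := :1 :* :1 :- :0 :* :0) refl ) e)) , 1≢0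
    canonical-class (suc (suc (suc (suc (suc zero))))) = (λ e → 1≢0 (trans (solve 0 (:1 := :1 :* :1 :- :0 :* :0) refl ) e)) , refl

    infix 3 _∼_
    _∼_ : V → V → Set
    z ∼ w = Matching origin z origin w

    move-to-origin : ∀ a b → Matching a b origin (δ a b)
    move-to-origin a b = subst (λ c → Matching a b c (δ a b)) (δ-diagonal a) (automorphism-matching (translation a) a b)

    origin-flat : Flat origin
    origin-flat = refl , refl , refl , refl

    flat-zero⇒origin : ∀ {v} → Flat v → t v ≡ 0# → v ≡ origin
    flat-zero⇒origin (p , q , r , s) u = vertex-≡ p q r s u

    linear-∼ : (φ : Linear) → ∀ z {w} → Linear.to φ z ≡ w → z ∼ w
    linear-∼ φ z {w} eq = subst₂ (Matching origin z)
      (flat-zero⇒origin (to-flat origin origin-flat) (trans (to-t origin) (zeroʳ scalar))) eq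
      (automorphism-matching automorphism origin z)
      where open Linear φ

    -- On a vertex whose second row is zero this changes only `t`, and thus normalises it to 1 in
    -- the flat and in the singular case.
    row-scale : ∀ k → k ≢ 0# → ∀ a b c d s → vertex a b c d s ∼ vertex a b (k * c) (k * d) (k * s)
    row-scale k k≢0 a b c d s = linear-∼ (row-operation 1# 0# 0# k (λ e → k≢0 (trans (solve 1 (λ k → k := :1 :* k :- :0 :* :0) refl k) e))) _
      (vertex-≡ (solve 2 (λ a c → :1 :* a :+ :0 :* c := a) refl a c) (solve 2 (λ b d → :1 :* b :+ :0 :* d := b) refl b d)
                (solve 3 (λ k a c → :0 :* a :+ k :* c := k :* c) refl k a c) (solve 3 (λ k b d → :0 :* b :+ k :* d := k :* d) refl k b d)
                (solve 2 (λ k s → (:1 :* k :- :0 :* :0) :* s := k :* s) refl k s))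

    -- Both rows are multiplied by the inverse (a - b √ν)/N of the first one.
    rank-one : ∀ a b s → norm a b ≢ 0# → ∃ λ s′ → (s ≡ 0# ⇔ s′ ≡ 0#) × (vertex a b 0# 0# s ∼ vertex 1# 0# 0# 0# s′)
    rank-one a b s N≢0 = norm e f * s , scaled-zero N′≢0 , linear-∼ (column-operation e f N′≢0) _
      (vertex-≡ (trans (solve 4 (λ ν i a b → a :* i :* a :+ ν :* (:- (b :* i)) :* b := i :* (a :* a :- ν :* (b :* b))) refl ν (N ⁻¹) a b) (⁻¹-inverseˡ N≢0))
        (solve 3 (λ i a b → (:- (b :* i)) :* a :+ a :* i :* b := :0) refl (N ⁻¹) a b)
        (solve 3 (λ ν e f → e :* :0 :+ ν :* f :* :0 := :0) refl ν e f) (solve 2 (λ e f → f :* :0 :+ e :* :0 := :0) refl e f) refl)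
      where
      N e f : Carrier
      N = norm a b
      e = a * N ⁻¹
      f = - (b * N ⁻¹)
      N′≢0 : norm e f ≢ 0#
      N′≢0 eq = ⁻¹-nonzero N≢0 (*-cancelˡ N≢0 (trans (⁻¹-inverseʳ N≢0) (trans (sym (*-identityˡ 1#))
        (trans (cong₂ _*_ (sym (⁻¹-inverseʳ N≢0)) (sym (⁻¹-inverseʳ N≢0)))
        (trans (solve 4 (λ ν i a b → (a :* a :- ν :* (b :* b)) :* i :* ((a :* a :- ν :* (b :* b)) :* i) := (a :* a :- ν :* (b :* b)) :* (a :* i :* (a :* i) :- ν :* ((:- (b :* i)) :* (:- (b :* i))))) refl ν (N ⁻¹) a b)
               (cong (N *_) eq))))))

    -- If the first row w₁ is nonzero, det = 0 means w₂ = k w₁ with k in GF(q), and k is the real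
    -- part of w₂ w̄₁ divided by N(w₁). A zero first row is exchanged with the second.
    singular : ∀ z → ¬ Flat z → det z ≡ 0# → ∃ λ s → (t z ≡ 0# ⇔ s ≡ 0#) × (z ∼ vertex 1# 0# 0# 0# s)
    singular (vertex a b c d s) nf dt with norm a b ≟ 0#
    ... | no N≢0 = let s′ , iff , m = rank-one a b _ N≢0 in s′ , iff , matching-trans
        (linear-∼ (row-operation 1# 0# (- k) 1# (λ e → 1≢0 (trans (solve 1 (λ k → :1 := :1 :* :1 :- :0 :* (:- k)) refl k) e))) _
          (vertex-≡ (solve 2 (λ a c → :1 :* a :+ :0 :* c := a) refl a c) (solve 2 (λ b d → :1 :* b :+ :0 :* d := b) refl b d)
            (trans (solve 3 (λ k a c → (:- k) :* a :+ :1 :* c := c :- k :* a) refl k a c) (x≡y⇒x-y≡0 (sym ka≡c)))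
            (trans (solve 3 (λ k b d → (:- k) :* b :+ :1 :* d := d :- k :* b) refl k b d) (x≡y⇒x-y≡0 (sym kb≡d)))
            (solve 2 (λ k s → (:1 :* :1 :- :0 :* (:- k)) :* s := s) refl k s))) m
      where
      open ≡-Reasoning
      N k : Carrier
      N = norm a b
      k = (a * c - ν * b * d) * N ⁻¹
      ad≡cb : a * d ≡ c * b
      ad≡cb = x-y≡0⇒x≡y dt
      ka≡c : k * a ≡ c
      ka≡c = begin
        k * a                                       ≡⟨ solve 6 (λ ν a b c d i → (a :* c :- ν :* b :* d) :* i :* a := (a :* a :* c :- ν :* b :* (a :* d)) :* i) refl ν a b c d (N ⁻¹) ⟩
        (a * a * c - ν * b * (a * d)) * N ⁻¹        ≡⟨ cong (λ y → (a * a * c - ν * b * y) * N ⁻¹) ad≡cb ⟩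
        (a * a * c - ν * b * (c * b)) * N ⁻¹        ≡⟨ solve 5 (λ ν a b c i → (a :* a :* c :- ν :* b :* (c :* b)) :* i := c :* ((a :* a :- ν :* (b :* b)) :* i)) refl ν a b c (N ⁻¹) ⟩
        c * (N * N ⁻¹)                              ≡⟨ cong (c *_) (⁻¹-inverseʳ N≢0) ⟩
        c * 1#                                      ≡⟨ *-identityʳ c ⟩
        c                                           ∎
      kb≡d : k * b ≡ d
      kb≡d = begin
        k * b                                       ≡⟨ solve 6 (λ ν a b c d i → (a :* c :- ν :* b :* d) :* i :* b := (a :* (c :* b) :- ν :* b :* b :* d) :* i) refl ν a b c d (N ⁻¹) ⟩
        (a * (c * b) - ν * b * b * d) * N ⁻¹        ≡⟨ cong (λ y → (a * y - ν * b * b * d) * N ⁻¹) ad≡cb ⟨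
        (a * (a * d) - ν * b * b * d) * N ⁻¹        ≡⟨ solve 5 (λ ν a b d i → (a :* (a :* d) :- ν :* b :* b :* d) :* i := d :* ((a :* a :- ν :* (b :* b)) :* i)) refl ν a b d (N ⁻¹) ⟩
        d * (N * N ⁻¹)                              ≡⟨ cong (d *_) (⁻¹-inverseʳ N≢0) ⟩
        d * 1#                                      ≡⟨ *-identityʳ d ⟩
        d                                           ∎
    ... | yes N≡0 = let a≡0 , b≡0 = norm-zero N≡0
                        s′ , iff , m = rank-one c d s (norm≢0 λ (c≡0 , d≡0) → nf (a≡0 , b≡0 , c≡0 , d≡0)) in
      s′ , iff , matching-trans
        (linear-∼ (row-operation 0# 1# (- 1#) 0# (λ e → 1≢0 (trans (solve 0 (:1 := :0 :* :0 :- :1 :* (:- :1)) refl ) e))) _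
          (vertex-≡ (solve 2 (λ a c → :0 :* a :+ :1 :* c := c) refl a c) (solve 2 (λ b d → :0 :* b :+ :1 :* d := d) refl b d)
            (trans (cong (λ y → (- 1#) * y + 0# * c) a≡0) (solve 1 (λ c → (:- :1) :* :0 :+ :0 :* c := :0) refl c))
            (trans (cong (λ y → (- 1#) * y + 0# * d) b≡0) (solve 1 (λ d → (:- :1) :* :0 :+ :0 :* d := :0) refl d))
            (solve 1 (λ s → (:0 :* :0 :- :1 :* (:- :1)) :* s := s) refl s))) m

    -- Multiplication by the inverse matrix, whose determinant `E` is 1/det. The value t/det
    -- remains.
    regular : ∀ z → det z ≢ 0# → ∃ λ s → (t z ≡ 0# ⇔ s ≡ 0#) × (z ∼ vertex 1# 0# 0# 1# s)
    regular (vertex a b c d s) D≢0 = E * s , scaled-zero E≢0 , linear-∼ (row-operation (d * i) (- (b * i)) (- (c * i)) (a * i) E≢0) _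
      (vertex-≡ (trans (solve 5 (λ a b c d i → d :* i :* a :+ (:- (b :* i)) :* c := i :* (a :* d :- c :* b)) refl a b c d i) (⁻¹-inverseˡ D≢0))
        (solve 3 (λ b d i → d :* i :* b :+ (:- (b :* i)) :* d := :0) refl b d i)
        (solve 3 (λ a c i → (:- (c :* i)) :* a :+ a :* i :* c := :0) refl a c i)
        (trans (solve 5 (λ a b c d i → (:- (c :* i)) :* b :+ a :* i :* d := i :* (a :* d :- c :* b)) refl a b c d i) (⁻¹-inverseˡ D≢0)) refl)
      where
      D i E : Carrier
      D = a * d - c * b
      i = D ⁻¹
      E = d * i * (a * i) - (- (b * i)) * (- (c * i))
      E≢0 : E ≢ 0#
      E≢0 eq = *-nonzero (⁻¹-nonzero D≢0) 1≢0 (trans (cong (i *_) (sym (⁻¹-inverseˡ D≢0)))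
        (trans (solve 5 (λ a b c d i → i :* (i :* (a :* d :- c :* b)) := d :* i :* (a :* i) :- (:- (b :* i)) :* (:- (c :* i))) refl a b c d i) eq))

    canonical-form : ∀ i z → Class i z → z ∼ canonical i
    canonical-form zero z (f , u) = subst (z ∼_) (flat-zero⇒origin f u) (linear-∼ identity z (identity-to z))
      where
      identity : Linear
      identity = row-operation 1# 0# 0# 1# (λ e → 1≢0 (trans (solve 0 (:1 := :1 :* :1 :- :0 :* :0) refl ) e))
      identity-to : ∀ z → Linear.to identity z ≡ z
      identity-to (vertex a b c d s) = vertex-≡ (solve 2 (λ a c → :1 :* a :+ :0 :* c := a) refl a c) (solve 2 (λ b d → :1 :* b :+ :0 :* d := b) refl b d)
        (solve 2 (λ a c → :0 :* a :+ :1 :* c := c) refl a c) (solve 2 (λ b d → :0 :* b :+ :1 :* d := d) refl b d) (solve 1 (λ s → (:1 :* :1 :- :0 :* :0) :* s := s) refl s)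
    canonical-form (suc zero) z (nf , d , u) = let s , iff , m = singular z nf d in
      subst (λ s → z ∼ vertex 1# 0# 0# 0# s) (proj₁ iff u) m
    canonical-form (suc (suc zero)) (vertex _ _ _ _ s) ((refl , refl , refl , refl) , u≢0) =
      subst (vertex 0# 0# 0# 0# s ∼_) (vertex-≡ refl refl (zeroʳ _) (zeroʳ _) (⁻¹-inverseˡ u≢0)) (row-scale (s ⁻¹) (⁻¹-nonzero u≢0) 0# 0# 0# 0# s)
    canonical-form (suc (suc (suc zero))) z (nf , d , u≢0) = let s , iff , m = singular z nf d ; s≢0 = u≢0 ∘ proj₂ iff in
      matching-trans m (subst (vertex 1# 0# 0# 0# s ∼_) (vertex-≡ refl refl (zeroʳ _) (zeroʳ _) (⁻¹-inverseˡ s≢0)) (row-scale (s ⁻¹) (⁻¹-nonzero s≢0) 1# 0# 0# 0# s))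
    -- The one class in which the remaining value is brought to 1 by a matching that is not an
    -- automorphism.
    canonical-form (suc (suc (suc (suc zero)))) z (d≢0 , u≢0) = let s , iff , m = regular z d≢0 in
      matching-trans m (Rescale.matching s 1# (u≢0 ∘ proj₂ iff) 1≢0)
    canonical-form (suc (suc (suc (suc (suc zero))))) z (d≢0 , u) = let s , iff , m = regular z d≢0 in
      subst (λ s → z ∼ vertex 1# 0# 0# 1# s) (proj₁ iff u) m

    class-matching : ∀ k a b a′ b′ → Class k (δ a b) → Class k (δ a′ b′) → Matching a b a′ b′
    class-matching k a b a′ b′ c c′ = matching-trans (matching-trans (move-to-origin a b) (canonical-form k _ c))
      (matching-sym (matching-trans (move-to-origin a′ b′) (canonical-form k _ c′)))

    -- Interchanging the vertices negates the rows and `t`, and `det` is quadratic in the rows.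
    δ-symmetric : ∀ i v w → Class i (δ v w) → Class i (δ w v)
    δ-symmetric i v w = similar-class i (flip-flat , flip-det , flip-t)
      where
      flip : ∀ {a b} → a - b ≡ 0# → b - a ≡ 0#
      flip eq = x≡y⇒x-y≡0 (sym (x-y≡0⇒x≡y eq))
      flip-flat : Flat (δ v w) ⇔ Flat (δ w v)
      flip-flat = (λ (p , q , r , s) → flip p , flip q , flip r , flip s) , λ (p , q , r , s) → flip p , flip q , flip r , flip s
      flip-det : det (δ v w) ≡ 0# ⇔ det (δ w v) ≡ 0#
      flip-det = subst (λ d → d ≡ 0# ⇔ det (δ w v) ≡ 0#) (even (x₁ v) (y₁ v) (x₂ v) (y₂ v) (x₁ w) (y₁ w) (x₂ w) (y₂ w)) ⇔-refl
        where
        even : ∀ a b c d a′ b′ c′ d′ → (a - a′) * (d - d′) - (c - c′) * (b - b′) ≡ (a′ - a) * (d′ - d) - (c′ - c) * (b′ - b)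
        even a b c d a′ b′ c′ d′ = solve 8 (λ a b c d a′ b′ c′ d′ → (a :- a′) :* (d :- d′) :- (c :- c′) :* (b :- b′) := (a′ :- a) :* (d′ :- d) :- (c′ :- c) :* (b′ :- b)) refl a b c d a′ b′ c′ d′
      flip-t : t (δ v w) ≡ 0# ⇔ t (δ w v) ≡ 0#
      flip-t = (λ e → trans (odd v w) (trans (cong -_ e) (solve 0 (:- :0 := :0) refl ))) ,
               (λ e → trans (odd w v) (trans (cong -_ e) (solve 0 (:- :0 := :0) refl )))
        where
        odd : ∀ v w → t (δ w v) ≡ - t (δ v w)
        odd (vertex a b c d s) (vertex a′ b′ c′ d′ s′) = solve 11 (λ ν a b c d s a′ b′ c′ d′ s′ → s :- s′ :+ (a :* c′ :- ν :* b :* d′ :- c :* a′ :+ ν :* d :* b′) := :- (s′ :- s :+ (a′ :* c :- ν :* b′ :* d :- c′ :* a :+ ν :* d′ :* b))) refl ν a b c d s a′ b′ c′ d′ s′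

    δ≡origin⇒≡ : ∀ v w → Flat (δ v w) → t (δ v w) ≡ 0# → v ≡ w
    δ≡origin⇒≡ v w f u = trans (sym (δ-inverse v v)) (trans (cong (δ (δ v origin))
      (trans (δ-diagonal v) (sym (flat-zero⇒origin f u)))) (δ-inverse v w))

    -- What each geometry has to supply: a bijection with the model, up to equality of vertices,
    -- that turns relations into classes of quotients. The axioms follow from one instance, an
    -- isomorphism from two.
    record Coordinatisation (X : Scheme) : Set where
      open Scheme X
      field
        ≈-refl    : ∀ x → x ≈ x
        ≈-sym     : ∀ x y → x ≈ y → y ≈ x
        ≈-trans   : ∀ x y z → x ≈ y → y ≈ z → x ≈ z
        coord     : Vtx → V
        point     : V → Vtx
        coord-cong : ∀ x y → x ≈ y → coord x ≡ coord y
        point-coord : ∀ x → point (coord x) ≈ x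
        coord-point : ∀ v → coord (point v) ≡ v
        class⇒relation     : ∀ i x y → Class i (δ (coord x) (coord y)) → R i x y
        relation⇒class : ∀ i x y → R i x y → Class i (δ (coord x) (coord y))

      coord-injective : ∀ x y → coord x ≡ coord y → x ≈ y
      coord-injective x y eq = ≈-trans x _ y (≈-sym _ x (point-coord x))
        (subst (λ v → point v ≈ y) (sym eq) (point-coord y))

      class⇒relation-points : ∀ i v w → Class i (δ v w) → R i (point v) (point w)
      class⇒relation-points i v w c = class⇒relation i _ _ (subst₂ (λ v w → Class i (δ v w)) (sym (coord-point v)) (sym (coord-point w)) c)

      equinumerous : ∀ {i j a b a′ b′} → Matching (coord a) (coord b) (coord a′) (coord b′) →
                     Equinumerous _≈_ (λ z → R i a z × R j z b) (λ z → R i a′ z × R j z b′)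
      equinumerous {i} {j} m = forth m , forth (matching-sym m) ,
        (λ (x , _) (y , _) x≈y → forth-cong m x y x≈y) , (λ (x , _) (y , _) x≈y → forth-cong (matching-sym m) x y x≈y) ,
        (λ (x , _) → back-forth m x) , λ (x , _) → back-forth (matching-sym m) x
        where
        forth : ∀ {a b a′ b′} → Matching (coord a) (coord b) (coord a′) (coord b′) →
                Σ Vtx (λ z → R i a z × R j z b) → Σ Vtx (λ z → R i a′ z × R j z b′)
        forth {a} {b} {a′} {b′} m (z , Riaz , Rjzb) = point (to (coord z)) ,
          class⇒relation i _ _ (subst (λ w → Class i (δ (coord a′) w)) (sym (coord-point _)) (similar-class i (left (coord z)) (relation⇒class i a z Riaz))) ,
          class⇒relation j _ _ (subst (λ w → Class j (δ w (coord b′))) (sym (coord-point _)) (similar-class j (right (coord z)) (relation⇒class j z b Rjzb)))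
          where open Matching m
        point-cong : ∀ v w → v ≡ w → point v ≈ point w
        point-cong v w refl = ≈-refl _
        forth-cong : ∀ {a b a′ b′} (m : Matching a b a′ b′) → ∀ x y → x ≈ y → point (Matching.to m (coord x)) ≈ point (Matching.to m (coord y))
        forth-cong m x y x≈y = point-cong _ _ (cong (Matching.to m) (coord-cong x y x≈y))
        back-forth : ∀ {a b a′ b′} (m : Matching a b a′ b′) → ∀ x → point (Matching.from m (coord (point (Matching.to m (coord x))))) ≈ x
        back-forth m x = ≈-trans _ _ _ (point-cong _ _ (trans (cong (Matching.from m) (coord-point _)) (Matching.from-to m (coord x)))) (point-coord x)

      isSymmetricAssociationScheme : IsSymmetricAssociationScheme X
      isSymmetricAssociationScheme =
        ≈-refl , ≈-sym , ≈-trans ,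
        (λ i x x′ y y′ x≈x′ y≈y′ r → class⇒relation i x′ y′
          (subst₂ (λ v w → Class i (δ v w)) (coord-cong x x′ x≈x′) (coord-cong y y′ y≈y′) (relation⇒class i x y r))) ,
        (λ x y → let i , c = classify (δ (coord x) (coord y)) in i , class⇒relation i x y c) ,
        (λ i j x y r r′ → class-unique i j _ (relation⇒class i x y r) (relation⇒class j x y r′)) ,
        (λ i → point origin , point (canonical i) ,
          class⇒relation-points i origin (canonical i) (subst (Class i) (sym (δ-origin (canonical i))) (canonical-class i))) ,
        (λ x y → (λ r → let f , e = relation⇒class zero x y r in coord-injective x y (δ≡origin⇒≡ (coord x) (coord y) f e)) ,
                 (λ x≈y → class⇒relation zero x y (subst (λ w → Class zero (δ (coord x) w)) (coord-cong x y x≈y)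
                   (subst (Class zero) (sym (δ-diagonal (coord x))) (canonical-class zero))))) ,
        (λ i x y r → class⇒relation i y x (δ-symmetric i (coord x) (coord y) (relation⇒class i x y r))) ,
        (λ i j k x y x′ y′ r r′ → equinumerous {i} {j} {x} {y} {x′} {y′}
          (class-matching k (coord x) (coord y) (coord x′) (coord y′) (relation⇒class k x y r) (relation⇒class k x′ y′ r′)))

      -- The relation R₂ ∪ R₀ leaves the rows of the coordinates fixed.
      isImprimitive : IsImprimitive X
      isImprimitive = suc (suc zero) , (λ ()) , point origin , point (canonical (suc zero)) ,
        λ path → 1≢0 (trans (cong x₁ (sym (coord-point (canonical (suc zero))))) (trans (sym (invariant path)) (cong x₁ (coord-point origin))))
        where
        invariant : ∀ {x y} → Star (λ a b → R (suc (suc zero)) a b ⊎ a ≈ b) x y → x₁ (coord x) ≡ x₁ (coord y)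
        invariant ε = refl
        invariant {x} (_◅_ {j = y} (inj₁ r) path) = trans (sym (x-y≡0⇒x≡y (proj₁ (proj₁ (relation⇒class (suc (suc zero)) x y r))))) (invariant path)
        invariant {x} (_◅_ {j = y} (inj₂ x≈y) path) = trans (cong x₁ (coord-cong x y x≈y)) (invariant path)

    isomorphic : ∀ {X Y} → Coordinatisation X → Coordinatisation Y → Isomorphic X Y
    isomorphic {X} {Y} cx cy = (λ x → CY.point (CX.coord x)) , (λ y → CX.point (CY.coord y)) , Perm.id ,
      (λ x x′ e → subst (λ v → Y._≈_ (CY.point (CX.coord x)) (CY.point v)) (CX.coord-cong x x′ e) (CY.≈-refl _)) ,
      (λ y y′ e → subst (λ v → X._≈_ (CX.point (CY.coord y)) (CX.point v)) (CY.coord-cong y y′ e) (CX.≈-refl _)) ,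
      (λ x → subst (λ v → X._≈_ (CX.point v) x) (sym (CY.coord-point _)) (CX.point-coord x)) ,
      (λ y → subst (λ v → Y._≈_ (CY.point v) y) (sym (CX.coord-point _)) (CY.point-coord y)) ,
      (λ i x x′ → (λ r → CY.class⇒relation-points i _ _ (CX.relation⇒class i x x′ r)) ,
        (λ r → CX.class⇒relation i x x′ (subst₂ (λ v w → Class i (δ v w)) (CY.coord-point _) (CY.coord-point _) (CY.relation⇒class i _ _ r))))
      where
      module X = Scheme X
      module Y = Scheme Y
      module CX = Coordinatisation cx
      module CY = Coordinatisation cy

-- Linear systems, dimension and dual bases

module LinearSystems where

  open Rings
  open Fields
  open import Data.Empty using (⊥-elim)
  open import Data.Fin as Fin using (Fin; zero; suc; punchIn; punchOut)
  import Data.Fin.Properties as Fin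
  open import Data.Nat as ℕ using (ℕ; zero; suc; _<_; s≤s)
  import Data.Nat.Properties as ℕ
  open import Data.Product using (∃; _×_; _,_; proj₁; proj₂)
  open import Function using (_∘_)
  open import Relation.Binary.Definitions using (tri<; tri≈; tri>)
  open import Relation.Nullary using (¬_; yes; no)
  open import Relation.Nullary.Decidable using (¬?; decidable-stable)
  open import Relation.Binary.PropositionalEquality

  module LinearAlgebra (F : FiniteField) where
    open FiniteField F
    open Arithmetic F
    open FieldProperties F
    open LinAlg F

    sumF-cong : ∀ {k} {f g : Fin k → Carrier} → (∀ i → f i ≡ g i) → sumF f ≡ sumF g
    sumF-cong {zero}  eq = refl
    sumF-cong {suc k} eq = cong₂ _+_ (eq zero) (sumF-cong (eq ∘ suc))

    sumF-0 : ∀ k → sumF {k} (λ _ → 0#) ≡ 0#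
    sumF-0 zero    = refl
    sumF-0 (suc k) = trans (+-identityˡ _) (sumF-0 k)

    sumF-+ : ∀ {k} (f g : Fin k → Carrier) → sumF (λ i → f i + g i) ≡ sumF f + sumF g
    sumF-+ {zero}  f g = sym (+-identityˡ 0#)
    sumF-+ {suc k} f g = trans (cong (f zero + g zero +_) (sumF-+ (f ∘ suc) (g ∘ suc)))
      (solve 4 (λ a b u v → a :+ b :+ (u :+ v) := (a :+ u) :+ (b :+ v)) refl (f zero) (g zero) (sumF (f ∘ suc)) (sumF (g ∘ suc)))

    sumF-* : ∀ {k} c (f : Fin k → Carrier) → sumF (λ i → c * f i) ≡ c * sumF f
    sumF-* {zero}  c f = sym (zeroʳ c)
    sumF-* {suc k} c f = trans (cong (c * f zero +_) (sumF-* c (f ∘ suc))) (sym (distribˡ c _ _))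

    sumF-swap : ∀ {k n} (f : Fin k → Fin n → Carrier) →
                sumF (λ i → sumF (λ j → f i j)) ≡ sumF (λ j → sumF (λ i → f i j))
    sumF-swap {zero} {n} f = sym (sumF-0 n)
    sumF-swap {suc k}    f = trans (cong (sumF (f zero) +_) (sumF-swap (f ∘ suc))) (sym (sumF-+ (f zero) _))

    -- Gaussian elimination by the first column: if it is zero the first unknown is free, and
    -- otherwise a pivot row eliminates that unknown from the remaining equations.
    homogeneous : ∀ n k (M : Fin k → Fin n → Carrier) → k < n →
                  ∃ λ (c : Fin n → Carrier) → (∃ λ j → c j ≢ 0#) × (∀ i → sumF (λ j → M i j * c j) ≡ 0#)
    homogeneous (suc n) k M k<n with Fin.any? (λ i → ¬? (M i zero ≟ 0#))
    ... | no ∄i = c , (zero , 1≢0) , solves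
      where
      c : Fin (suc n) → Carrier
      c zero    = 1#
      c (suc _) = 0#
      solves : ∀ i → sumF (λ j → M i j * c j) ≡ 0#
      solves i = trans (cong₂ _+_ (trans (cong (_* 1#) (decidable-stable (M i zero ≟ 0#) (λ nz → ∄i (i , nz)))) (zeroˡ 1#))
                                  (trans (sumF-cong (λ j → zeroʳ (M i (suc j)))) (sumF-0 n)))
                       (+-identityˡ 0#)
    homogeneous (suc n) (suc k) M (s≤s k<n) | yes (i₀ , p≢0) =
      let c , (j , cj≢0) , solves = homogeneous n k M′ k<n in full c , (suc j , cj≢0) , full-solves c solves
      where
      p : Carrier
      p = M i₀ zero
      M′ : Fin k → Fin n → Carrier
      M′ i j = M (punchIn i₀ i) (suc j) + (- (M (punchIn i₀ i) zero * p ⁻¹)) * M i₀ (suc j)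
      row : Fin (suc k) → (Fin n → Carrier) → Carrier
      row i c = sumF (λ j → M i (suc j) * c j)
      full : (Fin n → Carrier) → Fin (suc n) → Carrier
      full c zero    = - (p ⁻¹ * row i₀ c)
      full c (suc j) = c j
      pivot : ∀ c → p * (- (p ⁻¹ * row i₀ c)) + row i₀ c ≡ 0#
      pivot c = trans (solve 3 (λ p i r → p :* (:- (i :* r)) :+ r := (:1 :- p :* i) :* r) refl p (p ⁻¹) (row i₀ c))
        (trans (cong (λ y → (1# - y) * row i₀ c) (⁻¹-inverseʳ p≢0)) (solve 1 (λ r → (:1 :- :1) :* r := :0) refl (row i₀ c)))
      full-solves : ∀ c → (∀ i → sumF (λ j → M′ i j * c j) ≡ 0#) → ∀ i → M i zero * full c zero + row i c ≡ 0#
      full-solves c solves i with i₀ Fin.≟ i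
      ... | yes refl = pivot c
      ... | no i₀≢i = subst (λ i → M i zero * full c zero + row i c ≡ 0#) (Fin.punchIn-punchOut i₀≢i) (begin
        M i′ zero * (- (p ⁻¹ * row i₀ c)) + row i′ c          ≡⟨ solve 4 (λ m i r s → m :* (:- (i :* r)) :+ s := s :+ (:- (m :* i)) :* r) refl (M i′ zero) (p ⁻¹) (row i₀ c) (row i′ c) ⟩
        row i′ c + k′ * row i₀ c                              ≡⟨ cong (row i′ c +_) (sumF-* k′ (λ j → M i₀ (suc j) * c j)) ⟨
        row i′ c + sumF (λ j → k′ * (M i₀ (suc j) * c j))     ≡⟨ sumF-+ (λ j → M i′ (suc j) * c j) (λ j → k′ * (M i₀ (suc j) * c j)) ⟨
        sumF (λ j → M i′ (suc j) * c j + k′ * (M i₀ (suc j) * c j))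
          ≡⟨ sumF-cong (λ j → solve 4 (λ m c k a → m :* c :+ k :* (a :* c) := (m :+ k :* a) :* c) refl (M i′ (suc j)) (c j) k′ (M i₀ (suc j))) ⟩
        sumF (λ j → M′ (punchOut i₀≢i) j * c j)               ≡⟨ solves (punchOut i₀≢i) ⟩
        0#                                                    ∎)
        where
        open ≡-Reasoning
        i′ : Fin (suc k)
        i′ = punchIn i₀ (punchOut i₀≢i)
        k′ : Carrier
        k′ = - (M i′ zero * p ⁻¹)

    -- Expressing l vectors by k < l others gives a matrix whose homogeneous system has a nontrivial
    -- solution, and this solution is a dependence among the l vectors.
    span-bound : ∀ {n k l} (b : Fin k → V n) (b′ : Fin l → V n) → LinIndep b′ → (∀ j → InSpan b (b′ j)) → ¬ (k < l)
    span-bound {n} {k} {l} b b′ indep spans k<l =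
      let c , (j , cj≢0) , solves = homogeneous l k (λ i j → proj₁ (spans j) i) k<l
      in cj≢0 (indep c (λ x → vanishes c solves x) j)
      where
      open ≡-Reasoning
      M : Fin l → Fin k → Carrier
      M j = proj₁ (spans j)
      vanishes : ∀ c → (∀ i → sumF (λ j → M j i * c j) ≡ 0#) → ∀ x → sumF (λ j → c j * b′ j x) ≡ 0#
      vanishes c solves x = begin
        sumF (λ j → c j * b′ j x)                               ≡⟨ sumF-cong (λ j → cong (c j *_) (proj₂ (spans j) x)) ⟨
        sumF (λ j → c j * sumF (λ i → M j i * b i x))           ≡⟨ sumF-cong (λ j → sumF-* (c j) (λ i → M j i * b i x)) ⟨
        sumF (λ j → sumF (λ i → c j * (M j i * b i x)))         ≡⟨ sumF-swap (λ j i → c j * (M j i * b i x)) ⟩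
        sumF (λ i → sumF (λ j → c j * (M j i * b i x)))         ≡⟨ sumF-cong (λ i → sumF-cong (λ j →
                                                                     solve 3 (λ c m b → c :* (m :* b) := b :* (m :* c)) refl (c j) (M j i) (b i x))) ⟩
        sumF (λ i → sumF (λ j → b i x * (M j i * c j)))         ≡⟨ sumF-cong (λ i → trans (sumF-* (b i x) (λ j → M j i * c j))
                                                                     (trans (cong (b i x *_) (solves i)) (zeroʳ _))) ⟩
        sumF {k} (λ i → 0#)                                     ≡⟨ sumF-0 k ⟩
        0#                                                      ∎

    Dim-unique : ∀ {n k l} {P : V n → Set} → Dim P k → Dim P l → k ≡ l
    Dim-unique {k = k} {l} (b , b∈P , b-indep , b-span) (b′ , b′∈P , b′-indep , b′-span) with ℕ.<-cmp k l
    ... | tri< k<l _ _ = ⊥-elim (span-bound b b′ b′-indep (λ j → b-span _ (b′∈P j)) k<l)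
    ... | tri≈ _ k≡l _ = k≡l
    ... | tri> _ _ l<k = ⊥-elim (span-bound b′ b b-indep (λ j → b′-span _ (b∈P j)) l<k)

    infixl 7 _∙_
    _∙_ : ∀ {n} → Carrier → V n → V n
    (c ∙ x) i = c * x i

    record Linear {n} (f : V n → Carrier) : Set where
      field
        f-cong : ∀ {x y} → x ≋ y → f x ≡ f y
        f-⊕    : ∀ x y → f (x ⊕ y) ≡ f x + f y
        f-∙    : ∀ c x → f (c ∙ x) ≡ c * f x

      f-0 : ∀ {x} → x ≋ 0V → f x ≡ 0#
      f-0 {x} x≋0 = trans (f-cong {y = 0# ∙ x} (λ i → trans (x≋0 i) (sym (zeroˡ (x i))))) (trans (f-∙ 0# x) (zeroˡ (f x)))

      f-lincomb : ∀ {k} (c : Fin k → Carrier) (b : Fin k → V n) → f (lincomb c b) ≡ sumF (λ j → c j * f (b j))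
      f-lincomb {zero}  c b = f-0 (λ _ → refl)
      f-lincomb {suc k} c b = trans (f-⊕ (c zero ∙ b zero) (lincomb (c ∘ suc) (b ∘ suc)))
        (cong₂ _+_ (f-∙ (c zero) (b zero)) (f-lincomb (c ∘ suc) (b ∘ suc)))

    scaled-linear : ∀ {n} {f : V n → Carrier} s → Linear f → Linear (λ x → s * f x)
    scaled-linear {f = f} s l = record
      { f-cong = λ eq → cong (s *_) (f-cong eq)
      ; f-⊕ = λ x y → trans (cong (s *_) (f-⊕ x y)) (distribˡ s _ _)
      ; f-∙ = λ c x → trans (cong (s *_) (f-∙ c x)) (solve 3 (λ s c y → s :* (c :* y) := c :* (s :* y)) refl s c (f x)) }
      where open Linear l

    -- n + 1 vectors of an n-dimensional space are dependent, and a dual family makes the relation explicit.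
    dual-expansion : ∀ {n} (b : Fin n → V n) (f : Fin n → V n → Carrier) → (∀ j → Linear (f j)) →
                     (∀ c j → f j (lincomb c b) ≡ c j) → ∀ x → lincomb (λ j → f j x) b ≋ x
    dual-expansion {n} b f linear dual x =
      let c , (j , cj≢0) , relation = homogeneous (suc n) n (λ i j → family j i) (ℕ.n<1+n n)
      in expansion c j cj≢0 relation
      where
      open ≡-Reasoning
      family : Fin (suc n) → V n
      family zero    = x
      family (suc j) = b j
      module _ (c : Fin (suc n) → Carrier) (j : Fin (suc n)) (cj≢0 : c j ≢ 0#)
               (relation : ∀ i → sumF (λ j → family j i * c j) ≡ 0#) where
        relation′ : ((c zero ∙ x) ⊕ lincomb (c ∘ suc) b) ≋ 0V
        relation′ i = trans (sumF-cong {f = λ j → c j * family j i} (λ j → *-comm (c j) (family j i))) (relation i)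
        coefficient : ∀ j → c zero * f j x + c (suc j) ≡ 0#
        coefficient j = begin
          c zero * f j x + c (suc j)                              ≡⟨ cong₂ _+_ (f-∙ (c zero) x) (dual (c ∘ suc) j) ⟨
          f j (c zero ∙ x) + f j (lincomb (c ∘ suc) b)            ≡⟨ f-⊕ _ _ ⟨
          f j ((c zero ∙ x) ⊕ lincomb (c ∘ suc) b)                ≡⟨ f-0 relation′ ⟩
          0#                                                      ∎
          where open Linear (linear j)
        c₀≢0 : ∀ j → c j ≢ 0# → c zero ≢ 0#
        c₀≢0 zero    nz = nz
        c₀≢0 (suc j) nz c₀≡0 = nz (trans (solve 2 (λ f c → c := :0 :* f :+ c) refl (f j x) (c (suc j)))
          (trans (cong (λ y → y * f j x + c (suc j)) (sym c₀≡0)) (coefficient j)))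
        expansion : lincomb (λ j → f j x) b ≋ x
        expansion i = *-cancelˡ (c₀≢0 j cj≢0) (begin
          c zero * sumF (λ j → f j x * b j i)          ≡⟨ sumF-* (c zero) (λ j → f j x * b j i) ⟨
          sumF (λ j → c zero * (f j x * b j i))        ≡⟨ sumF-cong (λ j → trans
              (solve 4 (λ a f c b → a :* (f :* b) := (a :* f :+ c) :* b :+ (:- :1) :* (c :* b)) refl (c zero) (f j x) (c (suc j)) (b j i))
              (trans (cong (λ y → y * b j i + (- 1#) * (c (suc j) * b j i)) (coefficient j))
              (solve 2 (λ c b → :0 :* b :+ (:- :1) :* (c :* b) := (:- :1) :* (c :* b)) refl (c (suc j)) (b j i)))) ⟩
          sumF (λ j → (- 1#) * (c (suc j) * b j i))    ≡⟨ sumF-* (- 1#) (λ j → c (suc j) * b j i) ⟩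
          (- 1#) * s                                   ≡⟨ solve 3 (λ a x s → (:- :1) :* s := a :* x :- (a :* x :+ s)) refl (c zero) (x i) s ⟩
          c zero * x i - (c zero * x i + s)            ≡⟨ cong (λ y → c zero * x i - y) (relation′ i) ⟩
          c zero * x i - 0#                            ≡⟨ solve 1 (λ y → y :- :0 := y) refl (c zero * x i) ⟩
          c zero * x i                                 ∎)
          where
          s : Carrier
          s = lincomb (c ∘ suc) b i

    span-0 : ∀ {n k} (b : Fin k → V n) → InSpan b 0V
    span-0 {k = k} b = (λ _ → 0#) , λ i → trans (sumF-cong (λ j → zeroˡ (b j i))) (sumF-0 k)

    span-⊕ : ∀ {n k} {b : Fin k → V n} {x y} → InSpan b x → InSpan b y → InSpan b (x ⊕ y)
    span-⊕ {b = b} (c , p) (d , q) = (λ j → c j + d j) , λ i → trans (sumF-cong (λ j → distribʳ (b j i) (c j) (d j)))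
      (trans (sumF-+ (λ j → c j * b j i) (λ j → d j * b j i)) (cong₂ _+_ (p i) (q i)))

    span-∙ : ∀ {n k} {b : Fin k → V n} {x} s → InSpan b x → InSpan b (s ∙ x)
    span-∙ {b = b} s (c , p) = (λ j → s * c j) , λ i → trans (sumF-cong (λ j → *-assoc s (c j) (b j i)))
      (trans (sumF-* s (λ j → c j * b j i)) (cong (s *_) (p i)))

    span-cong : ∀ {n k} {b : Fin k → V n} {x y} → x ≋ y → InSpan b x → InSpan b y
    span-cong eq (c , p) = c , λ i → trans (p i) (eq i)

    span-member : ∀ {n k} (b : Fin k → V n) j → InSpan b (b j)
    span-member b j = unit j , λ i → sum-unit j (λ l → b l i)
      where
      unit : ∀ {k} → Fin k → Fin k → Carrier
      unit zero    zero    = 1#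
      unit zero    (suc _) = 0#
      unit (suc _) zero    = 0#
      unit (suc j) (suc l) = unit j l
      sum-unit : ∀ {k} (j : Fin k) (f : Fin k → Carrier) → sumF (λ l → unit j l * f l) ≡ f j
      sum-unit {ℕ.suc k} zero f = trans (cong₂ _+_ (*-identityˡ (f zero)) (trans (sumF-cong (λ l → zeroˡ (f (suc l)))) (sumF-0 k))) (+-identityʳ _)
      sum-unit (suc j) f = trans (cong₂ _+_ (zeroˡ (f zero)) (sum-unit j (f ∘ suc))) (+-identityˡ _)

-- Hyperbolic frames for the Hermitian form

module HermitianFrames where

  open Rings
  open Fields
  open QuadraticExtensions
  open LinearSystems
  open import Data.Empty using (⊥-elim)
  open import Data.Fin as Fin using (Fin; zero; suc)
  open import Data.Product using (∃₂; proj₁; proj₂)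
  open import Function using (_∘_)
  open import Relation.Nullary using (¬_; yes; no)
  open import Relation.Binary.PropositionalEquality

  module Unitary (F K : FiniteField) (ν : FiniteField.Carrier F) (E : QuadraticExtension F K ν)
                 (two≢0 : Arithmetic.two F ≢ FiniteField.0# F) where
    private
      module F where
        open FiniteField F public
        open Arithmetic F public
        open FieldProperties F public
    open FiniteField K
    open Arithmetic K
    open FieldProperties K
    open LinAlg K
    open LinearAlgebra K
    open QuadraticExtension E
    open HomProperties hom
    open Hermitian K F.order

    ι-two : ι F.two ≡ two
    ι-two = trans (ι-+ _ _) (cong₂ _+_ ι-1 ι-1)

    twoK≢0 : two ≢ 0#
    twoK≢0 eq = two≢0 (ι≡0 (trans ι-two eq))

    θ≢0 : θ ≢ 0#
    θ≢0 eq = F.1≢0 (proj₂ (independent F.0# F.1# (trans (cong₂ (λ a b → a + b * θ) ι-0 ι-1)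
      (trans (solve 1 (λ θ → :0 :+ :1 :* θ := θ) refl θ) eq))))

    conj-* : ∀ x y → conj (x * y) ≡ conj x * conj y
    conj-* x y = pow-* x y F.order

    conj-+ : ∀ x y → conj (x + y) ≡ conj x + conj y
    conj-+ x y = begin
      conj (x + y)                                             ≡⟨ cong₂ (λ u v → conj (u + v)) (re-im x) (re-im y) ⟨
      conj ((ι a + ι b * θ) + (ι c + ι d * θ))                 ≡⟨ cong conj (solve 5 (λ a b c d θ → (a :+ b :* θ) :+ (c :+ d :* θ) := (a :+ c) :+ (b :+ d) :* θ) refl (ι a) (ι b) (ι c) (ι d) θ) ⟩
      conj ((ι a + ι c) + (ι b + ι d) * θ)                     ≡⟨ cong₂ (λ u v → conj (u + v * θ)) (ι-+ a c) (ι-+ b d) ⟨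
      conj (ι (a F.+ c) + ι (b F.+ d) * θ)                     ≡⟨ frobenius _ _ ⟩
      ι (a F.+ c) - ι (b F.+ d) * θ                            ≡⟨ cong₂ (λ u v → u - v * θ) (ι-+ a c) (ι-+ b d) ⟩
      (ι a + ι c) - (ι b + ι d) * θ                            ≡⟨ solve 5 (λ a b c d θ → (a :+ c) :- (b :+ d) :* θ := (a :- b :* θ) :+ (c :- d :* θ)) refl (ι a) (ι b) (ι c) (ι d) θ ⟩
      (ι a - ι b * θ) + (ι c - ι d * θ)                        ≡⟨ cong₂ _+_ (frobenius a b) (frobenius c d) ⟨
      conj (ι a + ι b * θ) + conj (ι c + ι d * θ)              ≡⟨ cong₂ (λ u v → conj u + conj v) (re-im x) (re-im y) ⟩
      conj x + conj y                                          ∎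
      where
      open ≡-Reasoning
      a b c d : F.Carrier
      a = re x
      b = im x
      c = re y
      d = im y

    conj-ι : ∀ a → conj (ι a) ≡ ι a
    conj-ι a = trans (cong conj (trans (solve 2 (λ a θ → a := a :+ :0 :* θ) refl (ι a) θ) (cong (λ y → ι a + y * θ) (sym ι-0))))
      (trans (frobenius a F.0#) (trans (cong (λ y → ι a - y * θ) ι-0) (solve 2 (λ a θ → a :- :0 :* θ := a) refl (ι a) θ)))

    conj-θ : conj θ ≡ - θ
    conj-θ = trans (cong conj (trans (solve 1 (λ θ → θ := :0 :+ :1 :* θ) refl θ) (cong₂ (λ x y → x + y * θ) (sym ι-0) (sym ι-1))))
      (trans (frobenius F.0# F.1#) (trans (cong₂ (λ x y → x - y * θ) ι-0 ι-1) (solve 1 (λ θ → :0 :- :1 :* θ := :- θ) refl θ)))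

    conj-0 : conj 0# ≡ 0#
    conj-0 = trans (cong conj (sym ι-0)) (trans (conj-ι F.0#) ι-0)

    conj-1 : conj 1# ≡ 1#
    conj-1 = trans (cong conj (sym ι-1)) (trans (conj-ι F.1#) ι-1)

    conj-neg : ∀ x → conj (- x) ≡ - conj x
    conj-neg x = x-y≡0⇒x≡y (trans (solve 2 (λ a b → a :- (:- b) := a :+ b) refl (conj (- x)) (conj x))
      (trans (sym (conj-+ (- x) x)) (trans (cong conj (-‿inverseˡ x)) conj-0)))

    conj-conj : ∀ x → conj (conj x) ≡ x
    conj-conj x = begin
      conj (conj x)                         ≡⟨ cong (conj ∘ conj) (re-im x) ⟨
      conj (conj (ι a + ι b * θ))           ≡⟨ cong conj (frobenius a b) ⟩
      conj (ι a - ι b * θ)                  ≡⟨ cong conj (solve 3 (λ a b θ → a :- b :* θ := a :+ (:- b) :* θ) refl (ι a) (ι b) θ) ⟩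
      conj (ι a + (- ι b) * θ)              ≡⟨ cong (λ y → conj (ι a + y * θ)) (ι-neg b) ⟨
      conj (ι a + ι (F.- b) * θ)            ≡⟨ frobenius a (F.- b) ⟩
      ι a - ι (F.- b) * θ                   ≡⟨ cong (λ y → ι a - y * θ) (ι-neg b) ⟩
      ι a - (- ι b) * θ                     ≡⟨ solve 3 (λ a b θ → a :- (:- b) :* θ := a :+ b :* θ) refl (ι a) (ι b) θ ⟩
      ι a + ι b * θ                         ≡⟨ re-im x ⟩
      x                                     ∎
      where
      open ≡-Reasoning
      a b : F.Carrier
      a = re x
      b = im x

    conj≢0 : ∀ {x} → x ≢ 0# → conj x ≢ 0#
    conj≢0 x≢0 eq = x≢0 (trans (sym (conj-conj _)) (trans (cong conj eq) conj-0))

    0F 1F 2F 3F : Fin 4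
    0F = zero
    1F = suc zero
    2F = suc (suc zero)
    3F = suc (suc (suc zero))

    h-cong : ∀ {x y x′ y′} → x ≋ x′ → y ≋ y′ → h x y ≡ h x′ y′
    h-cong p q = cong₂ _+_ (cong₂ _-_ (cong₂ _-_ (cong₂ _*_ (p 0F) (cong conj (q 3F))) (cong₂ _*_ (p 1F) (cong conj (q 1F))))
      (cong₂ _*_ (p 2F) (cong conj (q 2F)))) (cong₂ _*_ (p 3F) (cong conj (q 0F)))

    h-⊕ : ∀ x y z → h (x ⊕ y) z ≡ h x z + h y z
    h-⊕ x y z = solve 12 (λ a b c d a′ b′ c′ d′ e f g k → ((a :+ a′) :* k :- (b :+ b′) :* f :- (c :+ c′) :* g :+ (d :+ d′) :* e) := (a :* k :- b :* f :- c :* g :+ d :* e) :+ (a′ :* k :- b′ :* f :- c′ :* g :+ d′ :* e)) refl (x 0F) (x 1F) (x 2F) (x 3F) (y 0F) (y 1F) (y 2F) (y 3F) (conj (z 0F)) (conj (z 1F)) (conj (z 2F)) (conj (z 3F))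

    h-∙ : ∀ s x z → h (s ∙ x) z ≡ s * h x z
    h-∙ s x z = solve 9 (λ s a b c d e f g k → ((s :* a) :* k :- (s :* b) :* f :- (s :* c) :* g :+ (s :* d) :* e) := s :* (a :* k :- b :* f :- c :* g :+ d :* e)) refl s (x 0F) (x 1F) (x 2F) (x 3F) (conj (z 0F)) (conj (z 1F)) (conj (z 2F)) (conj (z 3F))

    h-linear : ∀ z → Linear (λ x → h x z)
    h-linear z = record { f-cong = λ {x} {y} p → h-cong {x} {z} {y} {z} p (λ _ → refl) ; f-⊕ = λ x y → h-⊕ x y z ; f-∙ = λ s x → h-∙ s x z }

    conj-h : ∀ x y → conj (h x y) ≡ h y x
    conj-h x y = begin
      conj (a * conj k - b * conj f - c * conj g + d * conj e)
        ≡⟨ trans (conj-+ _ _) (cong (_+ conj (d * conj e)) (trans (conj-minus _ _) (cong (_- conj (c * conj g)) (conj-minus _ _)))) ⟩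
      conj (a * conj k) - conj (b * conj f) - conj (c * conj g) + conj (d * conj e)
        ≡⟨ cong₂ _+_ (cong₂ _-_ (cong₂ _-_ (term a k) (term b f)) (term c g)) (term d e) ⟩
      conj a * k - conj b * f - conj c * g + conj d * e
        ≡⟨ solve 8 (λ a b c d e f g k → a :* k :- b :* f :- c :* g :+ d :* e := e :* d :- f :* b :- g :* c :+ k :* a) refl (conj a) (conj b) (conj c) (conj d) e f g k ⟩
      e * conj d - f * conj b - g * conj c + k * conj a ∎
      where
      open ≡-Reasoning
      a b c d e f g k : Carrier
      a = x 0F
      b = x 1F
      c = x 2F
      d = x 3F
      e = y 0F
      f = y 1F
      g = y 2F
      k = y 3F
      conj-minus : ∀ u v → conj (u - v) ≡ conj u - conj v
      conj-minus u v = trans (conj-+ u (- v)) (cong (conj u +_) (conj-neg v))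
      term : ∀ u v → conj (u * conj v) ≡ conj u * v
      term u v = trans (conj-* u (conj v)) (cong (conj u *_) (conj-conj v))

    h-∙ʳ : ∀ s x z → h x (s ∙ z) ≡ conj s * h x z
    h-∙ʳ s x z = trans (sym (conj-h (s ∙ z) x)) (trans (cong conj (h-∙ s z x))
      (trans (conj-* s (h z x)) (cong (conj s *_) (conj-h z x))))

    h≡0-sym : ∀ {x y} → h x y ≡ 0# → h y x ≡ 0#
    h≡0-sym {x} {y} eq = trans (sym (conj-h x y)) (trans (cong conj eq) conj-0)

    -- Two orthogonal hyperbolic pairs. The second is normalised to θ and not to 1, because then the
    -- form on it is θ (a b̄′ - b ā′), whose components over GF(q) are those of the model: `ω` in
    -- the θ-part, and the mixed terms of ν `det` of a difference in the real part.
    record Frame (P : V 4) : Set where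
      field
        P′ A B : V 4
        PP   : h P P ≡ 0#
        P′P′ : h P′ P′ ≡ 0#
        AA   : h A A ≡ 0#
        BB   : h B B ≡ 0#
        PP′  : h P P′ ≡ 1#
        AB   : h A B ≡ θ
        PA   : h P A ≡ 0#
        PB   : h P B ≡ 0#
        P′A  : h P′ A ≡ 0#
        P′B  : h P′ B ≡ 0#

    -- The scalars are conjugates because `h` is semilinear in its second argument.
    normalise-frame : ∀ P P′ A B → h P P ≡ 0# → h P′ P′ ≡ 0# → h A A ≡ 0# → h B B ≡ 0# → h P P′ ≢ 0# → h A B ≢ 0# →
                      h P A ≡ 0# → h P B ≡ 0# → h P′ A ≡ 0# → h P′ B ≡ 0# → Frame P
    normalise-frame P P′ A B PP P′P′ AA BB PP′ AB PA PB P′A P′B = record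
      { P′ = a ∙ P′ ; A = A ; B = b ∙ B ; PP = PP
      ; P′P′ = trans (h-∙ a P′ (a ∙ P′)) (trans (cong (a *_) (right a P′ P′ P′P′)) (zeroʳ a))
      ; AA = AA
      ; BB = trans (h-∙ b B (b ∙ B)) (trans (cong (b *_) (right b B B BB)) (zeroʳ b))
      ; PP′ = trans (h-∙ʳ a P P′) (trans (cong (_* h P P′) (conj-conj _)) (⁻¹-inverseˡ PP′))
      ; AB = trans (h-∙ʳ b A B) (trans (cong (_* h A B) (conj-conj _)) (/-*-cancel AB))
      ; PA = PA
      ; PB = right b P B PB
      ; P′A = trans (h-∙ a P′ A) (trans (cong (a *_) P′A) (zeroʳ a))
      ; P′B = trans (h-∙ a P′ (b ∙ B)) (trans (cong (a *_) (right b P′ B P′B)) (zeroʳ a)) }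
      where
      a b : Carrier
      a = conj (h P P′ ⁻¹)
      b = conj (θ / h A B)
      right : ∀ s x y → h x y ≡ 0# → h x (s ∙ y) ≡ 0#
      right s x y eq = trans (h-∙ʳ s x y) (trans (cong (conj s *_) eq) (zeroʳ _))

    h-value : ∀ a b c d {e f g k e′ f′ g′ k′} → conj e ≡ e′ → conj f ≡ f′ → conj g ≡ g′ → conj k ≡ k′ →
              h (vec₄ a b c d) (vec₄ e f g k) ≡ a * k′ - b * f′ - c * g′ + d * e′
    h-value a b c d = cong₄ (λ e f g k → a * k - b * f - c * g + d * e)

    -- As μ μ̄ = -1, the vectors (1, μ) and (1, -μ) are isotropic for the middle part -x₁ x̄₁ - x₂
    -- x̄₂ of the form. `A₁` and `B₁` are multiples of them, with a last coordinate that makes them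
    -- orthogonal to P.
    module ExistenceOfFrame (μ : Carrier) (μμ̄ : μ * conj μ ≡ - 1#)
                            (a b c d : Carrier) (nonzero : ¬ (vec₄ a b c d ≋ 0V)) (iso : h (vec₄ a b c d) (vec₄ a b c d) ≡ 0#) where
      ā b̄ c̄ d̄ μ̄ : Carrier
      ā = conj a
      b̄ = conj b
      c̄ = conj c
      d̄ = conj d
      μ̄ = conj μ

      P : V 4
      P = vec₄ a b c d

      conj-sum : ∀ s x y → conj (conj x + s * conj y) ≡ x + conj s * y
      conj-sum s x y = trans (conj-+ _ _) (cong₂ _+_ (conj-conj x) (trans (conj-* _ _) (cong (conj s *_) (conj-conj y))))

      conj-mul : ∀ s x → conj (s * conj x) ≡ conj s * x
      conj-mul s x = trans (conj-* s _) (cong (conj s *_) (conj-conj x))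

      use-μ : ∀ {x} (f : Carrier → Carrier) → x ≡ f (μ * μ̄) → f (- 1#) ≡ 0# → x ≡ 0#
      use-μ f eq eq′ = trans eq (trans (cong f μμ̄) eq′)

      module _ (a≢0 : a ≢ 0#) where
        A₁ B₁ : V 4
        A₁ = vec₄ 0# ā (μ * ā) (b̄ + μ * c̄)
        B₁ = vec₄ 0# ā ((- μ) * ā) (b̄ + (- μ) * c̄)

        h-A₁ : ∀ x y z w → h (vec₄ x y z w) A₁ ≡ x * (b + μ̄ * c) - y * a - z * (μ̄ * a) + w * 0#
        h-A₁ x y z w = h-value x y z w conj-0 (conj-conj a) (conj-mul μ a) (conj-sum μ b c)

        h-B₁ : ∀ x y z w → h (vec₄ x y z w) B₁ ≡ x * (b + (- μ̄) * c) - y * a - z * ((- μ̄) * a) + w * 0#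
        h-B₁ x y z w = h-value x y z w conj-0 (conj-conj a) (trans (conj-mul (- μ) a) (cong (_* a) (conj-neg μ)))
          (trans (conj-sum (- μ) b c) (cong (λ y → b + y * c) (conj-neg μ)))

        frame₁ : Frame P
        frame₁ = normalise-frame P (vec₄ 0# 0# 0# 1#) A₁ B₁ iso
          (solve 2 (λ x y → :0 :* y :- :0 :* x :- :0 :* x :+ :1 :* x := x) refl (conj 0#) (conj 1#) ⟨trans⟩ conj-0)
          (h-A₁ _ _ _ _ ⟨trans⟩ use-μ (λ m → - (ā * a) - m * (ā * a))
            (solve 8 (λ a b c ā b̄ c̄ μ m → :0 :* (b :+ m :* c) :- ā :* a :- μ :* ā :* (m :* a) :+ (b̄ :+ μ :* c̄) :* :0 := :- (ā :* a) :- μ :* m :* (ā :* a)) refl a b c ā b̄ c̄ μ μ̄)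
            (solve 2 (λ a ā → :- (ā :* a) :- (:- :1) :* (ā :* a) := :0) refl a ā))
          (h-B₁ _ _ _ _ ⟨trans⟩ use-μ (λ m → - (ā * a) - m * (ā * a))
            (solve 8 (λ a b c ā b̄ c̄ μ m → :0 :* (b :+ (:- m) :* c) :- ā :* a :- (:- μ) :* ā :* ((:- m) :* a) :+ (b̄ :+ (:- μ) :* c̄) :* :0 := :- (ā :* a) :- μ :* m :* (ā :* a)) refl a b c ā b̄ c̄ μ μ̄)
            (solve 2 (λ a ā → :- (ā :* a) :- (:- :1) :* (ā :* a) := :0) refl a ā))
          (λ eq → a≢0 (trans (trans (solve 4 (λ a b c d → a := a :* :1 :- b :* :0 :- c :* :0 :+ d :* :0) refl a b c d) (sym (h-value a b c d conj-0 conj-0 conj-0 conj-1))) eq))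
          (λ eq → *-nonzero twoK≢0 (*-nonzero (conj≢0 a≢0) a≢0) (-x≡0⇒x≡0 (trans (sym
            (h-B₁ _ _ _ _ ⟨trans⟩ (solve 8 (λ a b c ā b̄ c̄ μ m → :0 :* (b :+ (:- m) :* c) :- ā :* a :- μ :* ā :* ((:- m) :* a) :+ (b̄ :+ μ :* c̄) :* :0 := :- (ā :* a) :+ μ :* m :* (ā :* a)) refl a b c ā b̄ c̄ μ μ̄
               ⟨trans⟩ (cong (λ m → - (ā * a) + m * (ā * a)) μμ̄ ⟨trans⟩ solve 2 (λ a ā → :- (ā :* a) :+ (:- :1) :* (ā :* a) := :- (:2 :* (ā :* a))) refl a ā)))) eq)))
          (h-A₁ a b c d ⟨trans⟩ solve 5 (λ a b c d m → a :* (b :+ m :* c) :- b :* a :- c :* (m :* a) :+ d :* :0 := :0) refl a b c d μ̄)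
          (h-B₁ a b c d ⟨trans⟩ solve 5 (λ a b c d m → a :* (b :+ (:- m) :* c) :- b :* a :- c :* ((:- m) :* a) :+ d :* :0 := :0) refl a b c d μ̄)
          (h-A₁ 0# 0# 0# 1# ⟨trans⟩ solve 4 (λ a b c m → :0 :* (b :+ m :* c) :- :0 :* a :- :0 :* (m :* a) :+ :1 :* :0 := :0) refl a b c μ̄)
          (h-B₁ 0# 0# 0# 1# ⟨trans⟩ solve 4 (λ a b c m → :0 :* (b :+ (:- m) :* c) :- :0 :* a :- :0 :* ((:- m) :* a) :+ :1 :* :0 := :0) refl a b c μ̄)
          where
          infixr 1 _⟨trans⟩_
          _⟨trans⟩_ : ∀ {x y z : Carrier} → x ≡ y → y ≡ z → x ≡ z
          _⟨trans⟩_ = trans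

      -- With a = d = 0 isotropy reads b b̄ + c c̄ = 0. Hence changing the sign of c gives another
      -- isotropic vector, whose product with P is -2 b b̄, and the two outer unit vectors form the
      -- other pair.
      frame₃ : a ≡ 0# → d ≡ 0# → Frame P
      frame₃ a≡0 d≡0 = normalise-frame P (vec₄ 0# b (- c) 0#) (vec₄ 1# 0# 0# 0#) (vec₄ 0# 0# 0# 1#) iso
        (trans (h-value 0# b (- c) 0# conj-0 refl (conj-neg c) conj-0)
          (trans (solve 4 (λ b c b̄ c̄ → :0 :* :0 :- b :* b̄ :- (:- c) :* (:- c̄) :+ :0 :* :0 := :- (b :* b̄ :+ c :* c̄)) refl b c b̄ c̄) (trans (cong -_ norms) (solve 0 (:- :0 := :0) refl ))))
        (trans (h-value 1# 0# 0# 0# conj-1 conj-0 conj-0 conj-0) (solve 0 (:1 :* :0 :- :0 :* :0 :- :0 :* :0 :+ :0 :* :1 := :0) refl ))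
        (trans (h-value 0# 0# 0# 1# conj-0 conj-0 conj-0 conj-1) (solve 0 (:0 :* :1 :- :0 :* :0 :- :0 :* :0 :+ :1 :* :0 := :0) refl ))
        (λ eq → *-nonzero twoK≢0 bb̄≢0 (-x≡0⇒x≡0 (trans (solve 2 (λ b b̄ → :- (:2 :* (b :* b̄)) := :0 :- :2 :* (b :* b̄)) refl b b̄)
          (trans (cong (_- two * (b * b̄)) (sym norms)) (trans (solve 6 (λ a b c d b̄ c̄ → b :* b̄ :+ c :* c̄ :- :2 :* (b :* b̄) := a :* :0 :- b :* b̄ :- c :* (:- c̄) :+ d :* :0) refl a b c d b̄ c̄)
          (trans (sym (h-value a b c d conj-0 refl (conj-neg c) conj-0)) eq))))))
        (λ eq → 1≢0 (trans (solve 0 (:1 := :1 :* :1 :- :0 :* :0 :- :0 :* :0 :+ :0 :* :0) refl ) (trans (sym (h-value 1# 0# 0# 0# conj-0 conj-0 conj-0 conj-1)) eq)))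
        (trans (h-value a b c d conj-1 conj-0 conj-0 conj-0) (trans (solve 4 (λ a b c d → a :* :0 :- b :* :0 :- c :* :0 :+ d :* :1 := d) refl a b c d) d≡0))
        (trans (h-value a b c d conj-0 conj-0 conj-0 conj-1) (trans (solve 4 (λ a b c d → a :* :1 :- b :* :0 :- c :* :0 :+ d :* :0 := a) refl a b c d) a≡0))
        (trans (h-value 0# b (- c) 0# conj-1 conj-0 conj-0 conj-0) (solve 2 (λ b c → :0 :* :0 :- b :* :0 :- (:- c) :* :0 :+ :0 :* :1 := :0) refl b c))
        (trans (h-value 0# b (- c) 0# conj-0 conj-0 conj-0 conj-1) (solve 2 (λ b c → :0 :* :1 :- b :* :0 :- (:- c) :* :0 :+ :0 :* :0 := :0) refl b c))
        where
        norms : b * b̄ + c * c̄ ≡ 0#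
        norms = trans (solve 6 (λ b c b̄ c̄ ā d̄ → b :* b̄ :+ c :* c̄ := :- (:0 :* d̄ :- b :* b̄ :- c :* c̄ :+ :0 :* ā)) refl b c b̄ c̄ ā d̄)
          (trans (cong₂ (λ x y → - (x * d̄ - b * b̄ - c * c̄ + y * ā)) (sym a≡0) (sym d≡0)) (trans (cong -_ iso) (solve 0 (:- :0 := :0) refl )))
        b≢0 : b ≢ 0#
        b≢0 b≡0 = nonzero (all₄ a≡0 b≡0 c≡0 d≡0)
          where
          c≡0 : c ≡ 0#
          c≡0 with c ≟ 0#
          ... | yes c≡0 = c≡0
          ... | no c≢0 = ⊥-elim (*-nonzero c≢0 (conj≢0 c≢0) (trans (solve 2 (λ b̄ x → x := :0 :* b̄ :+ x) refl b̄ (c * c̄))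
                           (trans (cong (λ y → y * b̄ + c * c̄) (sym b≡0)) norms)))
        bb̄≢0 : b * b̄ ≢ 0#
        bb̄≢0 = *-nonzero b≢0 (conj≢0 b≢0)

    reverse : V 4 → V 4
    reverse x = vec₄ (x 3F) (x 1F) (x 2F) (x 0F)

    h-reverse : ∀ x y → h (reverse x) (reverse y) ≡ h x y
    h-reverse x y = solve 8 (λ a b c d e f g k → d :* e :- b :* f :- c :* g :+ a :* k := (a :* k :- b :* f :- c :* g :+ d :* e)) refl (x 0F) (x 1F) (x 2F) (x 3F) (conj (y 0F)) (conj (y 1F)) (conj (y 2F)) (conj (y 3F))

    -- Coordinates 0 and 3 enter `h` symmetrically, so a nonzero last coordinate is as good as a
    -- nonzero first one. Applied twice, it passes between vectors that are only pointwise equal.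
    reverse-frame : ∀ P Q → reverse Q ≋ P → Frame Q → Frame P
    reverse-frame P Q eq fr = record
      { P′ = reverse P′ ; A = reverse A ; B = reverse B
      ; PP = trans (h-cong {P} {P} {reverse Q} {reverse Q} (sym ∘ eq) (sym ∘ eq)) (trans (h-reverse Q Q) PP)
      ; P′P′ = trans (h-reverse P′ P′) P′P′ ; AA = trans (h-reverse A A) AA ; BB = trans (h-reverse B B) BB
      ; PP′ = move P′ PP′ ; AB = trans (h-reverse A B) AB ; PA = move A PA ; PB = move B PB
      ; P′A = trans (h-reverse P′ A) P′A ; P′B = trans (h-reverse P′ B) P′B }
      where
      open Frame fr
      move : ∀ x {v} → h Q x ≡ v → h P (reverse x) ≡ v
      move x e = trans (h-cong {P} {reverse x} {reverse Q} {reverse x} (sym ∘ eq) (λ _ → refl)) (trans (h-reverse Q x) e)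

    frame-exists : SquareRoots.NonSquare F ν → ∀ P → ¬ (P ≋ 0V) → h P P ≡ 0# → Frame P
    frame-exists ν-nonsquare P nonzero iso = cases
      where
      components : ∀ x → vec₄ (x 0F) (x 1F) (x 2F) (x 3F) ≋ x
      components x = all₄ refl refl refl refl
      ab : ∃₂ λ a b → a F.* a F.- ν F.* (b F.* b) ≡ F.- F.1#
      ab = SquareRoots.norm-surjective F ν (λ ν≡0 → ν-nonsquare F.0# (trans (F.zeroˡ _) (sym ν≡0))) (F.- F.1#)
      a b : F.Carrier
      a = proj₁ ab
      b = proj₁ (proj₂ ab)
      μ : Carrier
      μ = ι a + ι b * θ
      μμ̄ : μ * conj μ ≡ - 1#
      μμ̄ = begin
        μ * conj μ                              ≡⟨ cong (μ *_) (frobenius a b) ⟩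
        (ι a + ι b * θ) * (ι a - ι b * θ)       ≡⟨ solve 3 (λ a b θ → (a :+ b :* θ) :* (a :- b :* θ) := a :* a :- θ :* θ :* (b :* b)) refl (ι a) (ι b) θ ⟩
        ι a * ι a - θ * θ * (ι b * ι b)         ≡⟨ cong₂ _-_ (sym (ι-* a a)) (cong₂ _*_ θ² (sym (ι-* b b))) ⟩
        ι (a F.* a) - ι ν * ι (b F.* b)         ≡⟨ cong (λ y → ι (a F.* a) - y) (ι-* ν _) ⟨
        ι (a F.* a) - ι (ν F.* (b F.* b))       ≡⟨ ι-minus _ _ ⟨
        ι (a F.* a F.- ν F.* (b F.* b))         ≡⟨ cong ι (proj₂ (proj₂ ab)) ⟩
        ι (F.- F.1#)                            ≡⟨ trans (ι-neg _) (cong -_ ι-1) ⟩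
        - 1#                                    ∎
        where open ≡-Reasoning
      nz : ¬ (vec₄ (P 0F) (P 1F) (P 2F) (P 3F) ≋ 0V)
      nz eq = nonzero (λ i → trans (sym (components P i)) (eq i))
      nz′ : ¬ (reverse P ≋ 0V)
      nz′ eq = nonzero (all₄ (eq 3F) (eq 1F) (eq 2F) (eq 0F))
      reverse-reverse : reverse (reverse P) ≋ P
      reverse-reverse = components P
      cases : Frame P
      cases with P 0F ≟ 0# | P 3F ≟ 0#
      ... | no  p≢0 | _       = reverse-frame P (reverse P) reverse-reverse (reverse-frame (reverse P) (vec₄ (P 0F) (P 1F) (P 2F) (P 3F)) (λ _ → refl)
          (ExistenceOfFrame.frame₁ μ μμ̄ (P 0F) (P 1F) (P 2F) (P 3F) nz iso p≢0))
      ... | yes p≡0 | yes p′≡0 = reverse-frame P (reverse P) reverse-reverse (reverse-frame (reverse P) (vec₄ (P 0F) (P 1F) (P 2F) (P 3F)) (λ _ → refl)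
          (ExistenceOfFrame.frame₃ μ μμ̄ (P 0F) (P 1F) (P 2F) (P 3F) nz iso p≡0 p′≡0))
      ... | yes _   | no  p≢0 = reverse-frame P (reverse P) reverse-reverse
          (ExistenceOfFrame.frame₁ μ μμ̄ (P 3F) (P 1F) (P 2F) (P 0F) nz′ (trans (h-reverse P P) iso) p≢0)

-- Coordinates for the points not collinear with P

module HermitianScheme where

  open Rings
  open Fields
  open QuadraticExtensions
  open Model
  open ModelScheme
  open LinearSystems
  open HermitianFrames
  open import Data.Fin as Fin using (Fin; zero; suc)
  open import Data.Product using (Σ; _×_; _,_; proj₁; proj₂)
  open import Function using (_∘_)
  open import Relation.Nullary using (¬_)
  open import Relation.Nullary.Decidable using (decidable-stable)
  open import Relation.Binary.PropositionalEquality

  module HermitianCoordinates (F K : FiniteField) (ν : FiniteField.Carrier F) (E : QuadraticExtension F K ν)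
         (ν-nonsquare : SquareRoots.NonSquare F ν) (two≢0 : Arithmetic.two F ≢ FiniteField.0# F)
         (P : Hermitian.HPoint K (FiniteField.order F)) where
    private
      module F where
        open FiniteField F public
        open Arithmetic F public
        open FieldProperties F public
    open FiniteField K
    open Arithmetic K
    open FieldProperties K
    open LinAlg K
    open LinearAlgebra K
    open QuadraticExtension E
    open HomProperties hom
    open Hermitian K F.order
    open Unitary F K ν E two≢0
    open HeisenbergModel F ν ν-nonsquare two≢0 using (det; ω; δ; Flat; flat?; Class; classify; class-unique; δ-diagonal; flat⇒det≡0)
    open Coordinates F ν ν-nonsquare two≢0 using (Coordinatisation; canonical-class; δ≡origin⇒≡)
    open Vertex

    p : V 4
    p = HPoint.vec P

    opaque
      frame : Frame p
      frame = frame-exists ν-nonsquare p (HPoint.nonzero P) (HPoint.iso P)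

    open Frame frame

    hermitian : ∀ x y {v w} → h x y ≡ v → conj v ≡ w → h y x ≡ w
    hermitian x y eq eq′ = trans (sym (conj-h x y)) (trans (cong conj eq) eq′)

    P′P : h P′ p ≡ 1#
    P′P = hermitian p P′ PP′ conj-1
    AP : h A p ≡ 0#
    AP = hermitian p A PA conj-0
    BP : h B p ≡ 0#
    BP = hermitian p B PB conj-0
    AP′ : h A P′ ≡ 0#
    AP′ = hermitian P′ A P′A conj-0
    BP′ : h B P′ ≡ 0#
    BP′ = hermitian P′ B P′B conj-0
    BA : h B A ≡ - θ
    BA = hermitian A B AB conj-θ

    -- The coefficient 1 at `P′` is the normalisation h(x, P) = 1, which selects one vector of each
    -- point not collinear with P.
    comb : Carrier → Carrier → Carrier → V 4
    comb d a b = ((d ∙ p) ⊕ P′) ⊕ ((a ∙ A) ⊕ (b ∙ B))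

    h-comb : ∀ d a b z → h (comb d a b) z ≡ d * h p z + h P′ z + (a * h A z + b * h B z)
    h-comb d a b z = trans (h-⊕ ((d ∙ p) ⊕ P′) ((a ∙ A) ⊕ (b ∙ B)) z) (cong₂ _+_
      (trans (h-⊕ (d ∙ p) P′ z) (cong (_+ h P′ z) (h-∙ d p z)))
      (trans (h-⊕ (a ∙ A) (b ∙ B) z) (cong₂ _+_ (h-∙ a A z) (h-∙ b B z))))

    combine₄ : ∀ d a b {u v w x u′ v′ w′ x′ : Carrier} → u ≡ u′ → v ≡ v′ → w ≡ w′ → x ≡ x′ →
               d * u + v + (a * w + b * x) ≡ d * u′ + v′ + (a * w′ + b * x′)
    combine₄ d a b = cong₄ (λ u v w x → d * u + v + (a * w + b * x))

    h-comb-P : ∀ d a b → h (comb d a b) p ≡ 1#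
    h-comb-P d a b = trans (h-comb d a b p) (trans (combine₄ d a b PP P′P AP BP)
      (solve 3 (λ d a b → d :* :0 :+ :1 :+ (a :* :0 :+ b :* :0) := :1) refl d a b))

    h-comb-P′ : ∀ d a b → h (comb d a b) P′ ≡ d
    h-comb-P′ d a b = trans (h-comb d a b P′) (trans (combine₄ d a b PP′ P′P′ AP′ BP′)
      (solve 3 (λ d a b → d :* :1 :+ :0 :+ (a :* :0 :+ b :* :0) := d) refl d a b))

    h-comb-A : ∀ d a b → h (comb d a b) A ≡ - (b * θ)
    h-comb-A d a b = trans (h-comb d a b A) (trans (combine₄ d a b PA P′A AA BA)
      (solve 4 (λ d a b θ → d :* :0 :+ :0 :+ (a :* :0 :+ b :* (:- θ)) := :- (b :* θ)) refl d a b θ))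

    h-comb-B : ∀ d a b → h (comb d a b) B ≡ a * θ
    h-comb-B d a b = trans (h-comb d a b B) (trans (combine₄ d a b PB P′B AB BB)
      (solve 4 (λ d a b θ → d :* :0 :+ :0 :+ (a :* θ :+ b :* :0) := a :* θ) refl d a b θ))

    h-comb-comb : ∀ d a b d′ a′ b′ → h (comb d a b) (comb d′ a′ b′) ≡ d + conj d′ + (a * (conj b′ * θ) + b * (- (conj a′ * θ)))
    h-comb-comb d a b d′ a′ b′ = trans (h-comb d a b y) (trans (combine₄ d a b
        (hermitian y p (h-comb-P d′ a′ b′) conj-1)
        (hermitian y P′ (h-comb-P′ d′ a′ b′) refl)
        (hermitian y A (h-comb-A d′ a′ b′) (trans (conj-neg _) (trans (cong -_ (trans (conj-* b′ θ) (cong (conj b′ *_) conj-θ)))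
          (solve 2 (λ b θ → :- (b :* (:- θ)) := b :* θ) refl (conj b′) θ))))
        (hermitian y B (h-comb-B d′ a′ b′) (trans (conj-* a′ θ) (trans (cong (conj a′ *_) conj-θ)
          (solve 2 (λ a θ → a :* (:- θ) := :- (a :* θ)) refl (conj a′) θ)))))
      (cong (λ u → u + conj d′ + (a * (conj b′ * θ) + b * (- (conj a′ * θ)))) (*-identityʳ d)))
      where
      y : V 4
      y = comb d′ a′ b′

    infix 5 _⊹_
    _⊹_ : F.Carrier → F.Carrier → Carrier
    a ⊹ b = ι a + ι b * θ

    -- The real part of d is forced by isotropy; its θ-part is the free coordinate `t`.
    dCoef aCoef bCoef : Vertex F.Carrier → Carrier
    dCoef v = ν F.* det v ⊹ t v
    aCoef v = x₁ v ⊹ y₁ v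
    bCoef v = x₂ v ⊹ y₂ v

    vecV : Vertex F.Carrier → V 4
    vecV v = comb (dCoef v) (aCoef v) (bCoef v)

    ι-det : ∀ v → ι (det v) ≡ ι (x₁ v) * ι (y₂ v) - ι (x₂ v) * ι (y₁ v)
    ι-det v = trans (ι-minus _ _) (cong₂ _-_ (ι-* _ _) (ι-* _ _))

    ι-νdet : ∀ v → ι (ν F.* det v) ≡ θ * θ * (ι (x₁ v) * ι (y₂ v) - ι (x₂ v) * ι (y₁ v))
    ι-νdet v = trans (ι-* _ _) (cong₂ _*_ (sym θ²) (ι-det v))

    ι-ω : ∀ v w → ι (ω v w) ≡ ι (x₁ v) * ι (x₂ w) - θ * θ * ι (y₁ v) * ι (y₂ w) - ι (x₂ v) * ι (x₁ w) + θ * θ * ι (y₂ v) * ι (y₁ w)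
    ι-ω v w = trans (ι-+ _ _) (cong₂ _+_ (trans (ι-minus _ _) (cong₂ _-_ (trans (ι-minus _ _) (cong₂ _-_ (ι-* _ _) (three _ _))) (ι-* _ _))) (three _ _))
      where
      three : ∀ a b → ι (ν F.* a F.* b) ≡ θ * θ * ι a * ι b
      three a b = trans (ι-* _ _) (cong (_* ι b) (trans (ι-* _ _) (cong (_* ι a) (sym θ²))))

    -- The product depends only on the Heisenberg quotient. Its components over GF(q) are ν det and
    -- -t, so the cosets 0, GF(q)* and θ GF(q)* are told apart by the vanishing of `det` and `t`.
    h-vecV : ∀ v w → h (vecV v) (vecV w) ≡ ι (ν F.* det (δ v w)) - ι (t (δ v w)) * θ
    h-vecV v w = begin
      h (vecV v) (vecV w)
        ≡⟨ h-comb-comb (dCoef v) (aCoef v) (bCoef v) (dCoef w) (aCoef w) (bCoef w) ⟩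
      dCoef v + conj (dCoef w) + (aCoef v * (conj (bCoef w) * θ) + bCoef v * (- (conj (aCoef w) * θ)))
        ≡⟨ conjugate (frobenius _ _) (frobenius _ _) (frobenius _ _) ⟩
      dCoef v + (ι (ν F.* det w) - ι (t w) * θ) + (aCoef v * ((c′ - d′ * θ) * θ) + bCoef v * (- ((a′ - b′ * θ) * θ)))
        ≡⟨ cong₂ (λ x y → (x + s * θ) + (y - s′ * θ) + (aCoef v * ((c′ - d′ * θ) * θ) + bCoef v * (- ((a′ - b′ * θ) * θ)))) (ι-νdet v) (ι-νdet w) ⟩
      (θ * θ * (a * d - c * b) + s * θ) + (θ * θ * (a′ * d′ - c′ * b′) - s′ * θ) + ((a + b * θ) * ((c′ - d′ * θ) * θ) + (c + d * θ) * (- ((a′ - b′ * θ) * θ)))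
        ≡⟨ solve 11 (λ θ a b c d s a′ b′ c′ d′ s′ → (θ :* θ :* (a :* d :- c :* b) :+ s :* θ) :+ (θ :* θ :* (a′ :* d′ :- c′ :* b′) :- s′ :* θ) :+ ((a :+ b :* θ) :* ((c′ :- d′ :* θ) :* θ) :+ (c :+ d :* θ) :* (:- ((a′ :- b′ :* θ) :* θ))) := θ :* θ :* ((a′ :- a) :* (d′ :- d) :- (c′ :- c) :* (b′ :- b)) :- (s′ :- s :+ (a′ :* c :- θ :* θ :* b′ :* d :- c′ :* a :+ θ :* θ :* d′ :* b)) :* θ) refl θ a b c d s a′ b′ c′ d′ s′ ⟩
      θ * θ * ((a′ - a) * (d′ - d) - (c′ - c) * (b′ - b)) - (s′ - s + (a′ * c - θ * θ * b′ * d - c′ * a + θ * θ * d′ * b)) * θ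
        ≡⟨ cong₂ (λ x y → x - y * θ)
             (trans (ι-νdet (δ v w)) (cong (θ * θ *_) (cong₂ _-_ (cong₂ _*_ (ι-minus _ _) (ι-minus _ _)) (cong₂ _*_ (ι-minus _ _) (ι-minus _ _)))))
             (trans (ι-+ _ _) (cong₂ _+_ (ι-minus _ _) (ι-ω w v))) ⟨
      ι (ν F.* det (δ v w)) - ι (t (δ v w)) * θ ∎
      where
      open ≡-Reasoning
      a b c d s a′ b′ c′ d′ s′ : Carrier
      a = ι (x₁ v)
      b = ι (y₁ v)
      c = ι (x₂ v)
      d = ι (y₂ v)
      s = ι (t v)
      a′ = ι (x₁ w)
      b′ = ι (y₁ w)
      c′ = ι (x₂ w)
      d′ = ι (y₂ w)
      s′ = ι (t w)
      conjugate : ∀ {d d′ a a′ b b′ u x y} → d ≡ d′ → b ≡ b′ → a ≡ a′ → u + d + (x * (b * θ) + y * (- (a * θ))) ≡ u + d′ + (x * (b′ * θ) + y * (- (a′ * θ)))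
      conjugate {u = u} {x} {y} = cong₃ (λ d b a → u + d + (x * (b * θ) + y * (- (a * θ))))

    det-origin : ν F.* (F.0# F.* F.0# F.- F.0# F.* F.0#) ≡ F.0#
    det-origin = trans (cong (ν F.*_) (F.-‿inverseʳ _)) (F.zeroʳ ν)

    vecV-isotropic : ∀ v → h (vecV v) (vecV v) ≡ 0#
    vecV-isotropic v = trans (h-vecV v v) (trans (cong (λ w → ι (ν F.* det w) - ι (t w) * θ) (δ-diagonal v))
      (trans (cong₂ (λ x y → x - y * θ) (trans (cong ι det-origin) ι-0) ι-0) (solve 1 (λ θ → :0 :- :0 :* θ := :0) refl θ)))

    basis : Fin 4 → V 4
    basis = vec₄ p P′ A B

    -- The dual basis: products with the partner in each pair, divided by θ in the second pair, with
    -- a sign since h(B, A) = -θ.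
    functional : Fin 4 → V 4 → Carrier
    functional = vec₄ (λ x → h x P′) (λ x → h x p) (λ x → θ ⁻¹ * h x B) (λ x → (- (θ ⁻¹)) * h x A)

    functional-linear : ∀ j → Linear (functional j)
    functional-linear = all₄ (h-linear P′) (h-linear p) (scaled-linear (θ ⁻¹) (h-linear B)) (scaled-linear (- (θ ⁻¹)) (h-linear A))

    functional-dual : ∀ c j → functional j (lincomb c basis) ≡ c j
    functional-dual c j = trans (Linear.f-lincomb (functional-linear j) c basis) (go j)
      where
      c₀ c₁ c₂ c₃ i : Carrier
      c₀ = c zero
      c₁ = c (suc zero)
      c₂ = c (suc (suc zero))
      c₃ = c (suc (suc (suc zero)))
      i = θ ⁻¹
      sum₄ : ∀ {u v w x u′ v′ w′ x′ : Carrier} → u ≡ u′ → v ≡ v′ → w ≡ w′ → x ≡ x′ →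
             c₀ * u + (c₁ * v + (c₂ * w + (c₃ * x + 0#))) ≡ c₀ * u′ + (c₁ * v′ + (c₂ * w′ + (c₃ * x′ + 0#)))
      sum₄ = cong₄ (λ u v w x → c₀ * u + (c₁ * v + (c₂ * w + (c₃ * x + 0#))))
      scale : ∀ s {u v} → u ≡ v → s * u ≡ s * v
      scale s = cong (s *_)
      go : ∀ j → sumF (λ k → c k * functional j (basis k)) ≡ c j
      go = all₄
        (trans (sum₄ PP′ P′P′ AP′ BP′) (solve 4 (λ a b c d → a :* :1 :+ (b :* :0 :+ (c :* :0 :+ (d :* :0 :+ :0))) := a) refl c₀ c₁ c₂ c₃))
        (trans (sum₄ PP P′P AP BP) (solve 4 (λ a b c d → a :* :0 :+ (b :* :1 :+ (c :* :0 :+ (d :* :0 :+ :0))) := b) refl c₀ c₁ c₂ c₃))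
        (trans (sum₄ (scale i PB) (scale i P′B) (trans (scale i AB) (⁻¹-inverseˡ θ≢0)) (scale i BB))
        (solve 5 (λ a b c d i → a :* (i :* :0) :+ (b :* (i :* :0) :+ (c :* :1 :+ (d :* (i :* :0) :+ :0))) := c) refl c₀ c₁ c₂ c₃ i))
        (trans (sum₄ (scale (- i) PA) (scale (- i) P′A) (scale (- i) AA)
          (trans (scale (- i) BA) (trans (solve 2 (λ i θ → (:- i) :* (:- θ) := i :* θ) refl i θ) (⁻¹-inverseˡ θ≢0))))
        (solve 5 (λ a b c d i → a :* ((:- i) :* :0) :+ (b :* ((:- i) :* :0) :+ (c :* ((:- i) :* :0) :+ (d :* :1 :+ :0))) := d) refl c₀ c₁ c₂ c₃ i))

    opaque
      expansion : ∀ y → h y p ≡ 1# → comb (h y P′) (θ ⁻¹ * h y B) ((- (θ ⁻¹)) * h y A) ≋ y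
      expansion y y-p i = trans
        (solve 7 (λ d a b p q r s → (d :* p :+ q) :+ (a :* r :+ b :* s) := d :* p :+ (:1 :* q :+ (a :* r :+ (b :* s :+ :0)))) refl (h y P′) (θ ⁻¹ * h y B) ((- (θ ⁻¹)) * h y A) (p i) (P′ i) (A i) (B i))
        (trans (cong (λ k → h y P′ * p i + (k * P′ i + (θ ⁻¹ * h y B * A i + ((- (θ ⁻¹)) * h y A * B i + 0#)))) (sym y-p))
        (dual-expansion basis functional functional-linear functional-dual y i))

    ⊹-injective : ∀ {a b a′ b′} → a ⊹ b ≡ a′ ⊹ b′ → a ≡ a′ × b ≡ b′
    ⊹-injective {a} {b} {a′} {b′} eq =
      let u , v = independent (a F.- a′) (b F.- b′)
            (trans (cong₂ (λ x y → x + y * θ) (ι-minus a a′) (ι-minus b b′))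
            (trans (solve 5 (λ a b c d θ → (a :- c) :+ (b :- d) :* θ := (a :+ b :* θ) :- (c :+ d :* θ)) refl (ι a) (ι b) (ι a′) (ι b′) θ) (x≡y⇒x-y≡0 eq)))
      in F.x-y≡0⇒x≡y u , F.x-y≡0⇒x≡y v

    re-⊹ : ∀ a b → re (a ⊹ b) ≡ a
    re-⊹ a b = proj₁ (⊹-injective (re-im (a ⊹ b)))

    im-⊹ : ∀ a b → im (a ⊹ b) ≡ b
    im-⊹ a b = proj₂ (⊹-injective (re-im (a ⊹ b)))

    -- All products are divided by h(x, P), so that proportional vectors receive the same
    -- coordinates.
    coordV : V 4 → Vertex F.Carrier
    coordV x = vertex (re a) (im a) (re b) (im b) (im (h x P′ * κ⁻¹))
      where
      κ⁻¹ a b : Carrier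
      κ⁻¹ = h x p ⁻¹
      a = θ ⁻¹ * (h x B * κ⁻¹)
      b = (- (θ ⁻¹)) * (h x A * κ⁻¹)

    -- The vector x / h(x, p) has the form comb d a b, and isotropy determines the real part of d.
    module _ (x : V 4) (κ≢0 : h x p ≢ 0#) (iso : h x x ≡ 0#) where
      private
        κ κ⁻¹ d a b : Carrier
        κ = h x p
        κ⁻¹ = κ ⁻¹
        d = h x P′ * κ⁻¹
        a = θ ⁻¹ * (h x B * κ⁻¹)
        b = (- (θ ⁻¹)) * (h x A * κ⁻¹)
        v : Vertex F.Carrier
        v = coordV x
        y : V 4
        y = κ⁻¹ ∙ x
        y-at : ∀ z → h y z ≡ h x z * κ⁻¹
        y-at z = trans (h-∙ κ⁻¹ x z) (*-comm _ _)
        y≋ : comb d a b ≋ y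
        y≋ i = trans (comb-cong (sym (y-at P′)) (cong (θ ⁻¹ *_) (sym (y-at B))) (cong ((- (θ ⁻¹)) *_) (sym (y-at A))) i)
          (expansion y (trans (y-at p) (⁻¹-inverseʳ κ≢0)) i)
          where
          comb-cong : ∀ {d a b d′ a′ b′} → d ≡ d′ → a ≡ a′ → b ≡ b′ → comb d a b ≋ comb d′ a′ b′
          comb-cong p q r i = cong₃ (λ d a b → comb d a b i) p q r
        y-isotropic : h (comb d a b) (comb d a b) ≡ 0#
        y-isotropic = trans (h-cong {comb d a b} {comb d a b} {y} {y} y≋ y≋) (trans (h-∙ κ⁻¹ x y)
          (trans (cong (κ⁻¹ *_) (trans (h-∙ʳ κ⁻¹ x x) (trans (cong (conj κ⁻¹ *_) iso) (zeroʳ _)))) (zeroʳ _)))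
        -- The θ-parts cancel in h(x, x), and what remains is twice the difference of the two sides.
        real : ∀ e s a₁ a₂ b₁ b₂ → h (comb (e ⊹ s) (a₁ ⊹ a₂) (b₁ ⊹ b₂)) (comb (e ⊹ s) (a₁ ⊹ a₂) (b₁ ⊹ b₂)) ≡ 0# →
               e ≡ ν F.* (a₁ F.* b₂ F.- b₁ F.* a₂)
        real e s a₁ a₂ b₁ b₂ eq = ι-injective (*-cancelˡ twoK≢0 (trans (x-y≡0⇒x≡y (trans
            (solve 7 (λ θ e s a b c d → :2 :* e :- :2 :* (θ :* θ :* (a :* d :- c :* b)) := (e :+ s :* θ) :+ (e :- s :* θ) :+ ((a :+ b :* θ) :* ((c :- d :* θ) :* θ) :+ (c :+ d :* θ) :* (:- ((a :- b :* θ) :* θ)))) refl θ (ι e) (ι s) (ι a₁) (ι a₂) (ι b₁) (ι b₂))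
            (trans (sym (conjugate (frobenius e s) (frobenius b₁ b₂) (frobenius a₁ a₂)))
            (trans (sym (h-comb-comb (e ⊹ s) (a₁ ⊹ a₂) (b₁ ⊹ b₂) (e ⊹ s) (a₁ ⊹ a₂) (b₁ ⊹ b₂))) eq))))
          (cong (two *_) (sym (ι-νdet (vertex a₁ a₂ b₁ b₂ s))))))
          where
          conjugate : ∀ {d d′ a a′ b b′ u x y} → d ≡ d′ → b ≡ b′ → a ≡ a′ → u + d + (x * (b * θ) + y * (- (a * θ))) ≡ u + d′ + (x * (b′ * θ) + y * (- (a′ * θ)))
          conjugate {u = u} {x} {y} = cong₃ (λ d b a → u + d + (x * (b * θ) + y * (- (a * θ))))
        re-d : re d ≡ ν F.* det v
        re-d = real (re d) (im d) (re a) (im a) (re b) (im b) (subst₂ (λ d a → h (comb d a (re b ⊹ im b)) (comb d a (re b ⊹ im b)) ≡ 0#)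
          (sym (re-im d)) (sym (re-im a)) (subst (λ b → h (comb d a b) (comb d a b) ≡ 0#) (sym (re-im b)) y-isotropic))

      vecV-coordV : vecV (coordV x) ≋ (h x p ⁻¹ ∙ x)
      vecV-coordV i = trans (cong₂ (λ d a → comb d a (bCoef v) i)
          (trans (cong (λ e → ι e + ι (im d) * θ) (sym re-d)) (re-im d)) (re-im a))
        (trans (cong (λ b → comb d a b i) (re-im b)) (y≋ i))

      multiple-of-vecV : x ≋ (h x p ∙ vecV (coordV x))
      multiple-of-vecV i = begin
        x i                                 ≡⟨ *-identityˡ _ ⟨
        1# * x i                            ≡⟨ cong (_* x i) (⁻¹-inverseʳ κ≢0) ⟨
        κ * κ ⁻¹ * x i                      ≡⟨ *-assoc _ _ _ ⟩
        κ * (κ ⁻¹ * x i)                    ≡⟨ cong (κ *_) (vecV-coordV i) ⟨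
        κ * vecV (coordV x) i               ∎
        where open ≡-Reasoning

    coordV-scale : ∀ c x y → c ≢ 0# → h y p ≢ 0# → (∀ i → x i ≡ c * y i) → coordV x ≡ coordV y
    coordV-scale c x y c≢0 κ≢0 eq = vertex-≡ (cong re a≡) (cong im a≡) (cong re b≡) (cong im b≡) (cong im (ratio P′))
      where
      at : ∀ z → h x z ≡ c * h y z
      at z = trans (h-cong {x} {z} {c ∙ y} {z} eq (λ _ → refl)) (h-∙ c y z)
      ratio : ∀ z → h x z * h x p ⁻¹ ≡ h y z * h y p ⁻¹
      ratio z = *-cancelˡ (*-nonzero c≢0 κ≢0) (begin
        c * h y p * (h x z * h x p ⁻¹)     ≡⟨ cong₂ (λ u w → u * (w * h x p ⁻¹)) (sym (at p)) (at z) ⟩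
        h x p * (c * h y z * h x p ⁻¹)     ≡⟨ solve 3 (λ k u i → k :* (u :* i) := k :* i :* u) refl (h x p) (c * h y z) (h x p ⁻¹) ⟩
        h x p * h x p ⁻¹ * (c * h y z)     ≡⟨ cong (_* (c * h y z)) (⁻¹-inverseʳ (λ e → *-nonzero c≢0 κ≢0 (trans (sym (at p)) e))) ⟩
        1# * (c * h y z)                   ≡⟨ cong (_* (c * h y z)) (⁻¹-inverseʳ κ≢0) ⟨
        h y p * h y p ⁻¹ * (c * h y z)     ≡⟨ solve 4 (λ k c u i → k :* i :* (c :* u) := c :* k :* (u :* i)) refl (h y p) c (h y z) (h y p ⁻¹) ⟩
        c * h y p * (h y z * h y p ⁻¹)     ∎)
        where open ≡-Reasoning
      a≡ : θ ⁻¹ * (h x B * h x p ⁻¹) ≡ θ ⁻¹ * (h y B * h y p ⁻¹)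
      a≡ = cong (θ ⁻¹ *_) (ratio B)
      b≡ : (- (θ ⁻¹)) * (h x A * h x p ⁻¹) ≡ (- (θ ⁻¹)) * (h y A * h y p ⁻¹)
      b≡ = cong ((- (θ ⁻¹)) *_) (ratio A)

    coordV-vecV : ∀ v → coordV (vecV v) ≡ v
    coordV-vecV v = vertex-≡ (trans (cong re a≡) (re-⊹ _ _)) (trans (cong im a≡) (im-⊹ _ _))
      (trans (cong re b≡) (re-⊹ _ _)) (trans (cong im b≡) (im-⊹ _ _))
      (trans (cong im (trans (cong₂ _*_ (h-comb-P′ (dCoef v) (aCoef v) (bCoef v)) inv-κ) (*-identityʳ _))) (im-⊹ _ _))
      where
      inv-κ : h (vecV v) p ⁻¹ ≡ 1#
      inv-κ = trans (cong _⁻¹ (h-comb-P (dCoef v) (aCoef v) (bCoef v))) (trans (sym (*-identityˡ _)) (⁻¹-inverseʳ 1≢0))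
      a≡ : θ ⁻¹ * (h (vecV v) B * h (vecV v) p ⁻¹) ≡ aCoef v
      a≡ = trans (cong₂ (λ x y → θ ⁻¹ * (x * y)) (h-comb-B (dCoef v) (aCoef v) (bCoef v)) inv-κ)
        (trans (solve 3 (λ i a θ → i :* (a :* θ :* :1) := i :* θ :* a) refl (θ ⁻¹) (aCoef v) θ) (trans (cong (_* aCoef v) (⁻¹-inverseˡ θ≢0)) (*-identityˡ _)))
      b≡ : (- (θ ⁻¹)) * (h (vecV v) A * h (vecV v) p ⁻¹) ≡ bCoef v
      b≡ = trans (cong₂ (λ x y → (- (θ ⁻¹)) * (x * y)) (h-comb-A (dCoef v) (aCoef v) (bCoef v)) inv-κ)
        (trans (solve 3 (λ i b θ → (:- i) :* ((:- (b :* θ)) :* :1) := i :* θ :* b) refl (θ ⁻¹) (bCoef v) θ) (trans (cong (_* bCoef v) (⁻¹-inverseˡ θ≢0)) (*-identityˡ _)))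

    Vtx : Set
    Vtx = Σ HPoint λ Q → h p (HPoint.vec Q) ≢ 0#

    q : Vtx → V 4
    q (Q , _) = HPoint.vec Q

    κ≢0 : ∀ Q → h (q Q) p ≢ 0#
    κ≢0 (Q , pq≢0) eq = pq≢0 (h≡0-sym {HPoint.vec Q} {p} eq)

    coord : Vtx → Vertex F.Carrier
    coord Q = coordV (q Q)

    h-P-vecV : ∀ v → h p (vecV v) ≡ 1#
    h-P-vecV v = hermitian (vecV v) p (h-comb-P (dCoef v) (aCoef v) (bCoef v)) conj-1

    point : Vertex F.Carrier → Vtx
    point v = record
      { vec = vecV v
      ; nonzero = λ eq → 1≢0 (trans (sym (h-comb-P (dCoef v) (aCoef v) (bCoef v))) (Linear.f-0 (h-linear p) {vecV v} eq))
      ; iso = vecV-isotropic v } , λ eq → 1≢0 (trans (sym (h-P-vecV v)) eq)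

    rep : ∀ Q → q Q ≋ (h (q Q) p ∙ vecV (coord Q))
    rep Q = multiple-of-vecV (q Q) (κ≢0 Q) (HPoint.iso (proj₁ Q))

    same-refl : ∀ Q → SamePoint Q Q
    same-refl Q = 1# , λ i → sym (*-identityˡ _)

    factor≢0 : ∀ Q c (x : V 4) → (∀ i → HPoint.vec Q i ≡ c * x i) → c ≢ 0#
    factor≢0 Q c x eq c≡0 = HPoint.nonzero Q (λ i → trans (eq i) (trans (cong (_* x i) c≡0) (zeroˡ _)))

    same-sym : ∀ Q R → SamePoint Q R → SamePoint R Q
    same-sym Q R (c , eq) = c ⁻¹ , λ i → *-cancelˡ c≢0 (trans (sym (eq i)) (trans (sym (*-identityˡ _))
      (trans (cong (_* HPoint.vec Q i) (sym (⁻¹-inverseʳ c≢0))) (*-assoc _ _ _))))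
      where
      c≢0 : c ≢ 0#
      c≢0 = factor≢0 Q c (HPoint.vec R) eq

    same-trans : ∀ Q R S → SamePoint Q R → SamePoint R S → SamePoint Q S
    same-trans Q R S (c , eq) (d , eq′) = c * d , λ i → trans (eq i) (trans (cong (c *_) (eq′ i)) (sym (*-assoc c d _)))

    coord-cong : ∀ Q R → SamePoint (proj₁ Q) (proj₁ R) → coord Q ≡ coord R
    coord-cong Q R (c , eq) = coordV-scale c (q Q) (q R) (factor≢0 (proj₁ Q) c (q R) eq) (κ≢0 R) eq

    point-coord : ∀ Q → SamePoint (proj₁ (point (coord Q))) (proj₁ Q)
    point-coord Q = h (q Q) p ⁻¹ , vecV-coordV (q Q) (κ≢0 Q) (HPoint.iso (proj₁ Q))

    same-coord : ∀ Q R → coord Q ≡ coord R → SamePoint (proj₁ Q) (proj₁ R)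
    same-coord Q R eq = same-trans (proj₁ Q) (proj₁ (point (coord R))) (proj₁ R)
      (subst (λ v → SamePoint (proj₁ Q) (proj₁ (point v))) eq (same-sym (proj₁ (point (coord Q))) (proj₁ Q) (point-coord Q))) (point-coord R)

    module Pair (Q R : Vtx) where
      v w d : Vertex F.Carrier
      v = coord Q
      w = coord R
      d = δ v w
      κ l n h₀ z : Carrier
      κ = h (q Q) p
      l = h (q R) p
      n = conj κ * κ * (conj l * l)
      h₀ = ι (ν F.* det d) - ι (t d) * θ
      z = zrep P (proj₁ Q) (proj₁ R)

      n≢0 : n ≢ 0#
      n≢0 = *-nonzero (*-nonzero (conj≢0 (κ≢0 Q)) (κ≢0 Q)) (*-nonzero (conj≢0 (κ≢0 R)) (κ≢0 R))

      conj-n : conj n ≡ n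
      conj-n = trans (conj-* _ _) (cong₂ _*_ (self κ) (self l))
        where
        self : ∀ x → conj (conj x * x) ≡ conj x * x
        self x = trans (conj-* _ x) (trans (cong (_* conj x) (conj-conj x)) (*-comm _ _))

      -- The factor `n` is a product of two norms, hence a nonzero element of GF(q). It affects
      -- neither the vanishing of z nor the conditions z^q = z and z^q = -z.
      z≡ : z ≡ n * h₀
      z≡ = trans (cong₂ (λ a b → a * b * l) (sym (conj-h (q Q) p)) (begin
          h (q Q) (q R)                          ≡⟨ h-cong {q Q} {q R} {κ ∙ vecV v} {l ∙ vecV w} (rep Q) (rep R) ⟩
          h (κ ∙ vecV v) (l ∙ vecV w)            ≡⟨ h-∙ κ (vecV v) (l ∙ vecV w) ⟩
          κ * h (vecV v) (l ∙ vecV w)            ≡⟨ cong (κ *_) (trans (h-∙ʳ l (vecV v) (vecV w)) (cong (conj l *_) (h-vecV v w))) ⟩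
          κ * (conj l * h₀)                      ∎))
        (solve 5 (λ k k′ l l′ h → k′ :* (k :* (l′ :* h)) :* l := k′ :* k :* (l′ :* l) :* h) refl κ (conj κ) l (conj l) h₀)
        where open ≡-Reasoning

      conj-h₀ : conj h₀ ≡ ι (ν F.* det d) + ι (t d) * θ
      conj-h₀ = trans (conj-+ _ _) (cong₂ _+_ (conj-ι _) (trans (conj-neg _) (trans (cong -_ (trans (conj-* _ _) (cong₂ _*_ (conj-ι _) conj-θ)))
        (solve 2 (λ s θ → :- (s :* (:- θ)) := s :* θ) refl (ι (t d)) θ))))

      conj-z : conj z ≡ n * conj h₀
      conj-z = trans (cong conj z≡) (trans (conj-* n h₀) (cong (_* conj h₀) conj-n))

      ν≢0 : ν ≢ F.0#
      ν≢0 ν≡0 = ν-nonsquare F.0# (trans (F.zeroˡ _) (sym ν≡0))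

      ι-νdet≡0 : ι (ν F.* det d) ≡ 0# → det d ≡ F.0#
      ι-νdet≡0 eq = F.zero-product (ι≡0 eq) ν≢0

      det≡0⇒ : det d ≡ F.0# → ι (ν F.* det d) ≡ 0#
      det≡0⇒ eq = trans (cong ι (trans (cong (ν F.*_) eq) (F.zeroʳ ν))) ι-0

      t≡0⇒ : t d ≡ F.0# → ι (t d) ≡ 0#
      t≡0⇒ eq = trans (cong ι eq) ι-0

      det-t⇒z≡0 : det d ≡ F.0# → t d ≡ F.0# → z ≡ 0#
      det-t⇒z≡0 e e′ = trans z≡ (trans (cong₂ (λ a b → n * (a - b * θ)) (det≡0⇒ e) (t≡0⇒ e′)) (solve 2 (λ n θ → n :* (:0 :- :0 :* θ) := :0) refl n θ))

      z≡0⇒det-t : z ≡ 0# → det d ≡ F.0# × t d ≡ F.0#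
      z≡0⇒det-t e = let a , b = independent (ν F.* det d) (F.- t d) (trans (cong (λ y → ι (ν F.* det d) + y * θ) (ι-neg (t d)))
                          (trans (solve 3 (λ a b θ → a :+ (:- b) :* θ := a :- b :* θ) refl (ι (ν F.* det d)) (ι (t d)) θ) (zero-product (trans (sym z≡) e) n≢0)))
                    in F.zero-product a ν≢0 , F.-x≡0⇒x≡0 b

      t≡0⇒conj : t d ≡ F.0# → conj z ≡ z
      t≡0⇒conj e = trans conj-z (trans (cong (n *_) (trans conj-h₀ (trans (cong (λ y → ι (ν F.* det d) + y * θ) (t≡0⇒ e))
        (trans (solve 2 (λ a θ → a :+ :0 :* θ := a :- :0 :* θ) refl (ι (ν F.* det d)) θ) (cong (λ y → ι (ν F.* det d) - y * θ) (sym (t≡0⇒ e))))))) (sym z≡))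

      conj⇒t≡0 : conj z ≡ z → t d ≡ F.0#
      conj⇒t≡0 e = ι≡0 (zero-product (trans (*-comm θ _) (zero-product (trans
        (solve 3 (λ a b θ → :2 :* (b :* θ) := (a :+ b :* θ) :- (a :- b :* θ)) refl (ι (ν F.* det d)) (ι (t d)) θ)
        (x≡y⇒x-y≡0 (trans (sym conj-h₀) (*-cancelˡ n≢0 (trans (sym conj-z) (trans e z≡)))))) twoK≢0)) θ≢0)

      det≡0⇒conj : det d ≡ F.0# → conj z ≡ - z
      det≡0⇒conj e = trans conj-z (trans (cong (n *_) (trans conj-h₀ (cong (_+ ι (t d) * θ) (det≡0⇒ e))))
        (trans (solve 3 (λ n b θ → n :* (:0 :+ b :* θ) := :- (n :* (:0 :- b :* θ))) refl n (ι (t d)) θ)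
          (cong -_ (trans (cong (λ y → n * (y - ι (t d) * θ)) (sym (det≡0⇒ e))) (sym z≡)))))

      conj⇒det≡0 : conj z ≡ - z → det d ≡ F.0#
      conj⇒det≡0 e = ι-νdet≡0 (zero-product (trans
        (solve 3 (λ a b θ → :2 :* a := (a :+ b :* θ) :- (:- (a :- b :* θ))) refl (ι (ν F.* det d)) (ι (t d)) θ)
        (x≡y⇒x-y≡0 (trans (sym conj-h₀) (*-cancelˡ n≢0 (trans (sym conj-z) (trans e (trans (cong -_ z≡) (solve 2 (λ n h → :- (n :* h) := n :* (:- h)) refl n h₀)))))))) twoK≢0)

      three : Fin 3 → V 4
      three = fam3 p (q Q) (q R)

      functional-three : ∀ z c → lincomb c three ≋ 0V →
        c zero * h p z + (c (suc zero) * (κ * h (vecV v) z) + (c (suc (suc zero)) * (l * h (vecV w) z))) ≡ 0#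
      functional-three z c eq = trans (sum₃ (c zero) (c (suc zero)) (c (suc (suc zero)))
          (trans (h-cong {q Q} {z} {κ ∙ vecV v} {z} (rep Q) (λ _ → refl)) (h-∙ κ (vecV v) z))
          (trans (h-cong {q R} {z} {l ∙ vecV w} {z} (rep R) (λ _ → refl)) (h-∙ l (vecV w) z)))
        (trans (sym (f-lincomb c three)) (f-0 {lincomb c three} eq))
        where
        open Linear (h-linear z)
        sum₃ : ∀ a b c {x y x′ y′} → x ≡ x′ → y ≡ y′ → a * h p z + (b * x′ + c * y′) ≡ a * h p z + (b * x + (c * y + 0#))
        sum₃ a b c {x′ = x′} {y′} eq₁ eq₂ = trans (solve 3 (λ u v w → u :+ (v :+ w) := u :+ (v :+ (w :+ :0))) refl (a * h p z) (b * x′) (c * y′))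
          (cong₂ (λ x y → a * h p z + (b * x + (c * y + 0#))) (sym eq₁) (sym eq₂))

      -- Pairing a relation with P gives b κ + e l = 0. Pairing with A and B then leaves e l times
      -- the differences of the coordinates, so e = 0 unless the rows agree; b = 0 follows, and P′
      -- gives a = 0.
      independent₃ : ¬ Flat d → LinIndep three
      independent₃ ¬flat c eq = all₃ a≡0 b≡0 e≡0
        where
        a b e : Carrier
        a = c zero
        b = c (suc zero)
        e = c (suc (suc zero))
        values : ∀ {x y z x′ y′ z′} → x ≡ x′ → y ≡ y′ → z ≡ z′ → a * x + (b * (κ * y) + e * (l * z)) ≡ a * x′ + (b * (κ * y′) + e * (l * z′))
        values = cong₃ (λ x y z → a * x + (b * (κ * y) + e * (l * z)))
        at-p : b * κ + e * l ≡ 0#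
        at-p = trans (solve 5 (λ a b e k l → b :* k :+ e :* l := a :* :0 :+ (b :* (k :* :1) :+ e :* (l :* :1))) refl a b e κ l)
          (trans (sym (values PP (h-comb-P (dCoef v) (aCoef v) (bCoef v)) (h-comb-P (dCoef w) (aCoef w) (bCoef w)))) (functional-three p c eq))
        eliminate : ∀ x y → b * (κ * x) + e * (l * y) ≡ 0# → e * l * (y - x) ≡ 0#
        eliminate x y eq = trans (solve 6 (λ b e k l x y → e :* l :* (y :- x) := (b :* (k :* x) :+ e :* (l :* y)) :- (b :* k :+ e :* l) :* x) refl b e κ l x y)
          (trans (cong₂ (λ u w → u - w * x) eq at-p) (solve 1 (λ x → :0 :- :0 :* x := :0) refl x))
        at-B : e * l * (aCoef w * θ - aCoef v * θ) ≡ 0#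
        at-B = eliminate _ _ (trans (solve 2 (λ a u → u := a :* :0 :+ u) refl a (b * (κ * (aCoef v * θ)) + e * (l * (aCoef w * θ))))
          (trans (sym (values PB (h-comb-B (dCoef v) (aCoef v) (bCoef v)) (h-comb-B (dCoef w) (aCoef w) (bCoef w)))) (functional-three B c eq)))
        at-A : e * l * (- (bCoef w * θ) - (- (bCoef v * θ))) ≡ 0#
        at-A = eliminate _ _ (trans (solve 2 (λ a u → u := a :* :0 :+ u) refl a (b * (κ * (- (bCoef v * θ))) + e * (l * (- (bCoef w * θ)))))
          (trans (sym (values PA (h-comb-A (dCoef v) (aCoef v) (bCoef v)) (h-comb-A (dCoef w) (aCoef w) (bCoef w)))) (functional-three A c eq)))
        flat : e * l ≢ 0# → Flat d
        flat el≢0 =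
          let a≡ = *-cancelˡ θ≢0 (trans (*-comm θ _) (trans (x-y≡0⇒x≡y (zero-product at-B el≢0)) (*-comm _ θ)))
              b≡ = *-cancelˡ θ≢0 (trans (*-comm θ _) (trans (sym (x-y≡0⇒x≡y (zero-product (trans (cong (e * l *_) (solve 2 (λ x y → y :- x := :- x :- (:- y)) refl (bCoef w * θ) (bCoef v * θ))) at-A) el≢0))) (*-comm _ θ)))
              p₁ , p₂ = ⊹-injective a≡
              p₃ , p₄ = ⊹-injective b≡
          in F.x≡y⇒x-y≡0 p₁ , F.x≡y⇒x-y≡0 p₂ , F.x≡y⇒x-y≡0 p₃ , F.x≡y⇒x-y≡0 p₄
        e≡0 : e ≡ 0#
        e≡0 = decidable-stable (e ≟ 0#) (λ e≢0 → ¬flat (flat (*-nonzero e≢0 (κ≢0 R))))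
        b≡0 : b ≡ 0#
        b≡0 = zero-product (trans (solve 3 (λ b k l → k :* b := b :* k :+ :0 :* l) refl b κ l) (trans (cong (λ y → b * κ + y * l) (sym e≡0)) at-p)) (κ≢0 Q)
        a≡0 : a ≡ 0#
        a≡0 = trans (solve 3 (λ a u y → a := a :* :1 :+ (:0 :* u :+ :0 :* y)) refl a (κ * h (vecV v) P′) (l * h (vecV w) P′))
          (trans (cong₂ (λ x y → a * x + y) (sym PP′) (cong₂ (λ x y → x * (κ * h (vecV v) P′) + y * (l * h (vecV w) P′)) (sym b≡0) (sym e≡0)))
            (functional-three P′ c eq))
      line⇒flat : OnCommonLine P (proj₁ Q) (proj₁ R) → Flat d
      line⇒flat line = decidable-stable (flat? d) λ ¬flat →
        2≢3 (Dim-unique {P = InSpan three} line (three , member , independent₃ ¬flat , λ x x∈ → x∈))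
        where
        open import Data.Nat using (ℕ)
        2≢3 : ¬ (2 ≡ 3)
        2≢3 ()
        member : ∀ j → InSpan three (three j)
        member = all₃
          (vec₃ 1# 0# 0# , λ i → solve 3 (λ x y z → :1 :* x :+ (:0 :* y :+ (:0 :* z :+ :0)) := x) refl (p i) (q Q i) (q R i))
          (vec₃ 0# 1# 0# , λ i → solve 3 (λ x y z → :0 :* x :+ (:1 :* y :+ (:0 :* z :+ :0)) := y) refl (p i) (q Q i) (q R i))
          (vec₃ 0# 0# 1# , λ i → solve 3 (λ x y z → :0 :* x :+ (:0 :* y :+ (:1 :* z :+ :0)) := z) refl (p i) (q Q i) (q R i))

      -- If the rows agree, the normalised vectors of the two points differ by a multiple of P.
      flat⇒line : Flat d → OnCommonLine P (proj₁ Q) (proj₁ R)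
      flat⇒line (f₁ , f₂ , f₃ , f₄) = two-vectors , member , indep , spans
        where
        two-vectors : Fin 2 → V 4
        two-vectors = fam2 p (q Q)
        member : ∀ j → InSpan three (two-vectors j)
        member = all₂
          (vec₃ 1# 0# 0# , λ i → solve 3 (λ x y z → :1 :* x :+ (:0 :* y :+ (:0 :* z :+ :0)) := x) refl (p i) (q Q i) (q R i))
          (vec₃ 0# 1# 0# , λ i → solve 3 (λ x y z → :0 :* x :+ (:1 :* y :+ (:0 :* z :+ :0)) := y) refl (p i) (q Q i) (q R i))
        indep : LinIndep two-vectors
        indep c eq = all₂ a≡0 b≡0
          where
          a b : Carrier
          a = c zero
          b = c (suc zero)
          at : ∀ z → a * h p z + (b * h (q Q) z + 0#) ≡ 0#
          at z = trans (sym (f-lincomb c two-vectors)) (f-0 {lincomb c two-vectors} eq)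
            where open Linear (h-linear z)
          b≡0 : b ≡ 0#
          b≡0 = zero-product (trans (solve 3 (λ a b k → k :* b := a :* :0 :+ (b :* k :+ :0)) refl a b κ)
            (trans (cong (λ y → a * y + (b * κ + 0#)) (sym PP)) (at p))) (κ≢0 Q)
          a≡0 : a ≡ 0#
          a≡0 = trans (solve 2 (λ a u → a := a :* :1 :+ (:0 :* u :+ :0)) refl a (h (q Q) P′))
            (trans (cong₂ (λ x y → a * x + (y * h (q Q) P′ + 0#)) (sym PP′) (sym b≡0)) (at P′))
        ε : Carrier
        ε = dCoef w - dCoef v
        shift : ∀ i → vecV w i ≡ ε * p i + vecV v i
        shift i = trans (cong₂ (λ a b → comb (dCoef w) a b i) (cong₂ _⊹_ (F.x-y≡0⇒x≡y f₁) (F.x-y≡0⇒x≡y f₂)) (cong₂ _⊹_ (F.x-y≡0⇒x≡y f₃) (F.x-y≡0⇒x≡y f₄)))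
          (solve 5 (λ d′ d p y u → (d′ :* p :+ y) :+ u := (d′ :- d) :* p :+ ((d :* p :+ y) :+ u)) refl (dCoef w) (dCoef v) (p i) (P′ i) ((aCoef v ∙ A) i + (bCoef v ∙ B) i))
        r≡ : ∀ i → q R i ≡ l * ε * p i + l * κ ⁻¹ * q Q i
        r≡ i = trans (rep R i) (trans (cong (l *_) (trans (shift i) (cong (ε * p i +_) (vecV-coordV (q Q) (κ≢0 Q) (HPoint.iso (proj₁ Q)) i))))
          (solve 5 (λ l e p k y → l :* (e :* p :+ k :* y) := l :* e :* p :+ l :* k :* y) refl l ε (p i) (κ ⁻¹) (q Q i)))
        spans : ∀ x → InSpan three x → InSpan two-vectors x
        spans x (c , eq) = vec₂ (c zero + c (suc (suc zero)) * (l * ε)) (c (suc zero) + c (suc (suc zero)) * (l * κ ⁻¹)) ,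
          λ i → trans (solve 7 (λ a b e m k p y → (a :+ e :* m) :* p :+ ((b :+ e :* k) :* y :+ :0) := a :* p :+ (b :* y :+ (e :* (m :* p :+ k :* y) :+ :0))) refl (c zero) (c (suc zero)) (c (suc (suc zero))) (l * ε) (l * κ ⁻¹) (p i) (q Q i))
            (trans (cong (λ y → c zero * p i + (c (suc zero) * q Q i + (c (suc (suc zero)) * y + 0#))) (sym (r≡ i))) (eq i))

      same⇒class₀ : SamePoint (proj₁ Q) (proj₁ R) → Flat d × t d ≡ F.0#
      same⇒class₀ same = subst (Class zero) (trans (sym (δ-diagonal v)) (cong (δ v) (coord-cong Q R same))) (canonical-class zero)

      class₀⇒same : Flat d → t d ≡ F.0# → SamePoint (proj₁ Q) (proj₁ R)
      class₀⇒same f e = same-coord Q R (δ≡origin⇒≡ v w f e)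

    open Scheme (XP P) using (R)

    class⇒relation : ∀ i Q R′ → Class i (δ (coord Q) (coord R′)) → R i Q R′
    class⇒relation zero                               Q R′ (f , e) = Pair.class₀⇒same Q R′ f e
    class⇒relation (suc zero)                         Q R′ (nf , r , e) = nf ∘ proj₁ ∘ same⇒class₀ , det-t⇒z≡0 r e
      where open Pair Q R′
    class⇒relation (suc (suc zero))                   Q R′ (f , e) = e ∘ proj₂ ∘ same⇒class₀ , flat⇒line f
      where open Pair Q R′
    class⇒relation (suc (suc (suc zero)))             Q R′ (nf , r , e) =
      nf ∘ proj₁ ∘ same⇒class₀ , nf ∘ line⇒flat , e ∘ proj₂ ∘ z≡0⇒det-t , det≡0⇒conj r
      where open Pair Q R′
    class⇒relation (suc (suc (suc (suc zero))))       Q R′ (r , e) =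
      e ∘ proj₂ ∘ same⇒class₀ , e ∘ proj₂ ∘ z≡0⇒det-t , e ∘ conj⇒t≡0 , r ∘ conj⇒det≡0
      where open Pair Q R′
    class⇒relation (suc (suc (suc (suc (suc zero))))) Q R′ (r , e) =
      (λ same → r (flat⇒det≡0 {δ (coord Q) (coord R′)} (proj₁ (same⇒class₀ same)))) , r ∘ proj₁ ∘ z≡0⇒det-t , t≡0⇒conj e
      where open Pair Q R′

    relation⇒class : ∀ i Q R′ → R i Q R′ → Class i (δ (coord Q) (coord R′))
    relation⇒class zero                               Q R′ same = Pair.same⇒class₀ Q R′ same
    relation⇒class (suc zero)                         Q R′ (ns , z≡0) = let r , e = z≡0⇒det-t z≡0 in (λ f → ns (class₀⇒same f e)) , r , e
      where open Pair Q R′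
    relation⇒class (suc (suc zero))                   Q R′ (ns , line) = let f = line⇒flat line in f , λ e → ns (class₀⇒same f e)
      where open Pair Q R′
    -- Points on a line with P also have z in θ GF(q)*; the clause `nl` is what excludes them.
    relation⇒class (suc (suc (suc zero)))             Q R′ (ns , nl , z≢0 , c) = nl ∘ flat⇒line , conj⇒det≡0 c , λ e → z≢0 (det-t⇒z≡0 (conj⇒det≡0 c) e)
      where open Pair Q R′
    relation⇒class (suc (suc (suc (suc zero))))       Q R′ (ns , z≢0 , c , c′) = c′ ∘ det≡0⇒conj , c ∘ t≡0⇒conj
      where open Pair Q R′
    relation⇒class (suc (suc (suc (suc (suc zero))))) Q R′ (ns , z≢0 , c) = (λ r → z≢0 (det-t⇒z≡0 r (conj⇒t≡0 c))) , conj⇒t≡0 c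
      where open Pair Q R′

    coordinatisation : Coordinatisation (XP P)
    coordinatisation = record
      { ≈-refl = λ Q → same-refl (proj₁ Q)
      ; ≈-sym = λ Q R → same-sym (proj₁ Q) (proj₁ R)
      ; ≈-trans = λ Q R S → same-trans (proj₁ Q) (proj₁ R) (proj₁ S)
      ; coord = coord ; point = point
      ; coord-cong = coord-cong ; point-coord = point-coord ; coord-point = coordV-vecV
      ; class⇒relation = class⇒relation ; relation⇒class = relation⇒class }

-- The quadratic form in hyperbolic coordinates

module QuadraticForms where

  open Rings
  open Fields
  open QuadraticExtensions
  open LinearSystems
  open import Data.Fin as Fin using (Fin; zero; suc)
  open import Data.Product using (_×_; _,_)
  open import Relation.Binary.PropositionalEquality

  module Form (F : FiniteField) (a : Fin 6 → Fin 6 → FiniteField.Carrier F) where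
    open FiniteField F
    open Arithmetic F
    open FieldProperties F
    open LinAlg F
    open LinearAlgebra F
    open Quadric F a

    private
      -- The bilinear form of the given matrix, which need not be symmetric: Q(x) = G(x, x) and B(x,
      -- y) = G(x, y) + G(y, x).
      G : V 6 → V 6 → Carrier
      G x y = sumF (λ i → sumF (λ j → a i j * x i * y j))

      G-⊕ˡ : ∀ x y z → G (x ⊕ y) z ≡ G x z + G y z
      G-⊕ˡ x y z = trans (sumF-cong (λ i → trans (sumF-cong (λ j →
          solve 4 (λ a x y z → a :* (x :+ y) :* z := a :* x :* z :+ a :* y :* z) refl (a i j) (x i) (y i) (z j)))
          (sumF-+ (λ j → a i j * x i * z j) (λ j → a i j * y i * z j))))
        (sumF-+ (λ i → sumF (λ j → a i j * x i * z j)) (λ i → sumF (λ j → a i j * y i * z j)))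

      G-⊕ʳ : ∀ x y z → G z (x ⊕ y) ≡ G z x + G z y
      G-⊕ʳ x y z = trans (sumF-cong (λ i → trans (sumF-cong (λ j → distribˡ (a i j * z i) (x j) (y j)))
          (sumF-+ (λ j → a i j * z i * x j) (λ j → a i j * z i * y j))))
        (sumF-+ (λ i → sumF (λ j → a i j * z i * x j)) (λ i → sumF (λ j → a i j * z i * y j)))

      G-∙ˡ : ∀ c x z → G (c ∙ x) z ≡ c * G x z
      G-∙ˡ c x z = trans (sumF-cong (λ i → trans (sumF-cong (λ j →
          solve 4 (λ a c x z → a :* (c :* x) :* z := c :* (a :* x :* z)) refl (a i j) c (x i) (z j))) (sumF-* c (λ j → a i j * x i * z j))))
        (sumF-* c (λ i → sumF (λ j → a i j * x i * z j)))

      G-∙ʳ : ∀ c x z → G z (c ∙ x) ≡ c * G z x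
      G-∙ʳ c x z = trans (sumF-cong (λ i → trans (sumF-cong (λ j →
          solve 4 (λ a c x z → a :* z :* (c :* x) := c :* (a :* z :* x)) refl (a i j) c (x j) (z i))) (sumF-* c (λ j → a i j * z i * x j))))
        (sumF-* c (λ i → sumF (λ j → a i j * z i * x j)))

      G-cong : ∀ {x y x′ y′} → x ≋ x′ → y ≋ y′ → G x y ≡ G x′ y′
      G-cong p q = sumF-cong (λ i → sumF-cong (λ j → cong₂ (λ u v → a i j * u * v) (p i) (q j)))

    -- Opaque copies of `Qf` and `Bf`, so that goals show these names and not double sums over six
    -- coordinates.
    opaque
      Q : V 6 → Carrier
      Q = Qf

      B : V 6 → V 6 → Carrier
      B = Bf

      Q≡Qf : ∀ x → Q x ≡ Qf x
      Q≡Qf x = refl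

      B≡Bf : ∀ x y → B x y ≡ Bf x y
      B≡Bf x y = refl

      private
        B≡G : ∀ x y → B x y ≡ G x y + G y x
        B≡G x y = trans (cong (λ u → u - G x x - G y y) (trans (G-⊕ˡ x y (x ⊕ y)) (cong₂ _+_ (G-⊕ʳ x y x) (G-⊕ʳ x y y))))
          (solve 4 (λ p q r s → (p :+ q) :+ (r :+ s) :- p :- s := q :+ r) refl (G x x) (G x y) (G y x) (G y y))

      B-sym : ∀ x y → B x y ≡ B y x
      B-sym x y = trans (B≡G x y) (trans (+-comm _ _) (sym (B≡G y x)))

      B-cong : ∀ {x y x′ y′} → x ≋ x′ → y ≋ y′ → B x y ≡ B x′ y′
      B-cong {x} {y} {x′} {y′} p q = trans (B≡G x y) (trans (cong₂ _+_ (G-cong {x} {y} {x′} {y′} p q) (G-cong {y} {x} {y′} {x′} q p)) (sym (B≡G x′ y′)))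

      B-⊕ : ∀ x y z → B (x ⊕ y) z ≡ B x z + B y z
      B-⊕ x y z = trans (B≡G (x ⊕ y) z) (trans (cong₂ _+_ (G-⊕ˡ x y z) (G-⊕ʳ x y z))
        (trans (solve 4 (λ p q r s → p :+ q :+ (r :+ s) := (p :+ r) :+ (q :+ s)) refl (G x z) (G y z) (G z x) (G z y))
               (sym (cong₂ _+_ (B≡G x z) (B≡G y z)))))

      B-∙ : ∀ c x z → B (c ∙ x) z ≡ c * B x z
      B-∙ c x z = trans (B≡G (c ∙ x) z) (trans (cong₂ _+_ (G-∙ˡ c x z) (G-∙ʳ c x z)) (trans (sym (distribˡ c _ _)) (cong (c *_) (sym (B≡G x z)))))

      B-self : ∀ x → B x x ≡ two * Q x
      B-self x = trans (B≡G x x) (solve 1 (λ q → q :+ q := :2 :* q) refl (Q x))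

      Q-⊕ : ∀ x y → Q (x ⊕ y) ≡ Q x + Q y + B x y
      Q-⊕ x y = solve 3 (λ s p q → s := p :+ q :+ (s :- p :- q)) refl (Q (x ⊕ y)) (Q x) (Q y)

      Q-∙ : ∀ c x → Q (c ∙ x) ≡ c * c * Q x
      Q-∙ c x = trans (G-∙ˡ c x (c ∙ x)) (trans (cong (c *_) (G-∙ʳ c x x)) (sym (*-assoc c c _)))

      Q-cong : ∀ {x y} → x ≋ y → Q x ≡ Q y
      Q-cong {x} {y} p = G-cong {x} {x} {y} {y} p p

    B-linear : ∀ z → Linear (λ x → B x z)
    B-linear z = record { f-cong = λ {x} {y} p → B-cong {x} {z} {y} {z} p (λ _ → refl) ; f-⊕ = λ x y → B-⊕ x y z ; f-∙ = λ c x → B-∙ c x z }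

    B-∙ʳ : ∀ c x z → B z (c ∙ x) ≡ c * B z x
    B-∙ʳ c x z = trans (B-sym z (c ∙ x)) (trans (B-∙ c x z) (cong (c *_) (B-sym x z)))

    fam2-lincomb : ∀ (x y : V 6) (c : Fin 2 → Carrier) → lincomb c (fam2 x y) ≋ ((c zero ∙ x) ⊕ (c (suc zero) ∙ y))
    fam2-lincomb x y c i = cong (c zero * x i +_) (+-identityʳ _)

    independent₂ : ∀ {x y} → LinIndep (fam2 x y) → ∀ c d → ((c ∙ x) ⊕ (d ∙ y)) ≋ 0V → c ≡ 0# × d ≡ 0#
    independent₂ {x} {y} indep c d eq = coefficients zero , coefficients (suc zero)
      where
      coefficients : ∀ j → vec₂ c d j ≡ 0#
      coefficients = indep (vec₂ c d) (λ i → trans (fam2-lincomb x y (vec₂ c d) i) (eq i))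

    -- The constants g and ν are kept apart from the frame, because frames will be replaced while
    -- these stay the same.
    record Setting (l : Line) : Set where
      field
        two≢0 : two ≢ 0#
        g ν   : Carrier
        g≢0   : g ≢ 0#
        ν≢0   : ν ≢ 0#
        ν-nonsquare : SquareRoots.NonSquare F ν

    module Hyperbolic (l : Line) (st : Setting l) where
      open Setting st

      e₁ e₂ : V 6
      e₁ = Line.u l
      e₂ = Line.v l

      Qe₁ : Q e₁ ≡ 0#
      Qe₁ = trans (Q≡Qf e₁) (Line.sing-u l)

      Qe₂ : Q e₂ ≡ 0#
      Qe₂ = trans (Q≡Qf e₂) (Line.sing-v l)

      e₁e₂ : B e₁ e₂ ≡ 0#
      e₁e₂ = trans (B≡Bf e₁ e₂) (Line.orth l)

      record Frame : Set where
        field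
          f₁ f₂ w₁ w₂ : V 6
          Qf₁ : Q f₁ ≡ 0#
          Qf₂ : Q f₂ ≡ 0#
          Qw₁ : Q w₁ ≡ g
          Qw₂ : Q w₂ ≡ - (g * ν)
          e₁f₁ : B e₁ f₁ ≡ 1#
          e₁f₂ : B e₁ f₂ ≡ 0#
          e₂f₁ : B e₂ f₁ ≡ 0#
          e₂f₂ : B e₂ f₂ ≡ 1#
          f₁f₂ : B f₁ f₂ ≡ 0#
          e₁w₁ : B e₁ w₁ ≡ 0#
          e₁w₂ : B e₁ w₂ ≡ 0#
          e₂w₁ : B e₂ w₁ ≡ 0#
          e₂w₂ : B e₂ w₂ ≡ 0#
          f₁w₁ : B f₁ w₁ ≡ 0#
          f₁w₂ : B f₁ w₂ ≡ 0#
          f₂w₁ : B f₂ w₁ ≡ 0#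
          f₂w₂ : B f₂ w₂ ≡ 0#
          w₁w₂ : B w₁ w₂ ≡ 0#

      self-0 : ∀ {x} → Q x ≡ 0# → B x x ≡ 0#
      self-0 eq = trans (B-self _) (trans (cong (two *_) eq) (zeroʳ two))

      flip : ∀ {x y v} → B x y ≡ v → B y x ≡ v
      flip {x} {y} eq = trans (B-sym y x) eq

      -- The inverses of B(w₁, w₁) = 2 g and B(w₂, w₂) = -2 g ν.
      k₁ k₂ : Carrier
      k₁ = (two * g) ⁻¹
      k₂ = (two * (- (g * ν))) ⁻¹

      2g≢0 : two * g ≢ 0#
      2g≢0 = *-nonzero two≢0 g≢0

      2gν≢0 : two * (- (g * ν)) ≢ 0#
      2gν≢0 = *-nonzero two≢0 (λ eq → *-nonzero g≢0 ν≢0 (-x≡0⇒x≡0 eq))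

      module FrameProperties (fr : Frame) where
        open Frame fr public

        α₁ α₂ β₁ β₂ c₁ c₂ : V 6 → Carrier
        α₁ x = B x f₁
        α₂ x = B x f₂
        β₁ x = B x e₁
        β₂ x = B x e₂
        c₁ x = k₁ * B x w₁
        c₂ x = k₂ * B x w₂

        w₁-self : k₁ * B w₁ w₁ ≡ 1#
        w₁-self = trans (cong (k₁ *_) (trans (B-self w₁) (cong (two *_) Qw₁))) (⁻¹-inverseˡ 2g≢0)

        w₂-self : k₂ * B w₂ w₂ ≡ 1#
        w₂-self = trans (cong (k₂ *_) (trans (B-self w₂) (cong (two *_) Qw₂))) (⁻¹-inverseˡ 2gν≢0)

        k-0 : ∀ k {v} → v ≡ 0# → k * v ≡ 0#
        k-0 k eq = trans (cong (k *_) eq) (zeroʳ k)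

        basis : Fin 6 → V 6
        basis = vec₆ e₁ e₂ f₁ f₂ w₁ w₂

        functional : Fin 6 → V 6 → Carrier
        functional = vec₆ α₁ α₂ β₁ β₂ c₁ c₂

        functional-linear : ∀ j → Linear (functional j)
        functional-linear = all₆ (B-linear f₁) (B-linear f₂) (B-linear e₁) (B-linear e₂)
          (scaled-linear k₁ (B-linear w₁)) (scaled-linear k₂ (B-linear w₂))

        α₁-linear : Linear α₁
        α₁-linear = functional-linear zero
        α₂-linear : Linear α₂
        α₂-linear = functional-linear (suc zero)
        β₁-linear : Linear β₁
        β₁-linear = functional-linear (suc (suc zero))
        β₂-linear : Linear β₂
        β₂-linear = functional-linear (suc (suc (suc zero)))
        c₁-linear : Linear c₁
        c₁-linear = functional-linear (suc (suc (suc (suc zero))))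
        c₂-linear : Linear c₂
        c₂-linear = functional-linear (suc (suc (suc (suc (suc zero)))))

        comb : Carrier → Carrier → Carrier → Carrier → Carrier → Carrier → V 6
        comb a₁ a₂ b₁ b₂ d₁ d₂ = ((a₁ ∙ e₁) ⊕ (a₂ ∙ e₂)) ⊕ (((b₁ ∙ f₁) ⊕ (b₂ ∙ f₂)) ⊕ ((d₁ ∙ w₁) ⊕ (d₂ ∙ w₂)))

        module At {f : V 6 → Carrier} (f-linear : Linear f) where
          open Linear f-linear
          at-comb : ∀ a₁ a₂ b₁ b₂ d₁ d₂ {p q r s u v} → f e₁ ≡ p → f e₂ ≡ q → f f₁ ≡ r → f f₂ ≡ s → f w₁ ≡ u → f w₂ ≡ v →
                    f (comb a₁ a₂ b₁ b₂ d₁ d₂) ≡ (a₁ * p + a₂ * q) + ((b₁ * r + b₂ * s) + (d₁ * u + d₂ * v))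
          at-comb a₁ a₂ b₁ b₂ d₁ d₂ p q r s u v = trans (f-⊕ _ _) (trans (cong₂ _+_ (pair a₁ e₁ a₂ e₂)
            (trans (f-⊕ _ _) (cong₂ _+_ (pair b₁ f₁ b₂ f₂) (pair d₁ w₁ d₂ w₂))))
            (cong₆ (λ p q r s u v → (a₁ * p + a₂ * q) + ((b₁ * r + b₂ * s) + (d₁ * u + d₂ * v))) p q r s u v))
            where
            pair : ∀ a x b y → f ((a ∙ x) ⊕ (b ∙ y)) ≡ a * f x + b * f y
            pair a x b y = trans (f-⊕ _ _) (cong₂ _+_ (f-∙ a x) (f-∙ b y))

        module _ (a₁ a₂ b₁ b₂ d₁ d₂ : Carrier) where
          opaque
            α₁-comb : α₁ (comb a₁ a₂ b₁ b₂ d₁ d₂) ≡ a₁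
            α₁-comb = trans (At.at-comb α₁-linear a₁ a₂ b₁ b₂ d₁ d₂ e₁f₁ e₂f₁ (self-0 Qf₁) (flip f₁f₂) (flip f₁w₁) (flip f₁w₂))
              (solve 6 (λ a₁ a₂ b₁ b₂ d₁ d₂ → (a₁ :* :1 :+ a₂ :* :0) :+ ((b₁ :* :0 :+ b₂ :* :0) :+ (d₁ :* :0 :+ d₂ :* :0)) := a₁) refl a₁ a₂ b₁ b₂ d₁ d₂)
            α₂-comb : α₂ (comb a₁ a₂ b₁ b₂ d₁ d₂) ≡ a₂
            α₂-comb = trans (At.at-comb α₂-linear a₁ a₂ b₁ b₂ d₁ d₂ e₁f₂ e₂f₂ f₁f₂ (self-0 Qf₂) (flip f₂w₁) (flip f₂w₂))
              (solve 6 (λ a₁ a₂ b₁ b₂ d₁ d₂ → (a₁ :* :0 :+ a₂ :* :1) :+ ((b₁ :* :0 :+ b₂ :* :0) :+ (d₁ :* :0 :+ d₂ :* :0)) := a₂) refl a₁ a₂ b₁ b₂ d₁ d₂)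
            β₁-comb : β₁ (comb a₁ a₂ b₁ b₂ d₁ d₂) ≡ b₁
            β₁-comb = trans (At.at-comb β₁-linear a₁ a₂ b₁ b₂ d₁ d₂ (self-0 Qe₁) (flip e₁e₂) (flip e₁f₁) (flip e₁f₂) (flip e₁w₁) (flip e₁w₂))
              (solve 6 (λ a₁ a₂ b₁ b₂ d₁ d₂ → (a₁ :* :0 :+ a₂ :* :0) :+ ((b₁ :* :1 :+ b₂ :* :0) :+ (d₁ :* :0 :+ d₂ :* :0)) := b₁) refl a₁ a₂ b₁ b₂ d₁ d₂)
            β₂-comb : β₂ (comb a₁ a₂ b₁ b₂ d₁ d₂) ≡ b₂
            β₂-comb = trans (At.at-comb β₂-linear a₁ a₂ b₁ b₂ d₁ d₂ e₁e₂ (self-0 Qe₂) (flip e₂f₁) (flip e₂f₂) (flip e₂w₁) (flip e₂w₂))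
              (solve 6 (λ a₁ a₂ b₁ b₂ d₁ d₂ → (a₁ :* :0 :+ a₂ :* :0) :+ ((b₁ :* :0 :+ b₂ :* :1) :+ (d₁ :* :0 :+ d₂ :* :0)) := b₂) refl a₁ a₂ b₁ b₂ d₁ d₂)
            c₁-comb : c₁ (comb a₁ a₂ b₁ b₂ d₁ d₂) ≡ d₁
            c₁-comb = trans (At.at-comb c₁-linear a₁ a₂ b₁ b₂ d₁ d₂ (k-0 k₁ e₁w₁) (k-0 k₁ e₂w₁) (k-0 k₁ f₁w₁) (k-0 k₁ f₂w₁) w₁-self (k-0 k₁ (flip w₁w₂)))
              (solve 6 (λ a₁ a₂ b₁ b₂ d₁ d₂ → (a₁ :* :0 :+ a₂ :* :0) :+ ((b₁ :* :0 :+ b₂ :* :0) :+ (d₁ :* :1 :+ d₂ :* :0)) := d₁) refl a₁ a₂ b₁ b₂ d₁ d₂)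
            c₂-comb : c₂ (comb a₁ a₂ b₁ b₂ d₁ d₂) ≡ d₂
            c₂-comb = trans (At.at-comb c₂-linear a₁ a₂ b₁ b₂ d₁ d₂ (k-0 k₂ e₁w₂) (k-0 k₂ e₂w₂) (k-0 k₂ f₁w₂) (k-0 k₂ f₂w₂) (k-0 k₂ w₁w₂) w₂-self)
              (solve 6 (λ a₁ a₂ b₁ b₂ d₁ d₂ → (a₁ :* :0 :+ a₂ :* :0) :+ ((b₁ :* :0 :+ b₂ :* :0) :+ (d₁ :* :0 :+ d₂ :* :1)) := d₂) refl a₁ a₂ b₁ b₂ d₁ d₂)

        comb-lincomb : ∀ c → comb (c zero) (c (suc zero)) (c (suc (suc zero))) (c (suc (suc (suc zero))))
                         (c (suc (suc (suc (suc zero))))) (c (suc (suc (suc (suc (suc zero)))))) ≋ lincomb c basis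
        comb-lincomb c i = solve 6 (λ a b d e f h → (a :+ b) :+ ((d :+ e) :+ (f :+ h)) := a :+ (b :+ (d :+ (e :+ (f :+ (h :+ :0)))))) refl (c zero * e₁ i) (c (suc zero) * e₂ i) (c (suc (suc zero)) * f₁ i) (c (suc (suc (suc zero))) * f₂ i) (c (suc (suc (suc (suc zero)))) * w₁ i) (c (suc (suc (suc (suc (suc zero))))) * w₂ i)

        functional-dual : ∀ c j → functional j (lincomb c basis) ≡ c j
        functional-dual c j = trans (Linear.f-cong (functional-linear j) (λ i → sym (comb-lincomb c i))) (go j)
          where
          a₀ b d e f h : Carrier
          a₀ = c zero
          b = c (suc zero)
          d = c (suc (suc zero))
          e = c (suc (suc (suc zero)))
          f = c (suc (suc (suc (suc zero))))
          h = c (suc (suc (suc (suc (suc zero)))))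
          go : ∀ j → functional j (comb a₀ b d e f h) ≡ c j
          go = all₆ (α₁-comb a₀ b d e f h) (α₂-comb a₀ b d e f h) (β₁-comb a₀ b d e f h) (β₂-comb a₀ b d e f h)
            (c₁-comb a₀ b d e f h) (c₂-comb a₀ b d e f h)

        opaque
          expansion : ∀ x → comb (α₁ x) (α₂ x) (β₁ x) (β₂ x) (c₁ x) (c₂ x) ≋ x
          expansion x i = trans (comb-lincomb (λ j → functional j x) i)
            (dual-expansion basis functional functional-linear functional-dual x i)

        comb-cong : ∀ {a b d e f h a′ b′ d′ e′ f′ h′} → a ≡ a′ → b ≡ b′ → d ≡ d′ → e ≡ e′ → f ≡ f′ → h ≡ h′ →
                    comb a b d e f h ≋ comb a′ b′ d′ e′ f′ h′
        comb-cong p q r s u v i = cong₆ (λ a b d e f h → comb a b d e f h i) p q r s u v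

        coordinates-equal : ∀ x y → α₁ x ≡ α₁ y → α₂ x ≡ α₂ y → β₁ x ≡ β₁ y → β₂ x ≡ β₂ y → c₁ x ≡ c₁ y → c₂ x ≡ c₂ y → x ≋ y
        coordinates-equal x y p q r s u v i = trans (sym (expansion x i)) (trans (comb-cong p q r s u v i) (expansion y i))

        unscale₁ : ∀ x → B x w₁ ≡ two * g * c₁ x
        unscale₁ x = trans (sym (*-identityˡ _)) (trans (cong (_* B x w₁) (sym (⁻¹-inverseʳ 2g≢0))) (*-assoc _ _ _))

        unscale₂ : ∀ x → B x w₂ ≡ two * (- (g * ν)) * c₂ x
        unscale₂ x = trans (sym (*-identityˡ _)) (trans (cong (_* B x w₂) (sym (⁻¹-inverseʳ 2gν≢0))) (*-assoc _ _ _))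

        opaque
          B-comb : ∀ x a₁ a₂ b₁ b₂ d₁ d₂ → B (comb a₁ a₂ b₁ b₂ d₁ d₂) x ≡
                   a₁ * β₁ x + a₂ * β₂ x + b₁ * α₁ x + b₂ * α₂ x + two * g * (d₁ * c₁ x - ν * d₂ * c₂ x)
          B-comb x a₁ a₂ b₁ b₂ d₁ d₂ = trans (At.at-comb (B-linear x) a₁ a₂ b₁ b₂ d₁ d₂ (B-sym e₁ x) (B-sym e₂ x) (B-sym f₁ x) (B-sym f₂ x)
              (trans (B-sym w₁ x) (unscale₁ x)) (trans (B-sym w₂ x) (unscale₂ x)))
            (solve 14 (λ g ν a₁ a₂ b₁ b₂ d₁ d₂ p q r s u v → (a₁ :* p :+ a₂ :* q) :+ ((b₁ :* r :+ b₂ :* s) :+ (d₁ :* (:2 :* g :* u) :+ d₂ :* (:2 :* (:- (g :* ν)) :* v))) := a₁ :* p :+ a₂ :* q :+ b₁ :* r :+ b₂ :* s :+ :2 :* g :* (d₁ :* u :- ν :* d₂ :* v)) refl g ν a₁ a₂ b₁ b₂ d₁ d₂ (β₁ x) (β₂ x) (α₁ x) (α₂ x) (c₁ x) (c₂ x))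

          B-coordinates : ∀ x y → B x y ≡ α₁ x * β₁ y + α₂ x * β₂ y + β₁ x * α₁ y + β₂ x * α₂ y + two * g * (c₁ x * c₁ y - ν * c₂ x * c₂ y)
          B-coordinates x y = trans (B-cong {x} {y} {comb (α₁ x) (α₂ x) (β₁ x) (β₂ x) (c₁ x) (c₂ x)} {y} (λ i → sym (expansion x i)) (λ _ → refl))
            (B-comb y (α₁ x) (α₂ x) (β₁ x) (β₂ x) (c₁ x) (c₂ x))

          Q-coordinates : ∀ x → Q x ≡ α₁ x * β₁ x + α₂ x * β₂ x + g * (c₁ x * c₁ x - ν * (c₂ x * c₂ x))
          Q-coordinates x = *-cancelˡ two≢0 (trans (sym (B-self x)) (trans (B-coordinates x x)
            (solve 8 (λ g ν p q r s u v → r :* p :+ s :* q :+ p :* r :+ q :* s :+ :2 :* g :* (u :* u :- ν :* v :* v) := :2 :* (r :* p :+ s :* q :+ g :* (u :* u :- ν :* (v :* v)))) refl g ν (β₁ x) (β₂ x) (α₁ x) (α₂ x) (c₁ x) (c₂ x))))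

-- A hyperbolic frame at a line of an elliptic quadric

module FrameExistences where

  open Rings
  open Fields
  open QuadraticExtensions
  open LinearSystems
  open QuadraticForms
  open import Data.Empty using (⊥-elim)
  open import Data.Fin as Fin using (Fin; zero; suc)
  import Data.Fin.Properties as Fin
  open import Data.Nat as ℕ using (_<_; s≤s; z≤n)
  open import Data.Product using (∃; Σ; _×_; _,_; proj₁; proj₂)
  open import Function using (_∘_)
  open import Relation.Nullary using (¬_; yes; no)
  open import Relation.Nullary.Decidable using (¬?; decidable-stable)
  open import Relation.Binary.PropositionalEquality

  module FrameExistence (F : FiniteField) (a : Fin 6 → Fin 6 → FiniteField.Carrier F)
                        (two≢0 : Arithmetic.two F ≢ FiniteField.0# F) (elliptic : Quadric.Elliptic F a) where
    open FiniteField F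
    open Arithmetic F
    open FieldProperties F
    open LinAlg F
    open LinearAlgebra F
    open Quadric F a
    open Form F a

    unit : ∀ {n} → Fin n → V n
    unit zero    zero    = 1#
    unit zero    (suc j) = 0#
    unit (suc i) zero    = 0#
    unit (suc i) (suc j) = unit i j

    unit-expansion : ∀ {n} (x : V n) → lincomb x unit ≋ x
    unit-expansion {ℕ.suc n} x zero = trans (cong₂ _+_ (*-identityʳ (x zero)) (trans (sumF-cong (λ j → zeroʳ (x (suc j)))) (sumF-0 n))) (+-identityʳ _)
    unit-expansion x (suc i) = trans (cong₂ _+_ (zeroʳ (x zero)) (unit-expansion (x ∘ suc) i)) (+-identityˡ _)

    B-units : ∀ x z → B x z ≡ sumF (λ j → x j * B (unit j) z)
    B-units x z = trans (f-cong {x} {lincomb x unit} (λ i → sym (unit-expansion x i))) (f-lincomb x unit)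
      where open Linear (B-linear z)

    -- By linearity it suffices to test the six unit vectors, which turns the contrapositive of
    -- nondegeneracy into an explicit witness.
    nondegenerate : ∀ x → ¬ (x ≋ 0V) → ∃ λ y → B x y ≢ 0#
    nondegenerate x x≢0 with Fin.any? (λ i → ¬? (B x (unit i) ≟ 0#))
    ... | yes (i , nz) = unit i , nz
    ... | no ∄i = ⊥-elim (x≢0 (proj₁ elliptic x (λ y → trans (sym (B≡Bf x y)) (trans (B-sym x y) (trans (B-units y x)
        (trans (sumF-cong (λ j → trans (cong (y j *_) (trans (B-sym (unit j) x) (decidable-stable (B x (unit j) ≟ 0#) (λ nz → ∄i (j , nz)))))
          (zeroʳ (y j)))) (sumF-0 6)))))))

    perpendicular : ∀ {k} → k < 6 → (vs : Fin k → V 6) → ∃ λ x → ¬ (x ≋ 0V) × (∀ i → B x (vs i) ≡ 0#)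
    perpendicular {k} k<6 vs = let c , (j , cj≢0) , solves = homogeneous 6 k (λ i j → B (unit j) (vs i)) k<6
      in c , (λ eq → cj≢0 (eq j)) , λ i → trans (B-units c (vs i)) (trans (sumF-cong (λ j → *-comm (c j) (B (unit j) (vs i)))) (solves i))

    B-⊖ : ∀ c x d y z → B ((c ∙ x) ⊕ (d ∙ y)) z ≡ c * B x z + d * B y z
    B-⊖ c x d y z = trans (B-⊕ _ _ z) (cong₂ _+_ (B-∙ c x z) (B-∙ d y z))

    -- z = B(y, u) v - B(y, v) u is orthogonal to y by construction, and B(x, z) = B(x′, v) for x′ =
    -- B(y, u) x - B(x, u) y. The choice of u makes x′ nonzero by independence, and v is then chosen
    -- with B(x′, v) ≠ 0.
    dual-vector : ∀ x y → (∀ c d → ((c ∙ x) ⊕ (d ∙ y)) ≋ 0V → c ≡ 0# × d ≡ 0#) → ∃ λ z → B x z ≡ 1# × B y z ≡ 0#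
    dual-vector x y indep = k ⁻¹ ∙ z , trans (B-∙ʳ (k ⁻¹) z x) (⁻¹-inverseˡ k≢0) ,
        trans (B-∙ʳ (k ⁻¹) z y) (trans (cong (k ⁻¹ *_) y-z) (zeroʳ _))
      where
      y≢0 : ¬ (y ≋ 0V)
      y≢0 y≋0 = 1≢0 (proj₂ (indep 0# 1# (λ i → trans (cong (λ u → 0# * x i + 1# * u) (y≋0 i)) (solve 1 (λ x → :0 :* x :+ :1 :* :0 := :0) refl (x i)))))
      u : V 6
      u = proj₁ (nondegenerate y y≢0)
      yu≢0 : B y u ≢ 0#
      yu≢0 = proj₂ (nondegenerate y y≢0)
      x′ : V 6
      x′ = (B y u ∙ x) ⊕ ((- B x u) ∙ y)
      x′≢0 : ¬ (x′ ≋ 0V)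
      x′≢0 eq = yu≢0 (proj₁ (indep (B y u) (- B x u) eq))
      v : V 6
      v = proj₁ (nondegenerate x′ x′≢0)
      z : V 6
      z = (B y u ∙ v) ⊕ ((- B y v) ∙ u)
      at : ∀ t → B t z ≡ B y u * B t v + (- B y v) * B t u
      at t = trans (B-sym t z) (trans (B-⊖ (B y u) v (- B y v) u t) (cong₂ (λ p q → B y u * p + (- B y v) * q) (B-sym v t) (B-sym u t)))
      k : Carrier
      k = B x z
      k≢0 : k ≢ 0#
      k≢0 eq = proj₂ (nondegenerate x′ x′≢0) (trans (B-⊖ (B y u) x (- B x u) y v)
        (trans (solve 4 (λ p q r s → p :* q :+ (:- r) :* s := p :* q :+ (:- s) :* r) refl (B y u) (B x v) (B x u) (B y v)) (trans (sym (at x)) eq)))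
      y-z : B y z ≡ 0#
      y-z = trans (at y) (solve 2 (λ p q → p :* q :+ (:- q) :* p := :0) refl (B y u) (B y v))

    _-∙_ : Carrier → V 6 → V 6
    c -∙ x = (- c) ∙ x

    B-minus : ∀ x c y z → B (x ⊕ (c -∙ y)) z ≡ B x z - c * B y z
    B-minus x c y z = trans (B-⊕ x (c -∙ y) z) (trans (cong (B x z +_) (B-∙ (- c) y z)) (solve 3 (λ p c q → p :+ (:- c) :* q := p :- c :* q) refl (B x z) c (B y z)))

    B-minus-0 : ∀ x c y z → B y z ≡ 0# → B (x ⊕ (c -∙ y)) z ≡ B x z
    B-minus-0 x c y z eq = trans (B-minus x c y z) (trans (cong (λ u → B x z - c * u) eq) (solve 2 (λ p c → p :- c :* :0 := p) refl (B x z) c))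

    Q-minus : ∀ x c y → Q y ≡ 0# → Q (x ⊕ (c -∙ y)) ≡ Q x - c * B x y
    Q-minus x c y Qy = trans (Q-⊕ x (c -∙ y)) (trans (cong₂ (λ u v → Q x + u + v) (trans (Q-∙ (- c) y) (trans (cong (- c * - c *_) Qy) (zeroʳ _))) (B-∙ʳ (- c) y x))
      (solve 3 (λ q c b → q :+ :0 :+ (:- c) :* b := q :- c :* b) refl (Q x) c (B x y)))

    module _ (l : Line) where
      private
        e₁ e₂ : V 6
        e₁ = Line.u l
        e₂ = Line.v l
        Qe₁ : Q e₁ ≡ 0#
        Qe₁ = trans (Q≡Qf e₁) (Line.sing-u l)
        Qe₂ : Q e₂ ≡ 0#
        Qe₂ = trans (Q≡Qf e₂) (Line.sing-v l)
        e₁e₂ : B e₁ e₂ ≡ 0#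
        e₁e₂ = trans (B≡Bf e₁ e₂) (Line.orth l)
        indep : LinIndep (fam2 e₁ e₂)
        indep = Line.indep l
        zero-B : ∀ {x} → Q x ≡ 0# → B x x ≡ 0#
        zero-B eq = trans (B-self _) (trans (cong (two *_) eq) (zeroʳ two))
        swapped : ∀ c d → ((c ∙ e₂) ⊕ (d ∙ e₁)) ≋ 0V → c ≡ 0# × d ≡ 0#
        swapped c d eq = let p , q = independent₂ indep d c (λ i → trans (+-comm _ _) (eq i)) in q , p
        dual₁ : ∃ λ z → B e₁ z ≡ 1# × B e₂ z ≡ 0#
        dual₁ = dual-vector e₁ e₂ (independent₂ indep)
        dual₂ : ∃ λ z → B e₂ z ≡ 1# × B e₁ z ≡ 0#
        dual₂ = dual-vector e₂ e₁ swapped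

      record Complement : Set where
        field
          f₁ f₂ : V 6
          Qf₁   : Q f₁ ≡ 0#
          Qf₂   : Q f₂ ≡ 0#
          e₁f₁  : B e₁ f₁ ≡ 1#
          e₁f₂  : B e₁ f₂ ≡ 0#
          e₂f₁  : B e₂ f₁ ≡ 0#
          e₂f₂  : B e₂ f₂ ≡ 1#
          f₁f₂  : B f₁ f₂ ≡ 0#

      opaque
        -- A vector z with B(z, e) = 1 becomes singular by subtracting Q(z) e. Subtracting B(z₂, f₁)
        -- e₁ makes z₂ orthogonal to f₁ and leaves its products with e₁ and e₂ alone.
        complement : Complement
        complement = record
          { f₁ = f₁ ; f₂ = f₂
          ; Qf₁ = trans (Q-minus z₁ (Q z₁) e₁ Qe₁) (trans (cong (λ u → Q z₁ - Q z₁ * u) (trans (B-sym z₁ e₁) (proj₁ (proj₂ dual₁)))) (solve 1 (λ q → q :- q :* :1 := :0) refl (Q z₁)))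
          ; Qf₂ = trans (Q-minus z₃ (Q z₃) e₂ Qe₂) (trans (cong (λ u → Q z₃ - Q z₃ * u) z₃e₂) (solve 1 (λ q → q :- q :* :1 := :0) refl (Q z₃)))
          ; e₁f₁ = trans (B-sym e₁ f₁) f₁e₁
          ; e₁f₂ = trans (B-sym e₁ f₂) (trans (B-minus-0 z₃ (Q z₃) e₂ e₁ (trans (B-sym e₂ e₁) e₁e₂)) z₃e₁)
          ; e₂f₁ = trans (B-sym e₂ f₁) f₁e₂
          ; e₂f₂ = trans (B-sym e₂ f₂) (trans (B-minus-0 z₃ (Q z₃) e₂ e₂ (zero-B Qe₂)) z₃e₂)
          ; f₁f₂ = trans (B-sym f₁ f₂) (trans (B-minus-0 z₃ (Q z₃) e₂ f₁ (trans (B-sym e₂ f₁) f₁e₂))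
              (trans (B-minus z₂ (B z₂ f₁) e₁ f₁) (trans (cong (λ u → B z₂ f₁ - B z₂ f₁ * u) (trans (B-sym e₁ f₁) f₁e₁)) (solve 1 (λ q → q :- q :* :1 := :0) refl (B z₂ f₁))))) }
          where
          z₁ z₂ z₃ f₁ f₂ : V 6
          z₁ = proj₁ dual₁
          z₂ = proj₁ dual₂
          f₁ = z₁ ⊕ (Q z₁ -∙ e₁)
          z₃ = z₂ ⊕ (B z₂ f₁ -∙ e₁)
          f₂ = z₃ ⊕ (Q z₃ -∙ e₂)
          f₁e₁ : B f₁ e₁ ≡ 1#
          f₁e₁ = trans (B-minus-0 z₁ (Q z₁) e₁ e₁ (zero-B Qe₁)) (trans (B-sym z₁ e₁) (proj₁ (proj₂ dual₁)))
          f₁e₂ : B f₁ e₂ ≡ 0#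
          f₁e₂ = trans (B-minus-0 z₁ (Q z₁) e₁ e₂ e₁e₂) (trans (B-sym z₁ e₂) (proj₂ (proj₂ dual₁)))
          z₃e₁ : B z₃ e₁ ≡ 0#
          z₃e₁ = trans (B-minus-0 z₂ (B z₂ f₁) e₁ e₁ (zero-B Qe₁)) (trans (B-sym z₂ e₁) (proj₂ (proj₂ dual₂)))
          z₃e₂ : B z₃ e₂ ≡ 1#
          z₃e₂ = trans (B-minus-0 z₂ (B z₂ f₁) e₁ e₂ e₁e₂) (trans (B-sym z₂ e₂) (proj₁ (proj₂ dual₂)))

      module WithComplement (co : Complement) where
        open Complement co

        -- A nonzero such vector would extend e₁, e₂ to a totally singular subspace of dimension 3,
        -- which ellipticity excludes; f₁ and f₂ serve to read off independence.
        anisotropic : ∀ x → B x e₁ ≡ 0# → B x e₂ ≡ 0# → B x f₁ ≡ 0# → B x f₂ ≡ 0# → Q x ≡ 0# → x ≋ 0V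
        anisotropic x xe₁ xe₂ xf₁ xf₂ Qx with Fin.all? (λ i → x i ≟ 0#)
        ... | yes x≋0 = x≋0
        ... | no  x≢0 = ⊥-elim (proj₂ elliptic (fam3 e₁ e₂ x , indep₃ , singular , orthogonal))
          where
          flip : ∀ {x y v} → B x y ≡ v → B y x ≡ v
          flip {x} {y} eq = trans (B-sym y x) eq
          singular : ∀ i → Qf (fam3 e₁ e₂ x i) ≡ 0#
          singular = all₃ (trans (sym (Q≡Qf _)) Qe₁) (trans (sym (Q≡Qf _)) Qe₂) (trans (sym (Q≡Qf _)) Qx)
          orthogonal′ : ∀ i j → B (fam3 e₁ e₂ x i) (fam3 e₁ e₂ x j) ≡ 0#
          orthogonal′ = all₃ (all₃ (zero-B Qe₁) e₁e₂ (flip xe₁)) (all₃ (flip e₁e₂) (zero-B Qe₂) (flip xe₂)) (all₃ xe₁ xe₂ (zero-B Qx))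
          orthogonal : ∀ i j → Bf (fam3 e₁ e₂ x i) (fam3 e₁ e₂ x j) ≡ 0#
          orthogonal i j = trans (sym (B≡Bf _ _)) (orthogonal′ i j)
          indep₃ : LinIndep (fam3 e₁ e₂ x)
          indep₃ c eq = all₃ c₀≡0 c₁≡0 c₂≡0
            where
            at : ∀ z → c zero * B e₁ z + (c (suc zero) * B e₂ z + (c (suc (suc zero)) * B x z + 0#)) ≡ 0#
            at z = trans (sym (f-lincomb c (fam3 e₁ e₂ x))) (f-0 {lincomb c (fam3 e₁ e₂ x)} eq)
              where open Linear (B-linear z)
            sum₃ : Carrier → Carrier → Carrier → Carrier
            sum₃ p q r = c zero * p + (c (suc zero) * q + (c (suc (suc zero)) * r + 0#))
            c₀≡0 : c zero ≡ 0#
            c₀≡0 = trans (solve 3 (λ p q r → p := p :* :1 :+ (q :* :0 :+ (r :* :0 :+ :0))) refl (c zero) (c (suc zero)) (c (suc (suc zero))))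
              (trans (sym (cong₃ sum₃ e₁f₁ e₂f₁ xf₁)) (at f₁))
            c₁≡0 : c (suc zero) ≡ 0#
            c₁≡0 = trans (solve 3 (λ p q r → q := p :* :0 :+ (q :* :1 :+ (r :* :0 :+ :0))) refl (c zero) (c (suc zero)) (c (suc (suc zero))))
              (trans (sym (cong₃ sum₃ e₁f₂ e₂f₂ xf₂)) (at f₂))
            c₂≡0 : c (suc (suc zero)) ≡ 0#
            c₂≡0 with c (suc (suc zero)) ≟ 0#
            ... | yes z = z
            ... | no nz = ⊥-elim (x≢0 (λ i → zero-product (trans (solve 3 (λ e f u → u := :0 :* e :+ (:0 :* f :+ (u :+ :0))) refl (e₁ i) (e₂ i) (c (suc (suc zero)) * x i))
                (trans (cong₂ (λ p q → p * e₁ i + (q * e₂ i + (c (suc (suc zero)) * x i + 0#))) (sym c₀≡0) (sym c₁≡0)) (eq i))) nz))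

        private
          four : Fin 4 → V 6
          four = vec₄ e₁ e₂ f₁ f₂
          first : ∃ λ x → ¬ (x ≋ 0V) × (∀ i → B x (four i) ≡ 0#)
          first = perpendicular (s≤s (s≤s (s≤s (s≤s (s≤s z≤n))))) four
          w₁ : V 6
          w₁ = proj₁ first
          five : Fin 5 → V 6
          five zero    = w₁
          five (suc i) = four i
          second : ∃ λ x → ¬ (x ≋ 0V) × (∀ i → B x (five i) ≡ 0#)
          second = perpendicular (s≤s (s≤s (s≤s (s≤s (s≤s (s≤s z≤n)))))) five
          w₂ : V 6
          w₂ = proj₁ second
          w₁⊥ : ∀ i → B w₁ (four i) ≡ 0#
          w₁⊥ = proj₂ (proj₂ first)
          w₂⊥ : ∀ i → B w₂ (four i) ≡ 0#
          w₂⊥ i = proj₂ (proj₂ second) (suc i)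
          w₂w₁ : B w₂ w₁ ≡ 0#
          w₂w₁ = proj₂ (proj₂ second) zero
          Q≢0 : ∀ x → ¬ (x ≋ 0V) → (∀ i → B x (four i) ≡ 0#) → Q x ≢ 0#
          Q≢0 x x≢0 perp Qx = x≢0 (anisotropic x (perp zero) (perp (suc zero)) (perp (suc (suc zero))) (perp (suc (suc (suc zero)))) Qx)
          Qw₁≢0 : Q w₁ ≢ 0#
          Qw₁≢0 = Q≢0 w₁ (proj₁ (proj₂ first)) w₁⊥
          Qw₂≢0 : Q w₂ ≢ 0#
          Qw₂≢0 = Q≢0 w₂ (proj₁ (proj₂ second)) w₂⊥

        opaque
          frame-exists : Σ (Setting l) (Hyperbolic.Frame l)
          frame-exists = record { two≢0 = two≢0 ; g = Q w₁ ; ν = ν ; g≢0 = Qw₁≢0 ; ν≢0 = ν≢0 ; ν-nonsquare = nonsquare } , record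
              { f₁ = f₁ ; f₂ = f₂ ; w₁ = w₁ ; w₂ = w₂ ; Qf₁ = Qf₁ ; Qf₂ = Qf₂ ; Qw₁ = refl ; Qw₂ = sym gν
              ; e₁f₁ = e₁f₁ ; e₁f₂ = e₁f₂ ; e₂f₁ = e₂f₁ ; e₂f₂ = e₂f₂ ; f₁f₂ = f₁f₂
              ; e₁w₁ = flip (w₁⊥ zero) ; e₁w₂ = flip (w₂⊥ zero)
              ; e₂w₁ = flip (w₁⊥ (suc zero)) ; e₂w₂ = flip (w₂⊥ (suc zero))
              ; f₁w₁ = flip (w₁⊥ (suc (suc zero))) ; f₁w₂ = flip (w₂⊥ (suc (suc zero)))
              ; f₂w₁ = flip (w₁⊥ (suc (suc (suc zero)))) ; f₂w₂ = flip (w₂⊥ (suc (suc (suc zero))))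
              ; w₁w₂ = flip w₂w₁ }
            where
            flip : ∀ {x y v} → B x y ≡ v → B y x ≡ v
            flip {x} {y} eq = trans (B-sym y x) eq
            -- With this ν the form on ⟨w₁, w₂⟩ is g (x² - ν y²), where g = Q(w₁).
            ν : Carrier
            ν = - (Q w₂ / Q w₁)
            ν≢0 : ν ≢ 0#
            ν≢0 eq = *-nonzero Qw₂≢0 (⁻¹-nonzero Qw₁≢0) (-x≡0⇒x≡0 eq)
            gν : - (Q w₁ * ν) ≡ Q w₂
            gν = trans (solve 2 (λ g k → :- (g :* (:- k)) := k :* g) refl (Q w₁) (Q w₂ / Q w₁)) (/-*-cancel Qw₁≢0)
            -- If x² = ν, then x w₁ + w₂ is singular, hence 0 by anisotropy, and its product with w₂
            -- gives 2 Q(w₂) = 0.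
            nonsquare : ∀ x → x * x ≢ ν
            nonsquare x xx≡ν = *-nonzero two≢0 Qw₂≢0 (trans (sym (B-self w₂))
                (trans (solve 2 (λ x b → b := x :* :0 :+ b) refl x (B w₂ w₂)) (trans (cong (λ u → x * u + B w₂ w₂) (sym (flip w₂w₁)))
                (trans (sym (trans (B-⊕ (x ∙ w₁) w₂ w₂) (cong (_+ B w₂ w₂) (B-∙ x w₁ w₂)))) (Linear.f-0 (B-linear w₂) {y} y≋0)))))
              where
              y : V 6
              y = (x ∙ w₁) ⊕ w₂
              at : ∀ i → B y (four i) ≡ 0#
              at i = trans (B-⊕ (x ∙ w₁) w₂ (four i)) (trans (cong₂ _+_ (trans (B-∙ x w₁ (four i)) (trans (cong (x *_) (w₁⊥ i)) (zeroʳ x))) (w₂⊥ i)) (+-identityʳ 0#))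
              Qy : Q y ≡ 0#
              Qy = trans (Q-⊕ (x ∙ w₁) w₂) (trans (cong₂ (λ u v → u + Q w₂ + v) (trans (Q-∙ x w₁) (cong (_* Q w₁) xx≡ν))
                     (trans (B-∙ x w₁ w₂) (trans (cong (x *_) (flip w₂w₁)) (zeroʳ x))))
                   (trans (cong (λ u → ν * Q w₁ + u + 0#) (sym gν)) (solve 2 (λ n g → n :* g :+ (:- (g :* n)) :+ :0 := :0) refl ν (Q w₁))))
              y≋0 : y ≋ 0V
              y≋0 = anisotropic y (at zero) (at (suc zero)) (at (suc (suc zero))) (at (suc (suc (suc zero)))) Qy

      opaque
        frame-exists : Σ (Setting l) (Hyperbolic.Frame l)
        frame-exists = WithComplement.frame-exists complement

-- Lines disjoint from l in coordinates, and change of frame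

module LinesInFrames where

  open Rings
  open Fields
  open QuadraticExtensions
  open Model
  open LinearSystems
  open QuadraticForms
  open import Data.Fin as Fin using (Fin)
  open import Relation.Binary.PropositionalEquality

  module FrameLines (F : FiniteField) (a : Fin 6 → Fin 6 → FiniteField.Carrier F)
                    (l : Quadric.Line F a) (st : Form.Setting F a l) where
    open FiniteField F
    open Arithmetic F
    open FieldProperties F
    open LinAlg F
    open LinearAlgebra F
    open Form F a
    open Setting st public
    open Hyperbolic l st public
    open HeisenbergModel F ν ν-nonsquare two≢0 using (δ; ω; det; Flat; norm; norm-zero)
    open Vertex

    module LineCoordinates (fr : Frame) where
      open FrameProperties fr public

      S : Vertex Carrier → Carrier
      S v = x₁ v * x₂ v - ν * y₁ v * y₂ v

      -- Components along e₁, e₂ of the dual basis of a line. Singularity of the two vectors fixes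
      -- the diagonal, and their orthogonality fixes A₁₂ + A₂₁ = -2 g S. The difference A₁₂ - A₂₁ =
      -- 2 g t is the freedom that remains.
      A₁₁ A₁₂ A₂₁ A₂₂ : Vertex Carrier → Carrier
      A₁₁ v = - (g * norm (x₁ v) (y₁ v))
      A₁₂ v = g * (t v - S v)
      A₂₁ v = g * (- t v - S v)
      A₂₂ v = - (g * norm (x₂ v) (y₂ v))

      n₁ n₂ : Vertex Carrier → V 6
      n₁ v = comb (A₁₁ v) (A₁₂ v) 1# 0# (x₁ v) (y₁ v)
      n₂ v = comb (A₂₁ v) (A₂₂ v) 0# 1# (x₂ v) (y₂ v)

      opaque
        B-comb-comb : ∀ a b d e f h a′ b′ d′ e′ f′ h′ → B (comb a b d e f h) (comb a′ b′ d′ e′ f′ h′) ≡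
                      a * d′ + b * e′ + d * a′ + e * b′ + two * g * (f * f′ - ν * h * h′)
        B-comb-comb a b d e f h a′ b′ d′ e′ f′ h′ = trans (B-comb (comb a′ b′ d′ e′ f′ h′) a b d e f h)
          (six (α₁-comb a′ b′ d′ e′ f′ h′) (α₂-comb a′ b′ d′ e′ f′ h′) (β₁-comb a′ b′ d′ e′ f′ h′)
               (β₂-comb a′ b′ d′ e′ f′ h′) (c₁-comb a′ b′ d′ e′ f′ h′) (c₂-comb a′ b′ d′ e′ f′ h′))
          where
          six : ∀ {p q r s u v p′ q′ r′ s′ u′ v′} → p ≡ p′ → q ≡ q′ → r ≡ r′ → s ≡ s′ → u ≡ u′ → v ≡ v′ →
                a * r + b * s + d * p + e * q + two * g * (f * u - ν * h * v) ≡ a * r′ + b * s′ + d * p′ + e * q′ + two * g * (f * u′ - ν * h * v′)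
          six = cong₆ (λ p q r s u v → a * r + b * s + d * p + e * q + two * g * (f * u - ν * h * v))

        Q-comb : ∀ a b d e f h → Q (comb a b d e f h) ≡ a * d + b * e + g * (f * f - ν * (h * h))
        Q-comb a b d e f h = *-cancelˡ two≢0 (trans (sym (B-self (comb a b d e f h))) (trans (B-comb-comb a b d e f h a b d e f h)
          (solve 8 (λ g ν a b d e f h → a :* d :+ b :* e :+ d :* a :+ e :* b :+ :2 :* g :* (f :* f :- ν :* h :* h) := :2 :* (a :* d :+ b :* e :+ g :* (f :* f :- ν :* (h :* h)))) refl g ν a b d e f h)))

        Q-n₁ : ∀ v → Q (n₁ v) ≡ 0#
        Q-n₁ v = trans (Q-comb (A₁₁ v) (A₁₂ v) 1# 0# (x₁ v) (y₁ v)) (solve 5 (λ g ν x y b → (:- (g :* (x :* x :- ν :* (y :* y)))) :* :1 :+ b :* :0 :+ g :* (x :* x :- ν :* (y :* y)) := :0) refl g ν (x₁ v) (y₁ v) (A₁₂ v))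

        Q-n₂ : ∀ v → Q (n₂ v) ≡ 0#
        Q-n₂ v = trans (Q-comb (A₂₁ v) (A₂₂ v) 0# 1# (x₂ v) (y₂ v)) (solve 5 (λ g ν x y b → b :* :0 :+ (:- (g :* (x :* x :- ν :* (y :* y)))) :* :1 :+ g :* (x :* x :- ν :* (y :* y)) := :0) refl g ν (x₂ v) (y₂ v) (A₂₁ v))

        n₁n₂ : ∀ v → B (n₁ v) (n₂ v) ≡ 0#
        n₁n₂ v = trans (B-comb-comb (A₁₁ v) (A₁₂ v) 1# 0# (x₁ v) (y₁ v) (A₂₁ v) (A₂₂ v) 0# 1# (x₂ v) (y₂ v))
          (solve 9 (λ g ν p q t a b c d → p :* :0 :+ g :* (t :- (a :* c :- ν :* b :* d)) :* :1 :+ :1 :* (g :* (:- t :- (a :* c :- ν :* b :* d))) :+ :0 :* q :+ :2 :* g :* (a :* c :- ν :* b :* d) := :0) refl g ν (A₁₁ v) (A₂₂ v) (t v) (x₁ v) (y₁ v) (x₂ v) (y₂ v))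

        β₁-n₁ : ∀ v → β₁ (n₁ v) ≡ 1#
        β₁-n₁ v = β₁-comb (A₁₁ v) (A₁₂ v) 1# 0# (x₁ v) (y₁ v)
        β₂-n₁ : ∀ v → β₂ (n₁ v) ≡ 0#
        β₂-n₁ v = β₂-comb (A₁₁ v) (A₁₂ v) 1# 0# (x₁ v) (y₁ v)
        β₁-n₂ : ∀ v → β₁ (n₂ v) ≡ 0#
        β₁-n₂ v = β₁-comb (A₂₁ v) (A₂₂ v) 0# 1# (x₂ v) (y₂ v)
        β₂-n₂ : ∀ v → β₂ (n₂ v) ≡ 1#
        β₂-n₂ v = β₂-comb (A₂₁ v) (A₂₂ v) 0# 1# (x₂ v) (y₂ v)
        α₁-n₁ : ∀ v → α₁ (n₁ v) ≡ A₁₁ v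
        α₁-n₁ v = α₁-comb (A₁₁ v) (A₁₂ v) 1# 0# (x₁ v) (y₁ v)
        α₂-n₁ : ∀ v → α₂ (n₁ v) ≡ A₁₂ v
        α₂-n₁ v = α₂-comb (A₁₁ v) (A₁₂ v) 1# 0# (x₁ v) (y₁ v)
        α₁-n₂ : ∀ v → α₁ (n₂ v) ≡ A₂₁ v
        α₁-n₂ v = α₁-comb (A₂₁ v) (A₂₂ v) 0# 1# (x₂ v) (y₂ v)
        α₂-n₂ : ∀ v → α₂ (n₂ v) ≡ A₂₂ v
        α₂-n₂ v = α₂-comb (A₂₁ v) (A₂₂ v) 0# 1# (x₂ v) (y₂ v)
        c₁-n₁ : ∀ v → c₁ (n₁ v) ≡ x₁ v
        c₁-n₁ v = c₁-comb (A₁₁ v) (A₁₂ v) 1# 0# (x₁ v) (y₁ v)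
        c₂-n₁ : ∀ v → c₂ (n₁ v) ≡ y₁ v
        c₂-n₁ v = c₂-comb (A₁₁ v) (A₁₂ v) 1# 0# (x₁ v) (y₁ v)
        c₁-n₂ : ∀ v → c₁ (n₂ v) ≡ x₂ v
        c₁-n₂ v = c₁-comb (A₂₁ v) (A₂₂ v) 0# 1# (x₂ v) (y₂ v)
        c₂-n₂ : ∀ v → c₂ (n₂ v) ≡ y₂ v
        c₂-n₂ v = c₂-comb (A₂₁ v) (A₂₂ v) 0# 1# (x₂ v) (y₂ v)

      vertexOf : V 6 → V 6 → Vertex Carrier
      vertexOf m₁ m₂ = vertex (c₁ m₁) (c₂ m₁) (c₁ m₂) (c₂ m₂) (k₁ * (α₂ m₁ - α₁ m₂))

      vertexOf-cong : ∀ {m₁ m₂ m₁′ m₂′} → m₁ ≋ m₁′ → m₂ ≋ m₂′ → vertexOf m₁ m₂ ≡ vertexOf m₁′ m₂′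
      vertexOf-cong {m₁} {m₂} {m₁′} {m₂′} p q = vertex-≡ (Linear.f-cong c₁-linear p) (Linear.f-cong c₂-linear p)
        (Linear.f-cong c₁-linear q) (Linear.f-cong c₂-linear q)
        (cong (k₁ *_) (cong₂ _-_ (Linear.f-cong α₂-linear p) (Linear.f-cong α₁-linear q)))

      vertexOf-n : ∀ v → vertexOf (n₁ v) (n₂ v) ≡ v
      vertexOf-n v = vertex-≡ (c₁-n₁ v) (c₂-n₁ v) (c₁-n₂ v) (c₂-n₂ v)
        (trans (cong (k₁ *_) (cong₂ _-_ (α₂-n₁ v) (α₁-n₂ v))) (trans
          (solve 4 (λ k g t s → k :* (g :* (t :- s) :- g :* (:- t :- s)) := k :* (:2 :* g) :* t) refl k₁ g (t v) (S v))
          (trans (cong (_* t v) (⁻¹-inverseˡ 2g≢0)) (*-identityˡ (t v)))))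

      module _ (m₁ m₂ : V 6) (Qm₁ : Q m₁ ≡ 0#) (Qm₂ : Q m₂ ≡ 0#) (m₁m₂ : B m₁ m₂ ≡ 0#)
               (β₁₁ : β₁ m₁ ≡ 1#) (β₁₂ : β₁ m₂ ≡ 0#) (β₂₁ : β₂ m₁ ≡ 0#) (β₂₂ : β₂ m₂ ≡ 1#) where
        private
          v : Vertex Carrier
          v = vertexOf m₁ m₂
          A₁₁≡ : A₁₁ v ≡ α₁ m₁
          A₁₁≡ = sym (x-y≡0⇒x≡y (trans (solve 6 (λ g ν a b c d → a :- (:- (g :* (c :* c :- ν :* (d :* d)))) := a :* :1 :+ b :* :0 :+ g :* (c :* c :- ν :* (d :* d))) refl g ν (α₁ m₁) (α₂ m₁) (c₁ m₁) (c₂ m₁))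
            (trans (cong₂ (λ p q → α₁ m₁ * p + α₂ m₁ * q + g * (c₁ m₁ * c₁ m₁ - ν * (c₂ m₁ * c₂ m₁))) (sym β₁₁) (sym β₂₁))
              (trans (sym (Q-coordinates m₁)) Qm₁))))
          A₂₂≡ : A₂₂ v ≡ α₂ m₂
          A₂₂≡ = sym (x-y≡0⇒x≡y (trans (solve 6 (λ g ν a b c d → b :- (:- (g :* (c :* c :- ν :* (d :* d)))) := a :* :0 :+ b :* :1 :+ g :* (c :* c :- ν :* (d :* d))) refl g ν (α₁ m₂) (α₂ m₂) (c₁ m₂) (c₂ m₂))
            (trans (cong₂ (λ p q → α₁ m₂ * p + α₂ m₂ * q + g * (c₁ m₂ * c₁ m₂ - ν * (c₂ m₂ * c₂ m₂))) (sym β₁₂) (sym β₂₂))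
              (trans (sym (Q-coordinates m₂)) Qm₂))))
          sum : α₂ m₁ + α₁ m₂ + two * g * S v ≡ 0#
          sum = trans (solve 6 (λ g a b c d s → b :+ c :+ :2 :* g :* s := a :* :0 :+ b :* :1 :+ :1 :* c :+ :0 :* d :+ :2 :* g :* s) refl g (α₁ m₁) (α₂ m₁) (α₁ m₂) (α₂ m₂) (S v))
            (trans (four (sym β₁₂) (sym β₂₂) (sym β₁₁) (sym β₂₁)) (trans (sym (B-coordinates m₁ m₂)) m₁m₂))
            where
            four : ∀ {p q r s p′ q′ r′ s′} → p ≡ p′ → q ≡ q′ → r ≡ r′ → s ≡ s′ →
                   α₁ m₁ * p + α₂ m₁ * q + r * α₁ m₂ + s * α₂ m₂ + two * g * S v ≡ α₁ m₁ * p′ + α₂ m₁ * q′ + r′ * α₁ m₂ + s′ * α₂ m₂ + two * g * S v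
            four = cong₄ (λ p q r s → α₁ m₁ * p + α₂ m₁ * q + r * α₁ m₂ + s * α₂ m₂ + two * g * S v)
          double : two * g * t v ≡ α₂ m₁ - α₁ m₂
          double = trans (sym (*-assoc (two * g) k₁ _)) (trans (cong (_* (α₂ m₁ - α₁ m₂)) (⁻¹-inverseʳ 2g≢0)) (*-identityˡ _))
          A₁₂≡ : A₁₂ v ≡ α₂ m₁
          A₁₂≡ = *-cancelˡ two≢0 (trans (solve 5 (λ g t s b c → :2 :* (g :* (t :- s)) := :2 :* g :* t :+ (b :+ c) :- (b :+ c :+ :2 :* g :* s)) refl g (t v) (S v) (α₂ m₁) (α₁ m₂))
            (trans (cong₂ (λ p q → p + (α₂ m₁ + α₁ m₂) - q) double sum) (solve 2 (λ b c → (b :- c) :+ (b :+ c) :- :0 := :2 :* b) refl (α₂ m₁) (α₁ m₂))))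
          A₂₁≡ : A₂₁ v ≡ α₁ m₂
          A₂₁≡ = *-cancelˡ two≢0 (trans (solve 5 (λ g t s b c → :2 :* (g :* (:- t :- s)) := (b :+ c) :- :2 :* g :* t :- (b :+ c :+ :2 :* g :* s)) refl g (t v) (S v) (α₂ m₁) (α₁ m₂))
            (trans (cong₂ (λ p q → (α₂ m₁ + α₁ m₂) - p - q) double sum) (solve 2 (λ b c → (b :+ c) :- (b :- c) :- :0 := :2 :* c) refl (α₂ m₁) (α₁ m₂))))

        n₁-vertexOf : n₁ (vertexOf m₁ m₂) ≋ m₁
        n₁-vertexOf i = trans (comb-cong A₁₁≡ A₁₂≡ (sym β₁₁) (sym β₂₁) refl refl i) (expansion m₁ i)

        n₂-vertexOf : n₂ (vertexOf m₁ m₂) ≋ m₂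
        n₂-vertexOf i = trans (comb-cong A₂₁≡ A₂₂≡ (sym β₁₂) (sym β₂₂) refl refl i) (expansion m₂ i)

      opaque
        -- The new w₁, w₂ are the old ones plus vectors of l. The corrections make them orthogonal
        -- to the new f₁, f₂; they change neither Q nor the products with l, because l is totally
        -- singular and orthogonal to the old w₁, w₂.
        reframe : Vertex Carrier → Frame
        reframe v = record
          { f₁ = n₁ v ; f₂ = n₂ v
          ; w₁ = comb p q 0# 0# 1# 0#
          ; w₂ = comb r s 0# 0# 0# 1#
          ; Qf₁ = Q-n₁ v ; Qf₂ = Q-n₂ v
          ; Qw₁ = trans (Q-comb p q 0# 0# 1# 0#) (solve 4 (λ g ν p q → p :* :0 :+ q :* :0 :+ g :* (:1 :* :1 :- ν :* (:0 :* :0)) := g) refl g ν p q)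
          ; Qw₂ = trans (Q-comb r s 0# 0# 0# 1#) (solve 4 (λ g ν p q → p :* :0 :+ q :* :0 :+ g :* (:0 :* :0 :- ν :* (:1 :* :1)) := :- (g :* ν)) refl g ν r s)
          ; e₁f₁ = flip (β₁-n₁ v) ; e₁f₂ = flip (β₁-n₂ v) ; e₂f₁ = flip (β₂-n₁ v) ; e₂f₂ = flip (β₂-n₂ v)
          ; f₁f₂ = n₁n₂ v
          ; e₁w₁ = flip (β₁-comb p q 0# 0# 1# 0#) ; e₁w₂ = flip (β₁-comb r s 0# 0# 0# 1#)
          ; e₂w₁ = flip (β₂-comb p q 0# 0# 1# 0#) ; e₂w₂ = flip (β₂-comb r s 0# 0# 0# 1#)
          ; f₁w₁ = trans (B-comb-comb (A₁₁ v) (A₁₂ v) 1# 0# (x₁ v) (y₁ v) p q 0# 0# 1# 0#)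
              (solve 7 (λ g ν a b x y q → a :* :0 :+ b :* :0 :+ :1 :* (:- (:2 :* g :* x)) :+ :0 :* q :+ :2 :* g :* (x :* :1 :- ν :* y :* :0) := :0) refl g ν (A₁₁ v) (A₁₂ v) (x₁ v) (y₁ v) q)
          ; f₁w₂ = trans (B-comb-comb (A₁₁ v) (A₁₂ v) 1# 0# (x₁ v) (y₁ v) r s 0# 0# 0# 1#)
              (solve 7 (λ g ν a b x y q → a :* :0 :+ b :* :0 :+ :1 :* (:2 :* g :* ν :* y) :+ :0 :* q :+ :2 :* g :* (x :* :0 :- ν :* y :* :1) := :0) refl g ν (A₁₁ v) (A₁₂ v) (x₁ v) (y₁ v) s)
          ; f₂w₁ = trans (B-comb-comb (A₂₁ v) (A₂₂ v) 0# 1# (x₂ v) (y₂ v) p q 0# 0# 1# 0#)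
              (solve 7 (λ g ν a b x y q → a :* :0 :+ b :* :0 :+ :0 :* q :+ :1 :* (:- (:2 :* g :* x)) :+ :2 :* g :* (x :* :1 :- ν :* y :* :0) := :0) refl g ν (A₂₁ v) (A₂₂ v) (x₂ v) (y₂ v) p)
          ; f₂w₂ = trans (B-comb-comb (A₂₁ v) (A₂₂ v) 0# 1# (x₂ v) (y₂ v) r s 0# 0# 0# 1#)
              (solve 7 (λ g ν a b x y q → a :* :0 :+ b :* :0 :+ :0 :* q :+ :1 :* (:2 :* g :* ν :* y) :+ :2 :* g :* (x :* :0 :- ν :* y :* :1) := :0) refl g ν (A₂₁ v) (A₂₂ v) (x₂ v) (y₂ v) r)
          ; w₁w₂ = trans (B-comb-comb p q 0# 0# 1# 0# r s 0# 0# 0# 1#)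
              (solve 6 (λ g ν p q r s → p :* :0 :+ q :* :0 :+ :0 :* r :+ :0 :* s :+ :2 :* g :* (:1 :* :0 :- ν :* :0 :* :1) := :0) refl g ν p q r s) }
          where
          p q r s : Carrier
          p = - (two * g * x₁ v)
          q = - (two * g * x₂ v)
          r = two * g * ν * y₁ v
          s = two * g * ν * y₂ v

        reframe-f₁ : ∀ v → Frame.f₁ (reframe v) ≡ n₁ v
        reframe-f₁ v = refl

        reframe-f₂ : ∀ v → Frame.f₂ (reframe v) ≡ n₂ v
        reframe-f₂ v = refl

    -- In the frame obtained by moving ⟨f₁, f₂⟩ to the line with coordinates v, the line with coordinates w has coordinates δ v w.
    module _ (fr : Frame) where
      private
        module O = LineCoordinates fr
      module _ (v w : Vertex Carrier) where
        private
          module N = LineCoordinates (O.reframe v)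
        opaque
          unfolding LineCoordinates.reframe

          reframe-n₁ : N.n₁ (δ v w) ≋ O.n₁ w
          reframe-n₁ i = solve 18 (λ g ν e₁ e₂ f₁ f₂ w₁ w₂ a b c d s a′ b′ c′ d′ s′ → ((:- (g :* ((a′ :- a) :* (a′ :- a) :- ν :* ((b′ :- b) :* (b′ :- b))))) :* e₁ :+ g :* ((s′ :- s :+ (a′ :* c :- ν :* b′ :* d :- c′ :* a :+ ν :* d′ :* b)) :- ((a′ :- a) :* (c′ :- c) :- ν :* (b′ :- b) :* (d′ :- d))) :* e₂) :+ ((:1 :* (((:- (g :* (a :* a :- ν :* (b :* b)))) :* e₁ :+ g :* (s :- (a :* c :- ν :* b :* d)) :* e₂) :+ ((:1 :* f₁ :+ :0 :* f₂) :+ (a :* w₁ :+ b :* w₂))) :+ :0 :* ((g :* (:- s :- (a :* c :- ν :* b :* d)) :* e₁ :+ (:- (g :* (c :* c :- ν :* (d :* d)))) :* e₂) :+ ((:0 :* f₁ :+ :1 :* f₂) :+ (c :* w₁ :+ d :* w₂)))) :+ ((a′ :- a) :* (((:- (:2 :* g :* a)) :* e₁ :+ (:- (:2 :* g :* c)) :* e₂) :+ ((:0 :* f₁ :+ :0 :* f₂) :+ (:1 :* w₁ :+ :0 :* w₂))) :+ (b′ :- b) :* ((:2 :* g :* ν :* b :* e₁ :+ :2 :* g :* ν :* d :* e₂) :+ ((:0 :* f₁ :+ :0 :* f₂) :+ (:0 :* w₁ :+ :1 :* w₂))))) := ((:- (g :* (a′ :* a′ :- ν :* (b′ :* b′))))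 :* e₁ :+ g :* (s′ :- (a′ :* c′ :- ν :* b′ :* d′)) :* e₂) :+ ((:1 :* f₁ :+ :0 :* f₂) :+ (a′ :* w₁ :+ b′ :* w₂))) refl g ν (e₁ i) (e₂ i) (O.f₁ i) (O.f₂ i) (O.w₁ i) (O.w₂ i) (x₁ v) (y₁ v) (x₂ v) (y₂ v) (t v) (x₁ w) (y₁ w) (x₂ w) (y₂ w) (t w)

          reframe-n₂ : N.n₂ (δ v w) ≋ O.n₂ w
          reframe-n₂ i = solve 18 (λ g ν e₁ e₂ f₁ f₂ w₁ w₂ a b c d s a′ b′ c′ d′ s′ → (g :* (:- (s′ :- s :+ (a′ :* c :- ν :* b′ :* d :- c′ :* a :+ ν :* d′ :* b)) :- ((a′ :- a) :* (c′ :- c) :- ν :* (b′ :- b) :* (d′ :- d))) :* e₁ :+ (:- (g :* ((c′ :- c) :* (c′ :- c) :- ν :* ((d′ :- d) :* (d′ :- d))))) :* e₂) :+ ((:0 :* (((:- (g :* (a :* a :- ν :* (b :* b)))) :* e₁ :+ g :* (s :- (a :* c :- ν :* b :* d)) :* e₂) :+ ((:1 :* f₁ :+ :0 :* f₂) :+ (a :* w₁ :+ b :* w₂))) :+ :1 :* ((g :* (:- s :- (a :* c :- ν :* b :* d)) :* e₁ :+ (:- (g :* (c :* c :- ν :* (d :* d)))) :* e₂) :+ ((:0 :* f₁ :+ :1 :* f₂) :+ (c :* w₁ :+ d :* w₂)))) :+ ((c′ :- c) :* (((:- (:2 :* g :* a)) :* e₁ :+ (:- (:2 :* g :* c)) :*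 e₂) :+ ((:0 :* f₁ :+ :0 :* f₂) :+ (:1 :* w₁ :+ :0 :* w₂))) :+ (d′ :- d) :* ((:2 :* g :* ν :* b :* e₁ :+ :2 :* g :* ν :* d :* e₂) :+ ((:0 :* f₁ :+ :0 :* f₂) :+ (:0 :* w₁ :+ :1 :* w₂))))) := (g :* (:- s′ :- (a′ :* c′ :- ν :* b′ :* d′)) :* e₁ :+ (:- (g :* (c′ :* c′ :- ν :* (d′ :* d′)))) :* e₂) :+ ((:0 :* f₁ :+ :1 :* f₂) :+ (c′ :* w₁ :+ d′ :* w₂))) refl g ν (e₁ i) (e₂ i) (O.f₁ i) (O.f₂ i) (O.w₁ i) (O.w₂ i) (x₁ v) (y₁ v) (x₂ v) (y₂ v) (t v) (x₁ w) (y₁ w) (x₂ w) (y₂ w) (t w)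

-- Spans, intersections and perspectivity of three lines

module TriplesOfLines where

  open Rings
  open Fields
  open QuadraticExtensions
  open Model
  open LinearSystems
  open QuadraticForms
  open LinesInFrames
  import Data.Nat
  open import Data.Empty using (⊥-elim)
  open import Data.Fin as Fin using (Fin; zero; suc)
  open import Data.Product using (∃; ∃₂; _×_; _,_; proj₁; proj₂)
  open import Relation.Nullary using (¬_; Dec; yes; no)
  open import Relation.Nullary.Decidable using (decidable-stable; _×-dec_)
  open import Relation.Binary.PropositionalEquality

  module Triples (F : FiniteField) (a : Fin 6 → Fin 6 → FiniteField.Carrier F)
                 (l : Quadric.Line F a) (st : Form.Setting F a l) where
    open FiniteField F
    open Arithmetic F
    open FieldProperties F
    open LinAlg F
    open LinearAlgebra F
    open Quadric F a
    open Form F a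

    open FrameLines F a l st public
    open HeisenbergModel F ν ν-nonsquare two≢0 using (det; Flat; flat?; norm; norm-zero)
    open Vertex

    On₂ : V 6 → V 6 → V 6 → Set
    On₂ x y w = ∃₂ λ s t → ((s ∙ x) ⊕ (t ∙ y)) ≋ w

    -- Describes a line by a basis other than the one stored in it.
    Spanned : Line → V 6 → V 6 → Set
    Spanned m x y = ∀ w → (OnLine m w → On₂ x y w) × (On₂ x y w → OnLine m w)

    line-spanned : ∀ m → Spanned m (Line.u m) (Line.v m)
    line-spanned m w = (λ (c , eq) → c zero , c (suc zero) , λ i → trans (sym (fam2-lincomb (Line.u m) (Line.v m) c i)) (eq i)) ,
      λ (s , t , eq) → vec₂ s t , λ i → trans (fam2-lincomb (Line.u m) (Line.v m) (vec₂ s t) i) (eq i)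

    on-0 : ∀ m → OnLine m 0V
    on-0 m = span-0 (fam2 (Line.u m) (Line.v m))

    at₂ : ∀ {f : V 6 → Carrier} → Linear f → ∀ s x t y {w} → ((s ∙ x) ⊕ (t ∙ y)) ≋ w → ∀ {p q} → f x ≡ p → f y ≡ q → f w ≡ s * p + t * q
    at₂ lin s x t y eq p q = trans (sym (f-cong eq)) (trans (f-⊕ _ _) (cong₂ _+_ (trans (f-∙ s x) (cong (s *_) p)) (trans (f-∙ t y) (cong (t *_) q))))
      where open Linear lin

    first-of : ∀ x y → On₂ x y x
    first-of x y = 1# , 0# , λ i → solve 2 (λ x y → :1 :* x :+ :0 :* y := x) refl (x i) (y i)

    second-of : ∀ x y → On₂ x y y
    second-of x y = 0# , 1# , λ i → solve 2 (λ x y → :0 :* x :+ :1 :* y := y) refl (x i) (y i)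

    -- The configuration of l = ⟨e₁, e₂⟩, m = ⟨f₁, f₂⟩ and the line n with coordinates v.
    module Triple (fr : Frame) (v : Vertex Carrier) (m n : Line)
                  (m-spanned : Spanned m (Frame.f₁ fr) (Frame.f₂ fr))
                  (n-spanned : Spanned n (LineCoordinates.n₁ fr v) (LineCoordinates.n₂ fr v)) where
      open LineCoordinates fr

      l-e₁ : OnLine l e₁
      l-e₁ = proj₂ (line-spanned l e₁) (first-of e₁ e₂)
      l-e₂ : OnLine l e₂
      l-e₂ = proj₂ (line-spanned l e₂) (second-of e₁ e₂)
      m-f₁ : OnLine m f₁
      m-f₁ = proj₂ (m-spanned f₁) (first-of f₁ f₂)
      m-f₂ : OnLine m f₂
      m-f₂ = proj₂ (m-spanned f₂) (second-of f₁ f₂)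
      n-n₁ : OnLine n (n₁ v)
      n-n₁ = proj₂ (n-spanned (n₁ v)) (first-of (n₁ v) (n₂ v))
      n-n₂ : OnLine n (n₂ v)
      n-n₂ = proj₂ (n-spanned (n₂ v)) (second-of (n₁ v) (n₂ v))

      S₃ : V 6 → Set
      S₃ = Span3 l m n

      l⊆S₃ : ∀ {x} → OnLine l x → S₃ x
      l⊆S₃ {x} on = x , 0V , 0V , on , on-0 m , on-0 n , λ i → solve 1 (λ x → x :+ :0 :+ :0 := x) refl (x i)
      m⊆S₃ : ∀ {x} → OnLine m x → S₃ x
      m⊆S₃ {x} on = 0V , x , 0V , on-0 l , on , on-0 n , λ i → solve 1 (λ x → :0 :+ x :+ :0 := x) refl (x i)
      n⊆S₃ : ∀ {x} → OnLine n x → S₃ x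
      n⊆S₃ {x} on = 0V , 0V , x , on-0 l , on-0 m , on , λ i → solve 1 (λ x → :0 :+ :0 :+ x := x) refl (x i)

      spanned⊆ : ∀ {k} {b : Fin k → V 6} {x y w} → InSpan b x → InSpan b y → On₂ x y w → InSpan b w
      spanned⊆ {b = b} {x} {y} bx by (s , t , eq) = span-cong {b = b} {x = (s ∙ x) ⊕ (t ∙ y)} eq (span-⊕ {b = b} {x = s ∙ x} {t ∙ y} (span-∙ {b = b} {x} s bx) (span-∙ {b = b} {y} t by))

      S₃⊆ : ∀ {k} {b : Fin k → V 6} → InSpan b e₁ → InSpan b e₂ → InSpan b f₁ → InSpan b f₂ → InSpan b (n₁ v) → InSpan b (n₂ v) →
            ∀ x → S₃ x → InSpan b x
      S₃⊆ {b = b} be₁ be₂ bf₁ bf₂ bn₁ bn₂ x (y , z , w , ly , mz , nw , eq) = span-cong {b = b} {x = (y ⊕ z) ⊕ w} eq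
        (span-⊕ {b = b} {x = y ⊕ z} {w} (span-⊕ {b = b} {x = y} {z} (spanned⊆ {b = b} {e₁} {e₂} be₁ be₂ (proj₁ (line-spanned l y) ly))
          (spanned⊆ {b = b} {f₁} {f₂} bf₁ bf₂ (proj₁ (m-spanned z) mz))) (spanned⊆ {b = b} {n₁ v} {n₂ v} bn₁ bn₂ (proj₁ (n-spanned w) nw)))

      α₁-f₁ : α₁ f₁ ≡ 0#
      α₁-f₁ = self-0 Qf₁
      α₁-f₂ : α₁ f₂ ≡ 0#
      α₁-f₂ = flip f₁f₂
      α₂-f₁ : α₂ f₁ ≡ 0#
      α₂-f₁ = f₁f₂
      α₂-f₂ : α₂ f₂ ≡ 0#
      α₂-f₂ = self-0 Qf₂
      β₁-e₁ : β₁ e₁ ≡ 0#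
      β₁-e₁ = self-0 Qe₁
      β₁-e₂ : β₁ e₂ ≡ 0#
      β₁-e₂ = flip e₁e₂
      β₂-e₁ : β₂ e₁ ≡ 0#
      β₂-e₁ = e₁e₂
      β₂-e₂ : β₂ e₂ ≡ 0#
      β₂-e₂ = self-0 Qe₂
      c₁-e₁ : c₁ e₁ ≡ 0#
      c₁-e₁ = k-0 k₁ e₁w₁
      c₁-e₂ : c₁ e₂ ≡ 0#
      c₁-e₂ = k-0 k₁ e₂w₁
      c₂-e₁ : c₂ e₁ ≡ 0#
      c₂-e₁ = k-0 k₂ e₁w₂
      c₂-e₂ : c₂ e₂ ≡ 0#
      c₂-e₂ = k-0 k₂ e₂w₂
      c₁-f₁ : c₁ f₁ ≡ 0#
      c₁-f₁ = k-0 k₁ f₁w₁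
      c₁-f₂ : c₁ f₂ ≡ 0#
      c₁-f₂ = k-0 k₁ f₂w₁
      c₂-f₁ : c₂ f₁ ≡ 0#
      c₂-f₁ = k-0 k₂ f₁w₂
      c₂-f₂ : c₂ f₂ ≡ 0#
      c₂-f₂ = k-0 k₂ f₂w₂

      -- l and m together span ⟨e₁, e₂, f₁, f₂⟩, so the dimension of the span of l, m, n is 4 plus
      -- the rank of the matrix of c-coordinates of n.
      extend₄ : ∀ {k} → (Fin k → V 6) → Fin (4 Data.Nat.+ k) → V 6
      extend₄ b = all₄₊ e₁ e₂ f₁ f₂ b

      -- c₁ and c₂ vanish on the first four vectors and so involve only the others. Once those
      -- coefficients are 0, the functionals α and β recover the first four.
      extend₄-independent : ∀ {k} (b : Fin k → V 6) →
        (∀ c → sumF (λ j → c j * c₁ (b j)) ≡ 0# → sumF (λ j → c j * c₂ (b j)) ≡ 0# → ∀ j → c j ≡ 0#) → LinIndep (extend₄ b)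
      extend₄-independent {k} b indep c eq = all₄₊ a₁≡0 a₂≡0 b₁≡0 b₂≡0 rest
        where
        d : Fin k → Carrier
        d j = c (suc (suc (suc (suc j))))
        at : ∀ {f : V 6 → Carrier} → Linear f → ∀ {p q r s} → f e₁ ≡ p → f e₂ ≡ q → f f₁ ≡ r → f f₂ ≡ s →
             c zero * p + (c (suc zero) * q + (c (suc (suc zero)) * r + (c (suc (suc (suc zero))) * s + sumF (λ j → d j * f (b j))))) ≡ 0#
        at {f} lin p q r s = trans (cong₄ (λ p q r s → c zero * p + (c (suc zero) * q + (c (suc (suc zero)) * r + (c (suc (suc (suc zero))) * s + sumF (λ j → d j * f (b j))))))
            (sym p) (sym q) (sym r) (sym s)) (trans (sym (f-lincomb c (extend₄ b))) (f-0 {lincomb c (extend₄ b)} eq))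
          where open Linear lin
        all-0 : ∀ p q r s u → p * 0# + (q * 0# + (r * 0# + (s * 0# + u))) ≡ u
        all-0 p q r s u = solve 5 (λ p q r s u → p :* :0 :+ (q :* :0 :+ (r :* :0 :+ (s :* :0 :+ u))) := u) refl p q r s u
        rest : ∀ j → d j ≡ 0#
        rest = indep d
          (trans (sym (all-0 (c zero) (c (suc zero)) (c (suc (suc zero))) (c (suc (suc (suc zero)))) _)) (at c₁-linear c₁-e₁ c₁-e₂ c₁-f₁ c₁-f₂))
          (trans (sym (all-0 (c zero) (c (suc zero)) (c (suc (suc zero))) (c (suc (suc (suc zero)))) _)) (at c₂-linear c₂-e₁ c₂-e₂ c₂-f₁ c₂-f₂))
        tail-0 : ∀ f → sumF (λ j → d j * f (b j)) ≡ 0#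
        tail-0 f = trans (sumF-cong (λ j → trans (cong (_* f (b j)) (rest j)) (zeroˡ _))) (sumF-0 k)
        value : ∀ {u} p q r s {x} → x ≡ p * c zero + q * c (suc zero) + r * c (suc (suc zero)) + s * c (suc (suc (suc zero))) → u ≡ 0# →
                c zero * p + (c (suc zero) * q + (c (suc (suc zero)) * r + (c (suc (suc (suc zero))) * s + u))) ≡ 0# → x ≡ 0#
        value p q r s e u≡0 e′ = trans e (trans (solve 8 (λ p q r s a b d e → p :* a :+ q :* b :+ r :* d :+ s :* e := a :* p :+ (b :* q :+ (d :* r :+ (e :* s :+ :0)))) refl p q r s (c zero) (c (suc zero)) (c (suc (suc zero))) (c (suc (suc (suc zero)))))
          (trans (cong (λ u → c zero * p + (c (suc zero) * q + (c (suc (suc zero)) * r + (c (suc (suc (suc zero))) * s + u)))) (sym u≡0)) e′))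
        b₁≡0 : c (suc (suc zero)) ≡ 0#
        b₁≡0 = value 0# 0# 1# 0# (solve 4 (λ a b d e → d := :0 :* a :+ :0 :* b :+ :1 :* d :+ :0 :* e) refl (c zero) (c (suc zero)) (c (suc (suc zero))) (c (suc (suc (suc zero)))))
          (tail-0 β₁) (at β₁-linear β₁-e₁ β₁-e₂ (flip e₁f₁) (flip e₁f₂))
        b₂≡0 : c (suc (suc (suc zero))) ≡ 0#
        b₂≡0 = value 0# 0# 0# 1# (solve 4 (λ a b d e → e := :0 :* a :+ :0 :* b :+ :0 :* d :+ :1 :* e) refl (c zero) (c (suc zero)) (c (suc (suc zero))) (c (suc (suc (suc zero)))))
          (tail-0 β₂) (at β₂-linear β₂-e₁ β₂-e₂ (flip e₂f₁) (flip e₂f₂))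
        a₁≡0 : c zero ≡ 0#
        a₁≡0 = value 1# 0# 0# 0# (solve 4 (λ a b d e → a := :1 :* a :+ :0 :* b :+ :0 :* d :+ :0 :* e) refl (c zero) (c (suc zero)) (c (suc (suc zero))) (c (suc (suc (suc zero)))))
          (tail-0 α₁) (at α₁-linear e₁f₁ e₂f₁ α₁-f₁ α₁-f₂)
        a₂≡0 : c (suc zero) ≡ 0#
        a₂≡0 = value 0# 1# 0# 0# (solve 4 (λ a b d e → b := :0 :* a :+ :1 :* b :+ :0 :* d :+ :0 :* e) refl (c zero) (c (suc zero)) (c (suc (suc zero))) (c (suc (suc (suc zero)))))
          (tail-0 α₂) (at α₂-linear e₁f₂ e₂f₂ α₂-f₁ α₂-f₂)

      extend₄-member : ∀ {k} (b : Fin k → V 6) → (∀ j → S₃ (b j)) → ∀ j → S₃ (extend₄ b j)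
      extend₄-member b mem = all₄₊ (l⊆S₃ l-e₁) (l⊆S₃ l-e₂) (m⊆S₃ m-f₁) (m⊆S₃ m-f₂) mem

      extend₄-⊆ : ∀ {k} (b : Fin k → V 6) → InSpan (extend₄ b) (n₁ v) → InSpan (extend₄ b) (n₂ v) → ∀ x → S₃ x → InSpan (extend₄ b) x
      extend₄-⊆ b = S₃⊆ {b = extend₄ b} (span-member (extend₄ b) zero) (span-member (extend₄ b) (suc zero))
        (span-member (extend₄ b) (suc (suc zero))) (span-member (extend₄ b) (suc (suc (suc zero))))

      -- x - s y has vanishing c-coordinates, hence lies in ⟨e₁, e₂, f₁, f₂⟩.
      extend₄-reduce : ∀ {k} (b : Fin k → V 6) y s x → InSpan (extend₄ b) y → c₁ x ≡ s * c₁ y → c₂ x ≡ s * c₂ y → InSpan (extend₄ b) x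
      extend₄-reduce b y s x by p q = span-cong {b = extend₄ b} {x = z ⊕ (s ∙ y)} (λ i → solve 3 (λ x s y → x :+ (:- s) :* y :+ s :* y := x) refl (x i) s (y i))
        (span-⊕ {b = extend₄ b} {x = z} {s ∙ y} (span-cong {b = extend₄ b} {x = flatten} (λ i → trans (flatten-comb i) (expansion z i)) in-flat) (span-∙ {b = extend₄ b} {y} s by))
        where
        z flatten : V 6
        z = x ⊕ ((- s) ∙ y)
        flatten = ((α₁ z ∙ e₁) ⊕ (α₂ z ∙ e₂)) ⊕ ((β₁ z ∙ f₁) ⊕ (β₂ z ∙ f₂))
        vanish : ∀ {f : V 6 → Carrier} → Linear f → f x ≡ s * f y → f z ≡ 0#
        vanish {f} lin eq = trans (f-⊕ _ _) (trans (cong₂ _+_ eq (f-∙ (- s) y)) (solve 2 (λ s y → s :* y :+ (:- s) :* y := :0) refl s (f y)))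
          where open Linear lin
        flatten-comb : flatten ≋ comb (α₁ z) (α₂ z) (β₁ z) (β₂ z) (c₁ z) (c₂ z)
        flatten-comb i = trans (solve 4 (λ p q w w′ → p :+ q := p :+ (q :+ (:0 :* w :+ :0 :* w′))) refl (α₁ z * e₁ i + α₂ z * e₂ i) (β₁ z * f₁ i + β₂ z * f₂ i) (w₁ i) (w₂ i))
          (comb-cong refl refl refl refl (sym (vanish c₁-linear p)) (sym (vanish c₂-linear q)) i)
        in-flat : InSpan (extend₄ b) flatten
        in-flat = span-⊕ {b = extend₄ b} {x = (α₁ z ∙ e₁) ⊕ (α₂ z ∙ e₂)} {(β₁ z ∙ f₁) ⊕ (β₂ z ∙ f₂)}
          (span-⊕ {b = extend₄ b} {x = α₁ z ∙ e₁} {α₂ z ∙ e₂} (span-∙ {b = extend₄ b} {e₁} (α₁ z) (span-member (extend₄ b) zero)) (span-∙ {b = extend₄ b} {e₂} (α₂ z) (span-member (extend₄ b) (suc zero))))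
          (span-⊕ {b = extend₄ b} {x = β₁ z ∙ f₁} {β₂ z ∙ f₂} (span-∙ {b = extend₄ b} {f₁} (β₁ z) (span-member (extend₄ b) (suc (suc zero)))) (span-∙ {b = extend₄ b} {f₂} (β₂ z) (span-member (extend₄ b) (suc (suc (suc zero))))))

      dim₆ : det v ≢ 0# → Dim S₃ 6
      dim₆ d≢0 = extend₄ pair , extend₄-member pair member , extend₄-independent pair indep ,
        extend₄-⊆ pair (span-member (extend₄ pair) (suc (suc (suc (suc zero))))) (span-member (extend₄ pair) (suc (suc (suc (suc (suc zero))))))
        where
        pair : Fin 2 → V 6
        pair = fam2 (n₁ v) (n₂ v)
        member : ∀ j → S₃ (pair j)
        member = all₂ (n⊆S₃ n-n₁) (n⊆S₃ n-n₂)
        indep : ∀ c → sumF (λ j → c j * c₁ (pair j)) ≡ 0# → sumF (λ j → c j * c₂ (pair j)) ≡ 0# → ∀ j → c j ≡ 0#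
        indep c p q = all₂ (zero-product (trans (solve 6 (λ s t a b c d → (a :* d :- c :* b) :* s := d :* (s :* a :+ (t :* c :+ :0)) :- c :* (s :* b :+ (t :* d :+ :0))) refl s s′ (x₁ v) (y₁ v) (x₂ v) (y₂ v)) (eliminate (y₂ v) (x₂ v))) d≢0)
          (zero-product (trans (solve 6 (λ s t a b c d → (a :* d :- c :* b) :* t := (:- b) :* (s :* a :+ (t :* c :+ :0)) :- (:- a) :* (s :* b :+ (t :* d :+ :0))) refl s s′ (x₁ v) (y₁ v) (x₂ v) (y₂ v)) (eliminate (- y₁ v) (- x₁ v))) d≢0)
          where
          s s′ : Carrier
          s = c zero
          s′ = c (suc zero)
          p′ : s * x₁ v + (s′ * x₂ v + 0#) ≡ 0#
          p′ = trans (cong₂ (λ u w → s * u + (s′ * w + 0#)) (sym (c₁-n₁ v)) (sym (c₁-n₂ v))) p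
          q′ : s * y₁ v + (s′ * y₂ v + 0#) ≡ 0#
          q′ = trans (cong₂ (λ u w → s * u + (s′ * w + 0#)) (sym (c₂-n₁ v)) (sym (c₂-n₂ v))) q
          eliminate : ∀ k k′ → k * (s * x₁ v + (s′ * x₂ v + 0#)) - k′ * (s * y₁ v + (s′ * y₂ v + 0#)) ≡ 0#
          eliminate k k′ = trans (cong₂ (λ u w → k * u - k′ * w) p′ q′) (solve 2 (λ k k′ → k :* :0 :- k′ :* :0 := :0) refl k k′)

      dim₄ : Flat v → Dim S₃ 4
      dim₄ (p , q , r , s) = extend₄ none , extend₄-member none (λ ()) , extend₄-independent none (λ _ _ _ ()) ,
        extend₄-⊆ none
          (extend₄-reduce none e₁ 0# (n₁ v) (span-member (extend₄ none) zero) (trans (c₁-n₁ v) (trans p (sym (zeroˡ _)))) (trans (c₂-n₁ v) (trans q (sym (zeroˡ _)))))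
          (extend₄-reduce none e₁ 0# (n₂ v) (span-member (extend₄ none) zero) (trans (c₁-n₂ v) (trans r (sym (zeroˡ _)))) (trans (c₂-n₂ v) (trans s (sym (zeroˡ _)))))
        where
        none : Fin 0 → V 6
        none ()

      dim₅-by : ∀ y s s′ → S₃ y → ¬ (c₁ y ≡ 0# × c₂ y ≡ 0#) → x₁ v ≡ s * c₁ y → y₁ v ≡ s * c₂ y → x₂ v ≡ s′ * c₁ y → y₂ v ≡ s′ * c₂ y → Dim S₃ 5
      dim₅-by y s s′ S₃y y≢0 p q r u = extend₄ one , extend₄-member one (λ _ → S₃y) , extend₄-independent one indep ,
        extend₄-⊆ one
          (extend₄-reduce one y s (n₁ v) (span-member (extend₄ one) (suc (suc (suc (suc zero))))) (trans (c₁-n₁ v) p) (trans (c₂-n₁ v) q))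
          (extend₄-reduce one y s′ (n₂ v) (span-member (extend₄ one) (suc (suc (suc (suc zero))))) (trans (c₁-n₂ v) r) (trans (c₂-n₂ v) u))
        where
        one : Fin 1 → V 6
        one _ = y
        indep : ∀ c → sumF (λ j → c j * c₁ (one j)) ≡ 0# → sumF (λ j → c j * c₂ (one j)) ≡ 0# → ∀ j → c j ≡ 0#
        indep c p q zero = decidable-stable (c zero ≟ 0#) λ ne → (y≢0 (zero-product (trans (sym (+-identityʳ _)) p) ne , zero-product (trans (sym (+-identityʳ _)) q) ne))

      proportional : ¬ (x₁ v ≡ 0# × y₁ v ≡ 0#) → det v ≡ 0# → ∃ λ s → x₂ v ≡ s * x₁ v × y₂ v ≡ s * y₁ v
      proportional u₁≢0 d with x₁ v ≟ 0# | y₁ v ≟ 0#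
      ... | no x≢0 | _ = x₂ v / x₁ v , sym (/-*-cancel x≢0) , *-cancelˡ x≢0 (trans (x-y≡0⇒x≡y d)
          (trans (cong (_* y₁ v) (sym (/-*-cancel x≢0))) (solve 3 (λ k x y → k :* x :* y := x :* (k :* y)) refl (x₂ v / x₁ v) (x₁ v) (y₁ v))))
      ... | yes x≡0 | no y≢0 = y₂ v / y₁ v , *-cancelˡ y≢0 (trans (*-comm _ _) (trans (sym (x-y≡0⇒x≡y d))
          (trans (cong (_* y₂ v) x≡0) (trans (solve 3 (λ y z k → :0 :* y := z :* (k :* :0)) refl (y₂ v) (y₁ v) (y₂ v / y₁ v)) (cong (λ x → y₁ v * (y₂ v / y₁ v * x)) (sym x≡0)))))) , sym (/-*-cancel y≢0)
      ... | yes x≡0 | yes y≡0 = ⊥-elim (u₁≢0 (x≡0 , y≡0))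

      dim₅-row : ¬ (x₁ v ≡ 0# × y₁ v ≡ 0#) → det v ≡ 0# → Dim S₃ 5
      dim₅-row nz d = let s , p , q = proportional nz d in dim₅-by (n₁ v) 1# s (n⊆S₃ n-n₁)
        (λ (p , q) → nz (trans (sym (c₁-n₁ v)) p , trans (sym (c₂-n₁ v)) q))
        (trans (sym (c₁-n₁ v)) (sym (*-identityˡ _))) (trans (sym (c₂-n₁ v)) (sym (*-identityˡ _)))
        (trans p (cong (s *_) (sym (c₁-n₁ v)))) (trans q (cong (s *_) (sym (c₂-n₁ v))))

      dim₅ : ¬ Flat v → det v ≡ 0# → Dim S₃ 5
      dim₅ ¬flat d = cases (x₁ v ≟ 0#) (y₁ v ≟ 0#)
        where
        cases : Dec (x₁ v ≡ 0#) → Dec (y₁ v ≡ 0#) → Dim S₃ 5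
        cases (yes x≡0) (yes y≡0) = dim₅-by (n₂ v) 0# 1# (n⊆S₃ n-n₂)
          (λ (p , q) → ¬flat (x≡0 , y≡0 , trans (sym (c₁-n₂ v)) p , trans (sym (c₂-n₂ v)) q))
          (trans x≡0 (sym (zeroˡ _))) (trans y≡0 (sym (zeroˡ _))) (trans (sym (c₁-n₂ v)) (sym (*-identityˡ _))) (trans (sym (c₂-n₂ v)) (sym (*-identityˡ _)))
        cases (no x≢0) _ = dim₅-row (λ (p , _) → x≢0 p) d
        cases (yes _) (no y≢0) = dim₅-row (λ (_ , q) → y≢0 q) d
      private
        x y x′ y′ T : Carrier
        x  = x₁ v
        y  = y₁ v
        x′ = x₂ v
        y′ = y₂ v
        T  = Vertex.t v

      -- A common vector s n₁ + r n₂ has c-coordinates 0, since it lies on m. Modulo these equations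
      -- its α-coordinates are -g r t and g s t, and they vanish too. So a nonzero common vector
      -- forces both `det` and `t` to be 0.
      record Meeting (w : V 6) : Set where
        field
          s r : Carrier
          on-n : ((s ∙ n₁ v) ⊕ (r ∙ n₂ v)) ≋ w
          row₁ : s * x + r * x′ ≡ 0#
          row₂ : s * y + r * y′ ≡ 0#
          s-T : s * T ≡ 0#
          r-T : r * T ≡ 0#

      meeting : ∀ w → OnLine m w → OnLine n w → Meeting w
      meeting w mw nw = from (proj₁ (m-spanned w) mw) (proj₁ (n-spanned w) nw)
        where
        from : On₂ f₁ f₂ w → On₂ (n₁ v) (n₂ v) w → Meeting w
        from (s′ , r′ , eq′) (s , r , eq) = record { s = s ; r = r ; on-n = eq ; row₁ = row₁ ; row₂ = row₂
            ; s-T = zero-product (trans (solve 9 (λ g ν s r t a b c d → g :* (s :* t) := (s :* (g :* (t :- (a :* c :- ν :* b :* d))) :+ r :* (:- (g :* (c :* c :- ν :* (d :* d))))) :+ g :* (c :* (s :* a :+ r :* c) :- ν :* d :* (s :* b :+ r :* d))) refl g ν s r T x y x′ y′)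
                (use α₂≡0 x′ y′)) g≢0
            ; r-T = zero-product (trans (solve 9 (λ g ν s r t a b c d → (:- g) :* (r :* t) := (s :* (:- (g :* (a :* a :- ν :* (b :* b)))) :+ r :* (g :* (:- t :- (a :* c :- ν :* b :* d)))) :+ g :* (a :* (s :* a :+ r :* c) :- ν :* b :* (s :* b :+ r :* d))) refl g ν s r T x y x′ y′)
                (use α₁≡0 x y)) (λ e → g≢0 (-x≡0⇒x≡0 e)) }
          where
          on-m : ∀ {f : V 6 → Carrier} → Linear f → f f₁ ≡ 0# → f f₂ ≡ 0# → f w ≡ 0#
          on-m lin p q = trans (at₂ lin s′ f₁ r′ f₂ eq′ p q) (solve 2 (λ s′ r′ → s′ :* :0 :+ r′ :* :0 := :0) refl s′ r′)
          row₁ : s * x + r * x′ ≡ 0#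
          row₁ = trans (sym (at₂ c₁-linear s (n₁ v) r (n₂ v) eq (c₁-n₁ v) (c₁-n₂ v))) (on-m c₁-linear c₁-f₁ c₁-f₂)
          row₂ : s * y + r * y′ ≡ 0#
          row₂ = trans (sym (at₂ c₂-linear s (n₁ v) r (n₂ v) eq (c₂-n₁ v) (c₂-n₂ v))) (on-m c₂-linear c₂-f₁ c₂-f₂)
          α₁≡0 : s * A₁₁ v + r * A₂₁ v ≡ 0#
          α₁≡0 = trans (sym (at₂ α₁-linear s (n₁ v) r (n₂ v) eq (α₁-n₁ v) (α₁-n₂ v))) (on-m α₁-linear α₁-f₁ α₁-f₂)
          α₂≡0 : s * A₁₂ v + r * A₂₂ v ≡ 0#
          α₂≡0 = trans (sym (at₂ α₂-linear s (n₁ v) r (n₂ v) eq (α₂-n₁ v) (α₂-n₂ v))) (on-m α₂-linear α₂-f₁ α₂-f₂)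
          use : ∀ {u} → u ≡ 0# → ∀ p q → u + g * (p * (s * x + r * x′) - ν * q * (s * y + r * y′)) ≡ 0#
          use u≡0 p q = trans (cong₃ (λ u a b → u + g * (p * a - ν * q * b)) u≡0 row₁ row₂) (solve 4 (λ g ν p q → :0 :+ g :* (p :* :0 :- ν :* q :* :0) := :0) refl g ν p q)

      meeting-trivial : ∀ {w} (M : Meeting w) → Meeting.s M ≡ 0# → Meeting.r M ≡ 0# → w ≋ 0V
      meeting-trivial M p q i = trans (sym (Meeting.on-n M i)) (trans (cong₂ (λ s r → s * n₁ v i + r * n₂ v i) p q)
        (solve 2 (λ a b → :0 :* a :+ :0 :* b := :0) refl (n₁ v i) (n₂ v i)))

      disjoint-T : T ≢ 0# → Disjoint m n
      disjoint-T T≢0 w mw nw = meeting-trivial M (zero-product (trans (*-comm T _) s-T) T≢0) (zero-product (trans (*-comm T _) r-T) T≢0)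
        where
        M : Meeting w
        M = meeting w mw nw
        open Meeting M

      disjoint-det : det v ≢ 0# → Disjoint m n
      disjoint-det d≢0 w mw nw = meeting-trivial M
        (zero-product (trans (solve 6 (λ s r a b c d → (a :* d :- c :* b) :* s := d :* (s :* a :+ r :* c) :- c :* (s :* b :+ r :* d)) refl s r x y x′ y′) (eliminate y′ x′)) d≢0)
        (zero-product (trans (solve 6 (λ s r a b c d → (a :* d :- c :* b) :* r := (:- b) :* (s :* a :+ r :* c) :- (:- a) :* (s :* b :+ r :* d)) refl s r x y x′ y′) (eliminate (- y) (- x))) d≢0)
        where
        M : Meeting w
        M = meeting w mw nw
        open Meeting M
        eliminate : ∀ k k′ → k * (s * x + r * x′) - k′ * (s * y + r * y′) ≡ 0#
        eliminate k k′ = trans (cong₂ (λ u w → k * u - k′ * w) row₁ row₂) (solve 2 (λ k k′ → k :* :0 :- k′ :* :0 := :0) refl k k′)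

      kernel : ∀ p p′ s r → ¬ (p ≡ 0# × p′ ≡ 0#) → s * p + r * p′ ≡ 0# → ∃ λ k → s ≡ k * p′ × r ≡ k * (- p)
      kernel p p′ s r nz eq = cases (p ≟ 0#) (p′ ≟ 0#)
        where
        cases : Dec (p ≡ 0#) → Dec (p′ ≡ 0#) → ∃ λ k → s ≡ k * p′ × r ≡ k * (- p)
        cases (yes e) (yes e′) = ⊥-elim (nz (e , e′))
        cases _ (no p′≢0) = s / p′ , sym (/-*-cancel p′≢0) , *-cancelˡ p′≢0 (x-y≡0⇒x≡y (trans
          (solve 4 (λ k p p′ r → p′ :* r :- p′ :* (k :* (:- p)) := k :* p′ :* p :+ r :* p′) refl (s / p′) p p′ r) (trans (cong (λ u → u * p + r * p′) (/-*-cancel p′≢0)) eq)))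
        cases (no p≢0) (yes _) = - (r / p) , *-cancelˡ p≢0 (x-y≡0⇒x≡y (trans
          (solve 4 (λ k p p′ s → p :* s :- p :* (:- k :* p′) := s :* p :+ k :* p :* p′) refl (r / p) p p′ s) (trans (cong (λ u → s * p + u * p′) (/-*-cancel p≢0)) eq))) ,
          trans (sym (/-*-cancel p≢0)) (solve 2 (λ k p → k :* p := :- k :* (:- p)) refl (r / p) p)

      -- (p , p′) is a nonzero column of the matrix of `v`. The other column is proportional to it,
      -- so the common vectors are the multiples of p′ n₁ - p n₂.
      meet-by : ∀ p p′ → ¬ (p ≡ 0# × p′ ≡ 0#) → T ≡ 0# → p′ * x + (- p) * x′ ≡ 0# → p′ * y + (- p) * y′ ≡ 0# →
                (∀ s r → s * x + r * x′ ≡ 0# → s * y + r * y′ ≡ 0# → s * p + r * p′ ≡ 0#) →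
                Dim (λ w → OnLine m w × OnLine n w) 1
      meet-by p p′ nz T≡0 row₁ row₂ ker = (λ _ → w) , (λ _ → proj₂ (m-spanned w) (p′ , - p , on-m) , proj₂ (n-spanned w) (p′ , - p , λ _ → refl)) ,
          indep , spans
        where
        w : V 6
        w = (p′ ∙ n₁ v) ⊕ ((- p) ∙ n₂ v)
        at : ∀ {f : V 6 → Carrier} → Linear f → ∀ {u u′} → f (n₁ v) ≡ u → f (n₂ v) ≡ u′ → f w ≡ p′ * u + (- p) * u′
        at lin = at₂ lin p′ (n₁ v) (- p) (n₂ v) {w} (λ _ → refl)
        atf : ∀ {f : V 6 → Carrier} → Linear f → ∀ {u u′} → f f₁ ≡ u → f f₂ ≡ u′ → f ((p′ ∙ f₁) ⊕ ((- p) ∙ f₂)) ≡ p′ * u + (- p) * u′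
        atf lin = at₂ lin p′ f₁ (- p) f₂ {(p′ ∙ f₁) ⊕ ((- p) ∙ f₂)} (λ _ → refl)
        zeros : p′ * 0# + (- p) * 0# ≡ 0#
        zeros = solve 2 (λ p p′ → p′ :* :0 :+ (:- p) :* :0 := :0) refl p p′
        use : ∀ q q′ k → g * (q * (p′ * x + (- p) * x′) - ν * q′ * (p′ * y + (- p) * y′)) + g * k * T ≡ 0#
        use q q′ k = trans (three row₁ row₂ T≡0) (solve 5 (λ g ν q q′ k → g :* (q :* :0 :- ν :* q′ :* :0) :+ g :* k :* :0 := :0) refl g ν q q′ k)
          where
          three : ∀ {a b c a′ b′ c′} → a ≡ a′ → b ≡ b′ → c ≡ c′ → g * (q * a - ν * q′ * b) + g * k * c ≡ g * (q * a′ - ν * q′ * b′) + g * k * c′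
          three = cong₃ (λ a b c → g * (q * a - ν * q′ * b) + g * k * c)
        α₁-w : p′ * A₁₁ v + (- p) * A₂₁ v ≡ 0#
        α₁-w = trans (solve 9 (λ g ν p p′ t a b c d → p′ :* (:- (g :* (a :* a :- ν :* (b :* b)))) :+ (:- p) :* (g :* (:- t :- (a :* c :- ν :* b :* d))) := g :* ((:- a) :* (p′ :* a :+ (:- p) :* c) :- ν :* (:- b) :* (p′ :* b :+ (:- p) :* d)) :+ g :* p :* t) refl g ν p p′ T x y x′ y′) (use (- x) (- y) p)
        α₂-w : p′ * A₁₂ v + (- p) * A₂₂ v ≡ 0#
        α₂-w = trans (solve 9 (λ g ν p p′ t a b c d → p′ :* (g :* (t :- (a :* c :- ν :* b :* d))) :+ (:- p) :* (:- (g :* (c :* c :- ν :* (d :* d)))) := g :* ((:- c) :* (p′ :* a :+ (:- p) :* c) :- ν :* (:- d) :* (p′ :* b :+ (:- p) :* d)) :+ g :* p′ :* t) refl g ν p p′ T x y x′ y′) (use (- x′) (- y′) p′)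
        on-m : ((p′ ∙ f₁) ⊕ ((- p) ∙ f₂)) ≋ w
        on-m = coordinates-equal ((p′ ∙ f₁) ⊕ ((- p) ∙ f₂)) w
          (trans (atf α₁-linear α₁-f₁ α₁-f₂) (trans zeros (sym (trans (at α₁-linear (α₁-n₁ v) (α₁-n₂ v)) α₁-w))))
          (trans (atf α₂-linear α₂-f₁ α₂-f₂) (trans zeros (sym (trans (at α₂-linear (α₂-n₁ v) (α₂-n₂ v)) α₂-w))))
          (trans (atf β₁-linear (flip e₁f₁) (flip e₁f₂)) (sym (at β₁-linear (β₁-n₁ v) (β₁-n₂ v))))
          (trans (atf β₂-linear (flip e₂f₁) (flip e₂f₂)) (sym (at β₂-linear (β₂-n₁ v) (β₂-n₂ v))))
          (trans (atf c₁-linear c₁-f₁ c₁-f₂) (trans zeros (sym (trans (at c₁-linear (c₁-n₁ v) (c₁-n₂ v)) row₁))))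
          (trans (atf c₂-linear c₂-f₁ c₂-f₂) (trans zeros (sym (trans (at c₂-linear (c₂-n₁ v) (c₂-n₂ v)) row₂))))
        w≢0 : ¬ (w ≋ 0V)
        w≢0 eq = nz (trans (solve 2 (λ p p′ → p := :- (p′ :* :0 :+ (:- p) :* :1)) refl p p′) (trans (cong -_ (trans (sym (at β₂-linear (β₂-n₁ v) (β₂-n₂ v))) (Linear.f-0 β₂-linear {w} eq))) (solve 0 (:- :0 := :0) refl )) ,
          trans (solve 2 (λ p p′ → p′ := p′ :* :1 :+ (:- p) :* :0) refl p p′) (trans (sym (at β₁-linear (β₁-n₁ v) (β₁-n₂ v))) (Linear.f-0 β₁-linear {w} eq)))
        indep : LinIndep {k = 1} (λ _ → w)
        indep c eq zero = decidable-stable (c zero ≟ 0#) λ c≢0 →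
          w≢0 (λ i → zero-product {c zero} {w i} (trans (sym (+-identityʳ (c zero * w i))) (eq i)) c≢0)
        spans : ∀ z → OnLine m z × OnLine n z → InSpan {k = 1} (λ _ → w) z
        spans z (mz , nz′) = multiple (meeting z mz nz′)
          where
          multiple : Meeting z → InSpan {k = 1} (λ _ → w) z
          multiple M = let k , s≡ , r≡ = kernel p p′ s r nz (ker s r (Meeting.row₁ M) (Meeting.row₂ M)) in
            (λ _ → k) , λ i → trans (solve 5 (λ k p p′ a b → k :* (p′ :* a :+ (:- p) :* b) :+ :0 := k :* p′ :* a :+ k :* (:- p) :* b) refl k p p′ (n₁ v i) (n₂ v i))
              (trans (cong₂ (λ s r → s * n₁ v i + r * n₂ v i) (sym s≡) (sym r≡)) (on-n i))
            where open Meeting M using (s; r; on-n)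

      meet : ¬ Flat v → det v ≡ 0# → T ≡ 0# → Dim (λ w → OnLine m w × OnLine n w) 1
      meet ¬flat d T≡0 = cases ((x ≟ 0#) ×-dec (x′ ≟ 0#))
        where
        cases : Dec (x ≡ 0# × x′ ≡ 0#) → Dim (λ w → OnLine m w × OnLine n w) 1
        cases (no nz) = meet-by x x′ nz T≡0 (solve 2 (λ a c → c :* a :+ (:- a) :* c := :0) refl x x′)
          (trans (solve 4 (λ a b c d → c :* b :+ (:- a) :* d := :- (a :* d :- c :* b)) refl x y x′ y′) (trans (cong -_ d) (solve 0 (:- :0 := :0) refl )))
          (λ s r p q → p)
        cases (yes (p , q)) = meet-by y y′ (λ (r , s) → ¬flat (p , r , q , s)) T≡0
          (trans (cong₂ (λ u w → y′ * u + (- y) * w) p q) (solve 2 (λ b d → d :* :0 :+ (:- b) :* :0 := :0) refl y y′))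
          (solve 2 (λ b d → d :* b :+ (:- b) :* d := :0) refl y y′) (λ s r p q → q)

      -- The equations eqA, eqB, eqC express that w lies in Σ₁, Σ₂, Σ₃ for l₁ = l, l₂ = m, l₃ = n.
      record Perspective (w : V 6) : Set where
        field
          eqA₁ : β₁ w * A₁₁ v + β₂ w * A₁₂ v + two * g * (c₁ w * x - ν * c₂ w * y) ≡ 0#
          eqA₂ : β₁ w * A₂₁ v + β₂ w * A₂₂ v + two * g * (c₁ w * x′ - ν * c₂ w * y′) ≡ 0#
          eqB₁ : α₁ w + two * g * (c₁ w * x - ν * c₂ w * y) ≡ 0#
          eqB₂ : α₂ w + two * g * (c₁ w * x′ - ν * c₂ w * y′) ≡ 0#
          eqC₁ : α₁ w ≡ β₁ w * A₁₁ v + β₂ w * A₂₁ v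
          eqC₂ : α₂ w ≡ β₁ w * A₁₂ v + β₂ w * A₂₂ v

      Sigmas : V 6 → Set
      Sigmas w = SigmaK m n l w × SigmaK l n m w × SigmaK l m n w

      B-n₁ : ∀ w → B w (n₁ v) ≡ α₁ w + (β₁ w * A₁₁ v + β₂ w * A₁₂ v + two * g * (c₁ w * x - ν * c₂ w * y))
      B-n₁ w = trans (B-sym w (n₁ v)) (trans (B-comb w (A₁₁ v) (A₁₂ v) 1# 0# x y)
        (solve 12 (λ g ν a b p q r s c d x y → a :* r :+ b :* s :+ :1 :* p :+ :0 :* q :+ :2 :* g :* (x :* c :- ν :* y :* d) := p :+ (r :* a :+ s :* b :+ :2 :* g :* (c :* x :- ν :* d :* y))) refl g ν (A₁₁ v) (A₁₂ v) (α₁ w) (α₂ w) (β₁ w) (β₂ w) (c₁ w) (c₂ w) x y))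

      B-n₂ : ∀ w → B w (n₂ v) ≡ α₂ w + (β₁ w * A₂₁ v + β₂ w * A₂₂ v + two * g * (c₁ w * x′ - ν * c₂ w * y′))
      B-n₂ w = trans (B-sym w (n₂ v)) (trans (B-comb w (A₂₁ v) (A₂₂ v) 0# 1# x′ y′)
        (solve 12 (λ g ν a b p q r s c d x y → a :* r :+ b :* s :+ :0 :* p :+ :1 :* q :+ :2 :* g :* (x :* c :- ν :* y :* d) := q :+ (r :* a :+ s :* b :+ :2 :* g :* (c :* x :- ν :* d :* y))) refl g ν (A₂₁ v) (A₂₂ v) (α₁ w) (α₂ w) (β₁ w) (β₂ w) (c₁ w) (c₂ w) x′ y′))

      perp-at : ∀ {k w z} → Perp k w → OnLine k z → B w z ≡ 0#
      perp-at {k} {w} {z} perp on = trans (B≡Bf w z) (perp z on)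

      perp-from : ∀ {k p q w} → Spanned k p q → B w p ≡ 0# → B w q ≡ 0# → Perp k w
      perp-from {k} {p} {q} {w} sp wp wq z on = let s , r , eq = proj₁ (sp z) on in trans (sym (B≡Bf w z)) (trans (B-sym w z)
        (trans (at₂ (B-linear w) s p r q eq (flip wp) (flip wq)) (solve 2 (λ s r → s :* :0 :+ r :* :0 := :0) refl s r)))

      split : ∀ {f : V 6 → Carrier} → Linear f → ∀ y z {w} → (y ⊕ z) ≋ w → f z ≡ 0# → f y ≡ f w
      split {f} lin y z eq fz = trans (sym (trans (f-⊕ y z) (trans (cong (f y +_) fz) (+-identityʳ (f y))))) (f-cong eq)
        where open Linear lin

      on-line-0 : ∀ {k p q z} → Spanned k p q → OnLine k z → ∀ {f : V 6 → Carrier} → Linear f → f p ≡ 0# → f q ≡ 0# → f z ≡ 0#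
      on-line-0 {k} {p} {q} {z} sp on lin fp fq = let s , r , eq = proj₁ (sp z) on in
        trans (at₂ lin s p r q eq fp fq) (solve 2 (λ s r → s :* :0 :+ r :* :0 := :0) refl s r)

      -- Write w = y + z with z on one of the lines. On the coordinates that vanish on l,
      -- respectively m, w and y agree, so the conditions on y become conditions on w. For Σ₃ the α-
      -- and β-coordinates of y vanish, and w agrees there with z on n.
      perspective⇒ : ∀ w → Sigmas w → Perspective w
      perspective⇒ w ((yA , zA , (yA-m , yA-n) , zA-l , eqA) , (yB , zB , (yB-l , yB-n) , zB-m , eqB) , (yC , zC , (yC-l , yC-m) , zC-n , eqC)) = record
        { eqA₁ = trans (six (sym (moveA β₁-linear β₁-e₁ β₁-e₂)) (sym (moveA β₂-linear β₂-e₁ β₂-e₂)) (sym (moveA c₁-linear c₁-e₁ c₁-e₂)) (sym (moveA c₂-linear c₂-e₁ c₂-e₂)))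
            (drop (perp-at {m} {yA} {f₁} yA-m m-f₁) (trans (sym (B-n₁ yA)) (perp-at {n} {yA} {n₁ v} yA-n n-n₁)))
        ; eqA₂ = trans (six (sym (moveA β₁-linear β₁-e₁ β₁-e₂)) (sym (moveA β₂-linear β₂-e₁ β₂-e₂)) (sym (moveA c₁-linear c₁-e₁ c₁-e₂)) (sym (moveA c₂-linear c₂-e₁ c₂-e₂)))
            (drop (perp-at {m} {yA} {f₂} yA-m m-f₂) (trans (sym (B-n₂ yA)) (perp-at {n} {yA} {n₂ v} yA-n n-n₂)))
        ; eqB₁ = trans (three (sym (moveB α₁-linear α₁-f₁ α₁-f₂)) (sym (moveB c₁-linear c₁-f₁ c₁-f₂)) (sym (moveB c₂-linear c₂-f₁ c₂-f₂)))
            (dropβ (perp-at {l} {yB} {e₁} yB-l l-e₁) (perp-at {l} {yB} {e₂} yB-l l-e₂) (trans (sym (B-n₁ yB)) (perp-at {n} {yB} {n₁ v} yB-n n-n₁)))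
        ; eqB₂ = trans (three (sym (moveB α₂-linear α₂-f₁ α₂-f₂)) (sym (moveB c₁-linear c₁-f₁ c₁-f₂)) (sym (moveB c₂-linear c₂-f₁ c₂-f₂)))
            (dropβ (perp-at {l} {yB} {e₁} yB-l l-e₁) (perp-at {l} {yB} {e₂} yB-l l-e₂) (trans (sym (B-n₂ yB)) (perp-at {n} {yB} {n₂ v} yB-n n-n₂)))
        ; eqC₁ = onC α₁-linear (perp-at {m} {yC} {f₁} yC-m m-f₁) (α₁-n₁ v) (α₁-n₂ v)
        ; eqC₂ = onC α₂-linear (perp-at {m} {yC} {f₂} yC-m m-f₂) (α₂-n₁ v) (α₂-n₂ v) }
        where
        moveA : ∀ {f : V 6 → Carrier} → Linear f → f e₁ ≡ 0# → f e₂ ≡ 0# → f yA ≡ f w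
        moveA lin p q = split lin yA zA eqA (on-line-0 {l} {e₁} {e₂} {zA} (line-spanned l) zA-l lin p q)
        moveB : ∀ {f : V 6 → Carrier} → Linear f → f f₁ ≡ 0# → f f₂ ≡ 0# → f yB ≡ f w
        moveB lin p q = split lin yB zB eqB (on-line-0 {m} {f₁} {f₂} {zB} m-spanned zB-m lin p q)
        six : ∀ {b b′ c d b₁ b₁′ c₁ d₁ A A′ p q} → b ≡ b₁ → b′ ≡ b₁′ → c ≡ c₁ → d ≡ d₁ →
              b * A + b′ * A′ + two * g * (c * p - ν * d * q) ≡ b₁ * A + b₁′ * A′ + two * g * (c₁ * p - ν * d₁ * q)
        six {A = A} {A′} {p} {q} = cong₄ (λ b b′ c d → b * A + b′ * A′ + two * g * (c * p - ν * d * q))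
        three : ∀ {a c d a₁ c₁ d₁ p q} → a ≡ a₁ → c ≡ c₁ → d ≡ d₁ → a + two * g * (c * p - ν * d * q) ≡ a₁ + two * g * (c₁ * p - ν * d₁ * q)
        three {p = p} {q} = cong₃ (λ a c d → a + two * g * (c * p - ν * d * q))
        drop : ∀ {p q} → p ≡ 0# → p + q ≡ 0# → q ≡ 0#
        drop {q = q} p≡0 e = trans (sym (+-identityˡ _)) (trans (cong (_+ q) (sym p≡0)) e)
        dropβ : ∀ {b b′ p A A′ q} → b ≡ 0# → b′ ≡ 0# → p + (b * A + b′ * A′ + q) ≡ 0# → p + q ≡ 0#
        dropβ {p = p} {A} {A′} {q} b≡0 b′≡0 e = trans (solve 4 (λ p A A′ q → p :+ q := p :+ (:0 :* A :+ :0 :* A′ :+ q)) refl p A A′ q)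
          (trans (cong₂ (λ b b′ → p + (b * A + b′ * A′ + q)) (sym b≡0) (sym b′≡0)) e)
        onC : ∀ {f : V 6 → Carrier} → Linear f → f yC ≡ 0# → ∀ {p q} → f (n₁ v) ≡ p → f (n₂ v) ≡ q → f w ≡ β₁ w * p + β₂ w * q
        onC {f} lin fy {p} {q} fn₁ fn₂ = combine (proj₁ (n-spanned zC) zC-n)
          where
          add : ∀ {f : V 6 → Carrier} → Linear f → f yC ≡ 0# → f w ≡ f zC
          add {f} lin fy = trans (sym (f-cong eqC)) (trans (f-⊕ yC zC) (trans (cong (_+ f zC) fy) (+-identityˡ _)))
            where open Linear lin
          combine : On₂ (n₁ v) (n₂ v) zC → f w ≡ β₁ w * p + β₂ w * q
          combine (s , r , eq) = trans (add lin fy) (trans (at₂ lin s (n₁ v) r (n₂ v) eq fn₁ fn₂)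
            (cong₂ (λ s r → s * p + r * q)
              (sym (trans (add β₁-linear (perp-at {l} {yC} {e₁} yC-l l-e₁)) (trans (at₂ β₁-linear s (n₁ v) r (n₂ v) eq (β₁-n₁ v) (β₁-n₂ v)) (solve 2 (λ s r → s :* :1 :+ r :* :0 := s) refl s r))))
              (sym (trans (add β₂-linear (perp-at {l} {yC} {e₂} yC-l l-e₂)) (trans (at₂ β₂-linear s (n₁ v) r (n₂ v) eq (β₂-n₁ v) (β₂-n₂ v)) (solve 2 (λ s r → s :* :0 :+ r :* :1 := r) refl s r))))))

      -- The component z is α₁ e₁ + α₂ e₂ on l, β₁ f₁ + β₂ f₂ on m and β₁ n₁ + β₂ n₂ on n; the
      -- equations say that the remainder is orthogonal to the other two lines.
      perspective⇐ : ∀ w → Perspective w → Sigmas w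
      perspective⇐ w P = inA , inB , inC
        where
        open Perspective P
        a₁ a₂ b₁ b₂ d₁ d₂ : Carrier
        a₁ = α₁ w
        a₂ = α₂ w
        b₁ = β₁ w
        b₂ = β₂ w
        d₁ = c₁ w
        d₂ = c₂ w
        six : ∀ {A A′ p q a a′ b b′ c d a₁′ b₁′ b₂′ c′ d′} → a ≡ a₁′ → b ≡ b₁′ → b′ ≡ b₂′ → c ≡ c′ → d ≡ d′ →
              a₁′ + (b₁′ * A + b₂′ * A′ + two * g * (c′ * p - ν * d′ * q)) ≡ a′ → a + (b * A + b′ * A′ + two * g * (c * p - ν * d * q)) ≡ a′
        six {A} {A′} {p} {q} u v w x y = trans (cong₅ (λ a b b′ c d → a + (b * A + b′ * A′ + two * g * (c * p - ν * d * q))) u v w x y)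
        inA : SigmaK m n l w
        inA = y₀ , z₀ , (perp-from {m} {f₁} {f₂} {y₀} m-spanned (α₁-comb 0# 0# b₁ b₂ d₁ d₂) (α₂-comb 0# 0# b₁ b₂ d₁ d₂) ,
            perp-from {n} {n₁ v} {n₂ v} {y₀} n-spanned
              (trans (B-n₁ y₀) (six (α₁-comb 0# 0# b₁ b₂ d₁ d₂) (β₁-comb 0# 0# b₁ b₂ d₁ d₂) (β₂-comb 0# 0# b₁ b₂ d₁ d₂) (c₁-comb 0# 0# b₁ b₂ d₁ d₂) (c₂-comb 0# 0# b₁ b₂ d₁ d₂) (trans (+-identityˡ _) eqA₁)))
              (trans (B-n₂ y₀) (six (α₂-comb 0# 0# b₁ b₂ d₁ d₂) (β₁-comb 0# 0# b₁ b₂ d₁ d₂) (β₂-comb 0# 0# b₁ b₂ d₁ d₂) (c₁-comb 0# 0# b₁ b₂ d₁ d₂) (c₂-comb 0# 0# b₁ b₂ d₁ d₂) (trans (+-identityˡ _) eqA₂)))) ,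
          proj₂ (line-spanned l z₀) (a₁ , a₂ , λ _ → refl) ,
          λ i → trans (solve 8 (λ b₁ b₂ d₁ d₂ z e₁ e₂ u → ((:0 :* e₁ :+ :0 :* e₂) :+ u) :+ z := z :+ u) refl b₁ b₂ d₁ d₂ (a₁ * e₁ i + a₂ * e₂ i) (e₁ i) (e₂ i) ((b₁ * f₁ i + b₂ * f₂ i) + (d₁ * w₁ i + d₂ * w₂ i))) (expansion w i)
          where
          y₀ z₀ : V 6
          y₀ = comb 0# 0# b₁ b₂ d₁ d₂
          z₀ = (a₁ ∙ e₁) ⊕ (a₂ ∙ e₂)
        inB : SigmaK l n m w
        inB = y₀ , z₀ , (perp-from {l} {e₁} {e₂} {y₀} (line-spanned l) (β₁-comb a₁ a₂ 0# 0# d₁ d₂) (β₂-comb a₁ a₂ 0# 0# d₁ d₂) ,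
            perp-from {n} {n₁ v} {n₂ v} {y₀} n-spanned
              (trans (B-n₁ y₀) (six (α₁-comb a₁ a₂ 0# 0# d₁ d₂) (β₁-comb a₁ a₂ 0# 0# d₁ d₂) (β₂-comb a₁ a₂ 0# 0# d₁ d₂) (c₁-comb a₁ a₂ 0# 0# d₁ d₂) (c₂-comb a₁ a₂ 0# 0# d₁ d₂) (trans (none _ _ _ _) eqB₁)))
              (trans (B-n₂ y₀) (six (α₂-comb a₁ a₂ 0# 0# d₁ d₂) (β₁-comb a₁ a₂ 0# 0# d₁ d₂) (β₂-comb a₁ a₂ 0# 0# d₁ d₂) (c₁-comb a₁ a₂ 0# 0# d₁ d₂) (c₂-comb a₁ a₂ 0# 0# d₁ d₂) (trans (none _ _ _ _) eqB₂)))) ,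
          proj₂ (m-spanned z₀) (b₁ , b₂ , λ _ → refl) ,
          λ i → trans (solve 5 (λ z f₁ f₂ u u′ → (u :+ ((:0 :* f₁ :+ :0 :* f₂) :+ u′)) :+ z := u :+ (z :+ u′)) refl (b₁ * f₁ i + b₂ * f₂ i) (f₁ i) (f₂ i) (a₁ * e₁ i + a₂ * e₂ i) (d₁ * w₁ i + d₂ * w₂ i)) (expansion w i)
          where
          y₀ z₀ : V 6
          y₀ = comb a₁ a₂ 0# 0# d₁ d₂
          z₀ = (b₁ ∙ f₁) ⊕ (b₂ ∙ f₂)
          none : ∀ p q r s → p + (0# * q + 0# * r + s) ≡ p + s
          none p q r s = solve 4 (λ p q r s → p :+ (:0 :* q :+ :0 :* r :+ s) := p :+ s) refl p q r s
        inC : SigmaK l m n w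
        inC = y₀ , z₀ , (perp-from {l} {e₁} {e₂} {y₀} (line-spanned l) (β₁-comb 0# 0# 0# 0# s r) (β₂-comb 0# 0# 0# 0# s r) ,
            perp-from {m} {f₁} {f₂} {y₀} m-spanned (α₁-comb 0# 0# 0# 0# s r) (α₂-comb 0# 0# 0# 0# s r)) ,
          proj₂ (n-spanned z₀) (b₁ , b₂ , λ _ → refl) ,
          λ i → trans (solve 18 (λ b₁ b₂ d₁ d₂ x y x′ y′ p q p′ q′ e₁ e₂ f₁ f₂ w₁ w₂ → ((:0 :* e₁ :+ :0 :* e₂) :+ ((:0 :* f₁ :+ :0 :* f₂) :+ ((d₁ :- (b₁ :* x :+ b₂ :* x′)) :* w₁ :+ (d₂ :- (b₁ :* y :+ b₂ :* y′)) :* w₂))) :+ (b₁ :* ((p :* e₁ :+ q :* e₂) :+ ((:1 :* f₁ :+ :0 :* f₂) :+ (x :* w₁ :+ y :* w₂))) :+ b₂ :* ((p′ :* e₁ :+ q′ :* e₂) :+ ((:0 :* f₁ :+ :1 :* f₂) :+ (x′ :* w₁ :+ y′ :* w₂)))) := ((b₁ :* p :+ b₂ :* p′) :* e₁ :+ (b₁ :* q :+ b₂ :* q′) :* e₂) :+ ((b₁ :* f₁ :+ b₂ :* f₂) :+ (d₁ :* w₁ :+ d₂ :* w₂))) refl b₁ b₂ d₁ d₂ x y x′ y′ (A₁₁ v) (A₁₂ v) (A₂₁ v) (A₂₂ v) (e₁ i) (e₂ i) (f₁ i) (f₂ i) (w₁ i) (w₂ i))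
            (trans (comb-cong (sym eqC₁) (sym eqC₂) refl refl refl refl i) (expansion w i))
          where
          s r : Carrier
          s = d₁ - (b₁ * x + b₂ * x′)
          r = d₂ - (b₁ * y + b₂ * y′)
          y₀ z₀ : V 6
          y₀ = comb 0# 0# 0# 0# s r
          z₀ = (b₁ ∙ n₁ v) ⊕ (b₂ ∙ n₂ v)

      -- The matrix A is symmetric exactly when t = 0, as 2 g is nonzero; its symmetry decides
      -- perspectivity.
      A-difference : A₁₂ v - A₂₁ v ≡ two * g * T
      A-difference = solve 3 (λ g t s → g :* (t :- s) :- g :* (:- t :- s) := :2 :* g :* t) refl g T (S v)

      module Regular (d≢0 : det v ≢ 0#) where
        D : Carrier
        D = det v ⁻¹

        -- The solution of eqB and eqC with given β-coordinates: eqC yields the α-coordinates, and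
        -- eqB is then a linear system for c₁, c₂ that is solved by Cramer's rule.
        pa₁ pa₂ pc₁ pc₂ : Carrier → Carrier → Carrier
        pa₁ b b′ = b * A₁₁ v + b′ * A₂₁ v
        pa₂ b b′ = b * A₁₂ v + b′ * A₂₂ v
        pc₁ b b′ = D * (k₁ * (- pa₁ b b′) * y′ - k₁ * (- pa₂ b b′) * y)
        pc₂ b b′ = ν ⁻¹ * (D * (x′ * (k₁ * (- pa₁ b b′)) - x * (k₁ * (- pa₂ b b′))))

        persp : Carrier → Carrier → V 6
        persp b b′ = comb (pa₁ b b′) (pa₂ b b′) b b′ (pc₁ b b′) (pc₂ b b′)

        D-det : D * det v ≡ 1#
        D-det = ⁻¹-inverseˡ d≢0

        persp-unique : ∀ w → Perspective w → w ≋ persp (β₁ w) (β₂ w)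
        persp-unique w P i = trans (sym (expansion w i)) (comb-cong eqC₁ eqC₂ refl refl c₁≡ c₂≡ i)
          where
          open Perspective P
          solve-r : ∀ {p u} → p + two * g * u ≡ 0# → u ≡ k₁ * (- p)
          solve-r {p} {u} e = *-cancelˡ 2g≢0 (trans (solve 3 (λ g p u → :2 :* g :* u := (p :+ :2 :* g :* u) :- p) refl g p u) (trans (cong (_- p) e)
            (trans (solve 1 (λ p → :0 :- p := :1 :* (:- p)) refl p) (trans (cong (_* (- p)) (sym (⁻¹-inverseʳ 2g≢0))) (*-assoc _ _ _)))))
          r₁ : c₁ w * x - ν * c₂ w * y ≡ k₁ * (- pa₁ (β₁ w) (β₂ w))
          r₁ = solve-r (trans (cong (_+ two * g * (c₁ w * x - ν * c₂ w * y)) (sym eqC₁)) eqB₁)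
          r₂ : c₁ w * x′ - ν * c₂ w * y′ ≡ k₁ * (- pa₂ (β₁ w) (β₂ w))
          r₂ = solve-r (trans (cong (_+ two * g * (c₁ w * x′ - ν * c₂ w * y′)) (sym eqC₂)) eqB₂)
          c₁≡ : c₁ w ≡ pc₁ (β₁ w) (β₂ w)
          c₁≡ = sym (trans (cong₂ (λ u u′ → D * (u * y′ - u′ * y)) (sym r₁) (sym r₂))
            (trans (solve 8 (λ D ν c d x y x′ y′ → D :* ((c :* x :- ν :* d :* y) :* y′ :- (c :* x′ :- ν :* d :* y′) :* y) := D :* (x :* y′ :- x′ :* y) :* c) refl D ν (c₁ w) (c₂ w) x y x′ y′)
              (trans (cong (_* c₁ w) D-det) (*-identityˡ _))))
          c₂≡ : c₂ w ≡ pc₂ (β₁ w) (β₂ w)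
          c₂≡ = sym (trans (cong₂ (λ u u′ → ν ⁻¹ * (D * (x′ * u - x * u′))) (sym r₁) (sym r₂))
            (trans (solve 9 (λ D ν n c d x y x′ y′ → n :* (D :* (x′ :* (c :* x :- ν :* d :* y) :- x :* (c :* x′ :- ν :* d :* y′))) := (n :* ν) :* (D :* (x :* y′ :- x′ :* y)) :* d) refl D ν (ν ⁻¹) (c₁ w) (c₂ w) x y x′ y′)
              (trans (cong₂ (λ u u′ → u * u′ * c₂ w) (⁻¹-inverseˡ ν≢0) D-det) (solve 1 (λ c → :1 :* :1 :* c := c) refl (c₂ w)))))

        -- Substituting eqC into eqB and comparing with eqA leaves 2 g t β₂ = 0 and -2 g t β₁ = 0.
        -- So the three spaces Σ meet in 0, which has no two independent vectors.
        not-in-perspective : T ≢ 0# → ¬ InPerspective l m n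
        not-in-perspective T≢0 (b , mem , indep , _) = 1≢0 (indep one (λ i → trans (cong₂ (λ p q → 1# * p + (0# * q + 0#)) (vanish (b zero) (perspective⇒ (b zero) (mem zero)) i) refl)
            (solve 1 (λ q → :1 :* :0 :+ (:0 :* q :+ :0) := :0) refl (b (suc zero) i))) zero)
          where
          one : Fin 2 → Carrier
          one = vec₂ 1# 0#
          vanish : ∀ w → Perspective w → w ≋ 0V
          vanish w P i = trans (persp-unique w P i) (trans (cong₂ (λ b b′ → persp b b′ i) b₁≡0 b₂≡0)
            (solve 18 (λ D ν n k p q p′ q′ x y x′ y′ e₁ e₂ f₁ f₂ w₁ w₂ → ((:0 :* p :+ :0 :* p′) :* e₁ :+ (:0 :* q :+ :0 :* q′) :* e₂) :+ ((:0 :* f₁ :+ :0 :* f₂) :+ (D :* (k :* (:- (:0 :* p :+ :0 :* p′)) :* y′ :- k :* (:- (:0 :* q :+ :0 :* q′)) :* y) :* w₁ :+ n :* (D :* (x′ :* (k :* (:- (:0 :* p :+ :0 :* p′))) :- x :* (k :* (:- (:0 :* q :+ :0 :* q′))))) :* w₂)) := :0) refl D ν (ν ⁻¹) k₁ (A₁₁ v) (A₁₂ v) (A₂₁ v) (A₂₂ v) x y x′ y′ (e₁ i) (e₂ i) (f₁ i) (f₂ i) (w₁ i) (w₂ i)))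
            where
            open Perspective P
            2gT≢0 : two * g * T ≢ 0#
            2gT≢0 = *-nonzero 2g≢0 T≢0
            symmetric : ∀ {p q r r′ u} → p + u ≡ 0# → r + u ≡ 0# → r ≡ r′ → p - r′ ≡ q → q ≡ 0#
            symmetric {p} {q} {r} {u = u} e e′ r≡r′ e″ = trans (sym e″) (trans (cong (λ y → p - y) (sym r≡r′)) (trans (solve 3 (λ p r u → p :- r := (p :+ u) :- (r :+ u)) refl p r u) (trans (cong₂ _-_ e e′) (solve 0 (:0 :- :0 := :0) refl ))))
            b₂≡0 : β₂ w ≡ 0#
            b₂≡0 = zero-product (trans (cong (_* β₂ w) (sym A-difference)) (symmetric eqA₁ eqB₁ eqC₁
              (solve 5 (λ b b′ p q q′ → (b :* p :+ b′ :* q) :- (b :* p :+ b′ :* q′) := (q :- q′) :* b′) refl (β₁ w) (β₂ w) (A₁₁ v) (A₁₂ v) (A₂₁ v)))) 2gT≢0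
            b₁≡0 : β₁ w ≡ 0#
            b₁≡0 = -x≡0⇒x≡0 (zero-product (trans (cong (_* (- β₁ w)) (sym A-difference)) (symmetric eqA₂ eqB₂ eqC₂
              (solve 5 (λ b b′ p q q′ → (b :* q′ :+ b′ :* p) :- (b :* q :+ b′ :* p) := (q :- q′) :* (:- b)) refl (β₁ w) (β₂ w) (A₂₂ v) (A₁₂ v) (A₂₁ v)))) 2gT≢0)

        module _ (T≡0 : T ≡ 0#) where
          -- For symmetric A the equations eqA follow from eqB and eqC, so β₁ and β₂ can be
          -- prescribed freely and parametrise a 2-dimensional intersection.
          persp-perspective : ∀ b b′ → Perspective (persp b b′)
          persp-perspective b b′ = record
            { eqA₁ = rewriteA (trans (solve 7 (λ g b b′ p q q′ u → b :* p :+ b′ :* q :+ :2 :* g :* u := (b :* p :+ b′ :* q′ :+ :2 :* g :* u) :+ b′ :* (q :- q′)) refl g b b′ (A₁₁ v) (A₁₂ v) (A₂₁ v) U₁)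
                (trans (cong₂ (λ u w → u + b′ * w) row₁ (trans A-difference (trans (cong (two * g *_) T≡0) (zeroʳ _)))) (solve 1 (λ b′ → :0 :+ b′ :* :0 := :0) refl b′)))
            ; eqA₂ = rewriteA (trans (solve 7 (λ g b b′ p q q′ u → b :* q′ :+ b′ :* p :+ :2 :* g :* u := (b :* q :+ b′ :* p :+ :2 :* g :* u) :- b :* (q :- q′)) refl g b b′ (A₂₂ v) (A₁₂ v) (A₂₁ v) U₂)
                (trans (cong₂ (λ u w → u - b * w) row₂ (trans A-difference (trans (cong (two * g *_) T≡0) (zeroʳ _)))) (solve 1 (λ b → :0 :- b :* :0 := :0) refl b)))
            ; eqB₁ = rewriteB (α₁-comb p q b b′ r s) row₁
            ; eqB₂ = rewriteB (α₂-comb p q b b′ r s) row₂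
            ; eqC₁ = trans (α₁-comb p q b b′ r s) (cong₂ (λ u w → u * A₁₁ v + w * A₂₁ v) (sym (β₁-comb p q b b′ r s)) (sym (β₂-comb p q b b′ r s)))
            ; eqC₂ = trans (α₂-comb p q b b′ r s) (cong₂ (λ u w → u * A₁₂ v + w * A₂₂ v) (sym (β₁-comb p q b b′ r s)) (sym (β₂-comb p q b b′ r s))) }
            where
            p q r s U₁ U₂ : Carrier
            p = pa₁ b b′
            q = pa₂ b b′
            r = pc₁ b b′
            s = pc₂ b b′
            U₁ = r * x - ν * s * y
            U₂ = r * x′ - ν * s * y′
            rewriteA : ∀ {A A′ c d e} → b * A + b′ * A′ + two * g * (r * c - ν * s * d) ≡ e →
                       β₁ (persp b b′) * A + β₂ (persp b b′) * A′ + two * g * (c₁ (persp b b′) * c - ν * c₂ (persp b b′) * d) ≡ e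
            rewriteA {A} {A′} {c} {d} e = trans (four (β₁-comb p q b b′ r s) (β₂-comb p q b b′ r s) (c₁-comb p q b b′ r s) (c₂-comb p q b b′ r s)) e
              where
              four : ∀ {b₁ b₂ r₁ s₁} → b₁ ≡ b → b₂ ≡ b′ → r₁ ≡ r → s₁ ≡ s →
                     b₁ * A + b₂ * A′ + two * g * (r₁ * c - ν * s₁ * d) ≡ b * A + b′ * A′ + two * g * (r * c - ν * s * d)
              four = cong₄ (λ b₁ b₂ r₁ s₁ → b₁ * A + b₂ * A′ + two * g * (r₁ * c - ν * s₁ * d))
            rewriteB : ∀ {a₀ a₁ c d e} → a₀ ≡ a₁ → a₁ + two * g * (r * c - ν * s * d) ≡ e →
                       a₀ + two * g * (c₁ (persp b b′) * c - ν * c₂ (persp b b′) * d) ≡ e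
            rewriteB {c = c} {d} a≡ e = trans (cong₃ (λ a u w → a + two * g * (u * c - ν * w * d)) a≡ (c₁-comb p q b b′ r s) (c₂-comb p q b b′ r s)) e
            νν : ν * (ν ⁻¹) ≡ 1#
            νν = ⁻¹-inverseʳ ν≢0
            close : ∀ u → two * g * (1# * 1# * (k₁ * (- u))) ≡ - u
            close u = trans (solve 3 (λ g k u → :2 :* g :* (:1 :* :1 :* (k :* (:- u))) := (:2 :* g) :* k :* (:- u)) refl g k₁ u) (trans (cong (_* (- u)) (⁻¹-inverseʳ 2g≢0)) (*-identityˡ _))
            row₁ : p + two * g * U₁ ≡ 0#
            row₁ = trans (cong (λ u → p + two * g * u) (trans
                (solve 9 (λ D ν n r₁ r₂ x y x′ y′ → D :* (r₁ :* y′ :- r₂ :* y) :* x :- ν :* (n :* (D :* (x′ :* r₁ :- x :* r₂))) :* y := (D :* (x :* y′ :- x′ :* y)) :* (ν :* n) :* r₁ :+ (:1 :- ν :* n) :* (D :* (r₁ :* y′ :- r₂ :* y) :* x)) refl D ν (ν ⁻¹) (k₁ * (- p)) (k₁ * (- q)) x y x′ y′)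
                (cong₂ (λ u w → u * w * (k₁ * (- p)) + (1# - w) * (D * (k₁ * (- p) * y′ - k₁ * (- q) * y) * x)) D-det νν)))
              (trans (cong (λ u → p + two * g * u) (solve 2 (λ u w → u :+ (:1 :- :1) :* w := u) refl (1# * 1# * (k₁ * (- p))) (D * (k₁ * (- p) * y′ - k₁ * (- q) * y) * x)))
                (trans (cong (p +_) (close p)) (-‿inverseʳ p)))
            row₂ : q + two * g * U₂ ≡ 0#
            row₂ = trans (cong (λ u → q + two * g * u) (trans
                (solve 9 (λ D ν n r₁ r₂ x y x′ y′ → D :* (r₁ :* y′ :- r₂ :* y) :* x′ :- ν :* (n :* (D :* (x′ :* r₁ :- x :* r₂))) :* y′ := (D :* (x :* y′ :- x′ :* y)) :* (ν :* n) :* r₂ :+ (:1 :- ν :* n) :* (D :* (r₁ :* y′ :- r₂ :* y) :* x′)) refl D ν (ν ⁻¹) (k₁ * (- p)) (k₁ * (- q)) x y x′ y′)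
                (cong₂ (λ u w → u * w * (k₁ * (- q)) + (1# - w) * (D * (k₁ * (- p) * y′ - k₁ * (- q) * y) * x′)) D-det νν)))
              (trans (cong (λ u → q + two * g * u) (solve 2 (λ u w → u :+ (:1 :- :1) :* w := u) refl (1# * 1# * (k₁ * (- q))) (D * (k₁ * (- p) * y′ - k₁ * (- q) * y) * x′)))
                (trans (cong (q +_) (close q)) (-‿inverseʳ q)))

          in-perspective : InPerspective l m n
          in-perspective = pts , all₂ (perspective⇐ (pts zero) (persp-perspective 1# 0#)) (perspective⇐ (pts (suc zero)) (persp-perspective 0# 1#)) ,
              indep , λ w Σw → let P = perspective⇒ w Σw in vec₂ (β₁ w) (β₂ w) , λ i → trans (linear (β₁ w) (β₂ w) i) (sym (persp-unique w P i))
            where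
            pts : Fin 2 → V 6
            pts = fam2 (persp 1# 0#) (persp 0# 1#)
            linear : ∀ b b′ i → b * persp 1# 0# i + (b′ * persp 0# 1# i + 0#) ≡ persp b b′ i
            linear b b′ i = solve 19 (λ b b′ D n k p q p′ q′ x y x′ y′ e₁ e₂ f₁ f₂ w₁ w₂ → b :* (((:1 :* p :+ :0 :* p′) :* e₁ :+ (:1 :* q :+ :0 :* q′) :* e₂) :+ ((:1 :* f₁ :+ :0 :* f₂) :+ (D :* (k :* (:- (:1 :* p :+ :0 :* p′)) :* y′ :- k :* (:- (:1 :* q :+ :0 :* q′)) :* y) :* w₁ :+ n :* (D :* (x′ :* (k :* (:- (:1 :* p :+ :0 :* p′))) :- x :* (k :* (:- (:1 :* q :+ :0 :* q′))))) :* w₂))) :+ (b′ :* (((:0 :* p :+ :1 :* p′) :* e₁ :+ (:0 :* q :+ :1 :* q′) :* e₂) :+ ((:0 :* f₁ :+ :1 :* f₂) :+ (D :* (k :* (:- (:0 :* p :+ :1 :* p′)) :* y′ :- k :* (:- (:0 :* q :+ :1 :* q′)) :* y) :* w₁ :+ n :* (D :* (x′ :* (k :* (:- (:0 :* p :+ :1 :* p′))) :- x :* (k :* (:- (:0 :* q :+ :1 :* q′))))) :* w₂))) :+ :0) := ((b :* p :+ b′ :* p′) :* e₁ :+ (b :* q :+ b′ :* q′) :* e₂) :+ ((b :* f₁ :+ b′ :* f₂) :+ (D :* (k :* (:- (b :* p :+ b′ :* p′)) :* y′ :- k :* (:- (b :* q :+ b′ :* q′)) :* y) :* w₁ :+ n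 :* (D :* (x′ :* (k :* (:- (b :* p :+ b′ :* p′))) :- x :* (k :* (:- (b :* q :+ b′ :* q′))))) :* w₂))) refl b b′ D (ν ⁻¹) k₁ (A₁₁ v) (A₁₂ v) (A₂₁ v) (A₂₂ v) x y x′ y′ (e₁ i) (e₂ i) (f₁ i) (f₂ i) (w₁ i) (w₂ i)
            indep : LinIndep pts
            indep c eq = all₂ (trans (solve 2 (λ p q → p := p :* :1 :+ (q :* :0 :+ :0)) refl (c zero) (c (suc zero)))
                               (trans (cong₂ (λ u w → c zero * u + (c (suc zero) * w + 0#)) (sym (β₁-persp 1# 0#)) (sym (β₁-persp 0# 1#))) (at β₁-linear)))
              (trans (solve 2 (λ p q → q := p :* :0 :+ (q :* :1 :+ :0)) refl (c zero) (c (suc zero)))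
                               (trans (cong₂ (λ u w → c zero * u + (c (suc zero) * w + 0#)) (sym (β₂-persp 1# 0#)) (sym (β₂-persp 0# 1#))) (at β₂-linear)))
              where
              β₁-persp : ∀ b b′ → β₁ (persp b b′) ≡ b
              β₁-persp b b′ = β₁-comb (pa₁ b b′) (pa₂ b b′) b b′ (pc₁ b b′) (pc₂ b b′)
              β₂-persp : ∀ b b′ → β₂ (persp b b′) ≡ b′
              β₂-persp b b′ = β₂-comb (pa₁ b b′) (pa₂ b b′) b b′ (pc₁ b b′) (pc₂ b b′)
              at : ∀ {f : V 6 → Carrier} → Linear f → c zero * f (persp 1# 0#) + (c (suc zero) * f (persp 0# 1#) + 0#) ≡ 0#
              at lin = trans (sym (f-lincomb c pts)) (f-0 {lincomb c pts} eq)
                where open Linear lin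

-- Coordinates for the lines disjoint from l

module QuadricScheme where

  open Rings
  open Fields
  open QuadraticExtensions
  open Model
  open ModelScheme
  open LinearSystems
  open QuadraticForms
  open LinesInFrames
  open TriplesOfLines
  open import Data.Empty using (⊥)
  open import Data.Fin as Fin using (Fin; zero; suc)
  open import Data.Product using (Σ; _×_; _,_; proj₁; proj₂)
  open import Function using (_∘_)
  open import Relation.Nullary using (¬_; Dec; yes; no)
  open import Relation.Nullary.Decidable using (decidable-stable)
  open import Relation.Binary.PropositionalEquality

  module QuadricCoordinates (F : FiniteField) (a : Fin 6 → Fin 6 → FiniteField.Carrier F)
                 (l : Quadric.Line F a) (st : Form.Setting F a l) (frame : Form.Hyperbolic.Frame F a l st) where
    open FiniteField F
    open Arithmetic F
    open FieldProperties F
    open LinAlg F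
    open LinearAlgebra F
    open Quadric F a
    open Form F a
    open Triples F a l st public
    open LineCoordinates frame
    open HeisenbergModel F ν ν-nonsquare two≢0 using (det; δ; Flat; flat?; norm-zero; Class; δ-diagonal; flat⇒det≡0)
    open Coordinates F ν ν-nonsquare two≢0 using (Coordinatisation; canonical-class; δ≡origin⇒≡)
    open Vertex

    -- Without f-components, Q(y) is g times the norm of the c-coordinates, which vanishes only if
    -- these do.
    perpendicular-on-l : ∀ y → Q y ≡ 0# → β₁ y ≡ 0# → β₂ y ≡ 0# → OnLine l y
    perpendicular-on-l y Qy p q = proj₂ (line-spanned l y) (α₁ y , α₂ y , λ i → trans
        (solve 5 (λ z f₁ f₂ w₁ w₂ → z := z :+ ((:0 :* f₁ :+ :0 :* f₂) :+ (:0 :* w₁ :+ :0 :* w₂))) refl (α₁ y * e₁ i + α₂ y * e₂ i) (f₁ i) (f₂ i) (w₁ i) (w₂ i))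
        (trans (comb-cong refl refl (sym p) (sym q) (sym (proj₁ c≡0)) (sym (proj₂ c≡0)) i) (expansion y i)))
      where
      c≡0 : c₁ y ≡ 0# × c₂ y ≡ 0#
      c≡0 = norm-zero (zero-product (trans (solve 4 (λ g a b n → g :* n := a :* :0 :+ b :* :0 :+ g :* n) refl g (α₁ y) (α₂ y) (c₁ y * c₁ y - ν * (c₂ y * c₂ y)))
        (trans (cong₂ (λ u w → α₁ y * u + α₂ y * w + g * (c₁ y * c₁ y - ν * (c₂ y * c₂ y))) (sym p) (sym q)) (trans (sym (Q-coordinates y)) Qy))) g≢0)

    line-⊕ : ∀ m {x y} → OnLine m x → OnLine m y → OnLine m (x ⊕ y)
    line-⊕ m {x} {y} = span-⊕ {b = fam2 (Line.u m) (Line.v m)} {x} {y}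

    line-∙ : ∀ m s {x} → OnLine m x → OnLine m (s ∙ x)
    line-∙ m s {x} = span-∙ {b = fam2 (Line.u m) (Line.v m)} {x} s

    line-singular : ∀ m {w} → OnLine m w → Q w ≡ 0#
    line-singular m {w} on = go (proj₁ (line-spanned m w) on)
      where
      go : On₂ (Line.u m) (Line.v m) w → Q w ≡ 0#
      go (s , r , eq) = trans (sym (Q-cong eq)) (trans (Q-⊕ (s ∙ Line.u m) (r ∙ Line.v m)) (trans (three
          (trans (Q-∙ s _) (cong (s * s *_) (trans (Q≡Qf _) (Line.sing-u m)))) (trans (Q-∙ r _) (cong (r * r *_) (trans (Q≡Qf _) (Line.sing-v m))))
          (trans (B-∙ s (Line.u m) (r ∙ Line.v m)) (cong (s *_) (trans (B-∙ʳ r (Line.v m) (Line.u m)) (cong (r *_) (trans (B≡Bf _ _) (Line.orth m)))))))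
        (solve 2 (λ s r → s :* s :* :0 :+ r :* r :* :0 :+ s :* (r :* :0) := :0) refl s r)))
        where
        three : ∀ {p q r p′ q′ r′ : Carrier} → p ≡ p′ → q ≡ q′ → r ≡ r′ → p + q + r ≡ p′ + q′ + r′
        three = cong₃ (λ p q r → p + q + r)

    line-orthogonal : ∀ m {x y} → OnLine m x → OnLine m y → B x y ≡ 0#
    line-orthogonal m {x} {y} mx my = trans (solve 3 (λ p q b → b := (p :+ q :+ b) :- p :- q) refl (Q x) (Q y) (B x y))
      (trans (cong₂ _-_ (cong₂ _-_ (trans (sym (Q-⊕ x y)) (line-singular m (line-⊕ m mx my))) (line-singular m mx)) (line-singular m my))
        (solve 0 (:0 :- :0 :- :0 := :0) refl ))

    line-independent : ∀ m s r → ((s ∙ Line.u m) ⊕ (r ∙ Line.v m)) ≋ 0V → s ≡ 0# × r ≡ 0#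
    line-independent m = independent₂ (Line.indep m)

    Vtx : Set
    Vtx = Σ Line (Disjoint l)

    module Dual (M : Vtx) where
      m : Line
      m = proj₁ M

      private
        u v : V 6
        u = Line.u m
        v = Line.v m
        mu : OnLine m u
        mu = proj₂ (line-spanned m u) (first-of u v)

      trivial : ∀ w → OnLine m w → β₁ w ≡ 0# → β₂ w ≡ 0# → w ≋ 0V
      trivial w on p q = proj₂ M w (perpendicular-on-l w (line-singular m on) p q) on

      combination : ∀ s r → OnLine m ((s ∙ u) ⊕ (r ∙ v))
      combination s r = proj₂ (line-spanned m _) (s , r , λ _ → refl)

      β-combination : ∀ {f : V 6 → Carrier} → Linear f → ∀ s r → f ((s ∙ u) ⊕ (r ∙ v)) ≡ s * f u + r * f v
      β-combination lin s r = at₂ lin s u r v {(s ∙ u) ⊕ (r ∙ v)} (λ _ → refl) refl refl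

      D : Carrier
      D = β₁ u * β₂ v - β₁ v * β₂ u

      -- A vector of m orthogonal to l lies on l, hence is 0 by disjointness. If D = 0, the
      -- combinations β₂(v) u - β₂(u) v and β₁(v) u - β₁(u) v are such vectors. By independence all
      -- β-values are then 0, so that u is such a vector as well.
      D≢0 : D ≢ 0#
      D≢0 D≡0 = 1≢0 (proj₁ (line-independent m 1# 0# (λ i → trans (solve 2 (λ u v → :1 :* u :+ :0 :* v := u) refl (u i) (v i)) (u≋0 i))))
        where
        first : β₂ v ≡ 0# × - β₂ u ≡ 0#
        first = line-independent m _ _ (trivial _ (combination (β₂ v) (- β₂ u))
          (trans (β-combination β₁-linear (β₂ v) (- β₂ u)) (trans (solve 4 (λ a b c d → d :* a :+ (:- c) :* b := a :* d :- b :* c) refl (β₁ u) (β₁ v) (β₂ u) (β₂ v)) D≡0))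
          (trans (β-combination β₂-linear (β₂ v) (- β₂ u)) (solve 2 (λ c d → d :* c :+ (:- c) :* d := :0) refl (β₂ u) (β₂ v))))
        second : β₁ v ≡ 0# × - β₁ u ≡ 0#
        second = line-independent m _ _ (trivial _ (combination (β₁ v) (- β₁ u))
          (trans (β-combination β₁-linear (β₁ v) (- β₁ u)) (solve 2 (λ a b → b :* a :+ (:- a) :* b := :0) refl (β₁ u) (β₁ v)))
          (trans (β-combination β₂-linear (β₁ v) (- β₁ u)) (trans (solve 4 (λ a b c d → b :* c :+ (:- a) :* d := :- (a :* d :- b :* c)) refl (β₁ u) (β₁ v) (β₂ u) (β₂ v))
            (trans (cong -_ D≡0) (solve 0 (:- :0 := :0) refl )))))
        u≋0 : u ≋ 0V
        u≋0 = trivial u mu (-x≡0⇒x≡0 (proj₂ second)) (-x≡0⇒x≡0 (proj₂ first))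

      -- Cramer's rule for the basis of m that is dual to e₁, e₂ under B.
      m₁ m₂ : V 6
      m₁ = ((D ⁻¹ * β₂ v) ∙ u) ⊕ ((- (D ⁻¹ * β₂ u)) ∙ v)
      m₂ = ((- (D ⁻¹ * β₁ v)) ∙ u) ⊕ ((D ⁻¹ * β₁ u) ∙ v)

      m-m₁ : OnLine m m₁
      m-m₁ = combination (D ⁻¹ * β₂ v) (- (D ⁻¹ * β₂ u))
      m-m₂ : OnLine m m₂
      m-m₂ = combination (- (D ⁻¹ * β₁ v)) (D ⁻¹ * β₁ u)

      β₁-m₁ : β₁ m₁ ≡ 1#
      β₁-m₁ = trans (β-combination β₁-linear (D ⁻¹ * β₂ v) (- (D ⁻¹ * β₂ u))) (trans (solve 5 (λ i a b c d → i :* d :* a :+ (:- (i :* c)) :* b := i :* (a :* d :- b :* c)) refl (D ⁻¹) (β₁ u) (β₁ v) (β₂ u) (β₂ v)) (⁻¹-inverseˡ D≢0))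
      β₂-m₁ : β₂ m₁ ≡ 0#
      β₂-m₁ = trans (β-combination β₂-linear (D ⁻¹ * β₂ v) (- (D ⁻¹ * β₂ u))) (solve 3 (λ i c d → i :* d :* c :+ (:- (i :* c)) :* d := :0) refl (D ⁻¹) (β₂ u) (β₂ v))
      β₁-m₂ : β₁ m₂ ≡ 0#
      β₁-m₂ = trans (β-combination β₁-linear (- (D ⁻¹ * β₁ v)) (D ⁻¹ * β₁ u)) (solve 3 (λ i a b → (:- (i :* b)) :* a :+ i :* a :* b := :0) refl (D ⁻¹) (β₁ u) (β₁ v))
      β₂-m₂ : β₂ m₂ ≡ 1#
      β₂-m₂ = trans (β-combination β₂-linear (- (D ⁻¹ * β₁ v)) (D ⁻¹ * β₁ u)) (trans (solve 5 (λ i a b c d → (:- (i :* b)) :* c :+ i :* a :* d := i :* (a :* d :- b :* c)) refl (D ⁻¹) (β₁ u) (β₁ v) (β₂ u) (β₂ v)) (⁻¹-inverseˡ D≢0))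

      determined : ∀ x y → OnLine m x → OnLine m y → β₁ x ≡ β₁ y → β₂ x ≡ β₂ y → x ≋ y
      determined x y mx my p q i = x-y≡0⇒x≡y (trans (solve 2 (λ x y → x :- y := x :+ (:- :1) :* y) refl (x i) (y i))
        (trivial (x ⊕ ((- 1#) ∙ y)) (line-⊕ m mx (line-∙ m (- 1#) my)) (difference β₁-linear p) (difference β₂-linear q) i))
        where
        difference : ∀ {f : V 6 → Carrier} → Linear f → f x ≡ f y → f (x ⊕ ((- 1#) ∙ y)) ≡ 0#
        difference {f} lin e = trans (f-⊕ x ((- 1#) ∙ y)) (trans (cong₂ _+_ e (f-∙ (- 1#) y)) (solve 1 (λ y → y :+ (:- :1) :* y := :0) refl (f y)))
          where open Linear lin

      spanned : Spanned m m₁ m₂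
      spanned w = (λ on → β₁ w , β₂ w , determined _ w (line-⊕ m (line-∙ m (β₁ w) m-m₁) (line-∙ m (β₂ w) m-m₂)) on
          (trans (at₂ β₁-linear (β₁ w) m₁ (β₂ w) m₂ {(β₁ w ∙ m₁) ⊕ (β₂ w ∙ m₂)} (λ _ → refl) β₁-m₁ β₁-m₂) (solve 2 (λ s r → s :* :1 :+ r :* :0 := s) refl (β₁ w) (β₂ w)))
          (trans (at₂ β₂-linear (β₁ w) m₁ (β₂ w) m₂ {(β₁ w ∙ m₁) ⊕ (β₂ w ∙ m₂)} (λ _ → refl) β₂-m₁ β₂-m₂) (solve 2 (λ s r → s :* :0 :+ r :* :1 := r) refl (β₁ w) (β₂ w)))) ,
        λ (s , r , eq) → span-cong {b = fam2 u v} {x = (s ∙ m₁) ⊕ (r ∙ m₂)} eq (line-⊕ m (line-∙ m s m-m₁) (line-∙ m r m-m₂))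

      coord : Vertex Carrier
      coord = vertexOf m₁ m₂

      n₁-coord : n₁ coord ≋ m₁
      n₁-coord = n₁-vertexOf m₁ m₂ (line-singular m m-m₁) (line-singular m m-m₂) (line-orthogonal m m-m₁ m-m₂) β₁-m₁ β₁-m₂ β₂-m₁ β₂-m₂

      n₂-coord : n₂ coord ≋ m₂
      n₂-coord = n₂-vertexOf m₁ m₂ (line-singular m m-m₁) (line-singular m m-m₂) (line-orthogonal m m-m₁ m-m₂) β₁-m₁ β₁-m₂ β₂-m₁ β₂-m₂

    spanned-cong : ∀ {m x y x′ y′} → x ≋ x′ → y ≋ y′ → Spanned m x y → Spanned m x′ y′
    spanned-cong p q sp w =
      (λ on → let s , r , eq = proj₁ (sp w) on in s , r , λ i → trans (cong₂ (λ a b → s * a + r * b) (sym (p i)) (sym (q i))) (eq i)) ,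
      λ (s , r , eq) → proj₂ (sp w) (s , r , λ i → trans (cong₂ (λ a b → s * a + r * b) (p i) (q i)) (eq i))

    coord : Vtx → Vertex Carrier
    coord = Dual.coord

    coord-spanned : ∀ M → Spanned (proj₁ M) (n₁ (coord M)) (n₂ (coord M))
    coord-spanned M = spanned-cong {proj₁ M} {m₁} {m₂} (λ i → sym (n₁-coord i)) (λ i → sym (n₂-coord i)) spanned
      where open Dual M hiding (coord)

    pointLine : Vertex Carrier → Line
    pointLine v = record
      { u = n₁ v ; v = n₂ v
      ; sing-u = trans (sym (Q≡Qf (n₁ v))) (Q-n₁ v)
      ; sing-v = trans (sym (Q≡Qf (n₂ v))) (Q-n₂ v)
      ; orth   = trans (sym (B≡Bf (n₁ v) (n₂ v))) (n₁n₂ v)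
      ; indep  = λ c eq → all₂ (trans (solve 2 (λ p q → p := p :* :1 :+ (q :* :0 :+ :0)) refl (c zero) (c (suc zero)))
                                (trans (cong₂ (λ u w → c zero * u + (c (suc zero) * w + 0#)) (sym (β₁-n₁ v)) (sym (β₁-n₂ v))) (at c eq β₁-linear)))
          (trans (solve 2 (λ p q → q := p :* :0 :+ (q :* :1 :+ :0)) refl (c zero) (c (suc zero)))
                                (trans (cong₂ (λ u w → c zero * u + (c (suc zero) * w + 0#)) (sym (β₂-n₁ v)) (sym (β₂-n₂ v))) (at c eq β₂-linear))) }
      where
      at : ∀ c → lincomb c (fam2 (n₁ v) (n₂ v)) ≋ 0V → ∀ {f : V 6 → Carrier} → Linear f →
           c zero * f (n₁ v) + (c (suc zero) * f (n₂ v) + 0#) ≡ 0#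
      at c eq lin = trans (sym (f-lincomb c (fam2 (n₁ v) (n₂ v)))) (f-0 {lincomb c (fam2 (n₁ v) (n₂ v))} eq)
        where open Linear lin

    pointLine-disjoint : ∀ v → Disjoint l (pointLine v)
    pointLine-disjoint v x lx px = go (proj₁ (line-spanned l x) lx) (proj₁ (line-spanned (pointLine v) x) px)
      where
      go : On₂ e₁ e₂ x → On₂ (n₁ v) (n₂ v) x → x ≋ 0V
      go (s , r , eq) (s′ , r′ , eq′) i = trans (sym (eq′ i)) (trans (cong₂ (λ s r → s * n₁ v i + r * n₂ v i) s′≡0 r′≡0) (solve 2 (λ a b → :0 :* a :+ :0 :* b := :0) refl (n₁ v i) (n₂ v i)))
        where
        on-l : ∀ {f : V 6 → Carrier} → Linear f → f e₁ ≡ 0# → f e₂ ≡ 0# → f x ≡ 0#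
        on-l lin p q = trans (at₂ lin s e₁ r e₂ eq p q) (solve 2 (λ s r → s :* :0 :+ r :* :0 := :0) refl s r)
        s′≡0 : s′ ≡ 0#
        s′≡0 = trans (solve 2 (λ s′ r′ → s′ := s′ :* :1 :+ r′ :* :0) refl s′ r′) (trans (sym (at₂ β₁-linear s′ (n₁ v) r′ (n₂ v) eq′ (β₁-n₁ v) (β₁-n₂ v))) (on-l β₁-linear (self-0 Qe₁) (flip e₁e₂)))
        r′≡0 : r′ ≡ 0#
        r′≡0 = trans (solve 2 (λ s′ r′ → r′ := s′ :* :0 :+ r′ :* :1) refl s′ r′) (trans (sym (at₂ β₂-linear s′ (n₁ v) r′ (n₂ v) eq′ (β₂-n₁ v) (β₂-n₂ v))) (on-l β₂-linear e₁e₂ (self-0 Qe₂)))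

    point : Vertex Carrier → Vtx
    point v = pointLine v , pointLine-disjoint v

    same-refl : ∀ m → SameLine m m
    same-refl m = (λ _ on → on) , (λ _ on → on)

    same-sym : ∀ m n → SameLine m n → SameLine n m
    same-sym m n (p , q) = q , p

    same-trans : ∀ m n k → SameLine m n → SameLine n k → SameLine m k
    same-trans m n k (p , q) (p′ , q′) = (λ x → p′ x ∘ p x) , (λ x → q x ∘ q′ x)

    spanned-same : ∀ {m n x y} → Spanned m x y → Spanned n x y → SameLine m n
    spanned-same sp sp′ = (λ w → proj₂ (sp′ w) ∘ proj₁ (sp w)) , (λ w → proj₂ (sp w) ∘ proj₁ (sp′ w))

    coord-cong : ∀ M N → SameLine (proj₁ M) (proj₁ N) → coord M ≡ coord N
    coord-cong M N (_ , n⊆m) = vertexOf-cong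
      (M.determined M.m₁ N.m₁ M.m-m₁ (n⊆m N.m₁ N.m-m₁) (trans M.β₁-m₁ (sym N.β₁-m₁)) (trans M.β₂-m₁ (sym N.β₂-m₁)))
      (M.determined M.m₂ N.m₂ M.m-m₂ (n⊆m N.m₂ N.m-m₂) (trans M.β₁-m₂ (sym N.β₁-m₂)) (trans M.β₂-m₂ (sym N.β₂-m₂)))
      where
      module M = Dual M
      module N = Dual N

    point-coord : ∀ M → SameLine (pointLine (coord M)) (proj₁ M)
    point-coord M = spanned-same {pointLine (coord M)} {proj₁ M} {n₁ (coord M)} {n₂ (coord M)} (line-spanned (pointLine (coord M))) (coord-spanned M)

    coord-point : ∀ v → coord (point v) ≡ v
    coord-point v = trans (vertexOf-cong
        (determined m₁ (n₁ v) m-m₁ (proj₂ (line-spanned (pointLine v) (n₁ v)) (first-of (n₁ v) (n₂ v))) (trans β₁-m₁ (sym (β₁-n₁ v))) (trans β₂-m₁ (sym (β₂-n₁ v))))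
        (determined m₂ (n₂ v) m-m₂ (proj₂ (line-spanned (pointLine v) (n₂ v)) (second-of (n₁ v) (n₂ v))) (trans β₁-m₂ (sym (β₁-n₂ v))) (trans β₂-m₂ (sym (β₂-n₂ v)))))
      (vertexOf-n v)
      where open Dual (point v) hiding (coord)

    same-coord : ∀ M N → coord M ≡ coord N → SameLine (proj₁ M) (proj₁ N)
    same-coord M N eq = same-trans (proj₁ M) (pointLine (coord N)) (proj₁ N)
      (subst (λ v → SameLine (proj₁ M) (pointLine v)) eq (same-sym (pointLine (coord M)) (proj₁ M) (point-coord M))) (point-coord N)

    module Pair (M N : Vtx) where
      private
        v w : Vertex Carrier
        v = coord M
        w = coord N
        ≡⇒≋ : ∀ {x y : V 6} → x ≡ y → x ≋ y
        ≡⇒≋ refl i = refl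

      d : Vertex Carrier
      d = δ v w

      open Triple (reframe v) d (proj₁ M) (proj₁ N)
        (spanned-cong {proj₁ M} {n₁ v} {n₂ v} (≡⇒≋ (sym (reframe-f₁ v))) (≡⇒≋ (sym (reframe-f₂ v))) (coord-spanned M))
        (spanned-cong {proj₁ N} {n₁ w} {n₂ w} (λ i → sym (reframe-n₁ frame v w i)) (λ i → sym (reframe-n₂ frame v w i)) (coord-spanned N))
        public using (dim₄; dim₅; dim₆; disjoint-T; disjoint-det; meet; module Regular)

      same⇒class₀ : SameLine (proj₁ M) (proj₁ N) → Flat d × t d ≡ 0#
      same⇒class₀ same = subst (Class zero) (trans (sym (δ-diagonal v)) (cong (δ v) (coord-cong M N same))) (canonical-class zero)

      class₀⇒same : Flat d → t d ≡ 0# → SameLine (proj₁ M) (proj₁ N)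
      class₀⇒same f e = same-coord M N (δ≡origin⇒≡ v w f e)

      not-disjoint : Dim (λ x → OnLine (proj₁ M) x × OnLine (proj₁ N) x) 1 → ¬ Disjoint (proj₁ M) (proj₁ N)
      not-disjoint (b , mem , indep , _) disj = 1≢0 (indep (λ _ → 1#)
        (λ i → trans (cong (λ u → 1# * u + 0#) (disj (b zero) (proj₁ (mem zero)) (proj₂ (mem zero)) i)) (solve 0 (:1 :* :0 :+ :0 := :0) refl )) zero)

    open Scheme (Xl l) using (R)

    class⇒relation : ∀ i M N → Class i (δ (coord M) (coord N)) → R i M N
    class⇒relation zero                               M N (f , e) = Pair.class₀⇒same M N f e
    class⇒relation (suc zero)                         M N (nf , r , e) = nf ∘ proj₁ ∘ same⇒class₀ , meet nf r e
      where open Pair M N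
    class⇒relation (suc (suc zero))                   M N (f , e) = e ∘ proj₂ ∘ same⇒class₀ , dim₄ f
      where open Pair M N
    class⇒relation (suc (suc (suc zero)))             M N (nf , r , e) = nf ∘ proj₁ ∘ same⇒class₀ , disjoint-T e , dim₅ nf r
      where open Pair M N
    class⇒relation (suc (suc (suc (suc zero))))       M N (r , e) = e ∘ proj₂ ∘ same⇒class₀ , dim₆ r , Regular.not-in-perspective r e
      where open Pair M N
    class⇒relation (suc (suc (suc (suc (suc zero))))) M N (r , e) =
      (λ same → r (flat⇒det≡0 {δ (coord M) (coord N)} (proj₁ (same⇒class₀ same)))) , dim₆ r , Regular.in-perspective r e
      where open Pair M N

    dims-differ : ∀ {M N : Vtx} {j k} → j ≢ k → Dim (Span3 l (proj₁ M) (proj₁ N)) j → Dim (Span3 l (proj₁ M) (proj₁ N)) k → ⊥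
    dims-differ {M} {N} j≢k p q = j≢k (Dim-unique {P = Span3 l (proj₁ M) (proj₁ N)} p q)

    dim-6⇒det≢0 : ∀ M N → Dim (Span3 l (proj₁ M) (proj₁ N)) 6 → det (δ (coord M) (coord N)) ≢ 0#
    dim-6⇒det≢0 M N dim r = cases (flat? d)
      where
      open Pair M N
      cases : Dec (Flat d) → ⊥
      cases (yes f) = dims-differ {M} {N} (λ ()) dim (dim₄ f)
      cases (no nf) = dims-differ {M} {N} (λ ()) dim (dim₅ nf r)

    relation⇒class : ∀ i M N → R i M N → Class i (δ (coord M) (coord N))
    relation⇒class zero                               M N same = Pair.same⇒class₀ M N same
    relation⇒class (suc zero)                         M N (ns , dim₁) = (λ f → ns (class₀⇒same f t≡0)) ,
        decidable-stable (det d ≟ 0#) (not-disjoint dim₁ ∘ disjoint-det) , t≡0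
      where
      open Pair M N
      t≡0 : t d ≡ 0#
      t≡0 = decidable-stable (t d ≟ 0#) (not-disjoint dim₁ ∘ disjoint-T)
    relation⇒class (suc (suc zero))                   M N (ns , dim) = f , λ e → ns (class₀⇒same f e)
      where
      open Pair M N
      det≡0 : det d ≡ 0#
      det≡0 = decidable-stable (det d ≟ 0#) (λ r → dims-differ {M} {N} (λ ()) dim (dim₆ r))
      f : Flat d
      f = decidable-stable (flat? d) (λ nf → dims-differ {M} {N} (λ ()) dim (dim₅ nf det≡0))
    -- Lines m and n that meet in a point may span a space of dimension 5 with l as well;
    -- disjointness is what rules out t = 0.
    relation⇒class (suc (suc (suc zero)))             M N (ns , disj , dim) = nf , det≡0 , λ e → not-disjoint (meet nf det≡0 e) disj
      where
      open Pair M N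
      nf : ¬ Flat d
      nf f = dims-differ {M} {N} (λ ()) dim (dim₄ f)
      det≡0 : det d ≡ 0#
      det≡0 = decidable-stable (det d ≟ 0#) (λ r → dims-differ {M} {N} (λ ()) dim (dim₆ r))
    relation⇒class (suc (suc (suc (suc zero))))       M N (ns , dim , np) = det≢0 , λ e → np (Regular.in-perspective det≢0 e)
      where
      open Pair M N
      det≢0 : det d ≢ 0#
      det≢0 = dim-6⇒det≢0 M N dim
    relation⇒class (suc (suc (suc (suc (suc zero))))) M N (ns , dim , p) = det≢0 , decidable-stable (t d ≟ 0#) (λ e → Regular.not-in-perspective det≢0 e p)
      where
      open Pair M N
      det≢0 : det d ≢ 0#
      det≢0 = dim-6⇒det≢0 M N dim

    coordinatisation : Coordinatisation (Xl l)
    coordinatisation = record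
      { ≈-refl = λ M → same-refl (proj₁ M)
      ; ≈-sym = λ M N → same-sym (proj₁ M) (proj₁ N)
      ; ≈-trans = λ M N K → same-trans (proj₁ M) (proj₁ N) (proj₁ K)
      ; coord = coord ; point = point
      ; coord-cong = coord-cong ; point-coord = point-coord ; coord-point = coord-point
      ; class⇒relation = class⇒relation ; relation⇒class = relation⇒class }

-- Both schemes over one field with one nonsquare

open import Data.Nat using (ℕ; suc; _*_)
open import Data.Fin using (Fin)
open import Data.Product using (_×_; _,_; proj₁; proj₂)
open import Relation.Binary.PropositionalEquality using (_≡_; refl)
open Rings
open Fields
open QuadraticExtensions
open Model
open ModelScheme
open HermitianScheme
open QuadraticForms
open FrameExistences
open QuadricScheme

theorem5p2 : (q : ℕ) → OddPrimePower q →
    (F : FiniteField) → FiniteField.order F ≡ q →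
    (a : Fin 6 → Fin 6 → FiniteField.Carrier F) → Quadric.Elliptic F a →
    (l : Quadric.Line F a) →
    IsSymmetricAssociationScheme (Quadric.Xl F a l) ×
    IsImprimitive (Quadric.Xl F a l) ×
    ((K : FiniteField) → FiniteField.order K ≡ q * q →
    (P : Hermitian.HPoint K q) →
    Isomorphic (Quadric.Xl F a l) (Hermitian.XP K q P))
theorem5p2 q q-odd F refl a elliptic l =
  isSymmetricAssociationScheme , isImprimitive , λ K K-order P →
    isomorphic lines
      -- ν comes from the quadric, and K is presented as GF(q)(θ) with θ² = ν, so that both
      -- coordinatisations refer to the same model.
      (HermitianCoordinates.coordinatisation F K ν (quadratic-extension q-odd F K refl K-order ν ν-nonsquare) ν-nonsquare two≢0 P)
  where
  order-odd = odd-prime-power q-odd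
  framed = FrameExistence.frame-exists F a (OddOrder.two≢0 F (suc (proj₁ order-odd)) (proj₂ order-odd)) elliptic l
  open Form.Setting (proj₁ framed)
  open Coordinates F ν ν-nonsquare two≢0
  lines : Coordinatisation (Quadric.Xl F a l)
  lines = QuadricCoordinates.coordinatisation F a l (proj₁ framed) (proj₂ framed)
  open Coordinatisation lines using (isSymmetricAssociationScheme; isImprimitive)
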